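{- Algorithm $\mathsf{Str}$ super-streamlines every $\mathsf{SKS}$ derivation: for every $\mathsf{SKS}$ derivation $\Phi_0$, the output of $\mathsf{Str}$ on $\Phi_0$ is a super-streamlined $\mathsf{SKS}$ derivation (in particular a streamlined one) with the same premiss and the same conclusion as $\Phi_0$.
   Context: Formulae are built from units $\mathsf f$, $\mathsf t$, atoms $a,b,\dots$ (with a non-identical involution $a\mapsto\bar a$ on atoms), disjunction $[\alpha\vee\beta]$ and conjunction $(\alpha\wedge\beta)$. A context $\xi\{\ \}$ is a formula with a hole. An inference step rewrites $\xi\{\alpha\}$ into $\xi\{\beta\}$ where $\alpha\to\beta$ is an instance of a rule of system $\mathsf{SKS}$: interaction $\mathsf{ai}{\downarrow}\colon\mathsf t\to[a\vee\bar a]$; weakening $\mathsf{aw}{\downarrow}\colon\mathsf f\to a$; contraction $\mathsf{ac}{\downarrow}\colon[a\vee a]\to a$; cointeraction (cut) $\mathsf{ai}{\uparrow}\colon(a\wedge\bar a)\to\mathsf f$; coweakening $\mathsf{aw}{\uparrow}\colon a\to\mathsf t$; cocontraction $\mathsf{ac}{\uparrow}\colon a\to(a\wedge a)$ ($a$ an atom); switch $\mathsf s\colon(\alpha\wedge[\beta\vee\gamma])\to[(\alpha\wedge\beta)\vee\gamma]$; medial $\mathsf m\colon[(\alpha\wedge\beta)\vee(\gamma\wedge\delta)]\to([\alpha\vee\gamma]\wedge[\beta\vee\delta])$; and $=$, rewriting $\gamma$ to $\delta$ when $\gamma=\delta$ (either direction) is an instance of commutativity or associativity of $\vee$ or $\wedge$,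 or of $[\alpha\vee\mathsf f]=\alpha$, $(\alpha\wedge\mathsf t)=\alpha$, $[\mathsf t\vee\mathsf t]=\mathsf t$, $(\mathsf f\wedge\mathsf f)=\mathsf f$. A derivation from premiss $\alpha$ to conclusion $\beta$ is a finite sequence of formulae from $\alpha$ to $\beta$, consecutive ones related by an inference step. Atomic flows: a finite directed graph with vertex set $V$, each vertex labelled $\mathsf{ai}{\downarrow}$ (interaction), $\mathsf{ai}{\uparrow}$ (cointeraction), $\mathsf{aw}{\downarrow}$ (weakening), $\mathsf{aw}{\uparrow}$ (coweakening), $\mathsf{ac}{\downarrow}$ (contraction) or $\mathsf{ac}{\uparrow}$ (cocontraction), and edge set $E$, each edge having an upper end in $V\cup\{\top\}$ and a lower end in $V\cup\{\bot\}$; edges with upper end $\top$ (lower end $\bot$) are the upper (lower) edges of the flow. For a vertex, its upper edges are those with lower end at it and its lower edges those with upper end at it; the numbers (upper, lower) are $(0,2)$ for $\mathsf{ai}{\downarrow}$, $(2,0)$ for $\mathsf{ai}{\uparrow}$, $(0,1)$ for $\mathsf{aw}{\downarrow}$, $(1,0)$ for $\mathsf{aw}{\uparrow}$, $(2,1)$ for $\mathsf{ac}{\downarrow}$, $(1,2)$ for $\mathsf{ac}{\uparrow}$. There is no directed cycle, and there is a polarity map $E\to\{+,-\}$ such that all edges of a (co)contraction vertex have the same polarity and the two edges of a (co)interaction vertex have different polarities. The atomic flow of a derivation $\Phi$ is obtained by tracing atom occurrences: each atom occurrence belongs to an edge; occurrences in the context of an inference step, or inside the metavariables of an instance of $\mathsf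 s$, $\mathsf m$ or $=$, are on the same edge as the corresponding occurrences in the next formula; each instance of $\mathsf{ai}{\downarrow},\mathsf{ai}{\uparrow},\mathsf{aw}{\downarrow},\mathsf{aw}{\uparrow},\mathsf{ac}{\downarrow},\mathsf{ac}{\uparrow}$ yields a vertex with that label whose edges are the atom occurrences it destroys (upper edges) and creates (lower edges); occurrences in the premiss give the upper edges of the flow, those in the conclusion the lower edges. Paths: a path is a sequence of edges $\epsilon_1,\dots,\epsilon_h$ with lower end of $\epsilon_i$ = upper end of $\epsilon_{i+1}$, or its reverse. An $\mathsf{ai}$-path is either a path or a concatenation of an $\mathsf{ai}$-path ending at a vertex $\nu''$ labelled $\mathsf{ai}{\downarrow}$ or $\mathsf{ai}{\uparrow}$ with an $\mathsf{ai}$-path starting at $\nu''$, the two edges meeting at $\nu''$ being distinct. An $\mathsf{ai}$-path is maximal if no $\mathsf{ai}$-path containing its edges is longer. An $\mathsf{ai}$-connection is a path from an interaction vertex to a cointeraction vertex or vice versa; a simple edge is an $\mathsf{ai}$-connection of length one. A clean path is an $\mathsf{ai}$-path all of whose $\mathsf{ai}$-connections are simple edges. An $\mathsf{ai}$-cycle is an $\mathsf{ai}$-path from a vertex to itself with no repeated edge; it is fragile if it contains a simple edge; a flow is cycle-free if it has no $\mathsf{ai}$-cycle. A simple edge $\epsilon_k$ is extremal if there is a maximal $\mathsf{ai}$-path $\epsilon_1,\dots,\epsilon_h$ that is a clean path such that $\epsilon_{k+1},\dots,\epsilon_h$ are not simple edges. Local reduction rules (each replaces a subgraph by another, keeping the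 edges connecting it to the rest of the flow). System $\mathsf w$: (i) a weakening whose lower edge is an upper edge of a contraction: delete both vertices and that edge, merging the other upper edge and the lower edge of the contraction into one edge; (ii) dually a cocontraction one of whose lower edges is the upper edge of a coweakening: delete both and that edge, merging the remaining two edges; (iii) a weakening whose lower edge is an upper edge of a cointeraction: delete both and that edge, the other upper edge of the cointeraction gets a new coweakening; (iv) dually an interaction one of whose lower edges enters a coweakening: delete both and that edge, the other lower edge gets a new weakening; (v) a weakening whose lower edge is the upper edge of a coweakening: delete both and the edge; (vi) a weakening whose lower edge is the upper edge of a cocontraction: delete both and that edge, each lower edge of the cocontraction gets a new weakening; (vii) a contraction whose lower edge enters a coweakening: delete both and that edge, each upper edge of the contraction gets a new coweakening. System $\mathsf c$: (viii) a contraction with upper edges $\epsilon_1,\epsilon_2$ whose lower edge is an upper edge of a cointeraction with other upper edge $\epsilon_3$ is replaced by a cocontraction with upper edge $\epsilon_3$ and lower edges $\delta_1,\delta_2$ and two cointeractions with upper edges $\{\epsilon_1,\delta_1\}$ and $\{\epsilon_2,\delta_2\}$; (ix) dually an interaction with lower edges $\epsilon_3,\epsilon$, where $\epsilon$ is the upper edge of a cocontraction with lower edges $\epsilon_1,\epsilon_2$, is replaced by a contraction with lower edge $\epsilon_3$ and upper edges $\delta_1,\delta_2$ and two interactions with lower edges $\{\epsilon_1,\delta_1\}$, $\{\epsilon_2,\delta_2\}$; (x) a contraction with upper edges $\epsilon_1,\epsilon_2$ whose lower edge is the upper edge of a cocontraction with lower edges $\epsilon_3,\epsilon_4$ is replaced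 by cocontractions with upper edges $\epsilon_1,\epsilon_2$, contractions with lower edges $\epsilon_3,\epsilon_4$, and one new edge from each of the two cocontractions to each of the two contractions. $A\to_F B$ means one step of a rule of system $F$; $\to_F^\star$ is the reflexive–transitive closure; $A$ is normal for $F$ if no step applies. A relation $R$ on flows is sound if whenever $A\,R\,B$ and $\Phi$ has flow $A$, there is a derivation with flow $B$ and the same premiss and conclusion; all rules above are sound, and the algorithms below replace a derivation by such a derivation at each flow step. Global reductions: let $B$ be a flow with a simple edge $\epsilon_1$ from an interaction $\nu$ (other lower edge $\epsilon_2$) to a cointeraction $\mu$ (other upper edge $\epsilon_3$). Let $A$ be $B$ minus $\nu,\mu,\epsilon_1$ (so $\epsilon_2$ is an upper and $\epsilon_3$ a lower edge of $A$), with other upper edges $\epsilon_1',\dots$ — namely $e_1,\dots,e_h$ (the upper edges of $B$) and lower edges $e'_1,\dots,e'_k$ (those of $B$). Take disjoint copies $\tilde A,\hat A$; $B'$ is $\tilde A$ with a new weakening whose lower edge is $\tilde\epsilon_2$; $B''$ is $\hat A$ with a new coweakening whose upper edge is $\hat\epsilon_3$. For flows $D',D''$ with the same upper/lower edges as $B',B''$, $\mathrm{Comb}(D',D'')$ is their disjoint union with $\tilde\epsilon_3$ and $\hat\epsilon_2$ identified into one edge, plus for each $i\le h$ a cocontraction with upper edge $e_i$ and lower edges $\tilde e_i,\hat e_i$, and for each $j\le k$ a contraction with upper edges $\tilde e'_j,\hat e'_j$ and lower edge $e'_j$. Inductively: $B\to_{\mathsf{bc}}B$ if $B$ has no fragile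 cycle; if $\epsilon_1$ belongs to an $\mathsf{ai}$-cycle, $B'\to_{\mathsf{bc}}D'$ and $B''\to_{\mathsf{bc}}D''$, then $B\to_{\mathsf{bc}}\mathrm{Comb}(D',D'')$. Likewise $B\to_{\mathsf{ex}}B$ if $B$ has no extremal simple edge, and if $\epsilon_1$ is an extremal simple edge, $B'\to_{\mathsf{ex}}D'$, $B''\to_{\mathsf{ex}}D''$, then $B\to_{\mathsf{ex}}\mathrm{Comb}(D',D'')$. Algorithm $\mathsf{BC}$ on $\Phi_0$ with flow $A_0$: (1) fix a polarity assignment of $A_0$ and apply rules of $\mathsf c$ to negative contraction/cocontraction vertices lying on $\mathsf{ai}$-cycles until they are all positive, obtaining $\Phi_1$ with flow $A_1$; (2) obtain $\Phi_2$ with flow $A_2$ such that $A_1\to_{\mathsf{bc}}A_2$. Algorithm $\mathsf{EX}$ on $\Phi_2$ with cycle-free flow $A_2$: (1) obtain $\Phi_3$ whose flow $A_3$ with $A_2\to_{\mathsf c}^\star A_3$ is normal for $\mathsf c$; (2) obtain $\Phi_4$ with flow $A_4$, $A_3\to_{\mathsf{ex}}A_4$. Algorithm $\mathsf{Str}$ on $\Phi_0$: apply $\mathsf{BC}$ obtaining $\Phi_2$, then $\mathsf{EX}$ obtaining $\Phi_4$, then transform $\Phi_4$ into $\Phi_5$ whose flow is normal for $\mathsf w$ (via $\to_{\mathsf w}$ steps); $\Phi_5$ is the output. A derivation is streamlined if in its flow there is no path going downward from an interaction or weakening vertex to a cointeraction or coweakening vertex; it is super-streamlined if moreover its flow is normal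 for $\mathsf w$. -}

module Defs where

open import Data.Nat using (ℕ; zero; suc; _≤_)
open import Data.Fin using (Fin; zero; suc; #_)
open import Data.Vec using (Vec; []; _∷_; lookup)
open import Data.List using (List; []; _∷_; _++_; length; map; [_])
open import Data.List.Relation.Unary.All using (All)
open import Data.List.Relation.Unary.Any using (Any)
open import Data.List.Membership.Propositional using (_∈_)
open import Data.List.Relation.Unary.Unique.Propositional using (Unique)
open import Data.Sum using (_⊎_; inj₁; inj₂; map₁; map₂)
  renaming ([_,_] to case⊎)
open import Data.Product using (Σ; ∃; _×_; _,_; proj₁; proj₂)
open import Data.Empty using (⊥)
open import Data.Unit using (⊤; tt)
open import Relation.Nullary using (¬_)
open import Relation.Binary.PropositionalEquality using (_≡_; _≢_; refl)
open import Function.Bundles using (_↔_; Inverse)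
open import Relation.Binary.Construct.Closure.ReflexiveTransitive using (Star)

infixr 6 _∨_
infixr 7 _∧_

data Fm (At : Set) : Set where
  𝔣 𝔱  : Fm At
  atom : At → Fm At
  _∨_  : Fm At → Fm At → Fm At
  _∧_  : Fm At → Fm At → Fm At

data Ctx (At : Set) : Set where
  hole : Ctx At
  _∨ₗ_ : Ctx At → Fm At → Ctx At
  _∨ᵣ_ : Fm At → Ctx At → Ctx At
  _∧ₗ_ : Ctx At → Fm At → Ctx At
  _∧ᵣ_ : Fm At → Ctx At → Ctx At

_⟨_⟩ : {At : Set} → Ctx At → Fm At → Fm At
hole ⟨ α ⟩ = α
(ξ ∨ₗ γ) ⟨ α ⟩ = (ξ ⟨ α ⟩) ∨ γ
(γ ∨ᵣ ξ) ⟨ α ⟩ = γ ∨ (ξ ⟨ α ⟩)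
(ξ ∧ₗ γ) ⟨ α ⟩ = (ξ ⟨ α ⟩) ∧ γ
(γ ∧ᵣ ξ) ⟨ α ⟩ = γ ∧ (ξ ⟨ α ⟩)

Occ : {At : Set} → Fm At → Set
Occ 𝔣 = ⊥
Occ 𝔱 = ⊥
Occ (atom a) = ⊤
Occ (α ∨ β) = Occ α ⊎ Occ β
Occ (α ∧ β) = Occ α ⊎ Occ β

data EqAx {At : Set} : Fm At → Fm At → Set where
  ∨-comm  : ∀ {α β} → EqAx (α ∨ β) (β ∨ α)
  ∧-comm  : ∀ {α β} → EqAx (α ∧ β) (β ∧ α)
  ∨-assoc : ∀ {α β γ} → EqAx ((α ∨ β) ∨ γ) (α ∨ (β ∨ γ))
  ∧-assoc : ∀ {α β γ} → EqAx ((α ∧ β) ∧ γ) (α ∧ (β ∧ γ))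
  ∨-unit  : ∀ {α} → EqAx (α ∨ 𝔣) α
  ∧-unit  : ∀ {α} → EqAx (α ∧ 𝔱) α
  𝔱𝔱      : EqAx (𝔱 ∨ 𝔱) 𝔱
  𝔣𝔣      : EqAx (𝔣 ∧ 𝔣) 𝔣

eqTo : {At : Set} {α β : Fm At} → EqAx α β → Occ α → Occ β
eqTo ∨-comm (inj₁ x) = inj₂ x
eqTo ∨-comm (inj₂ y) = inj₁ y
eqTo ∧-comm (inj₁ x) = inj₂ x
eqTo ∧-comm (inj₂ y) = inj₁ y
eqTo ∨-assoc (inj₁ (inj₁ x)) = inj₁ x
eqTo ∨-assoc (inj₁ (inj₂ y)) = inj₂ (inj₁ y)
eqTo ∨-assoc (inj₂ z) = inj₂ (inj₂ z)
eqTo ∧-assoc (inj₁ (inj₁ x)) = inj₁ x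
eqTo ∧-assoc (inj₁ (inj₂ y)) = inj₂ (inj₁ y)
eqTo ∧-assoc (inj₂ z) = inj₂ (inj₂ z)
eqTo ∨-unit (inj₁ x) = x
eqTo ∧-unit (inj₁ x) = x
eqTo 𝔱𝔱 (inj₁ ())
eqTo 𝔱𝔱 (inj₂ ())
eqTo 𝔣𝔣 (inj₁ ())
eqTo 𝔣𝔣 (inj₂ ())

eqFrom : {At : Set} {α β : Fm At} → EqAx α β → Occ β → Occ α
eqFrom ∨-comm (inj₁ x) = inj₂ x
eqFrom ∨-comm (inj₂ y) = inj₁ y
eqFrom ∧-comm (inj₁ x) = inj₂ x
eqFrom ∧-comm (inj₂ y) = inj₁ y
eqFrom ∨-assoc (inj₁ x) = inj₁ (inj₁ x)
eqFrom ∨-assoc (inj₂ (inj₁ y)) = inj₁ (inj₂ y)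
eqFrom ∨-assoc (inj₂ (inj₂ z)) = inj₂ z
eqFrom ∧-assoc (inj₁ x) = inj₁ (inj₁ x)
eqFrom ∧-assoc (inj₂ (inj₁ y)) = inj₁ (inj₂ y)
eqFrom ∧-assoc (inj₂ (inj₂ z)) = inj₂ z
eqFrom ∨-unit x = inj₁ x
eqFrom ∧-unit x = inj₁ x
eqFrom 𝔱𝔱 ()
eqFrom 𝔣𝔣 ()

data Label : Set where
  ai↓ ai↑ aw↓ aw↑ ac↓ ac↑ : Label

data Rule {At : Set} (bar : At → At) : Fm At → Fm At → Set where
  ai↓ : (a : At) → Rule bar 𝔱 (atom a ∨ atom (bar a))
  aw↓ : (a : At) → Rule bar 𝔣 (atom a)
  ac↓ : (a : At) → Rule bar (atom a ∨ atom a) (atom a)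
  ai↑ : (a : At) → Rule bar (atom a ∧ atom (bar a)) 𝔣
  aw↑ : (a : At) → Rule bar (atom a) 𝔱
  ac↑ : (a : At) → Rule bar (atom a) (atom a ∧ atom a)
  s   : ∀ {α β γ} → Rule bar (α ∧ (β ∨ γ)) ((α ∧ β) ∨ γ)
  m   : ∀ {α β γ δ} → Rule bar ((α ∧ β) ∨ (γ ∧ δ)) ((α ∨ γ) ∧ (β ∨ δ))
  eq→ : ∀ {α β} → EqAx α β → Rule bar α β
  eq← : ∀ {α β} → EqAx α β → Rule bar β α

module _ {At : Set} where

  cFwd : (ξ : Ctx At) {α β : Fm At} {D : Set} →
         (Occ α → Occ β ⊎ D) → Occ (ξ ⟨ α ⟩) → Occ (ξ ⟨ β ⟩) ⊎ D
  cFwd hole f p = f p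
  cFwd (ξ ∨ₗ γ) f (inj₁ p) = map₁ inj₁ (cFwd ξ f p)
  cFwd (ξ ∨ₗ γ) f (inj₂ p) = inj₁ (inj₂ p)
  cFwd (γ ∨ᵣ ξ) f (inj₁ p) = inj₁ (inj₁ p)
  cFwd (γ ∨ᵣ ξ) f (inj₂ p) = map₁ inj₂ (cFwd ξ f p)
  cFwd (ξ ∧ₗ γ) f (inj₁ p) = map₁ inj₁ (cFwd ξ f p)
  cFwd (ξ ∧ₗ γ) f (inj₂ p) = inj₁ (inj₂ p)
  cFwd (γ ∧ᵣ ξ) f (inj₁ p) = inj₁ (inj₁ p)
  cFwd (γ ∧ᵣ ξ) f (inj₂ p) = map₁ inj₂ (cFwd ξ f p)

  cIn : (ξ : Ctx At) {β : Fm At} → Occ β → Occ (ξ ⟨ β ⟩)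
  cIn hole p = p
  cIn (ξ ∨ₗ γ) p = inj₁ (cIn ξ p)
  cIn (γ ∨ᵣ ξ) p = inj₂ (cIn ξ p)
  cIn (ξ ∧ₗ γ) p = inj₁ (cIn ξ p)
  cIn (γ ∧ᵣ ξ) p = inj₂ (cIn ξ p)


module _ {At : Set} {bar : At → At} where

  -- the vertex produced by a rule instance (⊤ for atomic rules, ⊥ otherwise)
  RV : {α β : Fm At} → Rule bar α β → Set
  RV (ai↓ a) = ⊤
  RV (aw↓ a) = ⊤
  RV (ac↓ a) = ⊤
  RV (ai↑ a) = ⊤
  RV (aw↑ a) = ⊤
  RV (ac↑ a) = ⊤
  RV s = ⊥
  RV m = ⊥
  RV (eq→ _) = ⊥
  RV (eq← _) = ⊥

  rlab : {α β : Fm At} (r : Rule bar α β) → RV r → Label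
  rlab (ai↓ a) _ = ai↓
  rlab (aw↓ a) _ = aw↓
  rlab (ac↓ a) _ = ac↓
  rlab (ai↑ a) _ = ai↑
  rlab (aw↑ a) _ = aw↑
  rlab (ac↑ a) _ = ac↑
  rlab s ()
  rlab m ()
  rlab (eq→ _) ()
  rlab (eq← _) ()

  -- where an occurrence of the redex goes: to an occurrence of the
  -- contractum (same edge), or it is destroyed by the rule's vertex
  rFwd : {α β : Fm At} (r : Rule bar α β) → Occ α → Occ β ⊎ RV r
  rFwd (ai↓ a) p = inj₂ tt
  rFwd (aw↓ a) p = inj₂ tt
  rFwd (ac↓ a) p = inj₂ tt
  rFwd (ai↑ a) p = inj₂ tt
  rFwd (aw↑ a) p = inj₂ tt
  rFwd (ac↑ a) p = inj₂ tt
  rFwd s (inj₁ x) = inj₁ (inj₁ (inj₁ x))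
  rFwd s (inj₂ (inj₁ y)) = inj₁ (inj₁ (inj₂ y))
  rFwd s (inj₂ (inj₂ z)) = inj₁ (inj₂ z)
  rFwd m (inj₁ (inj₁ a)) = inj₁ (inj₁ (inj₁ a))
  rFwd m (inj₁ (inj₂ b)) = inj₁ (inj₂ (inj₁ b))
  rFwd m (inj₂ (inj₁ c)) = inj₁ (inj₁ (inj₂ c))
  rFwd m (inj₂ (inj₂ d)) = inj₁ (inj₂ (inj₂ d))
  rFwd (eq→ e) p = inj₁ (eqTo e p)
  rFwd (eq← e) p = inj₁ (eqFrom e p)

  -- occurrences created by the rule's vertex (all contractum occurrences
  -- of an atomic rule; none for s, m, =)
  RNew : {α β : Fm At} → Rule bar α β → Set
  RNew {β = β} r = RV r × Occ β

data Step {At : Set} (bar : At → At) : Fm At → Fm At → Set where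
  step : (ξ : Ctx At) {α β : Fm At} → Rule bar α β → Step bar (ξ ⟨ α ⟩) (ξ ⟨ β ⟩)

infixr 5 _▸_
data Deriv {At : Set} (bar : At → At) : Fm At → Fm At → Set where
  done : ∀ {α} → Deriv bar α α
  _▸_  : ∀ {α β γ} → Step bar α β → Deriv bar β γ → Deriv bar α γ

-- Atomic flows (as graphs; interface = upper edges U, lower edges L)

record Flow (U L : Set) : Set₁ where
  field
    V   : Set
    E   : Set
    lab : V → Label
    up  : E → U ⊎ V     -- upper end: ⊤ (indexed by U) or a vertex
    dn  : E → L ⊎ V     -- lower end: ⊥ (indexed by L) or a vertex

ins outs : Label → ℕ
ins ai↓ = 0
ins ai↑ = 2
ins aw↓ = 0
ins aw↑ = 1
ins ac↓ = 2
ins ac↑ = 1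
outs ai↓ = 2
outs ai↑ = 0
outs aw↓ = 1
outs aw↑ = 0
outs ac↓ = 1
outs ac↑ = 2

data Dir : Set where
  ⇓ ⇑ : Dir

data Sign : Set where
  plus minus : Sign

module FlowNotions {U L : Set} (A : Flow U L) where
  open Flow A

  Pt : Set
  Pt = (U ⊎ L) ⊎ V

  upPt : U ⊎ V → Pt
  upPt (inj₁ u) = inj₁ (inj₁ u)
  upPt (inj₂ v) = inj₂ v

  dnPt : L ⊎ V → Pt
  dnPt (inj₁ l) = inj₁ (inj₂ l)
  dnPt (inj₂ v) = inj₂ v

  OE : Set
  OE = E × Dir

  src tgt : OE → Pt
  src (e , ⇓) = upPt (up e)
  src (e , ⇑) = dnPt (dn e)
  tgt (e , ⇓) = dnPt (dn e)
  tgt (e , ⇑) = upPt (up e)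

  IsAI : Label → Set
  IsAI l = l ≡ ai↓ ⊎ l ≡ ai↑

  -- consecutive edges of an ai-path: they meet at a vertex w and either
  -- continue in the same direction (a path), or the direction changes at an
  -- (co)interaction vertex w through two distinct edges (concatenation)
  Link : OE → OE → Set
  Link x y = Σ V λ w → tgt x ≡ inj₂ w × src y ≡ inj₂ w ×
             (proj₂ x ≡ proj₂ y ⊎
              (proj₂ x ≢ proj₂ y × IsAI (lab w) × proj₁ x ≢ proj₁ y))

  Chain : List OE → Set
  Chain [] = ⊤
  Chain (x ∷ []) = ⊤
  Chain (x ∷ y ∷ l) = Link x y × Chain (y ∷ l)

  NonEmpty : List OE → Set
  NonEmpty [] = ⊥
  NonEmpty (_ ∷ _) = ⊤

  StartsAt : List OE → Pt → Set
  StartsAt [] p = ⊥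
  StartsAt (x ∷ _) p = src x ≡ p

  EndsAt : List OE → Pt → Set
  EndsAt [] p = ⊥
  EndsAt (x ∷ []) p = tgt x ≡ p
  EndsAt (x ∷ y ∷ l) p = EndsAt (y ∷ l) p

  edges : List OE → List E
  edges = map proj₁

  IsAIPath : List OE → Set
  IsAIPath l = NonEmpty l × Chain l

  IsPath : List OE → Set
  IsPath l = IsAIPath l × Σ Dir λ d → All (λ x → proj₂ x ≡ d) l

  IsDownPath : List OE → Set
  IsDownPath l = IsAIPath l × All (λ x → proj₂ x ≡ ⇓) l

  From To : (Label → Set) → List OE → Set
  From P l = Σ V λ v → StartsAt l (inj₂ v) × P (lab v)
  To P l = Σ V λ v → EndsAt l (inj₂ v) × P (lab v)

  AIConn : List OE → Set
  AIConn l = IsPath l ×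
    ((From (_≡ ai↓) l × To (_≡ ai↑) l) ⊎ (From (_≡ ai↑) l × To (_≡ ai↓) l))

  SimpleEdge : E → Set
  SimpleEdge e = Σ Dir λ d → AIConn [ (e , d) ]

  Infix : List OE → List OE → Set
  Infix l' l = Σ (List OE) λ as → Σ (List OE) λ bs → l ≡ as ++ (l' ++ bs)

  Clean : List OE → Set
  Clean l = IsAIPath l × (∀ l' → Infix l' l → AIConn l' → length l' ≡ 1)

  Maximal : List OE → Set
  Maximal l = IsAIPath l ×
    (∀ l' → IsAIPath l' → (∀ {e} → e ∈ edges l → e ∈ edges l') →
       length l' ≤ length l)

  AICycle : List OE → Set
  AICycle l = IsAIPath l ×
    (Σ V λ v → StartsAt l (inj₂ v) × EndsAt l (inj₂ v)) × Unique (edges l)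

  Fragile : List OE → Set
  Fragile l = AICycle l × Any (λ x → SimpleEdge (proj₁ x)) l

  HasFragile : Set
  HasFragile = Σ (List OE) Fragile

  CycleFree : Set
  CycleFree = ∀ l → ¬ AICycle l

  EdgeOnAICycle : E → Set
  EdgeOnAICycle e = Σ (List OE) λ l → AICycle l × e ∈ edges l

  Incident : E → V → Set
  Incident e v = up e ≡ inj₂ v ⊎ dn e ≡ inj₂ v

  VertexOnAICycle : V → Set
  VertexOnAICycle v = Σ (List OE) λ l → AICycle l × Any (λ x → Incident (proj₁ x) v) l

  Extremal : E → Set
  Extremal e = SimpleEdge e × Σ (List OE) λ l → Maximal l × Clean l ×
    Σ (List E) λ as → Σ (List E) λ bs →
      edges l ≡ as ++ (e ∷ bs) × All (λ e' → ¬ SimpleEdge e') bs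

  StreamlinedFlow : Set
  StreamlinedFlow = ¬ (Σ (List OE) λ l → IsDownPath l ×
    From (λ x → x ≡ ai↓ ⊎ x ≡ aw↓) l × To (λ x → x ≡ ai↑ ⊎ x ≡ aw↑) l)

  IsContr : Label → Set
  IsContr x = x ≡ ac↓ ⊎ x ≡ ac↑

  Polarity : Set
  Polarity = E → Sign

  ValidPol : Polarity → Set
  ValidPol π = ∀ v →
    (IsContr (lab v) → ∀ e e' → Incident e v → Incident e' v → π e ≡ π e') ×
    (IsAI (lab v) → ∀ e e' → Incident e v → Incident e' v → e ≢ e' → π e ≢ π e')

  NegV PosV : Polarity → V → Set
  NegV π v = Σ E λ e → Incident e v × π e ≡ minus
  PosV π v = ∀ e → Incident e v → π e ≡ plus

  record WF : Set where
    field
      finV   : Σ ℕ λ n → Fin n ↔ V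
      finE   : Σ ℕ λ n → Fin n ↔ E
      upU    : ∀ u → Σ E λ e → up e ≡ inj₁ u × (∀ e' → up e' ≡ inj₁ u → e' ≡ e)
      dnL    : ∀ l → Σ E λ e → dn e ≡ inj₁ l × (∀ e' → dn e' ≡ inj₁ l → e' ≡ e)
      inDeg  : ∀ v → Fin (ins (lab v)) ↔ (Σ E λ e → dn e ≡ inj₂ v)
      outDeg : ∀ v → Fin (outs (lab v)) ↔ (Σ E λ e → up e ≡ inj₂ v)
      acyclic : ∀ l v → IsDownPath l → StartsAt l (inj₂ v) → EndsAt l (inj₂ v) → ⊥
      polar  : Σ Polarity ValidPol

open FlowNotions public

module _ {At : Set} {bar : At → At} where

  SV : {α β : Fm At} → Step bar α β → Set
  SV (step ξ r) = RV r

  slab : {α β : Fm At} (σ : Step bar α β) → SV σ → Label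
  slab (step ξ r) = rlab r

  sFwd : {α β : Fm At} (σ : Step bar α β) → Occ α → Occ β ⊎ SV σ
  sFwd (step ξ {α'} {β'} r) = cFwd ξ {α'} {β'} (rFwd r)

  SNew : {α β : Fm At} → Step bar α β → Set
  SNew (step ξ r) = RNew r

  sNewV : {α β : Fm At} (σ : Step bar α β) → SNew σ → SV σ
  sNewV (step ξ r) n = proj₁ n

  sNewOcc : {α β : Fm At} (σ : Step bar α β) → SNew σ → Occ β
  sNewOcc (step ξ {β = β'} r) n = cIn ξ {β'} (proj₂ n)

  -- vertices: one per atomic inference step
  DV : {α β : Fm At} → Deriv bar α β → Set
  DV done = ⊥
  DV (σ ▸ d) = SV σ ⊎ DV d

  dlab : {α β : Fm At} (d : Deriv bar α β) → DV d → Label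
  dlab done ()
  dlab (σ ▸ d) (inj₁ v) = slab σ v
  dlab (σ ▸ d) (inj₂ v) = dlab d v

  -- edges not starting in the premiss (identified by their creating step)
  Inner : {α β : Fm At} → Deriv bar α β → Set
  Inner done = ⊥
  Inner (σ ▸ d) = SNew σ ⊎ Inner d

  upInner : {α β : Fm At} (d : Deriv bar α β) → Inner d → DV d
  upInner done ()
  upInner (σ ▸ d) (inj₁ n) = inj₁ (sNewV σ n)
  upInner (σ ▸ d) (inj₂ x) = inj₂ (upInner d x)

  -- lower end of the edge through an occurrence of the premiss
  dnTop : {α β : Fm At} (d : Deriv bar α β) → Occ α → Occ β ⊎ DV d
  dnTop done p = inj₁ p
  dnTop (σ ▸ d) p =
    case⊎ (λ q → map₂ inj₂ (dnTop d q)) (λ v → inj₂ (inj₁ v)) (sFwd σ p)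

  dnInner : {α β : Fm At} (d : Deriv bar α β) → Inner d → Occ β ⊎ DV d
  dnInner done ()
  dnInner (σ ▸ d) (inj₁ n) = map₂ inj₂ (dnTop d (sNewOcc σ n))
  dnInner (σ ▸ d) (inj₂ x) = map₂ inj₂ (dnInner d x)

  flowOf : {α β : Fm At} → Deriv bar α β → Flow (Occ α) (Occ β)
  flowOf {α} d = record
    { V = DV d
    ; E = Occ α ⊎ Inner d
    ; lab = dlab d
    ; up = case⊎ inj₁ (λ x → inj₂ (upInner d x))
    ; dn = case⊎ (dnTop d) (dnInner d)
    }

-- Replacing a subgraph: A is obtained by plugging R into the hole of K.
-- K has the extra upper edges Q (edges leaving the hole) and extra lower
-- edges P (edges entering the hole); R has upper edges P, lower edges Q.

module Plug {U L P Q : Set} (K : Flow (U ⊎ Q) (L ⊎ P)) (R : Flow P Q) where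
  private
    module K = Flow K
    module R = Flow R

  -- a K-edge entering the hole at p, where R passes p straight through
  -- to some q: it is merged with the K-edge leaving at q
  Dropped : K.E → Set
  Dropped e = Σ P λ p → Σ R.E λ r → Σ Q λ q →
    K.dn e ≡ inj₁ (inj₂ p) × R.up r ≡ inj₁ p × R.dn r ≡ inj₁ q

  InternalR : R.E → Set
  InternalR r = Σ R.V (λ y → R.up r ≡ inj₂ y) × Σ R.V (λ x → R.dn r ≡ inj₂ x)

  GV : Set
  GV = K.V ⊎ R.V

  GE : Set
  GE = (Σ K.E λ e → ¬ Dropped e) ⊎ Σ R.E InternalR

  glab : GV → Label
  glab (inj₁ v) = K.lab v
  glab (inj₂ v) = R.lab v

  data UpRes : K.E → U ⊎ GV → Set where
    top  : ∀ {e u} → K.up e ≡ inj₁ (inj₁ u) → UpRes e (inj₁ u)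
    kv   : ∀ {e v} → K.up e ≡ inj₂ v → UpRes e (inj₂ (inj₁ v))
    rv   : ∀ {e q r y} → K.up e ≡ inj₁ (inj₂ q) → R.dn r ≡ inj₁ q →
           R.up r ≡ inj₂ y → UpRes e (inj₂ (inj₂ y))
    pass : ∀ {e q r p k z} → K.up e ≡ inj₁ (inj₂ q) → R.dn r ≡ inj₁ q →
           R.up r ≡ inj₁ p → K.dn k ≡ inj₁ (inj₂ p) → UpRes k z → UpRes e z

  data DnRes : K.E → L ⊎ GV → Set where
    bot : ∀ {e l} → K.dn e ≡ inj₁ (inj₁ l) → DnRes e (inj₁ l)
    kv  : ∀ {e v} → K.dn e ≡ inj₂ v → DnRes e (inj₂ (inj₁ v))
    rv  : ∀ {e p r x} → K.dn e ≡ inj₁ (inj₂ p) → R.up r ≡ inj₁ p →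
          R.dn r ≡ inj₂ x → DnRes e (inj₂ (inj₂ x))

  GUp : GE → U ⊎ GV → Set
  GUp (inj₁ (e , _)) z = UpRes e z
  GUp (inj₂ (r , _)) z = Σ R.V λ y → R.up r ≡ inj₂ y × z ≡ inj₂ (inj₂ y)

  GDn : GE → L ⊎ GV → Set
  GDn (inj₁ (e , _)) z = DnRes e z
  GDn (inj₂ (r , _)) z = Σ R.V λ x → R.dn r ≡ inj₂ x × z ≡ inj₂ (inj₂ x)

open Plug public using (Dropped; InternalR; GV; GE; glab; GUp; GDn)

record IsGlue {U L P Q : Set} (A : Flow U L) (K : Flow (U ⊎ Q) (L ⊎ P))
              (R : Flow P Q) : Set where
  field
    vbij  : Flow.V A ↔ GV K R
    ebij  : Flow.E A ↔ GE K R
    lab-ok : ∀ v → Flow.lab A v ≡ glab K R (Inverse.to vbij v)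
    up-ok : ∀ a → GUp K R (Inverse.to ebij a) (map₂ (Inverse.to vbij) (Flow.up A a))
    dn-ok : ∀ a → GDn K R (Inverse.to ebij a) (map₂ (Inverse.to vbij) (Flow.dn A a))

mkFlow : {U L : Set} (nv ne : ℕ) → Vec Label nv →
         Vec (U ⊎ Fin nv) ne → Vec (L ⊎ Fin nv) ne → Flow U L
mkFlow nv ne ls us ds = record
  { V = Fin nv ; E = Fin ne ; lab = lookup ls ; up = lookup us ; dn = lookup ds }

data LRule : Set where
  r-i r-ii r-iii r-iv r-v r-vi r-vii r-viii r-ix r-x : LRule

data InW : LRule → Set where
  w-i : InW r-i
  w-ii : InW r-ii
  w-iii : InW r-iii
  w-iv : InW r-iv
  w-v : InW r-v
  w-vi : InW r-vi
  w-vii : InW r-vii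

data InC : LRule → Set where
  c-viii : InC r-viii
  c-ix : InC r-ix
  c-x : InC r-x

-- number of boundary edges entering (lp) / leaving (lq) the replaced subgraph
lp lq : LRule → ℕ
lp r-i = 1
lp r-ii = 1
lp r-iii = 1
lp r-iv = 0
lp r-v = 0
lp r-vi = 0
lp r-vii = 2
lp r-viii = 3
lp r-ix = 0
lp r-x = 2
lq r-i = 1
lq r-ii = 1
lq r-iii = 0
lq r-iv = 1
lq r-v = 0
lq r-vi = 2
lq r-vii = 0
lq r-viii = 0
lq r-ix = 3
lq r-x = 2

-- notation: T k = k-th upper boundary edge (or ⊥-end for lower), N k = vertex k
private
  T : {n k : ℕ} → Fin n → Fin n ⊎ Fin k
  T i = inj₁ i
  N : {n k : ℕ} → Fin k → Fin n ⊎ Fin k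
  N i = inj₂ i

lhs rhs : (ρ : LRule) → Flow (Fin (lp ρ)) (Fin (lq ρ))
-- (i) weakening v0 into contraction v1 (other upper edge enters, lower leaves)
lhs r-i = mkFlow 2 3 (aw↓ ∷ ac↓ ∷ [])
  (N (# 0) ∷ T (# 0) ∷ N (# 1) ∷ []) (N (# 1) ∷ N (# 1) ∷ T (# 0) ∷ [])
-- (ii) cocontraction v0 with one lower edge into coweakening v1
lhs r-ii = mkFlow 2 3 (ac↑ ∷ aw↑ ∷ [])
  (T (# 0) ∷ N (# 0) ∷ N (# 0) ∷ []) (N (# 0) ∷ N (# 1) ∷ T (# 0) ∷ [])
-- (iii) weakening v0 into cointeraction v1; replaced by a coweakening
lhs r-iii = mkFlow 2 2 (aw↓ ∷ ai↑ ∷ [])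
  (N (# 0) ∷ T (# 0) ∷ []) (N (# 1) ∷ N (# 1) ∷ [])
-- (iv) interaction v0 with a lower edge into coweakening v1; replaced by a weakening
lhs r-iv = mkFlow 2 2 (ai↓ ∷ aw↑ ∷ [])
  (N (# 0) ∷ N (# 0) ∷ []) (N (# 1) ∷ T (# 0) ∷ [])
lhs r-v = mkFlow 2 1 (aw↓ ∷ aw↑ ∷ []) (N (# 0) ∷ []) (N (# 1) ∷ [])
lhs r-vi = mkFlow 2 3 (aw↓ ∷ ac↑ ∷ [])
  (N (# 0) ∷ N (# 1) ∷ N (# 1) ∷ []) (N (# 1) ∷ T (# 0) ∷ T (# 1) ∷ [])
lhs r-vii = mkFlow 2 3 (ac↓ ∷ aw↑ ∷ [])
  (T (# 0) ∷ T (# 1) ∷ N (# 0) ∷ []) (N (# 0) ∷ N (# 0) ∷ N (# 1) ∷ [])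
-- (viii) contraction v0 (upper ε1 = T0, ε2 = T1) into cointeraction v1
-- (other upper ε3 = T2)
lhs r-viii = mkFlow 2 4 (ac↓ ∷ ai↑ ∷ [])
  (T (# 0) ∷ T (# 1) ∷ N (# 0) ∷ T (# 2) ∷ [])
  (N (# 0) ∷ N (# 0) ∷ N (# 1) ∷ N (# 1) ∷ [])
-- (ix) interaction v0 (lower ε3 = T2 and ε) with ε into cocontraction v1
-- (lower ε1 = T0, ε2 = T1)
lhs r-ix = mkFlow 2 4 (ai↓ ∷ ac↑ ∷ [])
  (N (# 0) ∷ N (# 0) ∷ N (# 1) ∷ N (# 1) ∷ [])
  (T (# 2) ∷ N (# 1) ∷ T (# 0) ∷ T (# 1) ∷ [])
-- (x) contraction v0 (upper ε1, ε2) into cocontraction v1 (lower ε3, ε4)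
lhs r-x = mkFlow 2 5 (ac↓ ∷ ac↑ ∷ [])
  (T (# 0) ∷ T (# 1) ∷ N (# 0) ∷ N (# 1) ∷ N (# 1) ∷ [])
  (N (# 0) ∷ N (# 0) ∷ N (# 1) ∷ T (# 0) ∷ T (# 1) ∷ [])

rhs r-i = mkFlow 0 1 [] (T (# 0) ∷ []) (T (# 0) ∷ [])
rhs r-ii = mkFlow 0 1 [] (T (# 0) ∷ []) (T (# 0) ∷ [])
rhs r-iii = mkFlow 1 1 (aw↑ ∷ []) (T (# 0) ∷ []) (N (# 0) ∷ [])
rhs r-iv = mkFlow 1 1 (aw↓ ∷ []) (N (# 0) ∷ []) (T (# 0) ∷ [])
rhs r-v = mkFlow 0 0 [] [] []
rhs r-vi = mkFlow 2 2 (aw↓ ∷ aw↓ ∷ [])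
  (N (# 0) ∷ N (# 1) ∷ []) (T (# 0) ∷ T (# 1) ∷ [])
rhs r-vii = mkFlow 2 2 (aw↑ ∷ aw↑ ∷ [])
  (T (# 0) ∷ T (# 1) ∷ []) (N (# 0) ∷ N (# 1) ∷ [])
-- cocontraction v0 (upper ε3, lower δ1, δ2), cointeractions v1 {ε1,δ1}, v2 {ε2,δ2}
rhs r-viii = mkFlow 3 5 (ac↑ ∷ ai↑ ∷ ai↑ ∷ [])
  (T (# 2) ∷ N (# 0) ∷ N (# 0) ∷ T (# 0) ∷ T (# 1) ∷ [])
  (N (# 0) ∷ N (# 1) ∷ N (# 2) ∷ N (# 1) ∷ N (# 2) ∷ [])
-- contraction v0 (lower ε3, upper δ1, δ2), interactions v1 {ε1,δ1}, v2 {ε2,δ2}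
rhs r-ix = mkFlow 3 5 (ac↓ ∷ ai↓ ∷ ai↓ ∷ [])
  (N (# 0) ∷ N (# 1) ∷ N (# 2) ∷ N (# 1) ∷ N (# 2) ∷ [])
  (T (# 2) ∷ N (# 0) ∷ N (# 0) ∷ T (# 0) ∷ T (# 1) ∷ [])
-- cocontractions v0 (upper ε1), v1 (upper ε2); contractions v2 (lower ε3),
-- v3 (lower ε4); edges v0→v2, v0→v3, v1→v2, v1→v3
rhs r-x = mkFlow 4 8 (ac↑ ∷ ac↑ ∷ ac↓ ∷ ac↓ ∷ [])
  (T (# 0) ∷ T (# 1) ∷ N (# 2) ∷ N (# 3) ∷
   N (# 0) ∷ N (# 0) ∷ N (# 1) ∷ N (# 1) ∷ [])
  (N (# 0) ∷ N (# 1) ∷ T (# 0) ∷ T (# 1) ∷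
   N (# 2) ∷ N (# 3) ∷ N (# 2) ∷ N (# 3) ∷ [])



record LStep {U L : Set} (ρ : LRule) (A A' : Flow U L) : Set₁ where
  field
    K    : Flow (U ⊎ Fin (lq ρ)) (L ⊎ Fin (lp ρ))
    K-wf : WF K
    gl   : IsGlue A K (lhs ρ)
    gl'  : IsGlue A' K (rhs ρ)

_⟶w_ : {U L : Set} → Flow U L → Flow U L → Set₁
A ⟶w A' = Σ LRule λ ρ → InW ρ × LStep ρ A A'

_⟶c_ : {U L : Set} → Flow U L → Flow U L → Set₁
A ⟶c A' = Σ LRule λ ρ → InC ρ × LStep ρ A A'

NormalW NormalC : {U L : Set} → Flow U L → Set₁
NormalW A = ¬ (Σ _ λ A' → A ⟶w A')
NormalC A = ¬ (Σ _ λ A' → A ⟶c A')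

PFlow : Set → Set → Set₁
PFlow U L = Σ (Flow U L) (Polarity)

-- a c-step applied (in BC step 1) to a negative (co)contraction vertex of the
-- redex lying on an ai-cycle; the polarity is carried along (it agrees on all
-- edges outside the replaced subgraph and is a polarity of the new flow)
record PolCStep {U L : Set} (X Y : PFlow U L) : Set₁ where
  field
    ρ   : LRule
    isC : InC ρ
    st  : LStep ρ (proj₁ X) (proj₁ Y)
  open LStep st
  field
    v      : Flow.V (lhs ρ)
    v-contr : IsContr (lhs ρ) (Flow.lab (lhs ρ) v)
    v-neg  : NegV (proj₁ X) (proj₂ X) (Inverse.from (IsGlue.vbij gl) (inj₂ v))
    v-cyc  : VertexOnAICycle (proj₁ X) (Inverse.from (IsGlue.vbij gl) (inj₂ v))
    valid' : ValidPol (proj₁ Y) (proj₂ Y)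
    agree  : ∀ e (d : ¬ Dropped K (lhs ρ) e) (d' : ¬ Dropped K (rhs ρ) e) →
      proj₂ X (Inverse.from (IsGlue.ebij gl) (inj₁ (e , d))) ≡
      proj₂ Y (Inverse.from (IsGlue.ebij gl') (inj₁ (e , d')))

-- interaction v0 --ε1--> cointeraction v1; ε2 (other lower edge of v0) is
-- the boundary edge leaving, ε3 (other upper edge of v1) the one entering
Rai : Flow (Fin 1) (Fin 1)
Rai = mkFlow 2 3 (ai↓ ∷ ai↑ ∷ [])
  (N (# 0) ∷ N (# 0) ∷ T (# 0) ∷ []) (N (# 1) ∷ T (# 0) ∷ N (# 1) ∷ [])

ε₁ : {U L : Set} {B : Flow U L} {A : Flow (U ⊎ Fin 1) (L ⊎ Fin 1)} →
     IsGlue B A Rai → Flow.E B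
ε₁ g = Inverse.from (IsGlue.ebij g)
         (inj₂ (zero , (zero , refl) , (suc zero , refl)))

-- B' : add a weakening on the upper edge ε2 of A
Weak : {U L : Set} → Flow (U ⊎ Fin 1) (L ⊎ Fin 1) → Flow U (L ⊎ Fin 1)
Weak A = record
  { V = Flow.V A ⊎ ⊤
  ; E = Flow.E A
  ; lab = case⊎ (Flow.lab A) (λ _ → aw↓)
  ; up = λ e → f (Flow.up A e)
  ; dn = λ e → map₂ inj₁ (Flow.dn A e)
  }
  where
  f : _ → _
  f (inj₁ (inj₁ u)) = inj₁ u
  f (inj₁ (inj₂ _)) = inj₂ (inj₂ tt)
  f (inj₂ v) = inj₂ (inj₁ v)

-- B'' : add a coweakening on the lower edge ε3 of A
CoWeak : {U L : Set} → Flow (U ⊎ Fin 1) (L ⊎ Fin 1) → Flow (U ⊎ Fin 1) L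
CoWeak A = record
  { V = Flow.V A ⊎ ⊤
  ; E = Flow.E A
  ; lab = case⊎ (Flow.lab A) (λ _ → aw↑)
  ; up = λ e → map₂ inj₁ (Flow.up A e)
  ; dn = λ e → f (Flow.dn A e)
  }
  where
  f : _ → _
  f (inj₁ (inj₁ l)) = inj₁ l
  f (inj₁ (inj₂ _)) = inj₂ (inj₂ tt)
  f (inj₂ v) = inj₂ (inj₁ v)

module CombDef {U L : Set} (D' : Flow U (L ⊎ Fin 1)) (D'' : Flow (U ⊎ Fin 1) L) where
  private
    module D₁ = Flow D'
    module D₂ = Flow D''

  -- vertices: those of D', D'', a cocontraction per upper edge,
  -- a contraction per lower edge
  CV : Set
  CV = (D₁.V ⊎ D₂.V) ⊎ (U ⊎ L)

  clab : CV → Label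
  clab (inj₁ (inj₁ v)) = D₁.lab v
  clab (inj₁ (inj₂ v)) = D₂.lab v
  clab (inj₂ (inj₁ _)) = ac↑
  clab (inj₂ (inj₂ _)) = ac↓

  -- edges: new upper edges e_i, new lower edges e'_j, edges of D', edges of
  -- D'' except its upper edge ε̂2 (which is identified with ε̃3 of D')
  CE : Set
  CE = (U ⊎ L) ⊎ (D₁.E ⊎ Σ D₂.E λ e → ¬ (D₂.up e ≡ inj₁ (inj₂ zero)))

  coc : U → CV
  coc u = inj₂ (inj₁ u)
  con : L → CV
  con l = inj₂ (inj₂ l)

  data CUp : CE → U ⊎ CV → Set where
    u-new  : ∀ {u} → CUp (inj₁ (inj₁ u)) (inj₁ u)
    l-new  : ∀ {l} → CUp (inj₁ (inj₂ l)) (inj₂ (con l))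
    d₁-top : ∀ {e u} → D₁.up e ≡ inj₁ u → CUp (inj₂ (inj₁ e)) (inj₂ (coc u))
    d₁-v   : ∀ {e v} → D₁.up e ≡ inj₂ v → CUp (inj₂ (inj₁ e)) (inj₂ (inj₁ (inj₁ v)))
    d₂-top : ∀ {e u p} → D₂.up e ≡ inj₁ (inj₁ u) → CUp (inj₂ (inj₂ (e , p))) (inj₂ (coc u))
    d₂-v   : ∀ {e v p} → D₂.up e ≡ inj₂ v → CUp (inj₂ (inj₂ (e , p))) (inj₂ (inj₁ (inj₂ v)))

  data CDn : CE → L ⊎ CV → Set where
    u-new  : ∀ {u} → CDn (inj₁ (inj₁ u)) (inj₂ (coc u))
    l-new  : ∀ {l} → CDn (inj₁ (inj₂ l)) (inj₁ l)
    d₁-bot : ∀ {e l} → D₁.dn e ≡ inj₁ (inj₁ l) → CDn (inj₂ (inj₁ e)) (inj₂ (con l))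
    d₁-v   : ∀ {e v} → D₁.dn e ≡ inj₂ v → CDn (inj₂ (inj₁ e)) (inj₂ (inj₁ (inj₁ v)))
    -- the merged edge ε̃3 = ε̂2 ends where ε̂2 ends in D''
    d₁-mbot : ∀ {e e₂ l} → D₁.dn e ≡ inj₁ (inj₂ zero) → D₂.up e₂ ≡ inj₁ (inj₂ zero) →
              D₂.dn e₂ ≡ inj₁ l → CDn (inj₂ (inj₁ e)) (inj₂ (con l))
    d₁-mv  : ∀ {e e₂ v} → D₁.dn e ≡ inj₁ (inj₂ zero) → D₂.up e₂ ≡ inj₁ (inj₂ zero) →
              D₂.dn e₂ ≡ inj₂ v → CDn (inj₂ (inj₁ e)) (inj₂ (inj₁ (inj₂ v)))
    d₂-bot : ∀ {e l p} → D₂.dn e ≡ inj₁ l → CDn (inj₂ (inj₂ (e , p))) (inj₂ (con l))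
    d₂-v   : ∀ {e v p} → D₂.dn e ≡ inj₂ v → CDn (inj₂ (inj₂ (e , p))) (inj₂ (inj₁ (inj₂ v)))

open CombDef public using (CV; CE; clab; CUp; CDn)

record IsComb {U L : Set} (C : Flow U L) (D' : Flow U (L ⊎ Fin 1))
              (D'' : Flow (U ⊎ Fin 1) L) : Set where
  field
    vbij  : Flow.V C ↔ CV D' D''
    ebij  : Flow.E C ↔ CE D' D''
    lab-ok : ∀ v → Flow.lab C v ≡ clab D' D'' (Inverse.to vbij v)
    up-ok : ∀ a → CUp D' D'' (Inverse.to ebij a) (map₂ (Inverse.to vbij) (Flow.up C a))
    dn-ok : ∀ a → CDn D' D'' (Inverse.to ebij a) (map₂ (Inverse.to vbij) (Flow.dn C a))

data _⟶bc_ : {U L : Set} → Flow U L → Flow U L → Set₁ where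
  bc-stop  : ∀ {U L} {B : Flow U L} → ¬ HasFragile B → B ⟶bc B
  bc-split : ∀ {U L} {B C : Flow U L} (A : Flow (U ⊎ Fin 1) (L ⊎ Fin 1))
               {D' : Flow U (L ⊎ Fin 1)} {D'' : Flow (U ⊎ Fin 1) L} →
             WF A → (g : IsGlue B A Rai) → EdgeOnAICycle B (ε₁ g) →
             Weak A ⟶bc D' → CoWeak A ⟶bc D'' → IsComb C D' D'' → B ⟶bc C

data _⟶ex_ : {U L : Set} → Flow U L → Flow U L → Set₁ where
  ex-stop  : ∀ {U L} {B : Flow U L} → ¬ (Σ (Flow.E B) (Extremal B)) → B ⟶ex B
  ex-split : ∀ {U L} {B C : Flow U L} (A : Flow (U ⊎ Fin 1) (L ⊎ Fin 1))
               {D' : Flow U (L ⊎ Fin 1)} {D'' : Flow (U ⊎ Fin 1) L} →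
             WF A → (g : IsGlue B A Rai) → Extremal B (ε₁ g) →
             Weak A ⟶ex D' → CoWeak A ⟶ex D'' → IsComb C D' D'' → B ⟶ex C

-- Algorithm Str: Str Φ₀ Φ₅ means "Φ₅ is a possible output of Str on Φ₀"
-- (all intermediate derivations have the same premiss and conclusion)

record Str {At : Set} {bar : At → At} {α β : Fm At}
           (Φ₀ Φ₅ : Deriv bar α β) : Set₁ where
  field
    π₀       : Polarity (flowOf Φ₀)
    π₀-valid : ValidPol (flowOf Φ₀) π₀
    Φ₁       : Deriv bar α β
    π₁       : Polarity (flowOf Φ₁)
    bc₁      : Star PolCStep (flowOf Φ₀ , π₀) (flowOf Φ₁ , π₁)
    bc₁-done : ∀ v → IsContr (flowOf Φ₁) (Flow.lab (flowOf Φ₁) v) →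
               VertexOnAICycle (flowOf Φ₁) v → PosV (flowOf Φ₁) π₁ v
    Φ₂       : Deriv bar α β
    bc₂      : flowOf Φ₁ ⟶bc flowOf Φ₂
    Φ₃       : Deriv bar α β
    ex₁      : Star _⟶c_ (flowOf Φ₂) (flowOf Φ₃)
    ex₁-nf   : NormalC (flowOf Φ₃)
    Φ₄       : Deriv bar α β
    ex₂      : flowOf Φ₃ ⟶ex flowOf Φ₄
    w-steps  : Star _⟶w_ (flowOf Φ₄) (flowOf Φ₅)
    w-nf     : NormalW (flowOf Φ₅)

Streamlined : {At : Set} {bar : At → At} {α β : Fm At} → Deriv bar α β → Set
Streamlined Φ = StreamlinedFlow (flowOf Φ)

SuperStreamlined : {At : Set} {bar : At → At} {α β : Fm At} → Deriv bar α β → Set₁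
SuperStreamlined Φ = Streamlined Φ × NormalW (flowOf Φ)

-- A derivation is handled as a rewriting N of formulae whose atoms are edges of a fixed flow. Each
-- step of the algorithm substitutes formulae for edges in such a rewriting, and a rewriting that
-- uses every vertex once can be read back as a derivation with that flow.
--
-- Orienting positive edges downwards and negative ones upwards turns ai-paths into directed paths,
-- so a flow is cycle-free iff its vertices carry a rank that increases along all arcs. A rule of c
-- acts on two contractions at ranks i < j and produces at most two at each end, nearer to the end
-- of the order; weighing a contraction by 3 to the power of its distance to that end gives termination.
-- After step 1 of BC the negative edges on ai-cycles are simple, hence all ai-cycles are fragile;
-- this is inherited by the halves of a split flow, and Comb only puts one half before the other.
--
-- In a cycle-free c-normal flow the ai-connections are the simple edges. Past an extremal simple
-- edge the maximal path goes on along a non-simple edge, so there is no interaction above ε₃ or no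
-- cointeraction below ε₂. This persists in the halves and keeps descending paths from interactions
-- to cointeractions from crossing the bridge; the rules of w create no such paths either.
module Submission where

open import Defs
open import Level using (Level)
open import Data.Nat using (ℕ; zero; suc; _+_; _*_; _∸_; _^_; _≤_; _<_; z≤n; s≤s)
import Data.Nat.Properties as ℕP
open import Data.Fin using (Fin; zero; suc; #_; _↑ˡ_; _↑ʳ_)
import Data.Fin.Properties as FinP
open import Data.Vec using (Vec; []; _∷_; lookup)
open import Data.List using (List; []; _∷_; _++_; length; map; [_])
open import Data.Sum using (_⊎_; map₁; map₂) renaming (inj₁ to inl; inj₂ to inr; [_,_] to case⊎)
open import Data.Sum.Properties using () renaming (inj₁-injective to inl-inj; inj₂-injective to inr-inj)
import Data.Sum.Properties as SumP
open import Data.Sum.Function.Propositional using (_⊎-↔_)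
open import Data.Product using (Σ; ∃; _×_; _,_) renaming (proj₁ to fst; proj₂ to snd)
open import Data.Empty using (⊥; ⊥-elim)
open import Data.Unit using (⊤; tt)
open import Relation.Nullary using (¬_; Dec; yes; no; does; contradiction)
open import Relation.Nullary.Decidable using (map′; ¬?; _×-dec_; _⊎-dec_; _→-dec_; toWitness; fromWitness)
open import Relation.Binary.Definitions using () renaming (DecidableEquality to DecEq)
open import Relation.Binary.PropositionalEquality using (_≡_; _≢_; refl; sym; trans; cong; cong₂; subst; subst₂; inspect; module ≡-Reasoning)
open import Function using (_∘_; id)
open import Function.Bundles using (_↔_; Inverse; mk↔ₛ′)
open import Function.Properties.Inverse using (↔-refl; ↔-sym; ↔-trans)
open import Algebra.Properties.CommutativeMonoid.Sum ℕP.+-0-commutativeMonoid using (sum; sum-permute; sum-cong-≗)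
open import Relation.Nullary.Decidable using (True)
open import Data.Nat.Solver using (module +-*-Solver)
import Data.Sum
import Data.Nat
open import Data.List.Relation.Unary.All using (All; []; _∷_)
import Data.Unit.Properties as UnitP
open import Data.List using (tabulate; filter)
open import Data.List.Membership.Propositional using (_∈_; _∉_)
open import Data.List.Membership.Propositional.Properties using (∈-tabulate⁺)
open import Data.List.Relation.Unary.Any using (Any; here; there)
open import Data.List.Relation.Unary.AllPairs using (AllPairs; []; _∷_)
open import Data.List.Relation.Unary.Unique.Propositional using (Unique)
import Data.List.Relation.Unary.Any as Any
import Data.List.Relation.Unary.All as All
open import Data.Bool using (Bool; true; false; if_then_else_)
open import Data.List.Membership.Propositional using (lose)
open import Relation.Binary.Construct.Closure.ReflexiveTransitive using (Star; _◅_) renaming (ε to nil)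
import Data.List.Properties as ListP
open import Data.List.Relation.Unary.Any.Properties using (++⁺ʳ; ++⁺ˡ; ++⁻)
open import Data.List.Membership.Propositional.Properties using (∈-++⁺ˡ; ∈-map⁺)
import Data.List.Relation.Unary.Any.Properties as AnyP

open Inverse using (to; from) renaming (strictlyInverseˡ to inv-l; strictlyInverseʳ to inv-r)

to-inj : ∀ {A B : Set} (b : A ↔ B) {x y} → to b x ≡ to b y → x ≡ y
to-inj b {x} {y} p = trans (sym (inv-r b x)) (trans (cong (from b) p) (inv-r b y))

from-inj : ∀ {A B : Set} (b : A ↔ B) {x y} → from b x ≡ from b y → x ≡ y
from-inj b {x} {y} p = trans (sym (inv-l b x)) (trans (cong (to b) p) (inv-l b y))

uip : ∀ {A : Set} {x y : A} (p q : x ≡ y) → p ≡ q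
uip refl refl = refl

Σ≡ : ∀ {A : Set} {P : A → Set} → (∀ {a} (p q : P a) → p ≡ q) →
     {x y : Σ A P} → fst x ≡ fst y → x ≡ y
Σ≡ irr {a , p} {.a , q} refl = cong (a ,_) (irr p q)

inl≢inr : ∀ {A B : Set} {a : A} {b : B} → inl a ≢ inr b
inl≢inr ()

Finite : Set → Set
Finite A = Σ ℕ λ n → Fin n ↔ A

module _ {A : Set} where

  finite-≟ : Finite A → DecEq A
  finite-≟ (n , b) x y = map′ (from-inj b) (cong (from b)) (from b x FinP.≟ from b y)

  finite-any? : Finite A → {P : A → Set} → (∀ a → Dec (P a)) → Dec (Σ A P)
  finite-any? (n , b) {P} P? =
    map′ (λ { (i , p) → to b i , p })
         (λ { (a , p) → from b a , subst P (sym (inv-l b a)) p })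
         (FinP.any? (P? ∘ to b))

  finite-map : ∀ {B : Set} → Finite A → A ↔ B → Finite B
  finite-map (n , b) c = n , ↔-trans b c

  finite-⊎ : ∀ {B : Set} → Finite A → Finite B → Finite (A ⊎ B)
  finite-⊎ (k , b) (n , c) = k + n , ↔-trans FinP.+↔⊎ (b ⊎-↔ c)

finite-⊥ : Finite ⊥
finite-⊥ = 0 , FinP.0↔⊥

finite-⊤ : Finite ⊤
finite-⊤ = 1 , FinP.1↔⊤

Σ-suc : ∀ {n} {P : Fin (suc n) → Set} → Σ (Fin (suc n)) P ↔ (P zero ⊎ Σ (Fin n) (P ∘ suc))
Σ-suc = mk↔ₛ′ (λ { (zero , p) → inl p ; (suc i , p) → inr (i , p) })
              (λ { (inl p) → zero , p ; (inr (i , p)) → suc i , p })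
              (λ { (inl p) → refl ; (inr _) → refl })
              (λ { (zero , p) → refl ; (suc i , p) → refl })

finite-prop : {P : Set} → (∀ (p q : P) → p ≡ q) → Dec P → Finite P
finite-prop irr (yes p) = 1 , mk↔ₛ′ (λ _ → p) (λ _ → zero) (irr p) (λ { zero → refl })
finite-prop irr (no ¬p) = 0 , mk↔ₛ′ (λ ()) (⊥-elim ∘ ¬p) (⊥-elim ∘ ¬p) (λ ())

finite-ΣFin : ∀ n {P : Fin n → Set} → (∀ {a} (p q : P a) → p ≡ q) → (∀ a → Dec (P a)) → Finite (Σ (Fin n) P)
finite-ΣFin zero irr P? = 0 , mk↔ₛ′ (λ ()) (λ ()) (λ ()) (λ ())
finite-ΣFin (suc n) irr P? =
  finite-map (finite-⊎ (finite-prop irr (P? zero)) (finite-ΣFin n irr (P? ∘ suc))) (↔-sym Σ-suc)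

finite-Σ : ∀ {A : Set} → Finite A → {P : A → Set} → (∀ {a} (p q : P a) → p ≡ q) → (∀ a → Dec (P a)) → Finite (Σ A P)
finite-Σ (n , b) {P} irr P? = finite-map (finite-ΣFin n irr (P? ∘ to b))
  (mk↔ₛ′ (λ { (i , p) → to b i , p })
         (λ { (a , p) → from b a , subst P (sym (inv-l b a)) p })
         (λ { (a , p) → Σ≡ irr (inv-l b a) })
         (λ { (i , p) → Σ≡ irr (inv-r b i) }))

infix 4 _≟ˡ_ _≟ˢ_ _≟ᵈ_

private
  code : Label → Fin 6
  code ai↓ = # 0
  code ai↑ = # 1
  code aw↓ = # 2
  code aw↑ = # 3
  code ac↓ = # 4
  code ac↑ = # 5
  decode : Fin 6 → Label
  decode = lookup (ai↓ ∷ ai↑ ∷ aw↓ ∷ aw↑ ∷ ac↓ ∷ ac↑ ∷ [])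
  decode-code : ∀ k → decode (code k) ≡ k
  decode-code ai↓ = refl
  decode-code ai↑ = refl
  decode-code aw↓ = refl
  decode-code aw↑ = refl
  decode-code ac↓ = refl
  decode-code ac↑ = refl

_≟ˡ_ : DecEq Label
k ≟ˡ l = map′ (λ p → trans (sym (decode-code k)) (trans (cong decode p) (decode-code l))) (cong code) (code k FinP.≟ code l)

_≟ˢ_ : DecEq Sign
plus  ≟ˢ plus  = yes refl
plus  ≟ˢ minus = no λ ()
minus ≟ˢ plus  = no λ ()
minus ≟ˢ minus = yes refl

_≟ᵈ_ : DecEq Dir
⇓ ≟ᵈ ⇓ = yes refl
⇓ ≟ᵈ ⇑ = no λ ()
⇑ ≟ᵈ ⇓ = no λ ()
⇑ ≟ᵈ ⇑ = yes refl

opp : Sign → Sign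
opp plus = minus
opp minus = plus

opp-≢ : ∀ {x y} → x ≢ y → y ≡ opp x
opp-≢ {plus} {plus} p = ⊥-elim (p refl)
opp-≢ {plus} {minus} p = refl
opp-≢ {minus} {plus} p = refl
opp-≢ {minus} {minus} p = ⊥-elim (p refl)

record IsPorts {E B V I : Set} (end : E → B ⊎ V) (v : V) (i : I → E) : Set where
  field
    hit : ∀ j → end (i j) ≡ inr v
    inj : ∀ {j k} → i j ≡ i k → j ≡ k
    all : ∀ x → end x ≡ inr v → Σ I λ j → i j ≡ x
open IsPorts public

module _ {E B V I : Set} {end : E → B ⊎ V} {v : V} where

  ↔⇒ports : (b : I ↔ Σ E λ e → end e ≡ inr v) → IsPorts end v (fst ∘ to b)
  ↔⇒ports b = record
    { hit = λ j → snd (to b j)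
    ; inj = λ p → to-inj b (Σ≡ uip p)
    ; all = λ x p → from b (x , p) , cong fst (inv-l b (x , p)) }

  ports⇒↔ : {i : I → E} → IsPorts end v i → I ↔ Σ E λ e → end e ≡ inr v
  ports⇒↔ {i} P = mk↔ₛ′ (λ j → i j , hit P j) (λ { (x , p) → fst (all P x p) })
    (λ { (x , p) → Σ≡ uip (snd (all P x p)) }) (λ j → inj P (snd (all P (i j) (hit P j))))

  ports-∘ : {J : Set} {i : I → E} → IsPorts end v i → (b : J ↔ I) → IsPorts end v (i ∘ to b)
  ports-∘ {i = i} P b = record
    { hit = λ j → hit P (to b j)
    ; inj = λ p → to-inj b (inj P p)
    ; all = λ x p → let (k , q) = all P x p in from b k , trans (cong i (inv-l b k)) q }

open WF public

ins-ports : ∀ {U L} {A : Flow U L} → WF A → ∀ v → Σ (Fin (ins (Flow.lab A v)) → Flow.E A) (IsPorts (Flow.dn A) v)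
ins-ports W v = _ , ↔⇒ports (inDeg W v)

outs-ports : ∀ {U L} {A : Flow U L} → WF A → ∀ v → Σ (Fin (outs (Flow.lab A v)) → Flow.E A) (IsPorts (Flow.up A) v)
outs-ports W v = _ , ↔⇒ports (outDeg W v)

swap2 : Fin 2 ↔ Fin 2
swap2 = mk↔ₛ′ f f g g
  where
  f : Fin 2 → Fin 2
  f zero = suc zero
  f (suc zero) = zero
  g : ∀ j → f (f j) ≡ j
  g zero = refl
  g (suc zero) = refl

orient : ∀ {E B V : Set} {end : E → B ⊎ V} {v : V} {n} {i : Fin n → E} → n ≤ 2 → IsPorts end v i →
         ∀ e → end e ≡ inr v → (k : Fin n) → Σ (Fin n → E) λ i' → IsPorts end v i' × i' k ≡ e
orient {n = suc zero} le P e p zero with all P e p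
... | zero , q = _ , P , q
orient {n = suc (suc zero)} le P e p k with all P e p
orient {n = suc (suc zero)} le P e p zero | zero , q = _ , P , q
orient {n = suc (suc zero)} le P e p zero | suc zero , q = _ , ports-∘ P swap2 , q
orient {n = suc (suc zero)} le P e p (suc zero) | zero , q = _ , ports-∘ P swap2 , q
orient {n = suc (suc zero)} le P e p (suc zero) | suc zero , q = _ , P , q
orient {n = suc (suc (suc n))} (s≤s (s≤s ())) P e p k

ins≤2 : ∀ k → ins k ≤ 2
ins≤2 ai↓ = z≤n
ins≤2 ai↑ = ℕP.≤-refl
ins≤2 aw↓ = z≤n
ins≤2 aw↑ = s≤s z≤n
ins≤2 ac↓ = ℕP.≤-refl
ins≤2 ac↑ = s≤s z≤n

outs≤2 : ∀ k → outs k ≤ 2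
outs≤2 ai↓ = ℕP.≤-refl
outs≤2 ai↑ = z≤n
outs≤2 aw↓ = s≤s z≤n
outs≤2 aw↑ = z≤n
outs≤2 ac↓ = s≤s z≤n
outs≤2 ac↑ = ℕP.≤-refl

-- Maps of flows that may forget boundary edges and weakenings, but create no paths.
record Mor {U1 L1 U2 L2 : Set} (A : Flow U1 L1) (B : Flow U2 L2) : Set where
  private
    module A = Flow A
    module B = Flow B
  field
    fV  : A.V → B.V
    fE  : A.E → B.E
    fE-inj : ∀ {x y} → fE x ≡ fE y → x ≡ y
    fup : ∀ {e v} → A.up e ≡ inr v → B.up (fE e) ≡ inr (fV v)
    fdn : ∀ {e v} → A.dn e ≡ inr v → B.dn (fE e) ≡ inr (fV v)
    flab : ∀ v → B.lab (fV v) ≡ A.lab v ⊎ (¬ IsAI A (A.lab v) × ¬ IsContr A (A.lab v))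

module MorProps {U1 L1 U2 L2 : Set} {A : Flow U1 L1} {B : Flow U2 L2} (M : Mor A B) where
  open Mor M
  private
    module A = Flow A
    module B = Flow B

  fOE : OE A → OE B
  fOE (e , d) = fE e , d

  fsrc : ∀ x {v} → src A x ≡ inr v → src B (fOE x) ≡ inr (fV v)
  fsrc (e , ⇓) p with A.up e in eq
  fsrc (e , ⇓) refl | inr v rewrite fup eq = refl
  fsrc (e , ⇑) p with A.dn e in eq
  fsrc (e , ⇑) refl | inr v rewrite fdn eq = refl

  ftgt : ∀ x {v} → tgt A x ≡ inr v → tgt B (fOE x) ≡ inr (fV v)
  ftgt (e , ⇓) p with A.dn e in eq
  ftgt (e , ⇓) refl | inr v rewrite fdn eq = refl
  ftgt (e , ⇑) p with A.up e in eq
  ftgt (e , ⇑) refl | inr v rewrite fup eq = refl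

  fAI : ∀ v → IsAI A (A.lab v) → IsAI B (B.lab (fV v))
  fAI v i with flab v
  ... | inl p rewrite p = i
  ... | inr (n , _) = ⊥-elim (n i)

  fContr : ∀ v → IsContr A (A.lab v) → IsContr B (B.lab (fV v))
  fContr v i with flab v
  ... | inl p rewrite p = i
  ... | inr (_ , n) = ⊥-elim (n i)

  flink : ∀ x y → Link A x y → Link B (fOE x) (fOE y)
  flink x y (w , p , q , inl d) = fV w , ftgt x p , fsrc y q , inl d
  flink x y (w , p , q , inr (d , i , n)) = fV w , ftgt x p , fsrc y q , inr (d , fAI w i , n ∘ fE-inj)

  fchain : ∀ l → Chain A l → Chain B (map fOE l)
  fchain [] c = tt
  fchain (x ∷ []) c = tt
  fchain (x ∷ y ∷ l) (k , c) = flink x y k , fchain (y ∷ l) c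

  fstart : ∀ l {v} → StartsAt A l (inr v) → StartsAt B (map fOE l) (inr (fV v))
  fstart (x ∷ l) p = fsrc x p

  fend : ∀ l {v} → EndsAt A l (inr v) → EndsAt B (map fOE l) (inr (fV v))
  fend (x ∷ []) p = ftgt x p
  fend (x ∷ y ∷ l) p = fend (y ∷ l) p

  fpath : ∀ l → IsAIPath A l → IsAIPath B (map fOE l)
  fpath (x ∷ l) (_ , c) = tt , fchain (x ∷ l) c

  acyclic-pull : WF B → ∀ l v → IsDownPath A l → StartsAt A l (inr v) → EndsAt A l (inr v) → ⊥
  acyclic-pull W l v (p , d) q e = acyclic W (map fOE l) (fV v) (fpath l p , AllP.map⁺ d) (fstart l q) (fend l e)
    where import Data.List.Relation.Unary.All.Properties as AllP

  fincident : ∀ {e v} → Incident A e v → Incident B (fE e) (fV v)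
  fincident (inl p) = inl (fup p)
  fincident (inr p) = inr (fdn p)

  polar-pull : ∀ {π} → ValidPol B π → ValidPol A (π ∘ fE)
  polar-pull val v =
    (λ i e e' p q → fst (val (fV v)) (fContr v i) (fE e) (fE e') (fincident p) (fincident q)) ,
    (λ i e e' p q n → snd (val (fV v)) (fAI v i) (fE e) (fE e') (fincident p) (fincident q) (n ∘ fE-inj))

record Shape {P Q : Set} (R : Flow P Q) : Set where
  open Flow R
  field
    iR : ∀ y → Fin (ins (lab y)) → E
    oR : ∀ y → Fin (outs (lab y)) → E
    iP : ∀ y → IsPorts dn y (iR y)
    oP : ∀ y → IsPorts up y (oR y)
    topR : ∀ p → Σ E λ r → up r ≡ inl p × (∀ r' → up r' ≡ inl p → r' ≡ r)
    botR : ∀ q → Σ E λ r → dn r ≡ inl q × (∀ r' → dn r' ≡ inl q → r' ≡ r)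
    nopass : ∀ r {p q} → up r ≡ inl p → dn r ≡ inl q → ⊥
    finR : Finite V

record Redex {P Q : Set} (R : Flow P Q) : Set where
  open Flow R
  field
    shape : Shape R
    r0    : E
    y0 x0 : V
    up0   : up r0 ≡ inr y0
    dn0   : dn r0 ≡ inr x0
    only  : ∀ r {y x} → up r ≡ inr y → dn r ≡ inr x → r ≡ r0
    two   : ∀ y → y ≡ y0 ⊎ y ≡ x0
    lab≢  : lab y0 ≢ lab x0
  open Shape shape public

record Emb {U L P Q : Set} (A : Flow U L) {R : Flow P Q} (X : Redex R) : Set where
  private
    module A = Flow A
    module R = Flow R
    module X = Redex X
  field
    jV  : R.V → A.V
    jV-inj : ∀ {x y} → jV x ≡ jV y → x ≡ y
    jlab : ∀ y → A.lab (jV y) ≡ R.lab y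
    jE  : R.E → A.E
    ji  : ∀ y → IsPorts A.dn (jV y) (jE ∘ X.iR y)
    jo  : ∀ y → IsPorts A.up (jV y) (jE ∘ X.oR y)

module CutEnd {V E B RV RE P Q : Set} {n : RV → Set}
  (end : E → B ⊎ V) (Rend : RE → P ⊎ RV) (Roth : RE → Q ⊎ RV)
  (jV : RV → V) (jV-inj : ∀ {x y} → jV x ≡ jV y → x ≡ y) (jV? : ∀ v → Dec (Σ RV λ y → v ≡ jV y))
  (jE : RE → E) (t : ∀ y → n y → RE) (t-ports : ∀ y → IsPorts Rend y (t y))
  (j-ports : ∀ y → IsPorts end (jV y) (jE ∘ t y))
  (r0 : RE) (only : ∀ r {y x} → Rend r ≡ inr y → Roth r ≡ inr x → r ≡ r0)
  (y0 : RV) (end0 : Rend r0 ≡ inr y0) where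

  KV KE : Set
  KV = Σ V λ v → ∀ y → v ≢ jV y
  KE = Σ E λ e → e ≢ jE r0

  jend : ∀ {r y} → Rend r ≡ inr y → end (jE r) ≡ inr (jV y)
  jend {r} {y} p with all (t-ports y) r p
  ... | (j , refl) = hit (j-ports y) j

  jend-inj : ∀ {r r' y} → Rend r ≡ inr y → Rend r' ≡ inr y → jE r ≡ jE r' → r ≡ r'
  jend-inj {r} {r'} {y} p q e with all (t-ports y) r p | all (t-ports y) r' q
  ... | (j , refl) | (k , refl) = cong (t y) (inj (j-ports y) e)

  data View (e : E) : (B ⊎ Q) ⊎ KV → Set where
    bnd  : ∀ {b} → end e ≡ inl b → View e (inl (inl b))
    ver  : ∀ {v} → end e ≡ inr (fst v) → View e (inr v)
    port : ∀ {q} r y → e ≡ jE r → Rend r ≡ inr y → Roth r ≡ inl q → View e (inl (inr q))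

  View-unique : ∀ {e z z'} → View e z → View e z' → z ≡ z'
  View-unique (bnd p) (bnd q) = cong (λ z → inl (inl z)) (inl-inj (trans (sym p) q))
  View-unique (bnd p) (ver q) = ⊥-elim (inl≢inr (trans (sym p) q))
  View-unique (bnd p) (port r y refl a b) = ⊥-elim (inl≢inr (trans (sym p) (jend a)))
  View-unique (ver p) (bnd q) = ⊥-elim (inl≢inr (trans (sym q) p))
  View-unique (ver p) (ver q) = cong inr (Σ≡ (λ _ _ → refl) (inr-inj (trans (sym p) q)))
  View-unique (ver {v} p) (port r y refl a b) = ⊥-elim (snd v y (inr-inj (trans (sym p) (jend a))))
  View-unique (port r y refl a b) (bnd p) = ⊥-elim (inl≢inr (trans (sym p) (jend a)))
  View-unique (port r y refl a b) (ver {v} p) = ⊥-elim (snd v y (inr-inj (trans (sym p) (jend a))))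
  View-unique (port r y refl a b) (port r' y' e' a' b')
    with jV-inj (inr-inj (trans (sym (jend a)) (trans (cong end e') (jend a'))))
  ... | refl with jend-inj a a' e'
  ... | refl = cong (λ z → inl (inr z)) (inl-inj (trans (sym b) b'))

  view′ : ∀ (k : KE) → Σ _ (View (fst k))
  view′ (e , n) with end e in eq
  ... | inl b = _ , bnd eq
  ... | inr v with jV? v
  ...   | no ¬y = inr (v , λ y p → ¬y (y , p)) , ver eq
  ...   | yes (y , refl) with all (j-ports y) e eq
  ...     | (j , refl) with Roth (t y j) in eq'
  ...       | inl q = _ , port (t y j) y refl (hit (t-ports y) j) eq'
  ...       | inr x = ⊥-elim (n (cong jE (only (t y j) (hit (t-ports y) j) eq')))

  kend : KE → (B ⊎ Q) ⊎ KV
  kend k = fst (view′ k)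

  view : ∀ k → View (fst k) (kend k)
  view k = snd (view′ k)

  kend≡ : ∀ {k z} → View (fst k) z → kend k ≡ z
  kend≡ {k} v = View-unique (view k) v

  kend-view : ∀ {k z} → kend k ≡ z → View (fst k) z
  kend-view {k} p = subst (View (fst k)) p (view k)

  kend-ver : ∀ {k v} → kend k ≡ inr v → end (fst k) ≡ inr (fst v)
  kend-ver p with kend-view p
  ... | ver q = q

  kend-bnd : ∀ {k b} → kend k ≡ inl (inl b) → end (fst k) ≡ inl b
  kend-bnd p with kend-view p
  ... | bnd q = q

  bnd≢ : ∀ {e b} → end e ≡ inl b → e ≢ jE r0
  bnd≢ p refl = inl≢inr (trans (sym p) (jend end0))

  ver≢ : ∀ {e} {v : KV} → end e ≡ inr (fst v) → e ≢ jE r0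
  ver≢ {v = v} p refl = snd v y0 (inr-inj (trans (sym p) (jend end0)))

  port≢ : ∀ {r y q} → Rend r ≡ inr y → Roth r ≡ inl q → Roth r0 ≢ inl q → jE r ≢ jE r0
  port≢ {r} a b n e with jV-inj (inr-inj (trans (sym (jend a)) (trans (cong end e) (jend end0))))
  ... | refl with jend-inj a end0 e
  ... | refl = n b

  kbnd-unique : (∀ b → Σ E λ e → end e ≡ inl b × (∀ e' → end e' ≡ inl b → e' ≡ e)) →
    ∀ b → Σ KE λ k → kend k ≡ inl (inl b) × (∀ k' → kend k' ≡ inl (inl b) → k' ≡ k)
  kbnd-unique u b with u b
  ... | (e , p , un) = (e , bnd≢ p) , kend≡ (bnd p) , λ k' q → Σ≡ (λ _ _ → refl) (un _ (kend-bnd q))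

  kport-unique : ∀ {q} r y → Rend r ≡ inr y → Roth r ≡ inl q → (∀ r' → Roth r' ≡ inl q → r' ≡ r) →
    (n : jE r ≢ jE r0) →
    kend (jE r , n) ≡ inl (inr q) × (∀ k' → kend k' ≡ inl (inr q) → k' ≡ (jE r , n))
  kport-unique {q} r y a b un n = kend≡ (port r y refl a b) , λ k' p → Σ≡ (λ _ _ → refl) (f k' (kend-view p))
    where
    f : ∀ k' → View (fst k') (inl (inr q)) → fst k' ≡ jE r
    f k' (port r' y' e' a' b') = trans e' (cong jE (un r' b'))

  kdeg : ∀ v → (Σ E λ e → end e ≡ inr (fst v)) ↔ (Σ KE λ k → kend k ≡ inr v)
  kdeg v = mk↔ₛ′ f g (λ z → Σ≡ uip refl) (λ z → Σ≡ uip refl)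
    where
    f : (Σ E λ e → end e ≡ inr (fst v)) → (Σ KE λ k → kend k ≡ inr v)
    f (e , p) = (e , ver≢ {v = v} p) , kend≡ (ver {v = v} p)
    g : (Σ KE λ k → kend k ≡ inr v) → (Σ E λ e → end e ≡ inr (fst v))
    g (k , p) = fst k , kend-ver p

module Cut {U L P Q : Set} {A : Flow U L} {R : Flow P Q} (W : WF A) {X : Redex R} (F : Emb A X) where
  private
    module A = Flow A
    module R = Flow R
    module X = Redex X
  open Emb F public

  infix 4 _≟V_ _≟E_
  _≟V_ : DecEq A.V
  _≟V_ = finite-≟ (finV W)
  _≟E_ : DecEq A.E
  _≟E_ = finite-≟ (finE W)

  _≟K_ : DecEq (Σ A.V λ v → ∀ y → v ≢ jV y)
  x ≟K y = map′ (Σ≡ (λ _ _ → refl)) (cong fst) (fst x ≟V fst y)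

  jV? : ∀ v → Dec (Σ R.V λ y → v ≡ jV y)
  jV? v = finite-any? X.finR (λ y → v ≟V jV y)

  module Up = CutEnd A.up R.up R.dn jV jV-inj jV? jE X.oR X.oP jo X.r0 X.only X.y0 X.up0
  module Dn = CutEnd A.dn R.dn R.up jV jV-inj jV? jE X.iR X.iP ji X.r0 (λ r p q → X.only r q p) X.x0 X.dn0

  ε : A.E
  ε = jE X.r0

  KV KE : Set
  KV = Σ A.V λ v → ∀ y → v ≢ jV y
  KE = Σ A.E λ e → e ≢ ε

  K : Flow (U ⊎ Q) (L ⊎ P)
  K = record { V = KV ; E = KE ; lab = A.lab ∘ fst ; up = Up.kend ; dn = Dn.kend }

  nodrop : ∀ k → ¬ Dropped K R k
  nodrop k (p , r , q , _ , a , b) = X.nopass r a b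

  inR : A.V → GV K R
  inR v with jV? v
  ... | yes (y , _) = inr y
  ... | no n = inl (v , λ y p → n (y , p))

  outR : GV K R → A.V
  outR (inl k) = fst k
  outR (inr y) = jV y

  inR-K : ∀ (k : KV) → inR (fst k) ≡ inl k
  inR-K (v , n) with jV? v
  ... | yes (y , p) = ⊥-elim (n y p)
  ... | no _ = refl

  inR-R : ∀ y → inR (jV y) ≡ inr y
  inR-R y with jV? (jV y)
  ... | yes (y' , p) = cong inr (sym (jV-inj p))
  ... | no n = ⊥-elim (n (y , refl))

  outR-inR : ∀ v → outR (inR v) ≡ v
  outR-inR v with jV? v
  ... | yes (y , p) = sym p
  ... | no n = refl

  int0 : InternalR K R X.r0
  int0 = (_ , X.up0) , (_ , X.dn0)

  Internal-irr : ∀ {r} (p q : InternalR K R r) → p ≡ q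
  Internal-irr ((y , a) , (x , b)) ((y' , a') , (x' , b'))
    with inr-inj (trans (sym a) a') | inr-inj (trans (sym b) b')
  ... | refl | refl with uip a a' | uip b b'
  ... | refl | refl = refl

  inE : A.E → GE K R
  inE e with e ≟E ε
  ... | yes _ = inr (X.r0 , int0)
  ... | no n = inl ((e , n) , nodrop (e , n))

  outE : GE K R → A.E
  outE (inl (k , _)) = fst k
  outE (inr (r , _)) = jE r

  inE-K : ∀ (k : KE) d → inE (fst k) ≡ inl (k , d)
  inE-K (e , n) d with e ≟E ε
  ... | yes p = ⊥-elim (n p)
  ... | no _ = refl

  cut-glue : IsGlue A K R
  cut-glue = record
    { vbij = mk↔ₛ′ inR outR (λ { (inl k) → inR-K k ; (inr y) → inR-R y }) outR-inR
    ; ebij = mk↔ₛ′ inE outE in-out out-in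
    ; lab-ok = lab-ok
    ; up-ok = up-ok
    ; dn-ok = dn-ok }
    where
    in-out : ∀ g → inE (outE g) ≡ g
    in-out (inl (k , d)) = inE-K k d
    in-out (inr (r , i@((_ , a) , (_ , b)))) with X.only r a b
    ... | refl with ε ≟E ε
    ... | yes _ = cong (λ z → inr (X.r0 , z)) (Internal-irr int0 i)
    ... | no n = ⊥-elim (n refl)
    out-in : ∀ e → outE (inE e) ≡ e
    out-in e with e ≟E ε
    ... | yes p = sym p
    ... | no n = refl
    lab-ok : ∀ v → A.lab v ≡ glab K R (inR v)
    lab-ok v with jV? v
    ... | yes (y , p) = trans (cong A.lab p) (jlab y)
    ... | no n = refl
    toU : U ⊎ A.V → U ⊎ GV K R
    toU = map₂ inR
    up-ok : ∀ e → GUp K R (inE e) (map₂ inR (A.up e))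
    up-ok e with e ≟E ε
    ... | yes refl = X.y0 , X.up0 , trans (cong toU (Up.jend X.up0)) (cong inr (inR-R X.y0))
    ... | no n with Up.kend (e , n) | Up.kend≡ {e , n} | Up.view (e , n)
    ...   | _ | f | Up.bnd p rewrite p = Plug.top (Up.kend≡ {e , n} (Up.bnd p))
    ...   | _ | f | Up.ver {v} p rewrite p | inR-K v = Plug.kv (Up.kend≡ {e , n} (Up.ver p))
    ...   | _ | f | Up.port r y refl a b rewrite Up.jend a | inR-R y =
      Plug.rv (Up.kend≡ {jE r , n} (Up.port r y refl a b)) b a
    dn-ok : ∀ e → GDn K R (inE e) (map₂ inR (A.dn e))
    dn-ok e with e ≟E ε
    ... | yes refl = X.x0 , X.dn0 , trans (cong (map₂ inR) (Dn.jend X.dn0)) (cong inr (inR-R X.x0))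
    ... | no n with Dn.kend (e , n) | Dn.view (e , n)
    ...   | _ | Dn.bnd p rewrite p = Plug.bot (Dn.kend≡ {e , n} (Dn.bnd p))
    ...   | _ | Dn.ver {v} p rewrite p | inR-K v = Plug.kv (Dn.kend≡ {e , n} (Dn.ver p))
    ...   | _ | Dn.port r y refl a b rewrite Dn.jend a | inR-R y =
      Plug.rv (Dn.kend≡ {jE r , n} (Dn.port r y refl a b)) b a

  K-mor : Mor K A
  K-mor = record { fV = fst ; fE = fst ; fE-inj = Σ≡ (λ _ _ → refl) ; fup = Up.kend-ver ; fdn = Dn.kend-ver
                 ; flab = λ _ → inl refl }

  topr≢ : ∀ p → jE (fst (X.topR p)) ≢ ε
  topr≢ p with X.topR p
  ... | (r , a , _) with R.dn r in eq
  ...   | inl q = ⊥-elim (X.nopass r a eq)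
  ...   | inr x = Dn.port≢ eq a (λ z → inl≢inr (trans (sym z) X.up0))

  botr≢ : ∀ q → jE (fst (X.botR q)) ≢ ε
  botr≢ q with X.botR q
  ... | (r , a , _) with R.up r in eq
  ...   | inl p = ⊥-elim (X.nopass r eq a)
  ...   | inr x = Up.port≢ eq a (λ z → inl≢inr (trans (sym z) X.dn0))

  kP : P → KE
  kP p = jE (fst (X.topR p)) , topr≢ p
  kQ : Q → KE
  kQ q = jE (fst (X.botR q)) , botr≢ q

  kP-unique : ∀ p → Dn.kend (kP p) ≡ inl (inr p) × (∀ k' → Dn.kend k' ≡ inl (inr p) → k' ≡ kP p)
  kP-unique p with X.topR p | topr≢ p
  ... | (r , a , un) | n with R.dn r in eq
  ...   | inl q = ⊥-elim (X.nopass r a eq)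
  ...   | inr x = Dn.kport-unique r x eq a un n

  kQ-unique : ∀ q → Up.kend (kQ q) ≡ inl (inr q) × (∀ k' → Up.kend k' ≡ inl (inr q) → k' ≡ kQ q)
  kQ-unique q with X.botR q | botr≢ q
  ... | (r , a , un) | n with R.up r in eq
  ...   | inl p = ⊥-elim (X.nopass r eq a)
  ...   | inr x = Up.kport-unique r x eq a un n

  K-wf : WF K
  K-wf = record
    { finV = finite-Σ (finV W) (λ _ _ → refl)
               (λ v → map′ (λ f y p → f (y , p)) (λ f z → f (fst z) (snd z)) (¬? (jV? v)))
    ; finE = finite-Σ (finE W) (λ _ _ → refl) (λ e → ¬? (e ≟E ε))
    ; upU = λ { (inl u) → Up.kbnd-unique (upU W) u ; (inr q) → kQ q , kQ-unique q }
    ; dnL = λ { (inl l) → Dn.kbnd-unique (dnL W) l ; (inr p) → kP p , kP-unique p }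
    ; inDeg = λ v → ↔-trans (inDeg W (fst v)) (Dn.kdeg v)
    ; outDeg = λ v → ↔-trans (outDeg W (fst v)) (Up.kdeg v)
    ; acyclic = MorProps.acyclic-pull K-mor W
    ; polar = _ , MorProps.polar-pull K-mor (snd (polar W)) }

ports-≗ : ∀ {E B V I : Set} {end : E → B ⊎ V} {v} {i i' : I → E} → (∀ j → i' j ≡ i j) → IsPorts end v i → IsPorts end v i'
ports-≗ {end = end} f P = record
  { hit = λ j → trans (cong end (f j)) (hit P j)
  ; inj = λ {j} {k} p → inj P (trans (sym (f j)) (trans p (f k)))
  ; all = λ x p → let (j , q) = all P x p in j , trans (f j) q }

Pat : ∀ {U L P Q} (A : Flow U L) {R : Flow P Q} → Redex R → Set
Pat A {R} X = Σ (Flow.E A) λ e → Σ (Flow.V A) λ v → Σ (Flow.V A) λ w →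
  Flow.up A e ≡ inr v × Flow.dn A e ≡ inr w × Flow.lab A v ≡ Flow.lab R (Redex.y0 X) × Flow.lab A w ≡ Flow.lab R (Redex.x0 X)

pat? : ∀ {U L P Q} {A : Flow U L} {R : Flow P Q} → WF A → (X : Redex R) → Dec (Pat A X)
pat? {A = A} W X = finite-any? (finE W) λ e → go e (Flow.up A e) (Flow.dn A e)
  where
  go : ∀ e (x : _ ⊎ Flow.V A) (y : _ ⊎ Flow.V A) → Dec (Σ _ λ v → Σ _ λ w → x ≡ inr v × y ≡ inr w × _ × _)
  go e (inl _) y = no λ ()
  go e (inr v) (inl _) = no λ ()
  go e (inr v) (inr w) = map′ (λ { (p , q) → v , w , refl , refl , p , q }) (λ { (_ , _ , refl , refl , p , q) → p , q })
    ((_ ≟ˡ _) ×-dec (_ ≟ˡ _))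

pat-of-glue : ∀ {U L P Q} {A : Flow U L} {K : Flow (U ⊎ Q) (L ⊎ P)} {R : Flow P Q} → IsGlue A K R → (X : Redex R) → Pat A X
pat-of-glue {A = A} {K} {R} G X with from (IsGlue.ebij G) (inr (Redex.r0 X , ((_ , Redex.up0 X) , (_ , Redex.dn0 X)))) in eq
... | e with trans (sym (inv-l (IsGlue.ebij G) _)) (cong (to (IsGlue.ebij G)) eq) | IsGlue.up-ok G e | IsGlue.dn-ok G e
...   | p | a | b with to (IsGlue.ebij G) e | p
...     | _ | refl with a | b
...       | (y , a1 , a2) | (x , b1 , b2) with Flow.up A e in e1 | Flow.dn A e in e2
...         | inr v | inr w with inr-inj (trans (sym a1) (Redex.up0 X)) | inr-inj (trans (sym b1) (Redex.dn0 X))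
...           | refl | refl = e , v , w , e1 , e2 ,
  trans (IsGlue.lab-ok G v) (cong (glab K R) (inr-inj a2)) ,
  trans (IsGlue.lab-ok G w) (cong (glab K R) (inr-inj b2))

module _ {U L P Q : Set} {A : Flow U L} {R : Flow P Q} (W : WF A) (X : Redex R) where
  private
    module A = Flow A
    module R = Flow R
    module X = Redex X

  labelled-ins : ∀ v {k} → A.lab v ≡ k → Σ (Fin (ins k) → A.E) (IsPorts A.dn v)
  labelled-ins v refl = ins-ports W v

  labelled-outs : ∀ v {k} → A.lab v ≡ k → Σ (Fin (outs k) → A.E) (IsPorts A.up v)
  labelled-outs v refl = outs-ports W v

  embed : Pat A X → Emb A X
  embed (e , v , w , e1 , e2 , l1 , l2) = record
    { jV = jV ; jV-inj = λ {x} {y} → jV-inj x y ; jlab = jlab ; jE = jE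
    ; ji = λ y → ports-≗ (jE-i y) (snd (iA y)) ; jo = λ y → ports-≗ (jE-o y) (snd (oA y)) }
    module Embedding where
    jV : R.V → A.V
    jV y with X.two y
    ... | inl _ = v
    ... | inr _ = w
    v≢w : v ≢ w
    v≢w refl = X.lab≢ (trans (sym l1) l2)
    jV-inj : ∀ x y → jV x ≡ jV y → x ≡ y
    jV-inj x y p with X.two x | X.two y
    ... | inl a | inl b = trans a (sym b)
    ... | inl a | inr b = ⊥-elim (v≢w p)
    ... | inr a | inl b = ⊥-elim (v≢w (sym p))
    ... | inr a | inr b = trans a (sym b)
    jlab : ∀ y → A.lab (jV y) ≡ R.lab y
    jlab y with X.two y
    ... | inl refl = l1
    ... | inr refl = l2
    iA : ∀ y → Σ (Fin (ins (R.lab y)) → A.E) (IsPorts A.dn (jV y))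
    iA y with X.two y
    ... | inl refl = labelled-ins v l1
    ... | inr refl with orient (ins≤2 _) (snd (labelled-ins w l2)) e e2 (fst (all (X.iP y) X.r0 X.dn0))
    ... | (i , ip , _) = i , ip
    oA : ∀ y → Σ (Fin (outs (R.lab y)) → A.E) (IsPorts A.up (jV y))
    oA y with X.two y
    ... | inr refl = labelled-outs w l2
    ... | inl refl with orient (outs≤2 _) (snd (labelled-outs v l1)) e e1 (fst (all (X.oP y) X.r0 X.up0))
    ... | (i , ip , _) = i , ip
    iA-e : ∀ k → X.iR X.x0 k ≡ X.r0 → fst (iA X.x0) k ≡ e
    iA-e k p with X.two X.x0
    ... | inl q = ⊥-elim (X.lab≢ (cong R.lab (sym q)))
    ... | inr refl with orient (ins≤2 _) (snd (labelled-ins w l2)) e e2 (fst (all (X.iP X.x0) X.r0 X.dn0))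
    ... | (i , ip , q) with all (X.iP X.x0) X.r0 X.dn0
    ... | (k' , p') with inj (X.iP X.x0) (trans p (sym p'))
    ... | refl = q
    oA-e : ∀ k → X.oR X.y0 k ≡ X.r0 → fst (oA X.y0) k ≡ e
    oA-e k p with X.two X.y0
    ... | inr q = ⊥-elim (X.lab≢ (cong R.lab q))
    ... | inl refl with orient (outs≤2 _) (snd (labelled-outs v l1)) e e1 (fst (all (X.oP X.y0) X.r0 X.up0))
    ... | (i , ip , q) with all (X.oP X.y0) X.r0 X.up0
    ... | (k' , p') with inj (X.oP X.y0) (trans p (sym p'))
    ... | refl = q
    jE′ : ∀ r x y → R.up r ≡ x → R.dn r ≡ y → A.E
    jE′ r (inr y) _ eq _ = fst (oA y) (fst (all (X.oP y) r eq))
    jE′ r (inl p) (inr x) eq eq' = fst (iA x) (fst (all (X.iP x) r eq'))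
    jE′ r (inl p) (inl q) eq eq' = ⊥-elim (X.nopass r eq eq')
    jE : R.E → A.E
    jE r = jE′ r (R.up r) (R.dn r) refl refl
    jE′-o : ∀ y j x z (eq : R.up (X.oR y j) ≡ x) (eq' : R.dn (X.oR y j) ≡ z) → jE′ (X.oR y j) x z eq eq' ≡ fst (oA y) j
    jE′-o y j (inl p) z eq eq' = ⊥-elim (inl≢inr (trans (sym eq) (hit (X.oP y) j)))
    jE′-o y j (inr y') z eq eq' with inr-inj (trans (sym eq) (hit (X.oP y) j))
    ... | refl = cong (fst (oA y)) (inj (X.oP y) (snd (all (X.oP y) (X.oR y j) eq)))
    jE-o : ∀ y j → jE (X.oR y j) ≡ fst (oA y) j
    jE-o y j = jE′-o y j _ _ refl refl
    jE′-i : ∀ y j x z (eq : R.up (X.iR y j) ≡ x) (eq' : R.dn (X.iR y j) ≡ z) → jE′ (X.iR y j) x z eq eq' ≡ fst (iA y) j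
    jE′-i y j (inr y') z eq eq' with X.only _ eq (hit (X.iP y) j)
    ... | p with inr-inj (trans (sym (trans (cong R.up p) X.up0)) eq)
               | inr-inj (trans (sym (trans (cong R.dn p) X.dn0)) (hit (X.iP y) j))
    ...   | refl | refl =
      trans (oA-e _ (trans (snd (all (X.oP X.y0) (X.iR X.x0 j) eq)) p)) (sym (iA-e j p))
    jE′-i y j (inl p) (inl q) eq eq' = ⊥-elim (inl≢inr (trans (sym eq') (hit (X.iP y) j)))
    jE′-i y j (inl p) (inr y') eq eq' with inr-inj (trans (sym eq') (hit (X.iP y) j))
    ... | refl = cong (fst (iA y)) (inj (X.iP y) (snd (all (X.iP y) (X.iR y j) eq')))
    jE-i : ∀ y j → jE (X.iR y j) ≡ fst (iA y) j
    jE-i y j = jE′-i y j _ _ refl refl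

    jE-r0 : jE X.r0 ≡ e
    jE-r0 = trans (cong jE (sym (snd k))) (trans (jE-o X.y0 (fst k)) (oA-e (fst k) (snd k)))
      where k = all (X.oP X.y0) X.r0 X.up0

  embed-r0 : (p : Pat A X) → Emb.jE (embed p) X.r0 ≡ fst p
  embed-r0 (e , v , w , e1 , e2 , l1 , l2) = Embedding.jE-r0 e v w e1 e2 l1 l2

  embed-y0 : (p : Pat A X) → Emb.jV (embed p) X.y0 ≡ fst (snd p)
  embed-y0 p with X.two X.y0
  ... | inl _ = refl
  ... | inr q = ⊥-elim (X.lab≢ (cong R.lab q))

  embed-x0 : (p : Pat A X) → Emb.jV (embed p) X.x0 ≡ fst (snd (snd p))
  embed-x0 p with X.two X.x0
  ... | inl q = ⊥-elim (X.lab≢ (cong R.lab (sym q)))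
  ... | inr _ = refl

isPorts? : ∀ {ne nb nv n} (end : Fin ne → Fin nb ⊎ Fin nv) (y : Fin nv) (i : Fin n → Fin ne) → Dec (IsPorts end y i)
isPorts? {ne} end y i = map′ (λ { (a , b , c) → record { hit = a ; inj = λ {j} {k} → b j k ; all = c } })
  (λ P → hit P , (λ j k → inj P) , all P)
  (FinP.all? (λ j → end (i j) ≟ₑ inr y) ×-dec
   (FinP.all? (λ j → FinP.all? λ k → (i j FinP.≟ i k) →-dec (j FinP.≟ k)) ×-dec
    FinP.all? (λ x → (end x ≟ₑ inr y) →-dec FinP.any? (λ j → i j FinP.≟ x))))
  where
  _≟ₑ_ = SumP.≡-dec FinP._≟_ FinP._≟_

module _ {p q nv ne : ℕ} {lab : Fin nv → Label} {up : Fin ne → Fin p ⊎ Fin nv} {dn : Fin ne → Fin q ⊎ Fin nv} where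
  private
    E : Set
    E = Fin ne
    R : Flow (Fin p) (Fin q)
    R = record { V = Fin nv ; E = Fin ne ; lab = lab ; up = up ; dn = dn }
    _≟ᵤ_ : ∀ {k} → DecEq (Fin k ⊎ Fin nv)
    _≟ᵤ_ = SumP.≡-dec FinP._≟_ FinP._≟_

  shape? : (iR : ∀ y → Fin (ins (lab y)) → E) (oR : ∀ y → Fin (outs (lab y)) → E) →
    Dec ((∀ y → IsPorts dn y (iR y)) × (∀ y → IsPorts up y (oR y)) ×
         (∀ p → Σ E λ r → up r ≡ inl p × (∀ r' → up r' ≡ inl p → r' ≡ r)) ×
         (∀ q → Σ E λ r → dn r ≡ inl q × (∀ r' → dn r' ≡ inl q → r' ≡ r)) ×
         (∀ r p q → up r ≡ inl p → dn r ≡ inl q → ⊥))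
  shape? iR oR =
    FinP.all? (λ y → isPorts? dn y (iR y)) ×-dec FinP.all? (λ y → isPorts? up y (oR y)) ×-dec
    FinP.all? (λ p → FinP.any? λ r → (up r ≟ᵤ inl p) ×-dec FinP.all? λ r' → (up r' ≟ᵤ inl p) →-dec (r' FinP.≟ r)) ×-dec
    FinP.all? (λ q → FinP.any? λ r → (dn r ≟ᵤ inl q) ×-dec FinP.all? λ r' → (dn r' ≟ᵤ inl q) →-dec (r' FinP.≟ r)) ×-dec
    FinP.all? (λ r → FinP.all? λ p → FinP.all? λ q → (up r ≟ᵤ inl p) →-dec ((dn r ≟ᵤ inl q) →-dec no id))

  mkShape : ∀ iR oR → True (shape? iR oR) → Shape R
  mkShape iR oR t = record
    { iR = iR ; oR = oR ; iP = fst w ; oP = fst (snd w) ; topR = fst (snd (snd w))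
    ; botR = fst (snd (snd (snd w))) ; nopass = λ r {p} {q} → snd (snd (snd (snd w))) r p q ; finR = nv , ↔-refl }
    where w = toWitness t

  only? : ∀ r0 → Dec (∀ r y x → up r ≡ inr y → dn r ≡ inr x → r ≡ r0)
  only? r0 = FinP.all? (λ r → FinP.all? λ p → FinP.all? λ q → (up r ≟ᵤ inr p) →-dec ((dn r ≟ᵤ inr q) →-dec (r FinP.≟ r0)))

  only0 : ∀ r0 → True (only? r0) → ∀ r y x → up r ≡ inr y → dn r ≡ inr x → r ≡ r0
  only0 r0 t = toWitness t

two-vertices : (y : Fin 2) → y ≡ zero ⊎ y ≡ suc zero
two-vertices zero = inl refl
two-vertices (suc zero) = inr refl

lhs-ins : (ρ : LRule) (y : Flow.V (lhs ρ)) → Fin (ins (Flow.lab (lhs ρ) y)) → Flow.E (lhs ρ)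
lhs-ins r-i zero = lookup ([])
lhs-ins r-i (suc zero) = lookup (# 0 ∷ # 1 ∷ [])
lhs-ins r-ii zero = lookup (# 0 ∷ [])
lhs-ins r-ii (suc zero) = lookup (# 1 ∷ [])
lhs-ins r-iii zero = lookup ([])
lhs-ins r-iii (suc zero) = lookup (# 0 ∷ # 1 ∷ [])
lhs-ins r-iv zero = lookup ([])
lhs-ins r-iv (suc zero) = lookup (# 0 ∷ [])
lhs-ins r-v zero = lookup ([])
lhs-ins r-v (suc zero) = lookup (# 0 ∷ [])
lhs-ins r-vi zero = lookup ([])
lhs-ins r-vi (suc zero) = lookup (# 0 ∷ [])
lhs-ins r-vii zero = lookup (# 0 ∷ # 1 ∷ [])
lhs-ins r-vii (suc zero) = lookup (# 2 ∷ [])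
lhs-ins r-viii zero = lookup (# 0 ∷ # 1 ∷ [])
lhs-ins r-viii (suc zero) = lookup (# 2 ∷ # 3 ∷ [])
lhs-ins r-ix zero = lookup ([])
lhs-ins r-ix (suc zero) = lookup (# 1 ∷ [])
lhs-ins r-x zero = lookup (# 0 ∷ # 1 ∷ [])
lhs-ins r-x (suc zero) = lookup (# 2 ∷ [])

lhs-outs : (ρ : LRule) (y : Flow.V (lhs ρ)) → Fin (outs (Flow.lab (lhs ρ) y)) → Flow.E (lhs ρ)
lhs-outs r-i zero = lookup (# 0 ∷ [])
lhs-outs r-i (suc zero) = lookup (# 2 ∷ [])
lhs-outs r-ii zero = lookup (# 1 ∷ # 2 ∷ [])
lhs-outs r-ii (suc zero) = lookup ([])
lhs-outs r-iii zero = lookup (# 0 ∷ [])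
lhs-outs r-iii (suc zero) = lookup ([])
lhs-outs r-iv zero = lookup (# 0 ∷ # 1 ∷ [])
lhs-outs r-iv (suc zero) = lookup ([])
lhs-outs r-v zero = lookup (# 0 ∷ [])
lhs-outs r-v (suc zero) = lookup ([])
lhs-outs r-vi zero = lookup (# 0 ∷ [])
lhs-outs r-vi (suc zero) = lookup (# 1 ∷ # 2 ∷ [])
lhs-outs r-vii zero = lookup (# 2 ∷ [])
lhs-outs r-vii (suc zero) = lookup ([])
lhs-outs r-viii zero = lookup (# 2 ∷ [])
lhs-outs r-viii (suc zero) = lookup ([])
lhs-outs r-ix zero = lookup (# 0 ∷ # 1 ∷ [])
lhs-outs r-ix (suc zero) = lookup (# 2 ∷ # 3 ∷ [])
lhs-outs r-x zero = lookup (# 2 ∷ [])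
lhs-outs r-x (suc zero) = lookup (# 3 ∷ # 4 ∷ [])

NoPass : LRule → Set
NoPass r-i = ⊥
NoPass r-ii = ⊥
NoPass _ = ⊤

rhs-ins : (ρ : LRule) → NoPass ρ → (y : Flow.V (rhs ρ)) → Fin (ins (Flow.lab (rhs ρ) y)) → Flow.E (rhs ρ)
rhs-ins r-iii tt zero = lookup (# 0 ∷ [])
rhs-ins r-iv tt zero = lookup ([])
rhs-ins r-v tt ()
rhs-ins r-vi tt zero = lookup ([])
rhs-ins r-vi tt (suc zero) = lookup ([])
rhs-ins r-vii tt zero = lookup (# 0 ∷ [])
rhs-ins r-vii tt (suc zero) = lookup (# 1 ∷ [])
rhs-ins r-viii tt zero = lookup (# 0 ∷ [])
rhs-ins r-viii tt (suc zero) = lookup (# 3 ∷ # 1 ∷ [])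
rhs-ins r-viii tt (suc (suc zero)) = lookup (# 4 ∷ # 2 ∷ [])
rhs-ins r-ix tt zero = lookup (# 1 ∷ # 2 ∷ [])
rhs-ins r-ix tt (suc zero) = lookup ([])
rhs-ins r-ix tt (suc (suc zero)) = lookup ([])
rhs-ins r-x tt zero = lookup (# 0 ∷ [])
rhs-ins r-x tt (suc zero) = lookup (# 1 ∷ [])
rhs-ins r-x tt (suc (suc zero)) = lookup (# 4 ∷ # 6 ∷ [])
rhs-ins r-x tt (suc (suc (suc zero))) = lookup (# 5 ∷ # 7 ∷ [])

rhs-outs : (ρ : LRule) → NoPass ρ → (y : Flow.V (rhs ρ)) → Fin (outs (Flow.lab (rhs ρ) y)) → Flow.E (rhs ρ)
rhs-outs r-iii tt zero = lookup ([])
rhs-outs r-iv tt zero = lookup (# 0 ∷ [])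
rhs-outs r-v tt ()
rhs-outs r-vi tt zero = lookup (# 0 ∷ [])
rhs-outs r-vi tt (suc zero) = lookup (# 1 ∷ [])
rhs-outs r-vii tt zero = lookup ([])
rhs-outs r-vii tt (suc zero) = lookup ([])
rhs-outs r-viii tt zero = lookup (# 1 ∷ # 2 ∷ [])
rhs-outs r-viii tt (suc zero) = lookup ([])
rhs-outs r-viii tt (suc (suc zero)) = lookup ([])
rhs-outs r-ix tt zero = lookup (# 0 ∷ [])
rhs-outs r-ix tt (suc zero) = lookup (# 3 ∷ # 1 ∷ [])
rhs-outs r-ix tt (suc (suc zero)) = lookup (# 4 ∷ # 2 ∷ [])
rhs-outs r-x tt zero = lookup (# 4 ∷ # 5 ∷ [])
rhs-outs r-x tt (suc zero) = lookup (# 6 ∷ # 7 ∷ [])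
rhs-outs r-x tt (suc (suc zero)) = lookup (# 2 ∷ [])
rhs-outs r-x tt (suc (suc (suc zero))) = lookup (# 3 ∷ [])

redex : ∀ {p q ne} lab (up : Fin ne → Fin p ⊎ Fin 2) (dn : Fin ne → Fin q ⊎ Fin 2) iR oR r0 →
  True (shape? {lab = lab} {up} {dn} iR oR) → True (only? {lab = lab} {up} {dn} r0) →
  up r0 ≡ inr zero → dn r0 ≡ inr (suc zero) → lab zero ≢ lab (suc zero) →
  Redex (record { V = Fin 2 ; E = Fin ne ; lab = lab ; up = up ; dn = dn })
redex lab up dn iR oR r0 t t' a b c = record
  { shape = mkShape iR oR t ; r0 = r0 ; y0 = # 0 ; x0 = # 1 ; up0 = a ; dn0 = b
  ; only = λ r → only0 {lab = lab} {up} {dn} r0 t' r _ _ ; two = two-vertices ; lab≢ = c }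

lhs-redex : (ρ : LRule) → Redex (lhs ρ)
lhs-redex r-i = redex (Flow.lab (lhs r-i)) (Flow.up (lhs r-i)) (Flow.dn (lhs r-i)) (lhs-ins r-i) (lhs-outs r-i) (# 0) tt tt refl refl λ ()
lhs-redex r-ii = redex (Flow.lab (lhs r-ii)) (Flow.up (lhs r-ii)) (Flow.dn (lhs r-ii)) (lhs-ins r-ii) (lhs-outs r-ii) (# 1) tt tt refl refl λ ()
lhs-redex r-iii = redex (Flow.lab (lhs r-iii)) (Flow.up (lhs r-iii)) (Flow.dn (lhs r-iii)) (lhs-ins r-iii) (lhs-outs r-iii) (# 0) tt tt refl refl λ ()
lhs-redex r-iv = redex (Flow.lab (lhs r-iv)) (Flow.up (lhs r-iv)) (Flow.dn (lhs r-iv)) (lhs-ins r-iv) (lhs-outs r-iv) (# 0) tt tt refl refl λ ()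
lhs-redex r-v = redex (Flow.lab (lhs r-v)) (Flow.up (lhs r-v)) (Flow.dn (lhs r-v)) (lhs-ins r-v) (lhs-outs r-v) (# 0) tt tt refl refl λ ()
lhs-redex r-vi = redex (Flow.lab (lhs r-vi)) (Flow.up (lhs r-vi)) (Flow.dn (lhs r-vi)) (lhs-ins r-vi) (lhs-outs r-vi) (# 0) tt tt refl refl λ ()
lhs-redex r-vii = redex (Flow.lab (lhs r-vii)) (Flow.up (lhs r-vii)) (Flow.dn (lhs r-vii)) (lhs-ins r-vii) (lhs-outs r-vii) (# 2) tt tt refl refl λ ()
lhs-redex r-viii = redex (Flow.lab (lhs r-viii)) (Flow.up (lhs r-viii)) (Flow.dn (lhs r-viii)) (lhs-ins r-viii) (lhs-outs r-viii) (# 2) tt tt refl refl λ ()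
lhs-redex r-ix = redex (Flow.lab (lhs r-ix)) (Flow.up (lhs r-ix)) (Flow.dn (lhs r-ix)) (lhs-ins r-ix) (lhs-outs r-ix) (# 1) tt tt refl refl λ ()
lhs-redex r-x = redex (Flow.lab (lhs r-x)) (Flow.up (lhs r-x)) (Flow.dn (lhs r-x)) (lhs-ins r-x) (lhs-outs r-x) (# 2) tt tt refl refl λ ()

rhs-shape : (ρ : LRule) → NoPass ρ → Shape (rhs ρ)
rhs-shape r-iii tt = mkShape (rhs-ins r-iii tt) (rhs-outs r-iii tt) tt
rhs-shape r-iv tt = mkShape (rhs-ins r-iv tt) (rhs-outs r-iv tt) tt
rhs-shape r-v tt = mkShape (rhs-ins r-v tt) (rhs-outs r-v tt) tt
rhs-shape r-vi tt = mkShape (rhs-ins r-vi tt) (rhs-outs r-vi tt) tt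
rhs-shape r-vii tt = mkShape (rhs-ins r-vii tt) (rhs-outs r-vii tt) tt
rhs-shape r-viii tt = mkShape (rhs-ins r-viii tt) (rhs-outs r-viii tt) tt
rhs-shape r-ix tt = mkShape (rhs-ins r-ix tt) (rhs-outs r-ix tt) tt
rhs-shape r-x tt = mkShape (rhs-ins r-x tt) (rhs-outs r-x tt) tt

Rai-ins : (y : Fin 2) → Fin (ins (Flow.lab Rai y)) → Fin 3
Rai-ins zero = lookup []
Rai-ins (suc zero) = lookup (# 0 ∷ # 2 ∷ [])
Rai-outs : (y : Fin 2) → Fin (outs (Flow.lab Rai y)) → Fin 3
Rai-outs zero = lookup (# 0 ∷ # 1 ∷ [])
Rai-outs (suc zero) = lookup []

Rai-redex : Redex Rai
Rai-redex = redex (Flow.lab Rai) (Flow.up Rai) (Flow.dn Rai) Rai-ins Rai-outs (# 0) tt tt refl refl λ ()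

bind : ∀ {X Y : Set} → (X → Fm Y) → Fm X → Fm Y
bind h 𝔣 = 𝔣
bind h 𝔱 = 𝔱
bind h (atom x) = h x
bind h (α ∨ β) = bind h α ∨ bind h β
bind h (α ∧ β) = bind h α ∧ bind h β

mapFm : ∀ {X Y : Set} → (X → Y) → Fm X → Fm Y
mapFm f = bind (atom ∘ f)

bind-cong : ∀ {X Y : Set} {h h' : X → Fm Y} → (∀ x → h x ≡ h' x) → ∀ F → bind h F ≡ bind h' F
bind-cong p 𝔣 = refl
bind-cong p 𝔱 = refl
bind-cong p (atom x) = p x
bind-cong p (α ∨ β) = cong₂ _∨_ (bind-cong p α) (bind-cong p β)
bind-cong p (α ∧ β) = cong₂ _∧_ (bind-cong p α) (bind-cong p β)

bind-bind : ∀ {X Y Z : Set} (h : Y → Fm Z) (g : X → Fm Y) F → bind h (bind g F) ≡ bind (bind h ∘ g) F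
bind-bind h g 𝔣 = refl
bind-bind h g 𝔱 = refl
bind-bind h g (atom x) = refl
bind-bind h g (α ∨ β) = cong₂ _∨_ (bind-bind h g α) (bind-bind h g β)
bind-bind h g (α ∧ β) = cong₂ _∧_ (bind-bind h g α) (bind-bind h g β)

bindCtx : ∀ {X Y : Set} → (X → Fm Y) → Ctx X → Ctx Y
bindCtx h hole = hole
bindCtx h (ξ ∨ₗ γ) = bindCtx h ξ ∨ₗ bind h γ
bindCtx h (γ ∨ᵣ ξ) = bind h γ ∨ᵣ bindCtx h ξ
bindCtx h (ξ ∧ₗ γ) = bindCtx h ξ ∧ₗ bind h γ
bindCtx h (γ ∧ᵣ ξ) = bind h γ ∧ᵣ bindCtx h ξ

bind-⟨⟩ : ∀ {X Y : Set} (h : X → Fm Y) ξ F → bind h (ξ ⟨ F ⟩) ≡ bindCtx h ξ ⟨ bind h F ⟩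
bind-⟨⟩ h hole F = refl
bind-⟨⟩ h (ξ ∨ₗ γ) F = cong (_∨ _) (bind-⟨⟩ h ξ F)
bind-⟨⟩ h (γ ∨ᵣ ξ) F = cong (_ ∨_) (bind-⟨⟩ h ξ F)
bind-⟨⟩ h (ξ ∧ₗ γ) F = cong (_∧ _) (bind-⟨⟩ h ξ F)
bind-⟨⟩ h (γ ∧ᵣ ξ) F = cong (_ ∧_) (bind-⟨⟩ h ξ F)

data Lin {X : Set} : Fm X → Fm X → Set where
  sw  : ∀ {α β γ} → Lin (α ∧ (β ∨ γ)) ((α ∧ β) ∨ γ)
  md  : ∀ {α β γ δ} → Lin ((α ∧ β) ∨ (γ ∧ δ)) ((α ∨ γ) ∧ (β ∨ δ))
  ax→ : ∀ {α β} → EqAx α β → Lin α β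
  ax← : ∀ {α β} → EqAx α β → Lin β α

bindEq : ∀ {X Y : Set} (h : X → Fm Y) {α β} → EqAx α β → EqAx (bind h α) (bind h β)
bindEq h ∨-comm = ∨-comm
bindEq h ∧-comm = ∧-comm
bindEq h ∨-assoc = ∨-assoc
bindEq h ∧-assoc = ∧-assoc
bindEq h ∨-unit = ∨-unit
bindEq h ∧-unit = ∧-unit
bindEq h 𝔱𝔱 = 𝔱𝔱
bindEq h 𝔣𝔣 = 𝔣𝔣

bindLin : ∀ {X Y : Set} (h : X → Fm Y) {α β} → Lin α β → Lin (bind h α) (bind h β)
bindLin h sw = sw
bindLin h md = md
bindLin h (ax→ e) = ax→ (bindEq h e)
bindLin h (ax← e) = ax← (bindEq h e)

srcF : ∀ k → Fm (Fin (ins k))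
srcF ai↓ = 𝔱
srcF ai↑ = atom (# 0) ∧ atom (# 1)
srcF aw↓ = 𝔣
srcF aw↑ = atom (# 0)
srcF ac↓ = atom (# 0) ∨ atom (# 1)
srcF ac↑ = atom (# 0)

tgtF : ∀ k → Fm (Fin (outs k))
tgtF ai↓ = atom (# 0) ∨ atom (# 1)
tgtF ai↑ = 𝔣
tgtF aw↓ = atom (# 0)
tgtF aw↑ = 𝔱
tgtF ac↓ = atom (# 0)
tgtF ac↑ = atom (# 0) ∧ atom (# 1)

module _ {At : Set} (bar : At → At) where

  AtOK : ∀ k → (Fin (ins k) → At) → (Fin (outs k) → At) → Set
  AtOK ai↓ i o = o (# 1) ≡ bar (o (# 0))
  AtOK ai↑ i o = i (# 1) ≡ bar (i (# 0))
  AtOK aw↓ i o = ⊤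
  AtOK aw↑ i o = ⊤
  AtOK ac↓ i o = i (# 0) ≡ o (# 0) × i (# 1) ≡ o (# 0)
  AtOK ac↑ i o = o (# 0) ≡ i (# 0) × o (# 1) ≡ i (# 0)

  AtOK-cong : ∀ k {i i' o o'} → (∀ j → i' j ≡ i j) → (∀ j → o' j ≡ o j) → AtOK k i o → AtOK k i' o'
  AtOK-cong ai↓ p q r = trans (q _) (trans r (cong bar (sym (q _))))
  AtOK-cong ai↑ p q r = trans (p _) (trans r (cong bar (sym (p _))))
  AtOK-cong aw↓ p q r = tt
  AtOK-cong aw↑ p q r = tt
  AtOK-cong ac↓ p q (r , r') = trans (p _) (trans r (sym (q _))) , trans (p _) (trans r' (sym (q _)))
  AtOK-cong ac↑ p q (r , r') = trans (q _) (trans r (sym (p _))) , trans (q _) (trans r' (sym (p _)))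

  infixr 5 _⨾_
  infixr 6 _∨ᴺ_ _∧ᴺ_

  -- Derivations between formulae whose atoms are edges of A: an instance of an atomic rule is a
  -- vertex of A together with its edges.
  data N {U L : Set} (A : Flow U L) (at : Flow.E A → At) : Fm (Flow.E A) → Fm (Flow.E A) → Set where
    eqN  : ∀ {α β} → α ≡ β → N A at α β
    lin  : ∀ {α β} → Lin α β → N A at α β
    _⨾_  : ∀ {α β γ} → N A at α β → N A at β γ → N A at α γ
    _∨ᴺ_ : ∀ {α α' β β'} → N A at α α' → N A at β β' → N A at (α ∨ β) (α' ∨ β')
    _∧ᴺ_ : ∀ {α α' β β'} → N A at α α' → N A at β β' → N A at (α ∧ β) (α' ∧ β')
    vx   : ∀ k v i o → Flow.lab A v ≡ k → IsPorts (Flow.dn A) v i → IsPorts (Flow.up A) v o →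
           AtOK k (at ∘ i) (at ∘ o) → N A at (mapFm i (srcF k)) (mapFm o (tgtF k))

δ : {V : Set} → DecEq V → V → V → ℕ
δ _≟_ v w with v ≟ w
... | yes _ = 1
... | no _ = 0

δ-yes : {V : Set} (_≟_ : DecEq V) {v w : V} → v ≡ w → δ _≟_ v w ≡ 1
δ-yes _≟_ {v} {w} p with v ≟ w
... | yes _ = refl
... | no n = ⊥-elim (n p)

δ-no : {V : Set} (_≟_ : DecEq V) {v w : V} → v ≢ w → δ _≟_ v w ≡ 0
δ-no _≟_ {v} {w} p with v ≟ w
... | yes q = ⊥-elim (p q)
... | no n = refl

module _ {At : Set} {bar : At → At} {U L : Set} {A : Flow U L} {at : Flow.E A → At} where
  private
    module A = Flow A
    𝒩 : Fm A.E → Fm A.E → Set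
    𝒩 = N bar A at

  idN : ∀ {α} → 𝒩 α α
  idN = eqN refl

  fold : (A.V → ℕ) → ∀ {X Y} → 𝒩 X Y → ℕ
  fold f (eqN _) = 0
  fold f (lin _) = 0
  fold f (c ⨾ d) = fold f c + fold f d
  fold f (c ∨ᴺ d) = fold f c + fold f d
  fold f (c ∧ᴺ d) = fold f c + fold f d
  fold f (vx k v i o _ _ _ _) = f v

  fold-cong : ∀ {f g : A.V → ℕ} → (∀ v → f v ≡ g v) → ∀ {X Y} (d : 𝒩 X Y) → fold f d ≡ fold g d
  fold-cong p (eqN _) = refl
  fold-cong p (lin _) = refl
  fold-cong p (c ⨾ d) = cong₂ _+_ (fold-cong p c) (fold-cong p d)
  fold-cong p (c ∨ᴺ d) = cong₂ _+_ (fold-cong p c) (fold-cong p d)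
  fold-cong p (c ∧ᴺ d) = cong₂ _+_ (fold-cong p c) (fold-cong p d)
  fold-cong p (vx k v i o _ _ _ _) = p v

  AllV : (A.V → Set) → ∀ {X Y} → 𝒩 X Y → Set
  AllV P (eqN _) = ⊤
  AllV P (lin _) = ⊤
  AllV P (c ⨾ d) = AllV P c × AllV P d
  AllV P (c ∨ᴺ d) = AllV P c × AllV P d
  AllV P (c ∧ᴺ d) = AllV P c × AllV P d
  AllV P (vx k v i o _ _ _ _) = P v

  allV : ∀ {P : A.V → Set} → (∀ v → P v) → ∀ {X Y} (d : 𝒩 X Y) → AllV P d
  allV p (eqN _) = tt
  allV p (lin _) = tt
  allV p (c ⨾ d) = allV p c , allV p d
  allV p (c ∨ᴺ d) = allV p c , allV p d
  allV p (c ∧ᴺ d) = allV p c , allV p d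
  allV p (vx k v i o _ _ _ _) = p v

  module _ (_≟_ : DecEq A.V) where

    fold-0 : ∀ w {X Y} (d : 𝒩 X Y) → fold (δ _≟_ w) d ≡ 0 → AllV (_≢ w) d
    fold-0 w (eqN _) p = tt
    fold-0 w (lin _) p = tt
    fold-0 w (c ⨾ d) p = fold-0 w c (ℕP.m+n≡0⇒m≡0 _ p) , fold-0 w d (ℕP.m+n≡0⇒n≡0 (fold (δ _≟_ w) c) p)
    fold-0 w (c ∨ᴺ d) p = fold-0 w c (ℕP.m+n≡0⇒m≡0 _ p) , fold-0 w d (ℕP.m+n≡0⇒n≡0 (fold (δ _≟_ w) c) p)
    fold-0 w (c ∧ᴺ d) p = fold-0 w c (ℕP.m+n≡0⇒m≡0 _ p) , fold-0 w d (ℕP.m+n≡0⇒n≡0 (fold (δ _≟_ w) c) p)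
    fold-0 w (vx k v i o _ _ _ _) p q = ℕP.1+n≢0 (trans (sym (δ-yes _≟_ (sym q))) p)

    record Split (w : A.V) {X Y} (d : 𝒩 X Y) : Set where
      field
        ξ : Ctx A.E
        k : Label
        i : Fin (ins k) → A.E
        o : Fin (outs k) → A.E
        lk : A.lab w ≡ k
        pi : IsPorts A.dn w i
        po : IsPorts A.up w o
        ok : AtOK bar k (at ∘ i) (at ∘ o)
        d1 : 𝒩 X (ξ ⟨ mapFm i (srcF k) ⟩)
        d3 : 𝒩 (ξ ⟨ mapFm o (tgtF k) ⟩) Y
        folds : ∀ f → fold f d ≡ fold f d1 + f w + fold f d3

    private
      open +-*-Solver
      arith : ∀ a x b c → (a + x + b) + c ≡ a + x + (b + c)
      arith = solve 4 (λ a x b c → (a :+ x :+ b) :+ c := a :+ x :+ (b :+ c)) refl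
      arith2 : ∀ a x b c → c + (a + x + b) ≡ (c + a) + x + b
      arith2 = solve 4 (λ a x b c → c :+ (a :+ x :+ b) := (c :+ a) :+ x :+ b) refl
      arithˡ : ∀ a x b c → (a + x + b) + c ≡ (a + 0) + x + (b + c)
      arithˡ = solve 4 (λ a x b c → (a :+ x :+ b) :+ c := (a :+ con 0) :+ x :+ (b :+ c)) refl
      arithʳ : ∀ a x b c → c + (a + x + b) ≡ (0 + a) + x + (c + b)
      arithʳ = solve 4 (λ a x b c → c :+ (a :+ x :+ b) := (con 0 :+ a) :+ x :+ (c :+ b)) refl

    split : ∀ w {X Y} (d : 𝒩 X Y) → fold (δ _≟_ w) d ≢ 0 → Split w d
    split w (eqN _) n = ⊥-elim (n refl)
    split w (lin _) n = ⊥-elim (n refl)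
    split w (c ⨾ d) n with fold (δ _≟_ w) c ℕP.≟ 0
    ... | no n' = let q = split w c n' in record { Split q ; d3 = Split.d3 q ⨾ d
      ; folds = λ f → trans (cong (_+ fold f d) (Split.folds q f)) (arith (fold f (Split.d1 q)) (f w) (fold f (Split.d3 q)) _) }
    ... | yes p = let q = split w d (λ z → n (cong₂ _+_ p z)) in record { Split q ; d1 = c ⨾ Split.d1 q
      ; folds = λ f → trans (cong (fold f c +_) (Split.folds q f)) (arith2 (fold f (Split.d1 q)) (f w) (fold f (Split.d3 q)) _) }
    split w (c ∨ᴺ d) n with fold (δ _≟_ w) c ℕP.≟ 0
    ... | no n' = let q = split w c n' in record { Split q ; ξ = Split.ξ q ∨ₗ _ ; d1 = Split.d1 q ∨ᴺ idN ; d3 = Split.d3 q ∨ᴺ d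
      ; folds = λ f → trans (cong (_+ fold f d) (Split.folds q f)) (arithˡ (fold f (Split.d1 q)) (f w) (fold f (Split.d3 q)) _) }
    ... | yes p = let q = split w d (λ z → n (cong₂ _+_ p z)) in record { Split q ; ξ = _ ∨ᵣ Split.ξ q ; d1 = idN ∨ᴺ Split.d1 q ; d3 = c ∨ᴺ Split.d3 q
      ; folds = λ f → trans (cong (fold f c +_) (Split.folds q f)) (arithʳ (fold f (Split.d1 q)) (f w) (fold f (Split.d3 q)) _) }
    split w (c ∧ᴺ d) n with fold (δ _≟_ w) c ℕP.≟ 0
    ... | no n' = let q = split w c n' in record { Split q ; ξ = Split.ξ q ∧ₗ _ ; d1 = Split.d1 q ∧ᴺ idN ; d3 = Split.d3 q ∧ᴺ d
      ; folds = λ f → trans (cong (_+ fold f d) (Split.folds q f)) (arithˡ (fold f (Split.d1 q)) (f w) (fold f (Split.d3 q)) _) }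
    ... | yes p = let q = split w d (λ z → n (cong₂ _+_ p z)) in record { Split q ; ξ = _ ∧ᵣ Split.ξ q ; d1 = idN ∧ᴺ Split.d1 q ; d3 = c ∧ᴺ Split.d3 q
      ; folds = λ f → trans (cong (fold f c +_) (Split.folds q f)) (arithʳ (fold f (Split.d1 q)) (f w) (fold f (Split.d3 q)) _) }
    split w (vx k v i o l p q a) n with w ≟ v
    ... | no _ = ⊥-elim (n refl)
    ... | yes refl = record { ξ = hole ; k = k ; i = i ; o = o ; lk = l ; pi = p ; po = q ; ok = a ; d1 = idN ; d3 = idN
                            ; folds = λ f → sym (ℕP.+-identityʳ (f v)) }

  inCtx : ∀ ξ {X Y} → 𝒩 X Y → 𝒩 (ξ ⟨ X ⟩) (ξ ⟨ Y ⟩)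
  inCtx hole d = d
  inCtx (ξ ∨ₗ γ) d = inCtx ξ d ∨ᴺ idN
  inCtx (γ ∨ᵣ ξ) d = idN ∨ᴺ inCtx ξ d
  inCtx (ξ ∧ₗ γ) d = inCtx ξ d ∧ᴺ idN
  inCtx (γ ∧ᵣ ξ) d = idN ∧ᴺ inCtx ξ d

  fold-inCtx : ∀ f ξ {X Y} (d : 𝒩 X Y) → fold f (inCtx ξ d) ≡ fold f d
  fold-inCtx f hole d = refl
  fold-inCtx f (ξ ∨ₗ γ) d = trans (ℕP.+-identityʳ _) (fold-inCtx f ξ d)
  fold-inCtx f (γ ∨ᵣ ξ) d = fold-inCtx f ξ d
  fold-inCtx f (ξ ∧ₗ γ) d = trans (ℕP.+-identityʳ _) (fold-inCtx f ξ d)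
  fold-inCtx f (γ ∧ᵣ ξ) d = fold-inCtx f ξ d

  ∨-swap : ∀ {α β} → 𝒩 (α ∨ β) (β ∨ α)
  ∨-swap = lin (ax→ ∨-comm)
  ∧-swap : ∀ {α β} → 𝒩 (α ∧ β) (β ∧ α)
  ∧-swap = lin (ax→ ∧-comm)

  switch-out : ∀ ξ {X γ} → 𝒩 (ξ ⟨ X ∨ γ ⟩) (ξ ⟨ X ⟩ ∨ γ)
  switch-out hole = idN
  switch-out (ξ ∨ₗ γ') = switch-out ξ ∨ᴺ idN ⨾ lin (ax→ ∨-assoc) ⨾ idN ∨ᴺ ∨-swap ⨾ lin (ax← ∨-assoc)
  switch-out (γ' ∨ᵣ ξ) = idN ∨ᴺ switch-out ξ ⨾ lin (ax← ∨-assoc)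
  switch-out (ξ ∧ₗ γ') = switch-out ξ ∧ᴺ idN ⨾ ∧-swap ⨾ lin sw ⨾ ∧-swap ∨ᴺ idN
  switch-out (γ' ∧ᵣ ξ) = idN ∧ᴺ switch-out ξ ⨾ lin sw

  switch-in : ∀ ξ {X γ} → 𝒩 (ξ ⟨ X ⟩ ∧ γ) (ξ ⟨ X ∧ γ ⟩)
  switch-in hole = idN
  switch-in (ξ ∨ₗ γ') = ∧-swap ⨾ lin sw ⨾ (∧-swap ⨾ switch-in ξ) ∨ᴺ idN
  switch-in (γ' ∨ᵣ ξ) = ∧-swap ⨾ idN ∧ᴺ ∨-swap ⨾ lin sw ⨾ ∨-swap ⨾ idN ∨ᴺ (∧-swap ⨾ switch-in ξ)
  switch-in (ξ ∧ₗ γ') = lin (ax→ ∧-assoc) ⨾ idN ∧ᴺ ∧-swap ⨾ lin (ax← ∧-assoc) ⨾ switch-in ξ ∧ᴺ idN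
  switch-in (γ' ∧ᵣ ξ) = lin (ax→ ∧-assoc) ⨾ idN ∧ᴺ switch-in ξ

  fold-switch-out : ∀ f ξ {X γ} → fold f (switch-out ξ {X} {γ}) ≡ 0
  fold-switch-out f hole = refl
  fold-switch-out f (ξ ∨ₗ γ') = cong (λ z → z + 0 + 0) (fold-switch-out f ξ)
  fold-switch-out f (γ' ∨ᵣ ξ) = cong (_+ 0) (fold-switch-out f ξ)
  fold-switch-out f (ξ ∧ₗ γ') = cong (λ z → z + 0 + 0) (fold-switch-out f ξ)
  fold-switch-out f (γ' ∧ᵣ ξ) = cong (_+ 0) (fold-switch-out f ξ)

  fold-switch-in : ∀ f ξ {X γ} → fold f (switch-in ξ {X} {γ}) ≡ 0
  fold-switch-in f hole = refl
  fold-switch-in f (ξ ∨ₗ γ') = cong (_+ 0) (fold-switch-in f ξ)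
  fold-switch-in f (γ' ∨ᵣ ξ) = fold-switch-in f ξ
  fold-switch-in f (ξ ∧ₗ γ') = cong (_+ 0) (fold-switch-in f ξ)
  fold-switch-in f (γ' ∧ᵣ ξ) = fold-switch-in f ξ

data Reordered {E : Set} : ∀ {n} → (Fin n → E) → (Fin n → E) → Set where
  same    : ∀ {n} {i i' : Fin n → E} → (∀ j → i j ≡ i' j) → Reordered i i'
  twisted : {i i' : Fin 2 → E} → i (# 0) ≡ i' (# 1) → i (# 1) ≡ i' (# 0) → Reordered i i'

ports-≤2 : ∀ {E B V : Set} {end : E → B ⊎ V} {v : V} {n} {i i' : Fin n → E} → n ≤ 2 → IsPorts end v i → IsPorts end v i' →
  Reordered i i'
ports-≤2 {n = zero} le P P' = same λ ()
ports-≤2 {n = suc zero} {i} le P P' with all P' (i zero) (hit P zero)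
... | (zero , q) = same λ { zero → sym q }
ports-≤2 {n = suc (suc zero)} {i} le P P' with all P' (i zero) (hit P zero) | all P' (i (# 1)) (hit P (# 1))
... | (zero , q) | (zero , r) with () ← inj P (trans (sym q) r)
... | (zero , q) | (suc zero , r) = same λ { zero → sym q ; (suc zero) → sym r }
... | (suc zero , q) | (zero , r) = twisted (sym q) (sym r)
... | (suc zero , q) | (suc zero , r) with () ← inj P (trans (sym q) r)
ports-≤2 {n = suc (suc (suc n))} (s≤s (s≤s ())) P P'

module _ {At : Set} {bar : At → At} (invol : ∀ a → bar (bar a) ≡ a) {E : Set} (at : E → At) where

  AtOK-reorder : ∀ k {i i' o o'} → Reordered i i' → Reordered o o' → AtOK bar k (at ∘ i) (at ∘ o) → AtOK bar k (at ∘ i') (at ∘ o')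
  AtOK-reorder ai↓ {i} {i'} P (same e) a = AtOK-cong bar ai↓ {at ∘ i} {at ∘ i'} (λ ()) (λ j → cong at (sym (e j))) a
  AtOK-reorder ai↓ {o = o} {o'} P (twisted x y) a = trans (cong at (sym x)) (trans (sym (invol _)) (cong bar (trans (sym a) (cong at y))))
  AtOK-reorder ai↑ {o = o} {o'} (same e) Q a = AtOK-cong bar ai↑ {o = at ∘ o} {at ∘ o'} (λ j → cong at (sym (e j))) (λ ()) a
  AtOK-reorder ai↑ (twisted x y) Q a = trans (cong at (sym x)) (trans (sym (invol _)) (cong bar (trans (sym a) (cong at y))))
  AtOK-reorder aw↓ P Q a = tt
  AtOK-reorder aw↑ P Q a = tt
  AtOK-reorder ac↓ (same e) (same e') a = AtOK-cong bar ac↓ (λ j → cong at (sym (e j))) (λ j → cong at (sym (e' j))) a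
  AtOK-reorder ac↓ (twisted x y) (same e') (a , b) =
    trans (cong at (sym y)) (trans b (cong at (e' _))) , trans (cong at (sym x)) (trans a (cong at (e' _)))
  AtOK-reorder ac↑ (same e) (same e') a = AtOK-cong bar ac↑ (λ j → cong at (sym (e j))) (λ j → cong at (sym (e' j))) a
  AtOK-reorder ac↑ (same e) (twisted x y) (a , b) =
    trans (cong at (sym y)) (trans b (cong at (e _))) , trans (cong at (sym x)) (trans a (cong at (e _)))

module _ {At : Set} {bar : At → At} {U L U' L' : Set} {A : Flow U L} {at : Flow.E A → At}
         {A' : Flow U' L'} {at' : Flow.E A' → At} (h : Flow.E A → Fm (Flow.E A')) where
  private
    module A = Flow A
    module A' = Flow A'

  Patches : (A.V → Set) → Set
  Patches OK = ∀ k v i o → OK v → A.lab v ≡ k → IsPorts A.dn v i → IsPorts A.up v o → AtOK bar k (at ∘ i) (at ∘ o) →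
    N bar A' at' (bind h (mapFm i (srcF k))) (bind h (mapFm o (tgtF k)))

  -- A derivation can be translated vertex by vertex along a substitution of formulae for its edges.
  translate : ∀ {OK} → Patches OK → ∀ {X Y} (d : N bar A at X Y) → AllV OK d → N bar A' at' (bind h X) (bind h Y)
  translate p (eqN e) q = eqN (cong (bind h) e)
  translate p (lin l) q = lin (bindLin h l)
  translate p (c ⨾ d) (q , r) = translate p c q ⨾ translate p d r
  translate p (c ∨ᴺ d) (q , r) = translate p c q ∨ᴺ translate p d r
  translate p (c ∧ᴺ d) (q , r) = translate p c q ∧ᴺ translate p d r
  translate p (vx k v i o l a b c) q = p k v i o q l a b c

  fold-translate : ∀ {OK} (p : Patches OK) (f : A'.V → ℕ) (g : A.V → ℕ) →
    (∀ k v i o q l a b c → fold f (p k v i o q l a b c) ≡ g v) →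
    ∀ {X Y} (d : N bar A at X Y) (q : AllV OK d) → fold f (translate p d q) ≡ fold g d
  fold-translate p f g e (eqN _) q = refl
  fold-translate p f g e (lin _) q = refl
  fold-translate p f g e (c ⨾ d) (q , r) = cong₂ _+_ (fold-translate p f g e c q) (fold-translate p f g e d r)
  fold-translate p f g e (c ∨ᴺ d) (q , r) = cong₂ _+_ (fold-translate p f g e c q) (fold-translate p f g e d r)
  fold-translate p f g e (c ∧ᴺ d) (q , r) = cong₂ _+_ (fold-translate p f g e c q) (fold-translate p f g e d r)
  fold-translate p f g e (vx k v i o l a b c) q = e k v i o q l a b c

  private
    reordered-ins : ∀ k {i i' : Fin (ins k) → A.E} → Reordered i i' →
      Σ (N bar A' at' (bind h (mapFm i (srcF k))) (bind h (mapFm i' (srcF k)))) λ d → ∀ f → fold f d ≡ 0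
    reordered-ins ai↓ (same e) = eqN (cong (bind h) (bind-cong (λ j → cong atom (e j)) (srcF ai↓))) , λ _ → refl
    reordered-ins ai↑ (same e) = eqN (cong (bind h) (bind-cong (λ j → cong atom (e j)) (srcF ai↑))) , λ _ → refl
    reordered-ins ai↑ (twisted a b) = (eqN (cong₂ _∧_ (cong h a) (cong h b)) ⨾ ∧-swap) , λ _ → refl
    reordered-ins aw↓ (same e) = eqN (cong (bind h) (bind-cong (λ j → cong atom (e j)) (srcF aw↓))) , λ _ → refl
    reordered-ins aw↑ (same e) = eqN (cong (bind h) (bind-cong (λ j → cong atom (e j)) (srcF aw↑))) , λ _ → refl
    reordered-ins ac↓ (same e) = eqN (cong (bind h) (bind-cong (λ j → cong atom (e j)) (srcF ac↓))) , λ _ → refl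
    reordered-ins ac↓ (twisted a b) = (eqN (cong₂ _∨_ (cong h a) (cong h b)) ⨾ ∨-swap) , λ _ → refl
    reordered-ins ac↑ (same e) = eqN (cong (bind h) (bind-cong (λ j → cong atom (e j)) (srcF ac↑))) , λ _ → refl

  reorder-ins : ∀ k {v} {i i'} → IsPorts A.dn v i → IsPorts A.dn v i' →
    Σ (N bar A' at' (bind h (mapFm i (srcF k))) (bind h (mapFm i' (srcF k)))) λ d → ∀ f → fold f d ≡ 0
  reorder-ins k P P' = reordered-ins k (ports-≤2 (ins≤2 k) P P')

  private
    reordered-outs : ∀ k {i i' : Fin (outs k) → A.E} → Reordered i i' →
      Σ (N bar A' at' (bind h (mapFm i (tgtF k))) (bind h (mapFm i' (tgtF k)))) λ d → ∀ f → fold f d ≡ 0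
    reordered-outs ai↓ (same e) = eqN (cong (bind h) (bind-cong (λ j → cong atom (e j)) (tgtF ai↓))) , λ _ → refl
    reordered-outs ai↓ (twisted a b) = (eqN (cong₂ _∨_ (cong h a) (cong h b)) ⨾ ∨-swap) , λ _ → refl
    reordered-outs ai↑ (same e) = eqN (cong (bind h) (bind-cong (λ j → cong atom (e j)) (tgtF ai↑))) , λ _ → refl
    reordered-outs aw↓ (same e) = eqN (cong (bind h) (bind-cong (λ j → cong atom (e j)) (tgtF aw↓))) , λ _ → refl
    reordered-outs aw↑ (same e) = eqN (cong (bind h) (bind-cong (λ j → cong atom (e j)) (tgtF aw↑))) , λ _ → refl
    reordered-outs ac↓ (same e) = eqN (cong (bind h) (bind-cong (λ j → cong atom (e j)) (tgtF ac↓))) , λ _ → refl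
    reordered-outs ac↑ (same e) = eqN (cong (bind h) (bind-cong (λ j → cong atom (e j)) (tgtF ac↑))) , λ _ → refl
    reordered-outs ac↑ (twisted a b) = (eqN (cong₂ _∧_ (cong h a) (cong h b)) ⨾ ∧-swap) , λ _ → refl

  reorder-outs : ∀ k {v} {i i'} → IsPorts A.up v i → IsPorts A.up v i' →
    Σ (N bar A' at' (bind h (mapFm i (tgtF k))) (bind h (mapFm i' (tgtF k)))) λ d → ∀ f → fold f d ≡ 0
  reorder-outs k P P' = reordered-outs k (ports-≤2 (outs≤2 k) P P')

record FlowIso {U L : Set} (A B : Flow U L) : Set where
  private
    module A = Flow A
    module B = Flow B
  field
    vb : A.V ↔ B.V
    eb : A.E ↔ B.E
    lab-iso : ∀ v → A.lab v ≡ B.lab (to vb v)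
    up-iso : ∀ e → B.up (to eb e) ≡ map₂ (to vb) (A.up e)
    dn-iso : ∀ e → B.dn (to eb e) ≡ map₂ (to vb) (A.dn e)

map2-∘ : ∀ {A B C D : Set} {f : B → C} {g : C → D} (x : A ⊎ B) → map₂ g (map₂ f x) ≡ map₂ (g ∘ f) x
map2-∘ (inl x) = refl
map2-∘ (inr y) = refl

glue-iso : ∀ {U L P Q} {A B : Flow U L} {K : Flow (U ⊎ Q) (L ⊎ P)} {R : Flow P Q} → FlowIso A B → IsGlue B K R → IsGlue A K R
glue-iso {A = A} {B} {K} {R} I G = record
  { vbij = ↔-trans I.vb G.vbij ; ebij = ↔-trans I.eb G.ebij
  ; lab-ok = λ v → trans (I.lab-iso v) (G.lab-ok _)
  ; up-ok = λ e → subst (GUp K R _) (trans (cong (map₂ _) (I.up-iso e)) (map2-∘ (Flow.up A e))) (G.up-ok (to I.eb e))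
  ; dn-ok = λ e → subst (GDn K R _) (trans (cong (map₂ _) (I.dn-iso e)) (map2-∘ (Flow.dn A e))) (G.dn-ok (to I.eb e)) }
  where
  module I = FlowIso I
  module G = IsGlue G

comb-iso : ∀ {U L} {A B : Flow U L} {D1 : Flow U (L ⊎ Fin 1)} {D2 : Flow (U ⊎ Fin 1) L} → FlowIso A B → IsComb B D1 D2 → IsComb A D1 D2
comb-iso {A = A} {B} {D1} {D2} I G = record
  { vbij = ↔-trans I.vb G.vbij ; ebij = ↔-trans I.eb G.ebij
  ; lab-ok = λ v → trans (I.lab-iso v) (G.lab-ok _)
  ; up-ok = λ e → subst (CUp D1 D2 _) (trans (cong (map₂ _) (I.up-iso e)) (map2-∘ (Flow.up A e))) (G.up-ok (to I.eb e))
  ; dn-ok = λ e → subst (CDn D1 D2 _) (trans (cong (map₂ _) (I.dn-iso e)) (map2-∘ (Flow.dn A e))) (G.dn-ok (to I.eb e)) }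
  where
  module I = FlowIso I
  module G = IsComb G

record NStruct {At : Set} (bar : At → At) {U L : Set} (A : Flow U L) (aU : U → At) (aL : L → At)
               (X : Fm U) (Y : Fm L) : Set where
  open Flow A
  field
    _≟V_ : DecEq V
    at : E → At
    topE : U → E
    botE : L → E
    top-up : ∀ u → up (topE u) ≡ inl u
    top-un : ∀ e u → up e ≡ inl u → e ≡ topE u
    bot-dn : ∀ l → dn (botE l) ≡ inl l
    bot-un : ∀ e l → dn e ≡ inl l → e ≡ botE l
    at-top : ∀ u → at (topE u) ≡ aU u
    at-bot : ∀ l → at (botE l) ≡ aL l
    der : N bar A at (mapFm topE X) (mapFm botE Y)
    full : ∀ v → fold (δ _≟V_ v) der ≡ 1

atomAt : ∀ {At : Set} (α : Fm At) → Occ α → At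
atomAt (atom a) tt = a
atomAt (α ∨ β) (inl p) = atomAt α p
atomAt (α ∨ β) (inr p) = atomAt β p
atomAt (α ∧ β) (inl p) = atomAt α p
atomAt (α ∧ β) (inr p) = atomAt β p

name : ∀ {At E : Set} (α : Fm At) → (Occ α → E) → Fm E
name 𝔣 f = 𝔣
name 𝔱 f = 𝔱
name (atom a) f = atom (f tt)
name (α ∨ β) f = name α (f ∘ inl) ∨ name β (f ∘ inr)
name (α ∧ β) f = name α (f ∘ inl) ∧ name β (f ∘ inr)

map-name : ∀ {At E E' : Set} (h : E → E') (α : Fm At) f → mapFm h (name α f) ≡ name α (h ∘ f)
map-name h 𝔣 f = refl
map-name h 𝔱 f = refl
map-name h (atom a) f = refl
map-name h (α ∨ β) f = cong₂ _∨_ (map-name h α _) (map-name h β _)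
map-name h (α ∧ β) f = cong₂ _∧_ (map-name h α _) (map-name h β _)

RVsum : ∀ {At : Set} {bar : At → At} {α β} (r : Rule bar α β) → (RV r → ℕ) → ℕ
RVsum (ai↓ a) f = f tt
RVsum (aw↓ a) f = f tt
RVsum (ac↓ a) f = f tt
RVsum (ai↑ a) f = f tt
RVsum (aw↑ a) f = f tt
RVsum (ac↑ a) f = f tt
RVsum s f = 0
RVsum m f = 0
RVsum (eq→ _) f = 0
RVsum (eq← _) f = 0

atomic : ∀ {At : Set} {bar : At → At} {α β} (r : Rule bar α β) →
  (Σ (RV r) λ x → (∀ y → x ≡ y) × (∀ f → RVsum r f ≡ f x)) ⊎ (¬ RV r × (∀ f → RVsum r f ≡ 0))
atomic (ai↓ a) = inl (tt , (λ _ → refl) , λ _ → refl)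
atomic (aw↓ a) = inl (tt , (λ _ → refl) , λ _ → refl)
atomic (ac↓ a) = inl (tt , (λ _ → refl) , λ _ → refl)
atomic (ai↑ a) = inl (tt , (λ _ → refl) , λ _ → refl)
atomic (aw↑ a) = inl (tt , (λ _ → refl) , λ _ → refl)
atomic (ac↑ a) = inl (tt , (λ _ → refl) , λ _ → refl)
atomic s = inr (id , λ _ → refl)
atomic m = inr (id , λ _ → refl)
atomic (eq→ _) = inr (id , λ _ → refl)
atomic (eq← _) = inr (id , λ _ → refl)

module _ {At : Set} {bar : At → At} {α β : Fm At} (r : Rule bar α β) where

  RV-prop : ∀ (x y : RV r) → x ≡ y
  RV-prop x y with atomic r
  ... | inl (_ , u , _) = trans (sym (u x)) (u y)
  ... | inr (n , _) = ⊥-elim (n x)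

  RVsum-at : ∀ f x → RVsum r f ≡ f x
  RVsum-at f x with atomic r
  ... | inl (_ , u , e) = trans (e f) (cong f (u x))
  ... | inr (n , _) = ⊥-elim (n x)

  RVsum-≢0 : ∀ f → RVsum r f ≢ 0 → Σ (RV r) λ x → f x ≢ 0
  RVsum-≢0 f n with atomic r
  ... | inl (x , _ , e) = x , λ z → n (trans (e f) z)
  ... | inr (_ , e) = ⊥-elim (n (e f))

infixr 5 _▸▸_
_▸▸_ : ∀ {At : Set} {bar : At → At} {α β γ} → Deriv bar α β → Deriv bar β γ → Deriv bar α γ
done ▸▸ e = e
(σ ▸ d) ▸▸ e = σ ▸ (d ▸▸ e)

eqTo-From : ∀ {At : Set} {α β : Fm At} (e : EqAx α β) q → eqTo e (eqFrom e q) ≡ q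
eqTo-From ∨-comm (inl x) = refl
eqTo-From ∨-comm (inr x) = refl
eqTo-From ∧-comm (inl x) = refl
eqTo-From ∧-comm (inr x) = refl
eqTo-From ∨-assoc (inl x) = refl
eqTo-From ∨-assoc (inr (inl x)) = refl
eqTo-From ∨-assoc (inr (inr x)) = refl
eqTo-From ∨-unit x = refl
eqTo-From ∧-assoc (inl x) = refl
eqTo-From ∧-assoc (inr (inl x)) = refl
eqTo-From ∧-assoc (inr (inr x)) = refl
eqTo-From ∧-unit x = refl
eqTo-From 𝔱𝔱 ()
eqTo-From 𝔣𝔣 ()

eqFrom-To : ∀ {At : Set} {α β : Fm At} (e : EqAx α β) p → eqFrom e (eqTo e p) ≡ p
eqFrom-To ∨-comm (inl x) = refl
eqFrom-To ∨-comm (inr x) = refl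
eqFrom-To ∧-comm (inl x) = refl
eqFrom-To ∧-comm (inr x) = refl
eqFrom-To ∨-assoc (inl (inl x)) = refl
eqFrom-To ∨-assoc (inl (inr x)) = refl
eqFrom-To ∨-assoc (inr x) = refl
eqFrom-To ∨-unit (inl x) = refl
eqFrom-To ∧-assoc (inl (inl x)) = refl
eqFrom-To ∧-assoc (inl (inr x)) = refl
eqFrom-To ∧-assoc (inr x) = refl
eqFrom-To ∧-unit (inl x) = refl
eqFrom-To 𝔱𝔱 (inl ())
eqFrom-To 𝔱𝔱 (inr ())
eqFrom-To 𝔣𝔣 (inl ())
eqFrom-To 𝔣𝔣 (inr ())

module Realize {At : Set} (bar : At → At) {U0 L0 : Set} (A : Flow U0 L0) where
  private
    module A = Flow A

  FateOK : {I D : Set} → (I → A.E) → (D → A.V) → I ⊎ D → A.E → Set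
  FateOK g ν (inl q) e = e ≡ g q
  FateOK g ν (inr x) e = A.dn e ≡ inr (ν x)

  NamedStep : ∀ {α β} (σ : Step bar α β) → (Occ α → A.E) → (Occ β → A.E) → Set
  NamedStep (step ξ {α'} {β'} r) f f' = Σ (RV r → A.V) λ ν →
    (∀ x → A.lab (ν x) ≡ rlab r x) × (∀ p → FateOK f' ν (cFwd ξ {α'} {β'} (rFwd r) p) (f p)) ×
    (∀ x → IsPorts A.up (ν x) (λ (q : Occ β') → f' (cIn ξ q)))

  -- Named d f g: the edges of the flow of d are named by edges of A, extending f and g.
  Named : ∀ {α β} → Deriv bar α β → (Occ α → A.E) → (Occ β → A.E) → Set
  Named done f g = ∀ p → f p ≡ g p
  Named (_▸_ {β = β} σ d) f g = Σ (Occ β → A.E) λ f' → NamedStep σ f f' × Named d f' g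

  foldStep : ∀ {α β} (σ : Step bar α β) {f f'} → (A.V → ℕ) → NamedStep σ f f' → ℕ
  foldStep (step ξ r) w (ν , _) = RVsum r (w ∘ ν)

  foldD : ∀ {α β} {d : Deriv bar α β} {f g} → (A.V → ℕ) → Named d f g → ℕ
  foldD {d = done} w n = 0
  foldD {d = σ ▸ d} w (f' , n , n') = foldStep σ w n + foldD {d = d} w n'

  named-≗ : ∀ {α β} (d : Deriv bar α β) {f f' g} → (∀ p → f p ≡ f' p) → (n : Named d f' g) →
            Σ (Named d f g) λ n' → ∀ w → foldD {d = d} w n' ≡ foldD {d = d} w n
  named-≗ done e n = (λ p → trans (e p) (n p)) , λ _ → refl
  named-≗ (step ξ r ▸ d) e (f1 , (ν , a , b , c) , n) =
    (f1 , (ν , a , (λ p → subst (FateOK f1 ν (cFwd ξ (rFwd r) p)) (sym (e p)) (b p)) , c) , n) , λ _ → refl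

  append : ∀ {α β γ} (d : Deriv bar α β) (d' : Deriv bar β γ) {f g h} (n : Named d f g) (n' : Named d' g h) →
           Σ (Named (d ▸▸ d') f h) λ n1 → ∀ w → foldD {d = d ▸▸ d'} w n1 ≡ foldD {d = d} w n + foldD {d = d'} w n'
  append done d' n n' = named-≗ d' n n'
  append (σ ▸ d) d' (f1 , a , n) n' with append d d' n n'
  ... | (n1 , e) = (f1 , a , n1) , λ w → trans (cong (foldStep σ w a +_) (e w)) (sym (ℕP.+-assoc (foldStep σ w a) _ _))

  under-∨ₗ : ∀ γ (c : Occ γ → A.E) {α β} (d : Deriv bar α β) {f g} (n : Named d f g) →
    Σ (Deriv bar (α ∨ γ) (β ∨ γ)) λ d' → Σ (Named d' (case⊎ f c) (case⊎ g c)) λ n' → ∀ w → foldD {d = d'} w n' ≡ foldD {d = d} w n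
  under-∨ₗ γ c done {f} {g} n = done , (λ { (inl p) → n p ; (inr p) → refl }) , λ _ → refl
  under-∨ₗ γ c (step ξ r ▸ d) {f} {g} (f' , (ν , a , b , e) , n) with under-∨ₗ γ c d n
  ... | (d' , n' , k) = step (ξ ∨ₗ γ) r ▸ d' , ((case⊎ f' c) , (ν , a , fates , e) , n') , λ w → cong (RVsum r (w ∘ ν) +_) (k w)
    where
    fate : ∀ z x → FateOK f' ν z x → FateOK (case⊎ f' c) ν (map₁ inl z) x
    fate (inl _) x q = q
    fate (inr _) x q = q
    fates : ∀ p → FateOK (case⊎ f' c) ν (cFwd (ξ ∨ₗ γ) (rFwd r) p) ((case⊎ f c) p)
    fates (inl p) = fate (cFwd ξ (rFwd r) p) (f p) (b p)
    fates (inr p) = refl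

  under-∨ᵣ : ∀ γ (c : Occ γ → A.E) {α β} (d : Deriv bar α β) {f g} (n : Named d f g) →
    Σ (Deriv bar (γ ∨ α) (γ ∨ β)) λ d' → Σ (Named d' (case⊎ c f) (case⊎ c g)) λ n' → ∀ w → foldD {d = d'} w n' ≡ foldD {d = d} w n
  under-∨ᵣ γ c done {f} {g} n = done , (λ { (inr p) → n p ; (inl p) → refl }) , λ _ → refl
  under-∨ᵣ γ c (step ξ r ▸ d) {f} {g} (f' , (ν , a , b , e) , n) with under-∨ᵣ γ c d n
  ... | (d' , n' , k) = step (γ ∨ᵣ ξ) r ▸ d' , ((case⊎ c f') , (ν , a , fates , e) , n') , λ w → cong (RVsum r (w ∘ ν) +_) (k w)
    where
    fate : ∀ z x → FateOK f' ν z x → FateOK (case⊎ c f') ν (map₁ inr z) x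
    fate (inl _) x q = q
    fate (inr _) x q = q
    fates : ∀ p → FateOK (case⊎ c f') ν (cFwd (γ ∨ᵣ ξ) (rFwd r) p) ((case⊎ c f) p)
    fates (inr p) = fate (cFwd ξ (rFwd r) p) (f p) (b p)
    fates (inl p) = refl

  under-∧ₗ : ∀ γ (c : Occ γ → A.E) {α β} (d : Deriv bar α β) {f g} (n : Named d f g) →
    Σ (Deriv bar (α ∧ γ) (β ∧ γ)) λ d' → Σ (Named d' (case⊎ f c) (case⊎ g c)) λ n' → ∀ w → foldD {d = d'} w n' ≡ foldD {d = d} w n
  under-∧ₗ γ c done {f} {g} n = done , (λ { (inl p) → n p ; (inr p) → refl }) , λ _ → refl
  under-∧ₗ γ c (step ξ r ▸ d) {f} {g} (f' , (ν , a , b , e) , n) with under-∧ₗ γ c d n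
  ... | (d' , n' , k) = step (ξ ∧ₗ γ) r ▸ d' , ((case⊎ f' c) , (ν , a , fates , e) , n') , λ w → cong (RVsum r (w ∘ ν) +_) (k w)
    where
    fate : ∀ z x → FateOK f' ν z x → FateOK (case⊎ f' c) ν (map₁ inl z) x
    fate (inl _) x q = q
    fate (inr _) x q = q
    fates : ∀ p → FateOK (case⊎ f' c) ν (cFwd (ξ ∧ₗ γ) (rFwd r) p) ((case⊎ f c) p)
    fates (inl p) = fate (cFwd ξ (rFwd r) p) (f p) (b p)
    fates (inr p) = refl

  under-∧ᵣ : ∀ γ (c : Occ γ → A.E) {α β} (d : Deriv bar α β) {f g} (n : Named d f g) →
    Σ (Deriv bar (γ ∧ α) (γ ∧ β)) λ d' → Σ (Named d' (case⊎ c f) (case⊎ c g)) λ n' → ∀ w → foldD {d = d'} w n' ≡ foldD {d = d} w n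
  under-∧ᵣ γ c done {f} {g} n = done , (λ { (inr p) → n p ; (inl p) → refl }) , λ _ → refl
  under-∧ᵣ γ c (step ξ r ▸ d) {f} {g} (f' , (ν , a , b , e) , n) with under-∧ᵣ γ c d n
  ... | (d' , n' , k) = step (γ ∧ᵣ ξ) r ▸ d' , ((case⊎ c f') , (ν , a , fates , e) , n') , λ w → cong (RVsum r (w ∘ ν) +_) (k w)
    where
    fate : ∀ z x → FateOK f' ν z x → FateOK (case⊎ c f') ν (map₁ inr z) x
    fate (inl _) x q = q
    fate (inr _) x q = q
    fates : ∀ p → FateOK (case⊎ c f') ν (cFwd (γ ∧ᵣ ξ) (rFwd r) p) ((case⊎ c f) p)
    fates (inr p) = fate (cFwd ξ (rFwd r) p) (f p) (b p)
    fates (inl p) = refl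

  module _ (at : A.E → At) where

    occN : ∀ X → Occ (mapFm at X) → A.E
    occN (atom e) tt = e
    occN (X ∨ Y) (inl p) = occN X p
    occN (X ∨ Y) (inr p) = occN Y p
    occN (X ∧ Y) (inl p) = occN X p
    occN (X ∧ Y) (inr p) = occN Y p

    linRule : ∀ {X Y} → Lin X Y → Rule bar (mapFm at X) (mapFm at Y)
    linRule sw = s
    linRule md = m
    linRule (ax→ e) = eq→ (bindEq (atom ∘ at) e)
    linRule (ax← e) = eq← (bindEq (atom ∘ at) e)

    eqTo-name : ∀ {X Y} (e : EqAx X Y) p → occN X p ≡ occN Y (eqTo (bindEq (atom ∘ at) e) p)
    eqTo-name ∨-comm (inl x) = refl
    eqTo-name ∨-comm (inr x) = refl
    eqTo-name ∧-comm (inl x) = refl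
    eqTo-name ∧-comm (inr x) = refl
    eqTo-name ∨-assoc (inl (inl x)) = refl
    eqTo-name ∨-assoc (inl (inr x)) = refl
    eqTo-name ∨-assoc (inr x) = refl
    eqTo-name ∨-unit (inl x) = refl
    eqTo-name ∧-assoc (inl (inl x)) = refl
    eqTo-name ∧-assoc (inl (inr x)) = refl
    eqTo-name ∧-assoc (inr x) = refl
    eqTo-name ∧-unit (inl x) = refl
    eqTo-name 𝔱𝔱 (inl ())
    eqTo-name 𝔱𝔱 (inr ())
    eqTo-name 𝔣𝔣 (inl ())
    eqTo-name 𝔣𝔣 (inr ())

    eqFrom-name : ∀ {X Y} (e : EqAx X Y) p → occN Y p ≡ occN X (eqFrom (bindEq (atom ∘ at) e) p)
    eqFrom-name {X} {Y} e p = sym (trans (eqTo-name {X} {Y} e (eqFrom (bindEq (atom ∘ at) e) p)) (cong (occN Y) (eqTo-From (bindEq (atom ∘ at) e) p)))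

    occ∨ : ∀ X Y p → occN (X ∨ Y) p ≡ case⊎ (occN X) (occN Y) p
    occ∨ X Y (inl p) = refl
    occ∨ X Y (inr p) = refl
    occ∧ : ∀ X Y p → occN (X ∧ Y) p ≡ case⊎ (occN X) (occN Y) p
    occ∧ X Y (inl p) = refl
    occ∧ X Y (inr p) = refl

    named-≗ʳ : ∀ {α β} (d : Deriv bar α β) {f g g'} → (∀ p → g p ≡ g' p) → (n : Named d f g) →
              Σ (Named d f g') λ n' → ∀ w → foldD {d = d} w n' ≡ foldD {d = d} w n
    named-≗ʳ done e n = (λ p → trans (n p) (e p)) , λ _ → refl
    named-≗ʳ (σ ▸ d) e (f1 , a , n) with named-≗ʳ d e n
    ... | (n' , k) = (f1 , a , n') , λ w → cong (foldStep σ w a +_) (k w)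

    Realized : ∀ {X Y} → N bar A at X Y → Set
    Realized {X} {Y} d = Σ (Deriv bar (mapFm at X) (mapFm at Y)) λ D →
      Σ (Named D (occN X) (occN Y)) λ n → ∀ w → foldD {d = D} w n ≡ fold w d

    private
      single : ∀ {α β} (r : Rule bar α β) (f : Occ α → A.E) (g : Occ β → A.E) (ν : RV r → A.V) →
        (∀ x → A.lab (ν x) ≡ rlab r x) → (∀ p → FateOK g ν (rFwd r p) (f p)) → (∀ x → IsPorts A.up (ν x) g) →
        Named (step hole r ▸ done) f g
      single r f g ν a b c = g , (ν , a , b , c) , λ p → refl

      2↔⊤⊎⊤ : (⊤ ⊎ ⊤) ↔ Fin 2
      2↔⊤⊎⊤ = mk↔ₛ′ (λ { (inl _) → # 0 ; (inr _) → # 1 }) (λ { zero → inl tt ; (suc zero) → inr tt })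
                (λ { zero → refl ; (suc zero) → refl }) (λ { (inl _) → refl ; (inr _) → refl })
      1↔⊤ : ⊤ ↔ Fin 1
      1↔⊤ = mk↔ₛ′ (λ _ → # 0) (λ _ → tt) (λ { zero → refl }) (λ _ → refl)
      0↔⊥ : ⊥ ↔ Fin 0
      0↔⊥ = mk↔ₛ′ (λ ()) (λ ()) (λ ()) (λ ())

      ports2 : ∀ {v} {o : Fin 2 → A.E} {g : ⊤ ⊎ ⊤ → A.E} → g (inl tt) ≡ o (# 0) → g (inr tt) ≡ o (# 1) →
               IsPorts A.up v o → IsPorts A.up v g
      ports2 p q P = ports-≗ (λ { (inl _) → p ; (inr _) → q }) (ports-∘ P 2↔⊤⊎⊤)

    realize : ∀ {X Y} (d : N bar A at X Y) → Realized d
    realize (eqN refl) = done , (λ _ → refl) , λ _ → refl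
    realize (lin {X} {Y} l) = step hole (linRule l) ▸ done , single (linRule l) (occN X) (occN Y) (ν l) (⊥-elim ∘ none l) (b l) (⊥-elim ∘ none l) , w0 l
      where
      none : ∀ {X Y} (l : Lin X Y) → ¬ RV (linRule l)
      none sw ()
      none md ()
      none (ax→ _) ()
      none (ax← _) ()
      ν : ∀ {X Y} (l : Lin X Y) → RV (linRule l) → A.V
      ν l x = ⊥-elim (none l x)
      b : ∀ {X Y} (l : Lin X Y) p → FateOK (occN Y) (ν l) (rFwd (linRule l) p) (occN X p)
      b sw (inl x) = refl
      b sw (inr (inl x)) = refl
      b sw (inr (inr x)) = refl
      b md (inl (inl x)) = refl
      b md (inl (inr x)) = refl
      b md (inr (inl x)) = refl
      b md (inr (inr x)) = refl
      b (ax→ e) p = eqTo-name e p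
      b (ax← e) p = eqFrom-name e p
      w0 : ∀ {X Y} (l : Lin X Y) → ∀ w → RVsum (linRule l) (w ∘ ν l) + 0 ≡ 0
      w0 sw w = refl
      w0 md w = refl
      w0 (ax→ _) w = refl
      w0 (ax← _) w = refl
    realize (c ⨾ d) with realize c | realize d
    ... | (C , n , p) | (D , n' , q) with append C D n n'
    ...   | (n1 , r) = C ▸▸ D , n1 , λ w → trans (r w) (cong₂ _+_ (p w) (q w))
    realize (_∨ᴺ_ {X} {X'} {Y} {Y'} c d) with realize c | realize d
    ... | (C , n , p) | (D , n' , q) with under-∨ₗ _ (occN Y) C n | under-∨ᵣ _ (occN X') D n'
    ...   | (C' , n1 , p') | (D' , n1' , q') with append C' D' n1 n1'
    ...     | (n2 , r) with named-≗ (C' ▸▸ D') (occ∨ X Y) n2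
    ...       | (n3 , r') with named-≗ʳ (C' ▸▸ D') (λ z → sym (occ∨ X' Y' z)) n3
    ...         | (n4 , r'') = C' ▸▸ D' , n4 , λ w →
      trans (r'' w) (trans (r' w) (trans (r w) (cong₂ _+_ (trans (p' w) (p w)) (trans (q' w) (q w)))))
    realize (_∧ᴺ_ {X} {X'} {Y} {Y'} c d) with realize c | realize d
    ... | (C , n , p) | (D , n' , q) with under-∧ₗ _ (occN Y) C n | under-∧ᵣ _ (occN X') D n'
    ...   | (C' , n1 , p') | (D' , n1' , q') with append C' D' n1 n1'
    ...     | (n2 , r) with named-≗ (C' ▸▸ D') (occ∧ X Y) n2
    ...       | (n3 , r') with named-≗ʳ (C' ▸▸ D') (λ z → sym (occ∧ X' Y' z)) n3
    ...         | (n4 , r'') = C' ▸▸ D' , n4 , λ w →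
      trans (r'' w) (trans (r' w) (trans (r w) (cong₂ _+_ (trans (p' w) (p w)) (trans (q' w) (q w)))))
    realize (vx ai↓ v i o l P Q a) = go _ a (occN (mapFm o (tgtF ai↓))) refl refl
      where
      go : ∀ b → b ≡ bar (at (o (# 0))) → (g : ⊤ ⊎ ⊤ → A.E) → g (inl tt) ≡ o (# 0) → g (inr tt) ≡ o (# 1) →
        Σ (Deriv bar 𝔱 (atom (at (o (# 0))) ∨ atom b)) λ D → Σ (Named D (occN 𝔱) g) λ n → ∀ w → foldD {d = D} w n ≡ w v
      go _ refl g p q = step hole (ai↓ (at (o (# 0)))) ▸ done , single (ai↓ (at (o (# 0)))) (occN 𝔱) g (λ _ → v) (λ _ → l) (λ ()) (λ _ → ports2 p q Q) ,
        λ w → ℕP.+-identityʳ (w v)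
    realize (vx ai↑ v i o l P Q a) = go _ a (occN (mapFm i (srcF ai↑))) refl refl
      where
      go : ∀ b → b ≡ bar (at (i (# 0))) → (g : ⊤ ⊎ ⊤ → A.E) → g (inl tt) ≡ i (# 0) → g (inr tt) ≡ i (# 1) →
        Σ (Deriv bar (atom (at (i (# 0))) ∧ atom b) 𝔣) λ D → Σ (Named D g (occN 𝔣)) λ n → ∀ w → foldD {d = D} w n ≡ w v
      go _ refl g p q = step hole (ai↑ (at (i (# 0)))) ▸ done , single (ai↑ (at (i (# 0)))) g (occN 𝔣) (λ _ → v) (λ _ → l)
        (λ { (inl _) → trans (cong A.dn p) (hit P _) ; (inr _) → trans (cong A.dn q) (hit P _) })
        (λ _ → ports-≗ (λ ()) (ports-∘ Q 0↔⊥)) , λ w → ℕP.+-identityʳ (w v)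
    realize (vx aw↓ v i o l P Q a) = step hole (aw↓ (at (o (# 0)))) ▸ done ,
      single (aw↓ (at (o (# 0)))) (occN 𝔣) (occN (mapFm o (tgtF aw↓))) (λ _ → v) (λ _ → l) (λ ()) (λ _ → ports-≗ (λ _ → refl) (ports-∘ Q 1↔⊤)) ,
      λ w → ℕP.+-identityʳ (w v)
    realize (vx aw↑ v i o l P Q a) = step hole (aw↑ (at (i (# 0)))) ▸ done ,
      single (aw↑ (at (i (# 0)))) (occN (mapFm i (srcF aw↑))) (occN 𝔱) (λ _ → v) (λ _ → l) (λ _ → hit P _) (λ _ → ports-≗ (λ ()) (ports-∘ Q 0↔⊥)) ,
      λ w → ℕP.+-identityʳ (w v)
    realize (vx ac↓ v i o l P Q (a , b)) = go _ _ a b (occN (mapFm i (srcF ac↓))) refl refl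
      where
      go : ∀ x y → x ≡ at (o (# 0)) → y ≡ at (o (# 0)) → (g : ⊤ ⊎ ⊤ → A.E) → g (inl tt) ≡ i (# 0) → g (inr tt) ≡ i (# 1) →
        Σ (Deriv bar (atom x ∨ atom y) (atom (at (o (# 0))))) λ D →
        Σ (Named D g (occN (atom (o (# 0))))) λ n → ∀ w → foldD {d = D} w n ≡ w v
      go _ _ refl refl g p q = step hole (ac↓ (at (o (# 0)))) ▸ done , single (ac↓ (at (o (# 0)))) g (occN (atom (o (# 0)))) (λ _ → v) (λ _ → l)
        (λ { (inl _) → trans (cong A.dn p) (hit P _) ; (inr _) → trans (cong A.dn q) (hit P _) })
        (λ _ → ports-≗ (λ _ → refl) (ports-∘ Q 1↔⊤)) , λ w → ℕP.+-identityʳ (w v)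
    realize (vx ac↑ v i o l P Q (a , b)) = go _ _ a b (occN (mapFm o (tgtF ac↑))) refl refl
      where
      go : ∀ x y → x ≡ at (i (# 0)) → y ≡ at (i (# 0)) → (g : ⊤ ⊎ ⊤ → A.E) → g (inl tt) ≡ o (# 0) → g (inr tt) ≡ o (# 1) →
        Σ (Deriv bar (atom (at (i (# 0)))) (atom x ∧ atom y)) λ D →
        Σ (Named D (occN (atom (i (# 0)))) g) λ n → ∀ w → foldD {d = D} w n ≡ w v
      go _ _ refl refl g p q = step hole (ac↑ (at (i (# 0)))) ▸ done , single (ac↑ (at (i (# 0)))) (occN (atom (i (# 0)))) g (λ _ → v) (λ _ → l)
        (λ _ → hit P _) (λ _ → ports2 p q Q) , λ w → ℕP.+-identityʳ (w v)

  vmap : ∀ {α β} {d : Deriv bar α β} {f g} → Named d f g → DV d → A.V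
  vmap {d = step ξ r ▸ d} (_ , (ν , _) , n) (inl x) = ν x
  vmap {d = step ξ r ▸ d} (_ , _ , n) (inr x) = vmap {d = d} n x

  emap : ∀ {α β} {d : Deriv bar α β} {f g} → Named d f g → Inner d → A.E
  emap {d = step ξ r ▸ d} (f' , _ , n) (inl (_ , q)) = f' (cIn ξ q)
  emap {d = step ξ r ▸ d} (_ , _ , n) (inr x) = emap {d = d} n x

  vmap-lab : ∀ {α β} (d : Deriv bar α β) {f g} (n : Named d f g) x → A.lab (vmap {d = d} n x) ≡ dlab d x
  vmap-lab (step ξ r ▸ d) (_ , (ν , a , _) , n) (inl x) = a x
  vmap-lab (step ξ r ▸ d) (_ , _ , n) (inr x) = vmap-lab d n x

  emap-up : ∀ {α β} (d : Deriv bar α β) {f g} (n : Named d f g) i → A.up (emap {d = d} n i) ≡ inr (vmap {d = d} n (upInner d i))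
  emap-up (step ξ r ▸ d) (_ , (ν , _ , _ , c) , n) (inl (x , q)) = hit (c x) q
  emap-up (step ξ r ▸ d) (_ , _ , n) (inr i) = emap-up d n i

  emap-onto : ∀ {α β} (d : Deriv bar α β) {f g} (n : Named d f g) x e → A.up e ≡ inr (vmap {d = d} n x) → Σ (Inner d) λ i → emap {d = d} n i ≡ e
  emap-onto (step ξ r ▸ d) (_ , (ν , _ , _ , c) , n) (inl x) e p = let (q , k) = all (c x) e p in inl (x , q) , k
  emap-onto (step ξ r ▸ d) (_ , _ , n) (inr x) e p = let (i , k) = emap-onto d n x e p in inr i , k

  module _ (_≟_ : DecEq A.V) where

    vmap-find : ∀ {α β} (d : Deriv bar α β) {f g} (n : Named d f g) v → foldD {d = d} (δ _≟_ v) n ≢ 0 → Σ (DV d) λ x → vmap {d = d} n x ≡ v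
    vmap-find done n v k = ⊥-elim (k refl)
    vmap-find (step ξ r ▸ d) (f' , (ν , _) , n) v k with RVsum r (δ _≟_ v ∘ ν) ℕP.≟ 0
    ... | yes p = let (x , q) = vmap-find d n v (λ z → k (cong₂ _+_ p z)) in inr x , q
    ... | no p with RVsum-≢0 r (δ _≟_ v ∘ ν) p
    ...   | (x , q) with v ≟ ν x
    ...     | yes e = inl x , sym e
    ...     | no _ = ⊥-elim (q refl)

    vmap-≥1 : ∀ {α β} (d : Deriv bar α β) {f g} (n : Named d f g) x → 1 ≤ foldD {d = d} (δ _≟_ (vmap {d = d} n x)) n
    vmap-≥1 (step ξ r ▸ d) (f' , (ν , _) , n) (inl x) =
      ℕP.≤-trans (ℕP.≤-reflexive (sym (δ-yes _≟_ refl))) (ℕP.≤-trans (ℕP.≤-reflexive (sym (RVsum-at r (δ _≟_ (ν x) ∘ ν) x))) (ℕP.m≤m+n _ _))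
    vmap-≥1 (step ξ r ▸ d) (f' , (ν , _) , n) (inr x) = ℕP.≤-trans (vmap-≥1 d n x) (ℕP.m≤n+m _ _)

    vmap-inj : ∀ {α β} (d : Deriv bar α β) {f g} (n : Named d f g) → (∀ v → foldD {d = d} (δ _≟_ v) n ≤ 1) →
      ∀ x y → vmap {d = d} n x ≡ vmap {d = d} n y → x ≡ y
    vmap-inj (step ξ r ▸ d) n k (inl x) (inl y) e = cong inl (RV-prop r x y)
    vmap-inj (step ξ r ▸ d) (f' , (ν , _) , n) k (inl x) (inr y) e = ⊥-elim (ℕP.<⇒≱ (ℕP.≤-refl {2}) (ℕP.≤-trans (ℕP.+-mono-≤
      (ℕP.≤-trans (ℕP.≤-reflexive (sym (δ-yes _≟_ refl))) (ℕP.≤-reflexive (sym (RVsum-at r (δ _≟_ (ν x) ∘ ν) x))))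
      (subst (λ z → 1 ≤ foldD {d = d} (δ _≟_ z) n) (sym e) (vmap-≥1 d n y))) (k (ν x))))
    vmap-inj (step ξ r ▸ d) n k (inr x) (inl y) e = sym (vmap-inj (step ξ r ▸ d) n k (inl y) (inr x) (sym e))
    vmap-inj (step ξ r ▸ d) (_ , (ν , _) , n) k (inr x) (inr y) e = cong inr (vmap-inj d n (λ v → ℕP.≤-trans (ℕP.m≤n+m _ _) (k v)) x y e)

  emap-inj : ∀ {α β} (d : Deriv bar α β) {f g} (n : Named d f g) → (∀ x y → vmap {d = d} n x ≡ vmap {d = d} n y → x ≡ y) →
    ∀ i j → emap {d = d} n i ≡ emap {d = d} n j → i ≡ j
  emap-inj (step ξ r ▸ d) (f' , (ν , _ , _ , c) , n) k (inl (x , q)) (inl (y , q')) e with RV-prop r x y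
  ... | refl = cong (λ z → inl (x , z)) (inj (c x) e)
  emap-inj (step ξ r ▸ d) n0@(f' , (ν , _ , _ , c) , n) k (inl (x , q)) (inr j) e
    with () ← k (inl x) (inr (upInner d j)) (inr-inj (trans (sym (hit (c x) q)) (trans (cong A.up e) (emap-up d n j))))
  emap-inj (step ξ r ▸ d) n0@(f' , (ν , _ , _ , c) , n) k (inr i) (inl (x , q)) e
    with () ← k (inl x) (inr (upInner d i)) (inr-inj (trans (sym (hit (c x) q)) (trans (cong A.up (sym e)) (emap-up d n i))))
  emap-inj (step ξ r ▸ d) (f' , _ , n) k (inr i) (inr j) e =
    cong inr (emap-inj d n (λ x y p → inr-inj (k (inr x) (inr y) p)) i j e)

module _ {At : Set} {bar : At → At} {U0 : Set} {β : Fm At} {A : Flow U0 (Occ β)} where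
  open Realize bar A
  private
    module A = Flow A

  dnTop-named : ∀ {α} (d : Deriv bar α β) {f g} (n : Named d f g) → (∀ q → A.dn (g q) ≡ inl q) →
    ∀ p → A.dn (f p) ≡ map₂ (vmap {d = d} n) (dnTop d p)
  dnTop-named done n e p = trans (cong A.dn (n p)) (e p)
  dnTop-named (step ξ {α'} {β'} r ▸ d) {f} (f' , (ν , _ , b , _) , n) e p = go (cFwd ξ {α'} {β'} (rFwd r) p) (b p)
    where
    go : ∀ z → FateOK f' ν z (f p) →
      A.dn (f p) ≡ map₂ (vmap {d = step ξ r ▸ d} (f' , (ν , _ , b , _) , n)) (case⊎ (λ q → map₂ inr (dnTop d q)) (λ v → inr (inl v)) z)
    go (inl q) refl' = trans (cong A.dn refl') (trans (dnTop-named d n e q) (sym (map2-∘ (dnTop d q))))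
    go (inr x) h = h

  dnInner-named : ∀ {α} (d : Deriv bar α β) {f g} (n : Named d f g) → (∀ q → A.dn (g q) ≡ inl q) →
    ∀ i → A.dn (emap {d = d} n i) ≡ map₂ (vmap {d = d} n) (dnInner d i)
  dnInner-named (step ξ r ▸ d) (f' , _ , n) e (inl (x , q)) = trans (dnTop-named d n e (cIn ξ q)) (sym (map2-∘ (dnTop d (cIn ξ q))))
  dnInner-named (step ξ r ▸ d) (f' , _ , n) e (inr i) = trans (dnInner-named d n e i) (sym (map2-∘ (dnInner d i)))

named⇒iso : ∀ {At : Set} {bar : At → At} {α β : Fm At} {A : Flow (Occ α) (Occ β)} (let open Realize bar A) (let module A = Flow A)
  (d : Deriv bar α β) {f g} (n : Named d f g) (_≟_ : DecEq A.V) →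
  (∀ u → A.up (f u) ≡ inl u) → (∀ e u → A.up e ≡ inl u → e ≡ f u) → (∀ l → A.dn (g l) ≡ inl l) →
  (∀ v → foldD {d = d} (δ _≟_ v) n ≡ 1) → FlowIso (flowOf d) A
named⇒iso {bar = bar} {α} {β} {A} d {f} {g} n _≟_ fu fun gd cnt = record
  { vb = mk↔ₛ′ (vmap {d = d} n) (λ v → fst (find v)) (λ v → snd (find v)) (λ x → vinj _ x (snd (find (vmap {d = d} n x))))
  ; eb = mk↔ₛ′ eto (λ e → fst (eonto e)) (λ e → snd (eonto e)) (λ x → einj _ x (snd (eonto (eto x))))
  ; lab-iso = λ v → sym (vmap-lab d n v)
  ; up-iso = λ { (inl u) → fu u ; (inr i) → emap-up d n i }
  ; dn-iso = λ { (inl u) → dnTop-named d n gd u ; (inr i) → dnInner-named d n gd i } }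
  where
  open Realize bar A
  module A = Flow A
  find : ∀ v → Σ (DV d) λ x → vmap {d = d} n x ≡ v
  find v = vmap-find _≟_ d n v (λ z → ℕP.1+n≢0 (trans (sym (cnt v)) z))
  vinj : ∀ x y → vmap {d = d} n x ≡ vmap {d = d} n y → x ≡ y
  vinj = vmap-inj _≟_ d n (λ v → ℕP.≤-reflexive (cnt v))
  eto : Occ α ⊎ Inner d → A.E
  eto = case⊎ f (emap {d = d} n)
  eonto : ∀ e → Σ (Occ α ⊎ Inner d) λ x → eto x ≡ e
  eonto e with A.up e in eq
  ... | inl u = inl u , sym (fun e u eq)
  ... | inr v with find v
  ...   | (x , refl) = let (i , p) = emap-onto d n x e eq in inr i , p
  einj : ∀ x y → eto x ≡ eto y → x ≡ y
  einj (inl u) (inl u') p = cong inl (inl-inj (trans (sym (fu u)) (trans (cong A.up p) (fu u'))))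
  einj (inl u) (inr j) p = ⊥-elim (inl≢inr (trans (sym (fu u)) (trans (cong A.up p) (emap-up d n j))))
  einj (inr i) (inl u) p = ⊥-elim (inl≢inr (trans (sym (fu u)) (trans (cong A.up (sym p)) (emap-up d n i))))
  einj (inr i) (inr j) p = cong inr (emap-inj d n vinj i j p)

occFm : ∀ {At : Set} (α : Fm At) → Fm (Occ α)
occFm α = name α id

module _ {At : Set} {bar : At → At} {U0 L0 : Set} {A : Flow U0 L0} where
  open Realize bar A

  retype : ∀ {α α' β β' : Fm At} (p : α ≡ α') (q : β ≡ β') (d : Deriv bar α β) {f g} (n : Named d f g) →
    Σ (Deriv bar α' β') λ d' → Σ (Named d' (f ∘ subst Occ (sym p)) (g ∘ subst Occ (sym q))) λ n' → ∀ w → foldD {d = d'} w n' ≡ foldD {d = d} w n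
  retype refl refl d n = d , n , λ _ → refl

module _ {At : Set} {E : Set} (at : E → At) where

  mapFm-name : ∀ (α : Fm At) (f : Occ α → E) → (∀ p → at (f p) ≡ atomAt α p) → mapFm at (name α f) ≡ α
  mapFm-name 𝔣 f h = refl
  mapFm-name 𝔱 f h = refl
  mapFm-name (atom a) f h = cong atom (h tt)
  mapFm-name (α ∨ β) f h = cong₂ _∨_ (mapFm-name α _ (h ∘ inl)) (mapFm-name β _ (h ∘ inr))
  mapFm-name (α ∧ β) f h = cong₂ _∧_ (mapFm-name α _ (h ∘ inl)) (mapFm-name β _ (h ∘ inr))

  private
    subst-∨ : ∀ {α α' β β' : Fm At} (p : α ≡ α') (q : β ≡ β') z →
      subst Occ (sym (cong₂ _∨_ p q)) z ≡ Data.Sum.map (subst Occ (sym p)) (subst Occ (sym q)) z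
    subst-∨ refl refl (inl _) = refl
    subst-∨ refl refl (inr _) = refl
    subst-∧ : ∀ {α α' β β' : Fm At} (p : α ≡ α') (q : β ≡ β') z →
      subst Occ (sym (cong₂ _∧_ p q)) z ≡ Data.Sum.map (subst Occ (sym p)) (subst Occ (sym q)) z
    subst-∧ refl refl (inl _) = refl
    subst-∧ refl refl (inr _) = refl

  open Realize

  occN-name : ∀ {bar : At → At} {U0 L0 V : Set} {lb : V → Label} {up : E → U0 ⊎ V} {dn : E → L0 ⊎ V} →
    let A = record { V = V ; E = E ; lab = lb ; up = up ; dn = dn } in
    ∀ (α : Fm At) (f : Occ α → E) (h : ∀ p → at (f p) ≡ atomAt α p) p →
    occN bar A at (name α f) (subst Occ (sym (mapFm-name α f h)) p) ≡ f p
  occN-name (atom a) f h tt = refl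
  occN-name {bar} {lb = lb} {up} {dn} (α ∨ β) f h p rewrite subst-∨ (mapFm-name α _ (h ∘ inl)) (mapFm-name β _ (h ∘ inr)) p with p
  ... | inl q = occN-name {bar} {lb = lb} {up} {dn} α _ (h ∘ inl) q
  ... | inr q = occN-name {bar} {lb = lb} {up} {dn} β _ (h ∘ inr) q
  occN-name {bar} {lb = lb} {up} {dn} (α ∧ β) f h p rewrite subst-∧ (mapFm-name α _ (h ∘ inl)) (mapFm-name β _ (h ∘ inr)) p with p
  ... | inl q = occN-name {bar} {lb = lb} {up} {dn} α _ (h ∘ inl) q
  ... | inr q = occN-name {bar} {lb = lb} {up} {dn} β _ (h ∘ inr) q

-- A derivation named in A, using every vertex exactly once, is a derivation whose flow is A.
realizes : ∀ {At : Set} {bar : At → At} {α β : Fm At} {A : Flow (Occ α) (Occ β)} →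
  NStruct bar A (atomAt α) (atomAt β) (occFm α) (occFm β) → Σ (Deriv bar α β) λ d → FlowIso (flowOf d) A
realizes {bar = bar} {α} {β} {A} S with Realize.realize bar A (NStruct.at S) (NStruct.der S)
... | (d , n , k) with retype {A = A} (trans (cong (mapFm at) (map-name topE α id)) (mapFm-name at α topE at-top))
                              (trans (cong (mapFm at) (map-name botE β id)) (mapFm-name at β botE at-bot)) d n
  where open NStruct S
... | (d' , n' , k') = d' , named⇒iso d' n' _≟V_
    (λ u → trans (cong A.up (tops u)) (top-up u)) (λ e u p → trans (top-un e u p) (sym (tops u)))
    (λ l → trans (cong A.dn (bots l)) (bot-dn l)) (λ v → trans (k' _) (trans (k _) (full v)))
  where
  open NStruct S
  module A = Flow A
  occs : ∀ {γ} (X : Fm (Occ γ)) (t : Occ γ → A.E) (p : mapFm t X ≡ name γ t) (h : ∀ z → at (t z) ≡ atomAt γ z) z →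
    Realize.occN bar A at (mapFm t X) (subst Occ (sym (trans (cong (mapFm at) p) (mapFm-name at γ t h))) z) ≡ t z
  occs {γ} X t p h z = go (mapFm t X) p
    where
    go : ∀ Y (p : Y ≡ name γ t) → Realize.occN bar A at Y (subst Occ (sym (trans (cong (mapFm at) p) (mapFm-name at γ t h))) z) ≡ t z
    go _ refl = occN-name at {bar} {lb = A.lab} {A.up} {A.dn} γ t h z
  tops : ∀ u → _ ≡ topE u
  tops = occs (occFm α) topE (map-name topE α id) at-top
  bots : ∀ l → _ ≡ botE l
  bots = occs (occFm β) botE (map-name botE β id) at-bot

atom-in : ∀ {At : Set} (ξ : Ctx At) {α} (q : Occ α) → atomAt (ξ ⟨ α ⟩) (cIn ξ q) ≡ atomAt α q
atom-in hole q = refl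
atom-in (ξ ∨ₗ γ) q = atom-in ξ q
atom-in (γ ∨ᵣ ξ) q = atom-in ξ q
atom-in (ξ ∧ₗ γ) q = atom-in ξ q
atom-in (γ ∧ᵣ ξ) q = atom-in ξ q

module _ {At : Set} {bar : At → At} {E : Set} where

  newName : ∀ (ξ : Ctx At) {α β} → (Occ (ξ ⟨ α ⟩) → E) → (Occ β → E) → Occ (ξ ⟨ β ⟩) → E
  newName hole f g q = g q
  newName (ξ ∨ₗ γ) f g (inl q) = newName ξ (f ∘ inl) g q
  newName (ξ ∨ₗ γ) f g (inr q) = f (inr q)
  newName (γ ∨ᵣ ξ) f g (inl q) = f (inl q)
  newName (γ ∨ᵣ ξ) f g (inr q) = newName ξ (f ∘ inr) g q
  newName (ξ ∧ₗ γ) f g (inl q) = newName ξ (f ∘ inl) g q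
  newName (ξ ∧ₗ γ) f g (inr q) = f (inr q)
  newName (γ ∧ᵣ ξ) f g (inl q) = f (inl q)
  newName (γ ∧ᵣ ξ) f g (inr q) = newName ξ (f ∘ inr) g q

  ruleName : ∀ {α β} (r : Rule bar α β) → (Occ α → E) → (RNew r → E) → Occ β → E
  ruleName (ai↓ a) f g q = g (tt , q)
  ruleName (aw↓ a) f g q = g (tt , q)
  ruleName (ac↓ a) f g q = g (tt , q)
  ruleName (ai↑ a) f g q = g (tt , q)
  ruleName (aw↑ a) f g q = g (tt , q)
  ruleName (ac↑ a) f g q = g (tt , q)
  ruleName s f g (inl (inl x)) = f (inl x)
  ruleName s f g (inl (inr x)) = f (inr (inl x))
  ruleName s f g (inr x) = f (inr (inr x))
  ruleName m f g (inl (inl x)) = f (inl (inl x))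
  ruleName m f g (inl (inr x)) = f (inr (inl x))
  ruleName m f g (inr (inl x)) = f (inl (inr x))
  ruleName m f g (inr (inr x)) = f (inr (inr x))
  ruleName (eq→ e) f g q = f (eqFrom e q)
  ruleName (eq← e) f g q = f (eqTo e q)

  eqTo-atom : ∀ {α β : Fm At} (e : EqAx α β) p → atomAt β (eqTo e p) ≡ atomAt α p
  eqTo-atom ∨-comm (inl x) = refl
  eqTo-atom ∨-comm (inr x) = refl
  eqTo-atom ∧-comm (inl x) = refl
  eqTo-atom ∧-comm (inr x) = refl
  eqTo-atom ∨-assoc (inl (inl x)) = refl
  eqTo-atom ∨-assoc (inl (inr x)) = refl
  eqTo-atom ∨-assoc (inr x) = refl
  eqTo-atom ∨-unit (inl x) = refl
  eqTo-atom ∧-assoc (inl (inl x)) = refl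
  eqTo-atom ∧-assoc (inl (inr x)) = refl
  eqTo-atom ∧-assoc (inr x) = refl
  eqTo-atom ∧-unit (inl x) = refl
  eqTo-atom 𝔱𝔱 (inl ())
  eqTo-atom 𝔱𝔱 (inr ())
  eqTo-atom 𝔣𝔣 (inl ())
  eqTo-atom 𝔣𝔣 (inr ())

  rView : ∀ {α β} (r : Rule bar α β) (f : Occ α → E) (g : RNew r → E) q →
    (Σ (Occ α) λ p → rFwd r p ≡ inl q × ruleName r f g q ≡ f p) ⊎ (Σ (RNew r) λ n → snd n ≡ q × ruleName r f g q ≡ g n)
  rView (ai↓ a) f g q = inr ((tt , q) , refl , refl)
  rView (aw↓ a) f g q = inr ((tt , q) , refl , refl)
  rView (ac↓ a) f g q = inr ((tt , q) , refl , refl)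
  rView (ai↑ a) f g q = inr ((tt , q) , refl , refl)
  rView (aw↑ a) f g q = inr ((tt , q) , refl , refl)
  rView (ac↑ a) f g q = inr ((tt , q) , refl , refl)
  rView s f g (inl (inl x)) = inl (_ , refl , refl)
  rView s f g (inl (inr x)) = inl (inr (inl x) , refl , refl)
  rView s f g (inr x) = inl (inr (inr x) , refl , refl)
  rView m f g (inl (inl x)) = inl (inl (inl x) , refl , refl)
  rView m f g (inl (inr x)) = inl (inr (inl x) , refl , refl)
  rView m f g (inr (inl x)) = inl (inl (inr x) , refl , refl)
  rView m f g (inr (inr x)) = inl (inr (inr x) , refl , refl)
  rView (eq→ e) f g q = inl (eqFrom e q , cong inl (eqTo-From e q) , refl)
  rView (eq← e) f g q = inl (eqTo e q , cong inl (eqFrom-To e q) , refl)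

  rFwd-name : ∀ {α β} (r : Rule bar α β) (f : Occ α → E) (g : RNew r → E) p q → rFwd r p ≡ inl q → ruleName r f g q ≡ f p
  rFwd-name s f g (inl x) _ refl = refl
  rFwd-name s f g (inr (inl x)) _ refl = refl
  rFwd-name s f g (inr (inr x)) _ refl = refl
  rFwd-name m f g (inl (inl x)) _ refl = refl
  rFwd-name m f g (inl (inr x)) _ refl = refl
  rFwd-name m f g (inr (inl x)) _ refl = refl
  rFwd-name m f g (inr (inr x)) _ refl = refl
  rFwd-name (eq→ e) f g p _ refl = cong f (eqFrom-To e p)
  rFwd-name (eq← e) f g p _ refl = cong f (eqTo-From e p)

  rFwd-atom : ∀ {α β} (r : Rule bar α β) p q → rFwd r p ≡ inl q → atomAt β q ≡ atomAt α p
  rFwd-atom s (inl x) _ refl = refl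
  rFwd-atom s (inr (inl x)) _ refl = refl
  rFwd-atom s (inr (inr x)) _ refl = refl
  rFwd-atom m (inl (inl x)) _ refl = refl
  rFwd-atom m (inl (inr x)) _ refl = refl
  rFwd-atom m (inr (inl x)) _ refl = refl
  rFwd-atom m (inr (inr x)) _ refl = refl
  rFwd-atom (eq→ e) p _ refl = eqTo-atom e p
  rFwd-atom (eq← e) p _ refl = trans (sym (eqTo-atom e (eqFrom e p))) (cong (atomAt _) (eqTo-From e p))

  rFwd-dead : ∀ {α β} (r : Rule bar α β) (x : RV r) p → rFwd r p ≡ inr x
  rFwd-dead (ai↓ a) x p = refl
  rFwd-dead (aw↓ a) x p = refl
  rFwd-dead (ac↓ a) x p = refl
  rFwd-dead (ai↑ a) x p = refl
  rFwd-dead (aw↑ a) x p = refl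
  rFwd-dead (ac↑ a) x p = refl

  rNew-name : ∀ {α β} (r : Rule bar α β) (f : Occ α → E) (g : RNew r → E) n → ruleName r f g (snd n) ≡ g n
  rNew-name (ai↓ a) f g n = refl
  rNew-name (aw↓ a) f g n = refl
  rNew-name (ac↓ a) f g n = refl
  rNew-name (ai↑ a) f g n = refl
  rNew-name (aw↑ a) f g n = refl
  rNew-name (ac↑ a) f g n = refl

  module _ {α β : Fm At} {D : Set} (F : Occ α → Occ β ⊎ D) where

    ctxFwd-in : ∀ ξ p → cFwd ξ F (cIn ξ p) ≡ map₁ (cIn ξ) (F p)
    ctxFwd-in hole p with F p
    ... | inl _ = refl
    ... | inr _ = refl
    ctxFwd-in (ξ ∨ₗ γ) p rewrite ctxFwd-in ξ p with F p
    ... | inl _ = refl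
    ... | inr _ = refl
    ctxFwd-in (γ ∨ᵣ ξ) p rewrite ctxFwd-in ξ p with F p
    ... | inl _ = refl
    ... | inr _ = refl
    ctxFwd-in (ξ ∧ₗ γ) p rewrite ctxFwd-in ξ p with F p
    ... | inl _ = refl
    ... | inr _ = refl
    ctxFwd-in (γ ∧ᵣ ξ) p rewrite ctxFwd-in ξ p with F p
    ... | inl _ = refl
    ... | inr _ = refl

    ctxCase : ∀ ξ p → (Σ (Occ α) λ p0 → p ≡ cIn ξ p0) ⊎ (Σ (Occ (ξ ⟨ β ⟩)) λ q → cFwd ξ F p ≡ inl q ×
      atomAt (ξ ⟨ β ⟩) q ≡ atomAt (ξ ⟨ α ⟩) p × (∀ (f : Occ (ξ ⟨ α ⟩) → E) g → newName ξ f g q ≡ f p))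
    ctxCase hole p = inl (p , refl)
    ctxCase (ξ ∨ₗ γ) (inr p) = inr (inr p , refl , refl , λ _ _ → refl)
    ctxCase (ξ ∨ₗ γ) (inl p) with ctxCase ξ p
    ... | inl (p0 , e) = inl (p0 , cong inl e)
    ... | inr (q , e , a , n) = inr (inl q , cong (map₁ inl) e , a , λ f → n (f ∘ inl))
    ctxCase (γ ∨ᵣ ξ) (inl p) = inr (inl p , refl , refl , λ _ _ → refl)
    ctxCase (γ ∨ᵣ ξ) (inr p) with ctxCase ξ p
    ... | inl (p0 , e) = inl (p0 , cong inr e)
    ... | inr (q , e , a , n) = inr (inr q , cong (map₁ inr) e , a , λ f → n (f ∘ inr))
    ctxCase (ξ ∧ₗ γ) (inr p) = inr (inr p , refl , refl , λ _ _ → refl)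
    ctxCase (ξ ∧ₗ γ) (inl p) with ctxCase ξ p
    ... | inl (p0 , e) = inl (p0 , cong inl e)
    ... | inr (q , e , a , n) = inr (inl q , cong (map₁ inl) e , a , λ f → n (f ∘ inl))
    ctxCase (γ ∧ᵣ ξ) (inl p) = inr (inl p , refl , refl , λ _ _ → refl)
    ctxCase (γ ∧ᵣ ξ) (inr p) with ctxCase ξ p
    ... | inl (p0 , e) = inl (p0 , cong inr e)
    ... | inr (q , e , a , n) = inr (inr q , cong (map₁ inr) e , a , λ f → n (f ∘ inr))

    newName-in : ∀ ξ (f : Occ (ξ ⟨ α ⟩) → E) (g : Occ β → E) q → newName ξ {α} {β} f g (cIn ξ q) ≡ g q
    newName-in hole f g q = refl
    newName-in (ξ ∨ₗ γ) f g q = newName-in ξ (f ∘ inl) g q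
    newName-in (γ ∨ᵣ ξ) f g q = newName-in ξ (f ∘ inr) g q
    newName-in (ξ ∧ₗ γ) f g q = newName-in ξ (f ∘ inl) g q
    newName-in (γ ∧ᵣ ξ) f g q = newName-in ξ (f ∘ inr) g q

    private
      in-hole : ∀ ξ {p0 q} → cFwd ξ F (cIn ξ p0) ≡ inl q → Σ (Occ β) λ q0 → q ≡ cIn ξ q0 × F p0 ≡ inl q0
      in-hole ξ {p0} e with F p0 | trans (sym (ctxFwd-in ξ p0)) e
      ... | inl q0 | refl = q0 , refl , refl

    ctxFwd-name : ∀ ξ (f : Occ (ξ ⟨ α ⟩) → E) g → (∀ p q → F p ≡ inl q → g q ≡ f (cIn ξ p)) →
      ∀ p q → cFwd ξ F p ≡ inl q → newName ξ f g q ≡ f p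
    ctxFwd-name ξ f g h p q e with ctxCase ξ p
    ... | inr (q' , e' , _ , n) with trans (sym e) e'
    ...   | refl = n f g
    ctxFwd-name ξ f g h _ q e | inl (p0 , refl) with in-hole ξ e
    ... | (q0 , refl , e0) = trans (newName-in ξ f g q0) (h p0 q0 e0)

    ctxFwd-atom : ∀ ξ → (∀ p q → F p ≡ inl q → atomAt β q ≡ atomAt α p) →
      ∀ p q → cFwd ξ F p ≡ inl q → atomAt (ξ ⟨ β ⟩) q ≡ atomAt (ξ ⟨ α ⟩) p
    ctxFwd-atom ξ h p q e with ctxCase ξ p
    ... | inr (q' , e' , a , _) with trans (sym e) e'
    ...   | refl = a
    ctxFwd-atom ξ h _ q e | inl (p0 , refl) with in-hole ξ e
    ... | (q0 , refl , e0) = trans (atom-in ξ q0) (trans (h p0 q0 e0) (sym (atom-in ξ p0)))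

    ctxFwd-dead : ∀ ξ p x → cFwd ξ F p ≡ inr x → Σ (Occ α) λ p0 → p ≡ cIn ξ p0
    ctxFwd-dead ξ p x e with ctxCase ξ p
    ... | inl q = q
    ... | inr (_ , e' , _) with () ← trans (sym e) e'

    ctxView : ∀ ξ (f : Occ (ξ ⟨ α ⟩) → E) g q →
      (Σ (Occ (ξ ⟨ α ⟩)) λ p → cFwd ξ F p ≡ inl q × newName ξ f g q ≡ f p) ⊎ (Σ (Occ β) λ q0 → q ≡ cIn ξ q0 × newName ξ f g q ≡ g q0)
    ctxView hole f g q = inr (q , refl , refl)
    ctxView (ξ ∨ₗ γ) f g (inr q) = inl (inr q , refl , refl)
    ctxView (ξ ∨ₗ γ) f g (inl q) with ctxView ξ (f ∘ inl) g q
    ... | inl (p , a , b) = inl (inl p , cong (map₁ inl) a , b)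
    ... | inr (q0 , a , b) = inr (q0 , cong inl a , b)
    ctxView (γ ∨ᵣ ξ) f g (inl q) = inl (inl q , refl , refl)
    ctxView (γ ∨ᵣ ξ) f g (inr q) with ctxView ξ (f ∘ inr) g q
    ... | inl (p , a , b) = inl (inr p , cong (map₁ inr) a , b)
    ... | inr (q0 , a , b) = inr (q0 , cong inr a , b)
    ctxView (ξ ∧ₗ γ) f g (inr q) = inl (inr q , refl , refl)
    ctxView (ξ ∧ₗ γ) f g (inl q) with ctxView ξ (f ∘ inl) g q
    ... | inl (p , a , b) = inl (inl p , cong (map₁ inl) a , b)
    ... | inr (q0 , a , b) = inr (q0 , cong inl a , b)
    ctxView (γ ∧ᵣ ξ) f g (inl q) = inl (inl q , refl , refl)
    ctxView (γ ∧ᵣ ξ) f g (inr q) with ctxView ξ (f ∘ inr) g q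
    ... | inl (p , a , b) = inl (inr p , cong (map₁ inr) a , b)
    ... | inr (q0 , a , b) = inr (q0 , cong inr a , b)

  cIn-inj : ∀ (ξ : Ctx At) {β} {p q : Occ β} → cIn ξ p ≡ cIn ξ q → p ≡ q
  cIn-inj hole e = e
  cIn-inj (ξ ∨ₗ γ) e = cIn-inj ξ (inl-inj e)
  cIn-inj (γ ∨ᵣ ξ) e = cIn-inj ξ (inr-inj e)
  cIn-inj (ξ ∧ₗ γ) e = cIn-inj ξ (inl-inj e)
  cIn-inj (γ ∧ᵣ ξ) e = cIn-inj ξ (inr-inj e)

  stepName : ∀ {α β} (σ : Step bar α β) → (Occ α → E) → (SNew σ → E) → Occ β → E
  stepName (step ξ r) f g = newName ξ f (ruleName r (f ∘ cIn ξ) g)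

  stepName-fwd : ∀ {α β} (σ : Step bar α β) (f : Occ α → E) (g : SNew σ → E) p q → sFwd σ p ≡ inl q → stepName σ f g q ≡ f p
  stepName-fwd (step ξ r) f g = ctxFwd-name (rFwd r) ξ f _ (rFwd-name r (f ∘ cIn ξ) g)

  stepName-new : ∀ {α β} (σ : Step bar α β) (f : Occ α → E) (g : SNew σ → E) n → stepName σ f g (sNewOcc σ n) ≡ g n
  stepName-new (step ξ r) f g n = trans (newName-in (rFwd r) ξ f _ (snd n)) (rNew-name r (f ∘ cIn ξ) g n)

  stepView : ∀ {α β} (σ : Step bar α β) (f : Occ α → E) (g : SNew σ → E) q →
    (Σ (Occ α) λ p → sFwd σ p ≡ inl q × stepName σ f g q ≡ f p) ⊎ (Σ (SNew σ) λ n → sNewOcc σ n ≡ q × stepName σ f g q ≡ g n)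
  stepView (step ξ r) f g q with ctxView (rFwd r) ξ f (ruleName r (f ∘ cIn ξ) g) q
  ... | inl x = inl x
  ... | inr (q0 , a , b) with rView r (f ∘ cIn ξ) g q0
  ...   | inl (p0 , c , d) = inl (cIn ξ p0 , trans (ctxFwd-in (rFwd r) ξ p0) (trans (cong (map₁ (cIn ξ)) c) (cong inl (sym a))) , trans b d)
  ...   | inr (n , c , d) = inr (n , trans (cong (cIn ξ) c) (sym a) , trans b d)

  stepAtom : ∀ {α β} (σ : Step bar α β) p q → sFwd σ p ≡ inl q → atomAt β q ≡ atomAt α p
  stepAtom (step ξ r) = ctxFwd-atom (rFwd r) ξ (rFwd-atom r)

innerAt : ∀ {At : Set} {bar : At → At} {α β} (d : Deriv bar α β) → Inner d → At
innerAt (_▸_ {β = β} σ d) (inl n) = atomAt β (sNewOcc σ n)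
innerAt (σ ▸ d) (inr i) = innerAt d i

module Canonical {At : Set} {bar : At → At} {U L : Set} (A : Flow U L) (at : Flow.E A → At) where
  private
    module A = Flow A
    𝒩 : Fm A.E → Fm A.E → Set
    𝒩 = N bar A at

  bind-in : ∀ ξ {α β : Fm At} (f : Occ (ξ ⟨ α ⟩) → A.E) g → 𝒩 (name α (f ∘ cIn ξ)) (name β g) →
    𝒩 (name (ξ ⟨ α ⟩) f) (name (ξ ⟨ β ⟩) (newName {bar = bar} ξ {α} {β} f g))
  bind-in hole f g d = d
  bind-in (ξ ∨ₗ γ) f g d = bind-in ξ (f ∘ inl) g d ∨ᴺ idN
  bind-in (γ ∨ᵣ ξ) f g d = idN ∨ᴺ bind-in ξ (f ∘ inr) g d
  bind-in (ξ ∧ₗ γ) f g d = bind-in ξ (f ∘ inl) g d ∧ᴺ idN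
  bind-in (γ ∧ᵣ ξ) f g d = idN ∧ᴺ bind-in ξ (f ∘ inr) g d

  fold-bind-in : ∀ w ξ {α β : Fm At} (f : Occ (ξ ⟨ α ⟩) → A.E) g d → fold w (bind-in ξ {α} {β} f g d) ≡ fold w d
  fold-bind-in w hole f g d = refl
  fold-bind-in w (ξ ∨ₗ γ) f g d = trans (ℕP.+-identityʳ _) (fold-bind-in w ξ (f ∘ inl) g d)
  fold-bind-in w (γ ∨ᵣ ξ) f g d = fold-bind-in w ξ (f ∘ inr) g d
  fold-bind-in w (ξ ∧ₗ γ) f g d = trans (ℕP.+-identityʳ _) (fold-bind-in w ξ (f ∘ inl) g d)
  fold-bind-in w (γ ∧ᵣ ξ) f g d = fold-bind-in w ξ (f ∘ inr) g d

  eqTo-N : ∀ {α β : Fm At} (e : EqAx α β) (f : Occ α → A.E) → EqAx (name α f) (name β (f ∘ eqFrom e))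
  eqTo-N ∨-comm f = ∨-comm
  eqTo-N ∧-comm f = ∧-comm
  eqTo-N ∨-assoc f = ∨-assoc
  eqTo-N ∧-assoc f = ∧-assoc
  eqTo-N ∨-unit f = ∨-unit
  eqTo-N ∧-unit f = ∧-unit
  eqTo-N 𝔱𝔱 f = 𝔱𝔱
  eqTo-N 𝔣𝔣 f = 𝔣𝔣

  eqFrom-N : ∀ {α β : Fm At} (e : EqAx α β) (f : Occ β → A.E) → EqAx (name α (f ∘ eqTo e)) (name β f)
  eqFrom-N ∨-comm f = ∨-comm
  eqFrom-N ∧-comm f = ∧-comm
  eqFrom-N ∨-assoc f = ∨-assoc
  eqFrom-N ∧-assoc f = ∧-assoc
  eqFrom-N ∨-unit f = ∨-unit
  eqFrom-N ∧-unit f = ∧-unit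
  eqFrom-N 𝔱𝔱 f = 𝔱𝔱
  eqFrom-N 𝔣𝔣 f = 𝔣𝔣

  private
    2↔⊤⊎⊤ : Fin 2 ↔ (⊤ ⊎ ⊤)
    2↔⊤⊎⊤ = mk↔ₛ′ (λ { zero → inl tt ; (suc zero) → inr tt }) (λ { (inl _) → # 0 ; (inr _) → # 1 })
              (λ { (inl _) → refl ; (inr _) → refl }) (λ { zero → refl ; (suc zero) → refl })
    1↔⊤ : Fin 1 ↔ ⊤
    1↔⊤ = mk↔ₛ′ (λ _ → tt) (λ _ → # 0) (λ _ → refl) (λ { zero → refl })
    0↔⊥ : Fin 0 ↔ ⊥
    0↔⊥ = mk↔ₛ′ (λ ()) (λ ()) (λ ()) (λ ())

  ruleN : ∀ {α β} (r : Rule bar α β) (f : Occ α → A.E) (g : RNew r → A.E) (ν : RV r → A.V) →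
    (∀ x → A.lab (ν x) ≡ rlab r x) → (∀ x → IsPorts A.dn (ν x) f) → (∀ x → IsPorts A.up (ν x) (λ q → g (x , q))) →
    (∀ p → at (f p) ≡ atomAt α p) → (∀ n → at (g n) ≡ atomAt β (snd n)) →
    Σ (𝒩 (name α f) (name β (ruleName r f g))) λ d → ∀ w → fold w d ≡ RVsum r (w ∘ ν)
  ruleN (ai↓ a) f g ν l P Q b c = vx ai↓ (ν tt) _ _ (l tt) (ports-∘ (P tt) 0↔⊥) (ports-∘ (Q tt) 2↔⊤⊎⊤)
    (trans (c _) (cong bar (sym (c _)))) , λ _ → refl
  ruleN (aw↓ a) f g ν l P Q b c = vx aw↓ (ν tt) _ _ (l tt) (ports-∘ (P tt) 0↔⊥) (ports-∘ (Q tt) 1↔⊤) tt , λ _ → refl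
  ruleN (ac↓ a) f g ν l P Q b c = vx ac↓ (ν tt) _ _ (l tt) (ports-∘ (P tt) 2↔⊤⊎⊤) (ports-∘ (Q tt) 1↔⊤)
    (trans (b _) (sym (c _)) , trans (b _) (sym (c _))) , λ _ → refl
  ruleN (ai↑ a) f g ν l P Q b c = vx ai↑ (ν tt) _ _ (l tt) (ports-∘ (P tt) 2↔⊤⊎⊤) (ports-∘ (Q tt) 0↔⊥)
    (trans (b _) (cong bar (sym (b _)))) , λ _ → refl
  ruleN (aw↑ a) f g ν l P Q b c = vx aw↑ (ν tt) _ _ (l tt) (ports-∘ (P tt) 1↔⊤) (ports-∘ (Q tt) 0↔⊥) tt , λ _ → refl
  ruleN (ac↑ a) f g ν l P Q b c = vx ac↑ (ν tt) _ _ (l tt) (ports-∘ (P tt) 1↔⊤) (ports-∘ (Q tt) 2↔⊤⊎⊤)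
    (trans (c _) (sym (b _)) , trans (c _) (sym (b _))) , λ _ → refl
  ruleN s f g ν l P Q b c = lin sw , λ _ → refl
  ruleN m f g ν l P Q b c = lin md , λ _ → refl
  ruleN (eq→ e) f g ν l P Q b c = lin (ax→ (eqTo-N e f)) , λ _ → refl
  ruleN (eq← e) f g ν l P Q b c = lin (ax← (eqFrom-N e f)) , λ _ → refl

  record Inside {α β : Fm At} (d : Deriv bar α β) (f : Occ α → A.E) (fi : Inner d → A.E) (fv : DV d → A.V) (bl : Occ β → L) : Set where
    field
      labs : ∀ x → A.lab (fv x) ≡ dlab d x
      fv-inj : ∀ {x y} → fv x ≡ fv y → x ≡ y
      ups : ∀ i → A.up (fi i) ≡ inr (fv (upInner d i))
      up-all : ∀ e x → A.up e ≡ inr (fv x) → Σ (Inner d) λ i → e ≡ fi i × upInner d i ≡ x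
      dnT : ∀ p → A.dn (f p) ≡ Data.Sum.map bl fv (dnTop d p)
      dnI : ∀ i → A.dn (fi i) ≡ Data.Sum.map bl fv (dnInner d i)
      dn-all : ∀ e z → A.dn e ≡ Data.Sum.map bl fv z →
               (Σ (Occ α) λ p → e ≡ f p × dnTop d p ≡ z) ⊎ (Σ (Inner d) λ i → e ≡ fi i × dnInner d i ≡ z)
      f-inj : ∀ {p q} → f p ≡ f q → p ≡ q
      fi-inj : ∀ {i j} → fi i ≡ fi j → i ≡ j
      f≢fi : ∀ {p i} → f p ≢ fi i
      at-f : ∀ p → at (f p) ≡ atomAt α p
      at-fi : ∀ i → at (fi i) ≡ innerAt d i

  peel : ∀ {α β γ} (σ : Step bar α β) (d : Deriv bar β γ) {f fi fv bl} → Inside (σ ▸ d) f fi fv bl →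
    Inside d (stepName σ f (fi ∘ inl)) (fi ∘ inr) (fv ∘ inr) bl
  peel {α} {β} {γ} σ d {f} {fi} {fv} {bl} H = record
    { labs = λ x → labs (inr x)
    ; fv-inj = λ e → inr-inj (fv-inj e)
    ; ups = λ i → ups (inr i)
    ; up-all = up-all′
    ; dnT = dnT′
    ; dnI = λ i → trans (dnI (inr i)) (map-inj2 (dnInner d i))
    ; dn-all = dn-all′
    ; f-inj = λ {p} {q} → f-inj′ p q
    ; fi-inj = λ e → inr-inj (fi-inj e)
    ; f≢fi = λ {p} {i} → f≢fi′ p i
    ; at-f = at-f′
    ; at-fi = λ i → at-fi (inr i) }
    where
    open Inside H
    f' : Occ β → A.E
    f' = stepName σ f (fi ∘ inl)
    map-inj2 : ∀ z → Data.Sum.map bl fv (map₂ inr z) ≡ Data.Sum.map bl (fv ∘ inr) z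
    map-inj2 (inl _) = refl
    map-inj2 (inr _) = refl
    map2-inj : ∀ {z z' : Occ γ ⊎ DV d} → map₂ (inr {A = SV σ}) z ≡ map₂ inr z' → z ≡ z'
    map2-inj {inl _} {inl _} refl = refl
    map2-inj {inr _} {inr _} refl = refl
    up-all′ : ∀ e x → A.up e ≡ inr (fv (inr x)) → Σ (Inner d) λ i → e ≡ fi (inr i) × upInner d i ≡ x
    up-all′ e x p with up-all e (inr x) p
    ... | (inr i , q , refl) = i , q , refl
    dnT′ : ∀ q → A.dn (f' q) ≡ Data.Sum.map bl (fv ∘ inr) (dnTop d q)
    dnT′ q with stepView σ f (fi ∘ inl) q
    ... | inl (p , a , b) rewrite b = trans (dnT p) (trans (cong (λ z → Data.Sum.map bl fv (case⊎ _ _ z)) a) (map-inj2 (dnTop d q)))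
    ... | inr (n , refl , b) rewrite b = trans (dnI (inl n)) (map-inj2 (dnTop d q))
    dn-all′ : ∀ e z → A.dn e ≡ Data.Sum.map bl (fv ∘ inr) z →
      (Σ (Occ β) λ p → e ≡ f' p × dnTop d p ≡ z) ⊎ (Σ (Inner d) λ i → e ≡ fi (inr i) × dnInner d i ≡ z)
    dn-all′ e z p with dn-all e (map₂ inr z) (trans p (sym (map-inj2 z)))
    ... | inr (inl n , a , b) = inl (sNewOcc σ n , trans a (sym (stepName-new σ f (fi ∘ inl) n)) , map2-inj b)
    ... | inr (inr i , a , b) = inr (i , a , map2-inj b)
    ... | inl (p0 , a , b) with sFwd σ p0 in eq
    ...   | inl q = inl (q , trans a (sym (stepName-fwd σ f (fi ∘ inl) p0 q eq)) , map2-inj b)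
    dn-all′ e (inl z) p | inl (p0 , a , ()) | inr x
    dn-all′ e (inr z) p | inl (p0 , a , ()) | inr x
    f-inj′ : ∀ p q → f' p ≡ f' q → p ≡ q
    f-inj′ p q e with stepView σ f (fi ∘ inl) p | stepView σ f (fi ∘ inl) q
    ... | inl (p0 , a , b) | inl (q0 , a' , b') with f-inj (trans (sym b) (trans e b'))
    ...   | refl = inl-inj (trans (sym a) a')
    f-inj′ p q e | inl (p0 , a , b) | inr (n , a' , b') = ⊥-elim (f≢fi (trans (sym b) (trans e b')))
    f-inj′ p q e | inr (n , a , b) | inl (q0 , a' , b') = ⊥-elim (f≢fi (trans (sym b') (trans (sym e) b)))
    f-inj′ p q e | inr (n , a , b) | inr (n' , a' , b') with fi-inj (trans (sym b) (trans e b'))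
    ...   | refl = trans (sym a) a'
    f≢fi′ : ∀ p i → f' p ≢ fi (inr i)
    f≢fi′ p i e with stepView σ f (fi ∘ inl) p
    ... | inl (p0 , a , b) = f≢fi (trans (sym b) e)
    ... | inr (n , a , b) with () ← fi-inj (trans (sym b) e)
    at-f′ : ∀ p → at (f' p) ≡ atomAt β p
    at-f′ p with stepView σ f (fi ∘ inl) p
    ... | inl (p0 , a , b) = trans (cong at b) (trans (at-f p0) (sym (stepAtom {E = A.E} σ p0 p a)))
    ... | inr (n , a , b) = trans (cong at b) (trans (at-fi (inl n)) (cong (atomAt β) a))

  SVsum : ∀ {α β} (σ : Step bar α β) → (SV σ → ℕ) → ℕ
  SVsum (step ξ r) = RVsum r

  stepN : ∀ {α β γ} (σ : Step bar α β) (d : Deriv bar β γ) {f fi fv bl} → Inside (σ ▸ d) f fi fv bl →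
    Σ (𝒩 (name α f) (name β (stepName σ f (fi ∘ inl)))) λ d → ∀ w → fold w d ≡ SVsum σ (λ x → w (fv (inl x)))
  stepN (step ξ {α} {β} r) d {f} {fi} {fv} {bl} H =
    bind-in ξ f (ruleName r (f ∘ cIn ξ) (fi ∘ inl)) (fst rn) ,
    λ w → trans (fold-bind-in w ξ f (ruleName r (f ∘ cIn ξ) (fi ∘ inl)) (fst rn)) (snd rn w)
    where
    open Inside H
    ip : ∀ x → IsPorts A.dn (fv (inl x)) (f ∘ cIn ξ)
    ip x = record
      { hit = λ p → trans (dnT (cIn ξ p)) (cong (λ z → Data.Sum.map bl fv (case⊎ _ _ z))
                      (trans (ctxFwd-in {bar = bar} {E = A.E} (rFwd r) ξ p) (cong (map₁ (cIn ξ)) (rFwd-dead {E = A.E} r x p))))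
      ; inj = λ e → cIn-inj {bar = bar} {E = A.E} ξ (f-inj e)
      ; all = all′ }
      where
      all′ : ∀ e → A.dn e ≡ inr (fv (inl x)) → Σ (Occ α) λ p → f (cIn ξ p) ≡ e
      all′ e p with dn-all e (inr (inl x)) p
      all′ e p | inl (p0 , a , b) with cFwd ξ {α} {β} (rFwd r) p0 in eq
      ... | inr y with ctxFwd-dead {bar = bar} {E = A.E} (rFwd r) ξ p0 y eq
      ...   | (p1 , refl) = p1 , sym a
      all′ e p | inl (p0 , a , b) | inl q with dnTop d q
      all′ e p | inl (p0 , a , ()) | inl q | inl _
      all′ e p | inl (p0 , a , ()) | inl q | inr _
      all′ e p | inr (inl n , a , b) with dnTop d (cIn ξ (snd n))
      all′ e p | inr (inl n , a , ()) | inl _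
      all′ e p | inr (inl n , a , ()) | inr _
      all′ e p | inr (inr i , a , b) with dnInner d i
      all′ e p | inr (inr i , a , ()) | inl _
      all′ e p | inr (inr i , a , ()) | inr _
    op : ∀ x → IsPorts A.up (fv (inl x)) (λ q → fi (inl (x , q)))
    op x = record
      { hit = λ q → ups (inl (x , q))
      ; inj = λ e → pr (fi-inj e)
      ; all = λ e p → all′ e (up-all e (inl x) p) }
      where
      pr : ∀ {q q'} → _≡_ {A = Inner (step ξ r ▸ d)} (inl (x , q)) (inl (x , q')) → q ≡ q'
      pr refl = refl
      all′ : ∀ e → (Σ (Inner (step ξ r ▸ d)) λ i → e ≡ fi i × upInner (step ξ r ▸ d) i ≡ inl x) → Σ (Occ β) λ q → fi (inl (x , q)) ≡ e
      all′ e (inl (.x , q) , a , refl) = q , sym a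
    rn = ruleN r (f ∘ cIn ξ) (fi ∘ inl) (fv ∘ inl) (labs ∘ inl) ip op
           (λ p → trans (at-f (cIn ξ p)) (atom-in ξ p)) (λ n → trans (at-fi (inl n)) (atom-in ξ (snd n)))

  botName : ∀ {α β} (d : Deriv bar α β) → (Occ α → A.E) → (Inner d → A.E) → Occ β → A.E
  botName done f fi = f
  botName (σ ▸ d) f fi = botName d (stepName σ f (fi ∘ inl)) (fi ∘ inr)

  canonN : ∀ {α β} (d : Deriv bar α β) {f fi fv bl} → Inside d f fi fv bl → 𝒩 (name α f) (name β (botName d f fi))
  canonN done H = idN
  canonN (σ ▸ d) H = fst (stepN σ d H) ⨾ canonN d (peel σ d H)

  bot-facts : ∀ {α β} (d : Deriv bar α β) {f fi fv bl} → Inside d f fi fv bl → (∀ {q q'} → bl q ≡ bl q' → q ≡ q') →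
    ∀ q → A.dn (botName d f fi q) ≡ inl (bl q) × at (botName d f fi q) ≡ atomAt β q ×
          (∀ e → A.dn e ≡ inl (bl q) → e ≡ botName d f fi q)
  bot-facts done H bi q = Inside.dnT H q , Inside.at-f H q , un
    where
    un : ∀ e → _ → _
    un e p with Inside.dn-all H e (inl q) p
    ... | inl (p0 , a , refl) = a
  bot-facts (σ ▸ d) H bi q = bot-facts d (peel σ d H) bi q

  module _ (_≟_ : DecEq A.V) where

    zeros : ∀ {α β v} (r : Rule bar α β) {ν : RV r → A.V} → (∀ x → ν x ≢ v) → RVsum r (δ _≟_ v ∘ ν) ≡ 0
    zeros {v = v} r {ν} n with atomic r
    ... | inl (x , _ , e) = trans (e (δ _≟_ v ∘ ν)) (δ-no _≟_ (n x ∘ sym))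
    ... | inr (_ , e) = e (δ _≟_ v ∘ ν)

    canon-0 : ∀ {α β} (d : Deriv bar α β) {f fi fv bl} (H : Inside d f fi fv bl) v → (∀ x → fv x ≢ v) → fold (δ _≟_ v) (canonN d H) ≡ 0
    canon-0 done H v n = refl
    canon-0 (step ξ r ▸ d) {fv = fv} H v n = cong₂ _+_ (trans (snd (stepN (step ξ r) d H) (δ _≟_ v)) (zeros r (λ x → n (inl x))))
                                       (canon-0 d (peel (step ξ r) d H) v (λ x → n (inr x)))

    canon-1 : ∀ {α β} (d : Deriv bar α β) {f fi fv bl} (H : Inside d f fi fv bl) x → fold (δ _≟_ (fv x)) (canonN d H) ≡ 1
    canon-1 (step ξ r ▸ d) {fv = fv} H (inl x) = cong₂ _+_
      (trans (snd (stepN (step ξ r) d H) (δ _≟_ (fv (inl x)))) (trans (RVsum-at r _ x) (δ-yes _≟_ {fv (inl x)} refl)))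
      (canon-0 d (peel (step ξ r) d H) (fv (inl x)) (λ y e → inl≢inr (sym (Inside.fv-inj H e))))
    canon-1 (step ξ r ▸ d) {fv = fv} H (inr x) = cong₂ _+_
      (trans (snd (stepN (step ξ r) d H) (δ _≟_ (fv (inr x)))) (zeros r (λ y e → inl≢inr (Inside.fv-inj H e))))
      (canon-1 d (peel (step ξ r) d H) x)

finite-RV : ∀ {At : Set} {bar : At → At} {α β} (r : Rule bar α β) → Finite (RV r)
finite-RV r with atomic r
... | inl (x , u , _) = finite-prop (RV-prop r) (yes x)
... | inr (n , _) = finite-prop (RV-prop r) (no n)

finite-Occ : ∀ {At : Set} (α : Fm At) → Finite (Occ α)
finite-Occ 𝔣 = finite-⊥
finite-Occ 𝔱 = finite-⊥
finite-Occ (atom a) = finite-⊤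
finite-Occ (α ∨ β) = finite-⊎ (finite-Occ α) (finite-Occ β)
finite-Occ (α ∧ β) = finite-⊎ (finite-Occ α) (finite-Occ β)

finite-RNew : ∀ {At : Set} {bar : At → At} {α β} (r : Rule bar α β) → Finite (RNew r)
finite-RNew {β = β} r = fst (finite-RV r) Data.Nat.* fst (finite-Occ β) ,
  ↔-trans FinP.*↔× (mk↔ₛ′ (λ (x , y) → to (snd (finite-RV r)) x , to (snd (finite-Occ β)) y)
                          (λ (x , y) → from (snd (finite-RV r)) x , from (snd (finite-Occ β)) y)
                          (λ (x , y) → cong₂ _,_ (inv-l (snd (finite-RV r)) x) (inv-l (snd (finite-Occ β)) y))
                          (λ (x , y) → cong₂ _,_ (inv-r (snd (finite-RV r)) x) (inv-r (snd (finite-Occ β)) y)))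

finite-DV : ∀ {At : Set} {bar : At → At} {α β} (d : Deriv bar α β) → Finite (DV d)
finite-DV done = finite-⊥
finite-DV (step ξ r ▸ d) = finite-⊎ (finite-RV r) (finite-DV d)

finite-Inner : ∀ {At : Set} {bar : At → At} {α β} (d : Deriv bar α β) → Finite (Inner d)
finite-Inner done = finite-⊥
finite-Inner (step ξ r ▸ d) = finite-⊎ (finite-RNew r) (finite-Inner d)

flowOf-struct : ∀ {At : Set} {bar : At → At} {α β} (d : Deriv bar α β) →
  NStruct bar (flowOf d) (atomAt α) (atomAt β) (occFm α) (occFm β)
flowOf-struct {bar = bar} {α} {β} d = record
  { _≟V_ = finite-≟ (finite-DV d)
  ; at = at
  ; topE = inl
  ; botE = C.botName d inl inr
  ; top-up = λ _ → refl
  ; top-un = λ { (inl p) u refl → refl }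
  ; bot-dn = λ q → fst (bf q)
  ; bot-un = λ e q → snd (snd (bf q)) e
  ; at-top = λ _ → refl
  ; at-bot = λ q → fst (snd (bf q))
  ; der = eqN (map-name inl α id) ⨾ C.canonN d H ⨾ eqN (sym (map-name _ β id))
  ; full = λ v → trans (ℕP.+-identityʳ _) (C.canon-1 (finite-≟ (finite-DV d)) d H v) }
  where
  at : Occ α ⊎ Inner d → _
  at = case⊎ (atomAt α) (innerAt d)
  module C = Canonical (flowOf d) at
  map-id : ∀ {A B : Set} (z : A ⊎ B) → z ≡ Data.Sum.map id id z
  map-id (inl _) = refl
  map-id (inr _) = refl
  H : C.Inside d inl inr id id
  H = record
    { labs = λ _ → refl ; fv-inj = id ; ups = λ _ → refl
    ; up-all = λ { (inr i) x p → i , refl , inr-inj p }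
    ; dnT = λ p → map-id (dnTop d p) ; dnI = λ p → map-id (dnInner d p)
    ; dn-all = λ { (inl p) z e → inl (p , refl , trans e (sym (map-id z))) ; (inr i) z e → inr (i , refl , trans e (sym (map-id z))) }
    ; f-inj = inl-inj ; fi-inj = inr-inj ; f≢fi = λ () ; at-f = λ _ → refl ; at-fi = λ _ → refl }
  bf = C.bot-facts d H id

-- the time at which a vertex occurs, counted from the end
clock : ∀ {At : Set} {bar : At → At} {α β} (d : Deriv bar α β) → DV d → ℕ
size : ∀ {At : Set} {bar : At → At} {α β} (d : Deriv bar α β) → ℕ
size done = 0
size (σ ▸ d) = suc (size d)
clock (σ ▸ d) (inl _) = size d
clock (σ ▸ d) (inr v) = clock d v

clock<size : ∀ {At : Set} {bar : At → At} {α β} (d : Deriv bar α β) v → clock d v < size d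
clock<size (σ ▸ d) (inl _) = ℕP.≤-refl
clock<size (σ ▸ d) (inr v) = ℕP.m<n⇒m<1+n (clock<size d v)

clock-dn : ∀ {At : Set} {bar : At → At} {α β} (d : Deriv bar α β) i {w} → dnInner d i ≡ inr w → clock d w < clock d (upInner d i)
clock-dn (σ ▸ d) (inl n) p with dnTop d (sNewOcc σ n)
clock-dn (σ ▸ d) (inl n) refl | inr w = clock<size d w
clock-dn (σ ▸ d) (inr i) p with dnInner d i in eq
clock-dn (σ ▸ d) (inr i) refl | inr w = clock-dn d i eq

clock-edge : ∀ {At : Set} {bar : At → At} {α β} (d : Deriv bar α β) e {v w} →
  Flow.up (flowOf d) e ≡ inr v → Flow.dn (flowOf d) e ≡ inr w → clock d w < clock d v
clock-edge d (inr i) refl q = clock-dn d i q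

module _ {U L : Set} (A : Flow U L) where
  private
    module A = Flow A

  descent⇒acyclic : (ρ : A.V → ℕ) → (∀ e {v w} → A.up e ≡ inr v → A.dn e ≡ inr w → ρ w < ρ v) →
    ∀ l v → IsDownPath A l → StartsAt A l (inr v) → EndsAt A l (inr v) → ⊥
  descent⇒acyclic ρ h l v P q r = ℕP.<-irrefl refl (go l v v P q r)
    where
    src-dn : ∀ e {v} → src A (e , ⇓) ≡ inr v → A.up e ≡ inr v
    src-dn e p with A.up e
    src-dn e refl | inr _ = refl
    tgt-dn : ∀ e {v} → tgt A (e , ⇓) ≡ inr v → A.dn e ≡ inr v
    tgt-dn e p with A.dn e
    tgt-dn e refl | inr _ = refl
    go : ∀ l v w → IsDownPath A l → StartsAt A l (inr v) → EndsAt A l (inr w) → ρ w < ρ v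
    go ((e , ⇓) ∷ []) v w P q r = h e (src-dn e q) (tgt-dn e r)
    go ((e , ⇓) ∷ (e' , ⇓) ∷ l) v w ((_ , (x , a , b , _) , c) , refl ∷ ds) q r =
      ℕP.<-trans (go ((e' , ⇓) ∷ l) x w ((tt , c) , ds) b r) (h e (src-dn e q) (tgt-dn e a))
    go ((e , ⇓) ∷ (e' , ⇑) ∷ l) v w (_ , refl ∷ (() ∷ ds)) q r
    go ((e , ⇑) ∷ l) v w (_ , () ∷ _) q r

module Colouring {At : Set} (bar : At → At) (invol : ∀ a → bar (bar a) ≡ a) (bar≢ : ∀ a → bar a ≢ a)
                 {E : Set} (_≟_ : DecEq E) (at : E → At) where

  twist : Sign → At → At
  twist plus a = a
  twist minus a = bar a

  _·_ : Sign → Sign → Sign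
  plus · y = y
  minus · y = opp y

  twist-· : ∀ x y a → twist (x · y) a ≡ twist x (twist y a)
  twist-· plus y a = refl
  twist-· minus plus a = refl
  twist-· minus minus a = sym (invol a)

  ·-self : ∀ x y → x · (x · y) ≡ y
  ·-self plus y = refl
  ·-self minus plus = refl
  ·-self minus minus = refl

  ·-comm : ∀ x y → x · y ≡ y · x
  ·-comm plus plus = refl
  ·-comm plus minus = refl
  ·-comm minus plus = refl
  ·-comm minus minus = refl

  ·-assoc : ∀ x y z → (x · y) · z ≡ x · (y · z)
  ·-assoc plus y z = refl
  ·-assoc minus plus z = refl
  ·-assoc minus minus plus = refl
  ·-assoc minus minus minus = refl

  twist-inj : ∀ x y a → twist x a ≡ twist y a → x ≡ y
  twist-inj plus plus a p = refl
  twist-inj plus minus a p = ⊥-elim (bar≢ a (sym p))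
  twist-inj minus plus a p = ⊥-elim (bar≢ a p)
  twist-inj minus minus a p = refl

  Con : Set
  Con = E × E × Sign

  Valid : Con → Set
  Valid (e , e' , x) = at e' ≡ twist x (at e)

  -- a partition of E into classes coloured consistently with the atoms
  record State : Set where
    field
      cls : E → E
      sgn : E → Sign
      ok  : ∀ e → at e ≡ twist (sgn e) (at (cls e))

  Sat : State → Con → Set
  Sat S (e , e' , x) = State.cls S e ≡ State.cls S e' × State.sgn S e' ≡ x · State.sgn S e

  add : ∀ S c → Valid c → Σ State λ S' → (∀ d → Sat S d → Sat S' d) × Sat S' c
  add S (e , e' , x) v with State.cls S e ≟ State.cls S e'
  ... | yes p = S , (λ _ z → z) , p , twist-inj _ _ (at (cls e))
        (trans (trans (cong (λ z → twist (sgn e') (at z)) p) (sym (ok e')))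
               (trans v (trans (cong (twist x) (ok e)) (sym (twist-· x (sgn e) (at (cls e)))))))
    where open State S
  ... | no n = S' , mono , new
    where
    open State S
    c : Sign
    c = sgn e' · (x · sgn e)
    cls' : E → E
    cls' z with cls z ≟ cls e'
    ... | yes _ = cls e
    ... | no _ = cls z
    sgn' : E → Sign
    sgn' z with cls z ≟ cls e'
    ... | yes _ = sgn z · c
    ... | no _ = sgn z
    at-cls : at (cls e') ≡ twist c (at (cls e))
    at-cls = begin
      at (cls e') ≡⟨ cong (λ z → twist z (at (cls e'))) (sym (trans (cong (sgn e' ·_) (sym (·-comm (sgn e') plus))) (·-self (sgn e') plus))) ⟩
      twist (sgn e' · sgn e') (at (cls e')) ≡⟨ twist-· (sgn e') (sgn e') _ ⟩
      twist (sgn e') (twist (sgn e') (at (cls e'))) ≡⟨ cong (twist (sgn e')) (sym (ok e')) ⟩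
      twist (sgn e') (at e') ≡⟨ cong (twist (sgn e')) v ⟩
      twist (sgn e') (twist x (at e)) ≡⟨ cong (λ z → twist (sgn e') (twist x z)) (ok e) ⟩
      twist (sgn e') (twist x (twist (sgn e) (at (cls e)))) ≡⟨ cong (twist (sgn e')) (sym (twist-· x (sgn e) _)) ⟩
      twist (sgn e') (twist (x · sgn e) (at (cls e))) ≡⟨ sym (twist-· (sgn e') (x · sgn e) _) ⟩
      twist c (at (cls e)) ∎
      where open ≡-Reasoning
    ok' : ∀ z → at z ≡ twist (sgn' z) (at (cls' z))
    ok' z with cls z ≟ cls e'
    ... | yes p = trans (ok z) (trans (cong (twist (sgn z)) (trans (cong at p) at-cls)) (sym (twist-· (sgn z) c _)))
    ... | no _ = ok z
    S' : State
    S' = record { cls = cls' ; sgn = sgn' ; ok = ok' }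
    mono : ∀ d → Sat S d → Sat S' d
    mono (a , b , y) (p , q) with cls a ≟ cls e' | cls b ≟ cls e'
    ... | yes u | yes w = refl , trans (cong (_· c) q) (·-assoc y (sgn a) c)
    ... | yes u | no w = ⊥-elim (w (trans (sym p) u))
    ... | no u | yes w = ⊥-elim (u (trans p w))
    ... | no u | no w = p , q
    new : Sat S' (e , e' , x)
    new with cls e ≟ cls e' | cls e' ≟ cls e'
    ... | yes u | _ = ⊥-elim (n u)
    ... | no u | no w = ⊥-elim (w refl)
    ... | no u | yes w = refl , ·-self (sgn e') (x · sgn e)

  addAll : ∀ S cs → All Valid cs → Σ State λ S' → (∀ d → Sat S d → Sat S' d) × All (Sat S') cs
  addAll S [] [] = S , (λ _ z → z) , []
  addAll S (c ∷ cs) (v ∷ vs) with add S c v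
  ... | (S1 , f , z) with addAll S1 cs vs
  ...   | (S2 , g , zs) = S2 , (λ d q → g d (f d q)) , (g c z ∷ zs)

  addFin : ∀ n S (cs : Fin n → List Con) → (∀ i → All Valid (cs i)) → Σ State λ S' → (∀ d → Sat S d → Sat S' d) × (∀ i → All (Sat S') (cs i))
  addFin zero S cs v = S , (λ _ z → z) , λ ()
  addFin (suc n) S cs v with addAll S (cs zero) (v zero)
  ... | (S1 , f , zs) with addFin n S1 (cs ∘ suc) (v ∘ suc)
  ...   | (S2 , g , ws) = S2 , (λ d q → g d (f d q)) ,
        λ { zero → Data.List.Relation.Unary.All.map (λ {d} → g d) zs ; (suc i) → ws i }
    where import Data.List.Relation.Unary.All

  start : State
  start = record { cls = id ; sgn = λ _ → plus ; ok = λ _ → refl }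

  module _ {U L : Set} {A : Flow U L} where
    private
      module A = Flow A

    cons : ∀ k → (Fin (ins k) → E) → (Fin (outs k) → E) → List Con
    cons ai↓ i o = (o (# 0) , o (# 1) , minus) ∷ []
    cons ai↑ i o = (i (# 0) , i (# 1) , minus) ∷ []
    cons aw↓ i o = []
    cons aw↑ i o = []
    cons ac↓ i o = (i (# 0) , o (# 0) , plus) ∷ (i (# 1) , o (# 0) , plus) ∷ []
    cons ac↑ i o = (i (# 0) , o (# 0) , plus) ∷ (i (# 0) , o (# 1) , plus) ∷ []

    cons-valid : ∀ k i o → AtOK bar k (at ∘ i) (at ∘ o) → All Valid (cons k i o)
    cons-valid ai↓ i o p = p ∷ []
    cons-valid ai↑ i o p = p ∷ []
    cons-valid aw↓ i o p = []
    cons-valid aw↑ i o p = []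
    cons-valid ac↓ i o (p , q) = sym p ∷ sym q ∷ []
    cons-valid ac↑ i o (p , q) = p ∷ q ∷ []

module _ {U L : Set} (A : Flow U L) (π : Polarity A) where
  open Flow A
  open import Data.Fin.Properties using (¬Fin0)

  LocallyValid : V → Set
  LocallyValid v = (IsContr A (lab v) → ∀ e e' → Incident A e v → Incident A e' v → π e ≡ π e') ×
                   (IsAI A (lab v) → ∀ e e' → Incident A e v → Incident A e' v → e ≢ e' → π e ≢ π e')

  private
    neg : ∀ {x y} → y ≡ opp x → x ≢ y
    neg {plus} refl ()
    neg {minus} refl ()

    contr : ∀ {v k} → lab v ≡ k → k ≢ ai↓ → k ≢ ai↑ → (∀ e e' → Incident A e v → Incident A e' v → π e ≡ π e') → LocallyValid v
    contr refl a b f = (λ _ → f) , λ { (inl x) → ⊥-elim (a x) ; (inr x) → ⊥-elim (b x) }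
    ai : ∀ {v k} → lab v ≡ k → k ≢ ac↓ → k ≢ ac↑ → (∀ e e' → Incident A e v → Incident A e' v → e ≢ e' → π e ≢ π e') → LocallyValid v
    ai refl a b f = (λ { (inl x) → ⊥-elim (a x) ; (inr x) → ⊥-elim (b x) }) , λ _ → f
    weak : ∀ {v k} → lab v ≡ k → k ≢ ac↓ → k ≢ ac↑ → k ≢ ai↓ → k ≢ ai↑ → LocallyValid v
    weak refl a b c d = (λ { (inl x) → ⊥-elim (a x) ; (inr x) → ⊥-elim (b x) }) , λ { (inl x) → ⊥-elim (c x) ; (inr x) → ⊥-elim (d x) }

    ∈ports : ∀ {B n} {end : E → B ⊎ V} {v} {i : Fin n → E} {x} → IsPorts end v i → (∀ j → π (i j) ≡ x) → ∀ e → end e ≡ inr v → π e ≡ x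
    ∈ports Q h e p = let (j , q) = all Q e p in trans (cong π (sym q)) (h j)

    pair : ∀ {B} {end : E → B ⊎ V} {v} {i : Fin 2 → E} → IsPorts end v i → π (i (# 1)) ≡ opp (π (i (# 0))) →
      ∀ e e' → end e ≡ inr v → end e' ≡ inr v → e ≢ e' → π e ≢ π e'
    pair Q h e e' p p' n with all Q e p | all Q e' p'
    ... | (zero , refl) | (zero , refl) = ⊥-elim (n refl)
    ... | (zero , refl) | (suc zero , refl) = neg h
    ... | (suc zero , refl) | (zero , refl) = neg h ∘ sym
    ... | (suc zero , refl) | (suc zero , refl) = ⊥-elim (n refl)

  ok⇒valid : ∀ v k {i o} → lab v ≡ k → IsPorts dn v i → IsPorts up v o → AtOK opp k (π ∘ i) (π ∘ o) → LocallyValid v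
  ok⇒valid v ai↓ l P Q q = ai l (λ ()) (λ ()) go
    where
    go : ∀ e e' → Incident A e v → Incident A e' v → e ≢ e' → π e ≢ π e'
    go e e' (inl a) (inl b) = pair Q q e e' a b
    go e e' (inr a) b = ⊥-elim (¬Fin0 (fst (all P e a)))
    go e e' (inl a) (inr b) = ⊥-elim (¬Fin0 (fst (all P e' b)))
  ok⇒valid v ai↑ l P Q q = ai l (λ ()) (λ ()) go
    where
    go : ∀ e e' → Incident A e v → Incident A e' v → e ≢ e' → π e ≢ π e'
    go e e' (inr a) (inr b) = pair P q e e' a b
    go e e' (inl a) b = ⊥-elim (¬Fin0 (fst (all Q e a)))
    go e e' (inr a) (inl b) = ⊥-elim (¬Fin0 (fst (all Q e' b)))
  ok⇒valid v aw↓ l P Q _ = weak l (λ ()) (λ ()) (λ ()) (λ ())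
  ok⇒valid v aw↑ l P Q _ = weak l (λ ()) (λ ()) (λ ()) (λ ())
  ok⇒valid v ac↓ {i} {o} l P Q (q , r) = contr l (λ ()) (λ ()) λ e e' a b → trans (go e a) (sym (go e' b))
    where
    go : ∀ e → Incident A e v → π e ≡ π (o (# 0))
    go e (inl a) = ∈ports Q (λ { zero → refl }) e a
    go e (inr a) = ∈ports P (λ { zero → q ; (suc zero) → r }) e a
  ok⇒valid v ac↑ {i} {o} l P Q (q , r) = contr l (λ ()) (λ ()) λ e e' a b → trans (go e a) (sym (go e' b))
    where
    go : ∀ e → Incident A e v → π e ≡ π (i (# 0))
    go e (inl a) = ∈ports Q (λ { zero → q ; (suc zero) → r }) e a
    go e (inr a) = ∈ports P (λ { zero → refl }) e a

  valid⇒ok : ∀ v k {i o} → lab v ≡ k → IsPorts dn v i → IsPorts up v o → LocallyValid v → AtOK opp k (π ∘ i) (π ∘ o)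
  valid⇒ok v ai↓ l P Q (_ , f) = opp-≢ (f (inl l) _ _ (inl (hit Q (# 0))) (inl (hit Q (# 1))) (λ p → 0≢1 (inj Q p)))
    where
    0≢1 : _≡_ {A = Fin 2} (# 0) (# 1) → ⊥
    0≢1 ()
  valid⇒ok v ai↑ l P Q (_ , f) = opp-≢ (f (inr l) _ _ (inr (hit P (# 0))) (inr (hit P (# 1))) (λ p → 0≢1 (inj P p)))
    where
    0≢1 : _≡_ {A = Fin 2} (# 0) (# 1) → ⊥
    0≢1 ()
  valid⇒ok v aw↓ l P Q _ = tt
  valid⇒ok v aw↑ l P Q _ = tt
  valid⇒ok v ac↓ l P Q (f , _) = f (inl l) _ _ (inr (hit P _)) (inl (hit Q _)) , f (inl l) _ _ (inr (hit P _)) (inl (hit Q _))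
  valid⇒ok v ac↑ l P Q (f , _) = f (inr l) _ _ (inl (hit Q _)) (inr (hit P _)) , f (inr l) _ _ (inl (hit Q _)) (inr (hit P _))

module _ {At : Set} {bar : At → At} (invol : ∀ a → bar (bar a) ≡ a) (bar≢ : ∀ a → bar a ≢ a)
         {U L : Set} {A : Flow U L} {aU : U → At} {aL : L → At} {X : Fm U} {Y : Fm L}
         (S : NStruct bar A aU aL X Y) where
  open NStruct S
  open Flow A

  instance-at : ∀ v → Split _≟V_ v der
  instance-at v = split _≟V_ v der (λ z → ℕP.1+n≢0 (trans (sym (full v)) z))

  module _ (fV : Finite V) (fE : Finite E) where
    private
      open module C = Colouring bar invol bar≢ (finite-≟ fE) at
      module I (v : V) = Split (instance-at v)

      cs : V → List C.Con
      cs v = cons {A = A} (I.k v) (I.i v) (I.o v)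

      solved = C.addFin (fst fV) C.start (λ j → cs (to (snd fV) j)) (λ j → cons-valid {A = A} (I.k _) (I.i _) (I.o _) (I.ok _))

      π : Polarity A
      π = C.State.sgn (fst solved)

      sat : ∀ v → All (C.Sat (fst solved)) (cs v)
      sat v = subst (λ z → All (C.Sat (fst solved)) (cs z)) (inv-l (snd fV) v) (snd (snd solved) (from (snd fV) v))

      sat⇒ok : ∀ k {i o} → All (C.Sat (fst solved)) (cons {A = A} k i o) → AtOK opp k (π ∘ i) (π ∘ o)
      sat⇒ok ai↓ ((_ , q) ∷ []) = q
      sat⇒ok ai↑ ((_ , q) ∷ []) = q
      sat⇒ok aw↓ [] = tt
      sat⇒ok aw↑ [] = tt
      sat⇒ok ac↓ ((_ , q) ∷ (_ , r) ∷ []) = sym q , sym r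
      sat⇒ok ac↑ ((_ , q) ∷ (_ , r) ∷ []) = q , r

    struct-polar : Σ (Polarity A) (ValidPol A)
    struct-polar = π , λ v → ok⇒valid A π v (I.k v) (I.lk v) (I.pi v) (I.po v) (sat⇒ok (I.k v) (sat v))

    struct-wf : (∀ l v → IsDownPath A l → StartsAt A l (inr v) → EndsAt A l (inr v) → ⊥) → WF A
    struct-wf ac = record
      { finV = fV ; finE = fE
      ; upU = λ u → topE u , top-up u , λ e → top-un e u
      ; dnL = λ l → botE l , bot-dn l , λ e → bot-un e l
      ; inDeg = λ v → subst (λ k → Fin (ins k) ↔ _) (sym (I.lk v)) (ports⇒↔ (I.pi v))
      ; outDeg = λ v → subst (λ k → Fin (outs k) ↔ _) (sym (I.lk v)) (ports⇒↔ (I.po v))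
      ; acyclic = ac ; polar = struct-polar }

flowOf-wf : ∀ {At : Set} {bar : At → At} → (∀ a → bar (bar a) ≡ a) → (∀ a → bar a ≢ a) →
  ∀ {α β} (d : Deriv bar α β) → WF (flowOf d)
flowOf-wf invol bar≢ {α} d = struct-wf invol bar≢ (flowOf-struct d) (finite-DV d) (finite-⊎ (finite-Occ α) (finite-Inner d))
  (descent⇒acyclic (flowOf d) (clock d) (clock-edge d))

-- Soundness of replacing a redex, for any flow A' that keeps the rest of A.
module Transfer {At : Set} {bar : At → At} (invol : ∀ a → bar (bar a) ≡ a)
  {U L P Q : Set} {A : Flow U L} {R : Flow P Q} (W : WF A) {X : Redex R} (F : Emb A X)
  {aU : U → At} {aL : L → At} {α : Fm U} {β : Fm L} (S : NStruct bar A aU aL α β)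
  {VR E' : Set} (_≟R_ : DecEq VR) (lab' : Cut.KV W F ⊎ VR → Label)
  (up' : E' → U ⊎ (Cut.KV W F ⊎ VR)) (dn' : E' → L ⊎ (Cut.KV W F ⊎ VR)) (at' : E' → At)
  (nm : ∀ e → e ≢ Cut.ε W F → E') where

  open Cut W F
  private
    module A = Flow A
    module R = Flow R
    module X = Redex X
    module S = NStruct S

  A' : Flow U L
  A' = record { V = KV ⊎ VR ; E = E' ; lab = lab' ; up = up' ; dn = dn' }

  record Keeps : Set where
    field
      lab-nm : ∀ v → lab' (inl v) ≡ A.lab (fst v)
      at-nm : ∀ e n → at' (nm e n) ≡ S.at e
      ports-up : ∀ v {n} {i : Fin n → A.E} → IsPorts A.up (fst v) i → (ne : ∀ j → i j ≢ ε) → IsPorts up' (inl v) (λ j → nm (i j) (ne j))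
      ports-dn : ∀ v {n} {i : Fin n → A.E} → IsPorts A.dn (fst v) i → (ne : ∀ j → i j ≢ ε) → IsPorts dn' (inl v) (λ j → nm (i j) (ne j))
      up-nm : ∀ e n u → A.up e ≡ inl u → up' (nm e n) ≡ inl u
      dn-nm : ∀ e n l → A.dn e ≡ inl l → dn' (nm e n) ≡ inl l
      up-un : ∀ e' u → up' e' ≡ inl u → Σ A.E λ e → A.up e ≡ inl u × (∀ n → e' ≡ nm e n)
      dn-un : ∀ e' l → dn' e' ≡ inl l → Σ A.E λ e → A.dn e ≡ inl l × (∀ n → e' ≡ nm e n)

  -- A.der is translated by replacing the internal edge by φ; the images of the two vertices of the
  -- redex are the patches, which together use every new vertex once.
  module _ (φ : Fm E') where

    h : A.E → Fm E'
    h e with e ≟E ε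
    ... | yes _ = φ
    ... | no n = atom (nm e n)

    h-ε : h ε ≡ φ
    h-ε with ε ≟E ε
    ... | yes _ = refl
    ... | no n = ⊥-elim (n refl)

    h-nm : ∀ e n → h e ≡ atom (nm e n)
    h-nm e n with e ≟E ε
    ... | yes p = ⊥-elim (n p)
    ... | no _ = refl

    g′ : P ⊎ R.V → Q ⊎ R.V → Fm E'
    g′ (inl p) _ = atom (nm (fst (kP p)) (snd (kP p)))
    g′ (inr _) (inl q) = atom (nm (fst (kQ q)) (snd (kQ q)))
    g′ (inr _) (inr _) = φ

    g : R.E → Fm E'
    g r = g′ (R.up r) (R.dn r)

    h-jE : ∀ r → h (jE r) ≡ g r
    h-jE r = go (R.up r) (R.dn r) refl refl
      where
      go : ∀ x y → R.up r ≡ x → R.dn r ≡ y → h (jE r) ≡ g′ x y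
      go (inl p) y e1 e2 = trans (cong (h ∘ jE) (snd (snd (X.topR p)) r e1)) (h-nm _ _)
      go (inr x) (inl q) e1 e2 = trans (cong (h ∘ jE) (snd (snd (X.botR q)) r e2)) (h-nm _ _)
      go (inr x) (inr y) e1 e2 = trans (cong (h ∘ jE) (X.only r e1 e2)) h-ε

    Patch : R.V → Set
    Patch y = N bar A' at' (bind g (mapFm (X.iR y) (srcF (R.lab y)))) (bind g (mapFm (X.oR y) (tgtF (R.lab y))))

    module _ (keeps : Keeps) (own : VR → R.V) (patch : ∀ y → Patch y)
      (cnt0 : ∀ y k → fold (δ (SumP.≡-dec _≟K_ _≟R_) (inl k)) (patch y) ≡ 0)
      (cnt1 : ∀ y z → fold (δ (SumP.≡-dec _≟K_ _≟R_) (inr z)) (patch y) ≡ δ (finite-≟ X.finR) (own z) y) where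
      open Keeps keeps

      private
        _≟'_ : DecEq (KV ⊎ VR)
        _≟'_ = SumP.≡-dec _≟K_ _≟R_

        owner : KV ⊎ VR → A.V
        owner (inl k) = fst k
        owner (inr z) = jV (own z)

        bind-map : ∀ {n} (i : Fin n → R.E) (Z : Fm (Fin n)) → bind h (mapFm (jE ∘ i) Z) ≡ bind g (mapFm i Z)
        bind-map i Z = trans (bind-bind h _ Z) (trans (bind-cong (λ j → h-jE (i j)) Z) (sym (bind-bind g _ Z)))

        bind-nm : ∀ {n} (i : Fin n → A.E) (ne : ∀ j → i j ≢ ε) (Z : Fm (Fin n)) → bind h (mapFm i Z) ≡ mapFm (λ j → nm (i j) (ne j)) Z
        bind-nm i ne Z = trans (bind-bind h _ Z) (bind-cong (λ j → h-nm (i j) (ne j)) Z)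

        ne-up : ∀ {v : KV} {n} {i : Fin n → A.E} → IsPorts A.up (fst v) i → ∀ j → i j ≢ ε
        ne-up {v} Z j = Up.ver≢ {v = v} (hit Z j)
        ne-dn : ∀ {v : KV} {n} {i : Fin n → A.E} → IsPorts A.dn (fst v) i → ∀ j → i j ≢ ε
        ne-dn {v} Z j = Dn.ver≢ {v = v} (hit Z j)

        redex-patch : ∀ y k v i o → v ≡ jV y → R.lab y ≡ k → IsPorts A.dn v i → IsPorts A.up v o →
          Σ (N bar A' at' (bind h (mapFm i (srcF k))) (bind h (mapFm o (tgtF k)))) λ d → ∀ f → fold f d ≡ fold f (patch y)
        redex-patch y k v i o refl refl p q
          with reorder-ins {bar = bar} {A = A} {at = S.at} {A' = A'} {at' = at'} h (R.lab y) p (ji y)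
             | reorder-outs {bar = bar} {A = A} {at = S.at} {A' = A'} {at' = at'} h (R.lab y) (jo y) q
        ... | (c , c0) | (d , d0) = (c ⨾ eqN (bind-map (X.iR y) (srcF (R.lab y))) ⨾ patch y ⨾ eqN (sym (bind-map (X.oR y) (tgtF (R.lab y)))) ⨾ d) ,
              λ f → trans (cong₂ _+_ (c0 f) (cong (fold f (patch y) +_) (d0 f))) (ℕP.+-identityʳ _)

        patches : Patches {bar = bar} {A = A} {at = S.at} {A' = A'} {at' = at'} h (λ _ → ⊤)
        patches k v i o _ l p q ok with jV? v
        ... | yes (y , e) = fst (redex-patch y k v i o e (trans (sym (jlab y)) (trans (cong A.lab (sym e)) l)) p q)
        ... | no n = eqN (bind-nm i (ne-dn {v = v'} p) (srcF k)) ⨾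
                     vx k (inl v') _ _ (trans (lab-nm v') l) (ports-dn v' p (ne-dn {v = v'} p)) (ports-up v' q (ne-up {v = v'} q))
                       (AtOK-cong bar k (λ j → at-nm (i j) _) (λ j → at-nm (o j) _) ok) ⨾
                     eqN (sym (bind-nm o (ne-up {v = v'} q) (tgtF k)))
          where
          v' : KV
          v' = v , λ y p → n (y , p)

        patches-count : ∀ v' k v i o z l p q ok → fold (δ _≟'_ v') (patches k v i o z l p q ok) ≡ δ S._≟V_ (owner v') v
        patches-count v' k v i o z l p q ok with jV? v
        patches-count (inl v') k v i o z l p q ok | yes (y , e) =
          trans (snd (redex-patch y k v i o e (trans (sym (jlab y)) (trans (cong A.lab (sym e)) l)) p q) _) (trans (cnt0 y v') (sym (δ-no S._≟V_ λ e' → snd v' y (trans e' e))))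
        patches-count (inr w) k v i o z l p q ok | yes (y , refl) =
          trans (snd (redex-patch y k v i o refl (trans (sym (jlab y)) l) p q) _) (trans (cnt1 y w) (tr (finite-≟ X.finR (own w) y)))
          where
          tr : Dec (own w ≡ y) → δ (finite-≟ X.finR) (own w) y ≡ δ S._≟V_ (jV (own w)) (jV y)
          tr (yes e') = trans (δ-yes (finite-≟ X.finR) e') (sym (δ-yes S._≟V_ (cong jV e')))
          tr (no n') = trans (δ-no (finite-≟ X.finR) n') (sym (δ-no S._≟V_ (n' ∘ jV-inj)))
        patches-count (inr w) k v i o z l p q ok | no n =
          trans (ℕP.+-identityʳ _) (trans (δ-no _≟'_ {inr w} {inl (v , λ y p → n (y , p))} λ ()) (sym (δ-no S._≟V_ λ e → n (own w , sym e))))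
        patches-count (inl v') k v i o z l p q ok | no n = trans (ℕP.+-identityʳ _) (tr (fst v' S.≟V v))
          where
          tr : Dec (fst v' ≡ v) → δ _≟'_ (inl v') (inl (v , λ y p → n (y , p))) ≡ δ S._≟V_ (fst v') v
          tr (yes refl) = trans (δ-yes _≟'_ refl) (sym (δ-yes S._≟V_ refl))
          tr (no n') = trans (δ-no _≟'_ λ { refl → n' refl }) (sym (δ-no S._≟V_ n'))

        top≢ : ∀ u → S.topE u ≢ ε
        top≢ u = Up.bnd≢ (S.top-up u)
        bot≢ : ∀ l → S.botE l ≢ ε
        bot≢ l = Dn.bnd≢ (S.bot-dn l)
        topE' : U → E'
        topE' u = nm (S.topE u) (top≢ u)
        botE' : L → E'
        botE' l = nm (S.botE l) (bot≢ l)

        moved : N bar A' at' (bind h (mapFm S.topE α)) (bind h (mapFm S.botE β))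
        moved = translate h patches S.der (allV _ S.der)

      transferred : NStruct bar A' aU aL α β
      transferred = record
        { _≟V_ = _≟'_ ; at = at' ; topE = topE' ; botE = botE'
        ; top-up = λ u → up-nm _ _ u (S.top-up u)
        ; top-un = λ e' u p → let (e , q , r) = up-un e' u p in un-up e' u e (S.top-un e u q) r
        ; bot-dn = λ l → dn-nm _ _ l (S.bot-dn l)
        ; bot-un = λ e' l p → let (e , q , r) = dn-un e' l p in un-dn e' l e (S.bot-un e l q) r
        ; at-top = λ u → trans (at-nm _ _) (S.at-top u)
        ; at-bot = λ l → trans (at-nm _ _) (S.at-bot l)
        ; der = eqN (sym (trans (bind-bind h _ α) (bind-cong (λ u → h-nm _ (top≢ u)) α))) ⨾ moved ⨾
                eqN (trans (bind-bind h _ β) (bind-cong (λ l → h-nm _ (bot≢ l)) β))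
        ; full = λ v' → trans (ℕP.+-identityʳ _) (trans (fold-translate h patches (δ _≟'_ v') (δ S._≟V_ (owner v'))
                          (λ k v i o z l p q ok → patches-count v' k v i o z l p q ok) S.der (allV _ S.der)) (S.full (owner v'))) }
        where
        un-up : ∀ e' u e → e ≡ S.topE u → (∀ n → e' ≡ nm e n) → e' ≡ topE' u
        un-up e' u e refl r = r _
        un-dn : ∀ e' l e → e ≡ S.botE l → (∀ n → e' ≡ nm e n) → e' ≡ botE' l
        un-dn e' l e refl r = r _

module PlugEnd {KE KV RE RV B P Q : Set} {D : KE → Set} {Int : RE → Set}
  (kend : KE → (B ⊎ Q) ⊎ KV) (Rend : RE → P ⊎ RV) (Roth : RE → Q ⊎ RV) (nodrop : ∀ k → ¬ D k)
  (Int-end : ∀ {r} → Int r → Σ RV λ y → Rend r ≡ inr y)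
  (int : ∀ {r y x} → Rend r ≡ inr y → Roth r ≡ inr x → Int r)
  (kQ : Q → KE) (kQ-ok : ∀ q → kend (kQ q) ≡ inl (inr q)) (kQ-un : ∀ k q → kend k ≡ inl (inr q) → k ≡ kQ q)
  (rQ : ∀ q → Σ RE λ r → Roth r ≡ inl q × (∀ r' → Roth r' ≡ inl q → r' ≡ r))
  (nopass : ∀ r {p q} → Rend r ≡ inl p → Roth r ≡ inl q → ⊥)
  (nm : RE → (Σ KE λ k → ¬ D k) ⊎ Σ RE Int)
  (nm-q : ∀ r {y q} → Rend r ≡ inr y → Roth r ≡ inl q → nm r ≡ inl (kQ q , nodrop (kQ q)))
  (nm-int : ∀ {r} (i : Int r) → nm r ≡ inr (r , i)) where

  E' : Set
  E' = (Σ KE λ k → ¬ D k) ⊎ Σ RE Int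

  vQ : ∀ q → Σ RV λ y → Rend (fst (rQ q)) ≡ inr y
  vQ q with Rend (fst (rQ q)) in eq
  ... | inl p = ⊥-elim (nopass _ eq (fst (snd (rQ q))))
  ... | inr y = y , refl

  res : (B ⊎ Q) ⊎ KV → B ⊎ (KV ⊎ RV)
  res (inl (inl b)) = inl b
  res (inl (inr q)) = inr (inr (fst (vQ q)))
  res (inr v) = inr (inl v)

  gend : E' → B ⊎ (KV ⊎ RV)
  gend (inl (k , _)) = res (kend k)
  gend (inr (r , i)) = inr (inr (fst (Int-end i)))

  res-K : ∀ z {v} → res z ≡ inr (inl v) → z ≡ inr v
  res-K (inr v) refl = refl
  res-K (inl (inl _)) ()
  res-K (inl (inr _)) ()

  res-B : ∀ z {b} → res z ≡ inl b → z ≡ inl (inl b)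
  res-B (inl (inl b)) refl = refl
  res-B (inl (inr _)) ()
  res-B (inr _) ()

  ports-K : ∀ {I : Set} {v} {i : I → KE} → IsPorts kend v i → IsPorts gend (inl v) (λ j → inl (i j , nodrop (i j)))
  ports-K {I} {v} {i} Z = record { hit = λ j → cong res (hit Z j) ; inj = λ e → inj Z (cong fst (inl-inj e)) ; all = al }
    where
    al : ∀ x → gend x ≡ inr (inl v) → Σ I λ j → inl (i j , nodrop (i j)) ≡ x
    al (inl (k , d)) p = let (j , q) = all Z k (res-K (kend k) p) in j , cong inl (Σ≡ (λ _ _ → refl) q)

  ports-R : ∀ {I : Set} {y} {i : I → RE} → IsPorts Rend y i → IsPorts gend (inr y) (nm ∘ i)
  ports-R {I} {y} {i} Z = record { hit = λ j → ht (i j) (hit Z j) ; inj = λ {j} {k} e → inj Z (ij (i j) (i k) (hit Z j) (hit Z k) e) ; all = al }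
    where
    ht : ∀ r → Rend r ≡ inr y → gend (nm r) ≡ inr (inr y)
    ht r p with Roth r in eq
    ... | inr x rewrite nm-int (int p eq) = cong (λ z → inr (inr z)) (inr-inj (trans (sym (snd (Int-end (int p eq)))) p))
    ... | inl q rewrite nm-q r p eq | kQ-ok q = cong (λ z → inr (inr z)) (inr-inj (trans (sym (snd (vQ q)))
                           (trans (cong Rend (sym (snd (snd (rQ q)) r eq))) p)))
    ij : ∀ r r' → Rend r ≡ inr y → Rend r' ≡ inr y → nm r ≡ nm r' → r ≡ r'
    ij r r' p p' e with Roth r in eq | Roth r' in eq'
    ... | inr x | inr x' = cong fst (inr-inj (trans (sym (nm-int (int p eq))) (trans e (nm-int (int p' eq')))))
    ... | inr x | inl q = ⊥-elim (inl≢inr (trans (sym (nm-q r' p' eq')) (trans (sym e) (nm-int (int p eq)))))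
    ... | inl q | inr x = ⊥-elim (inl≢inr (trans (sym (nm-q r p eq)) (trans e (nm-int (int p' eq')))))
    ... | inl q | inl q' with inr-inj (inl-inj (trans (sym (kQ-ok q)) (trans (cong kend (cong fst (inl-inj
                                   (trans (sym (nm-q r p eq)) (trans e (nm-q r' p' eq')))))) (kQ-ok q'))))
    ...   | refl = trans (snd (snd (rQ q)) r eq) (sym (snd (snd (rQ q)) r' eq'))
    al : ∀ x → gend x ≡ inr (inr y) → Σ I λ j → nm (i j) ≡ x
    al (inr (r , z)) p with trans (snd (Int-end z)) (cong inr (inr-inj (inr-inj p)))
    ... | e = let (j , q) = all Z r e in j , trans (cong nm q) (nm-int z)
    al (inl (k , d)) p with kend k in eq
    ... | inl (inr q) with inr-inj (inr-inj p)
    ...   | refl = let (j , w) = all Z (fst (rQ q)) (snd (vQ q)) in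
      j , trans (cong nm w) (trans (nm-q (fst (rQ q)) (snd (vQ q)) (fst (snd (rQ q)))) (cong inl (Σ≡ (λ _ _ → refl) (sym (kQ-un k q eq)))))

  bnd : ∀ x {b} → gend x ≡ inl b → Σ KE λ k → Σ (¬ D k) λ d → x ≡ inl (k , d) × kend k ≡ inl (inl b)
  bnd (inl (k , d)) p = k , d , refl , res-B (kend k) p

module Plugged {U L P Q : Set} {K : Flow (U ⊎ Q) (L ⊎ P)} {R : Flow P Q} (S : Shape R)
  (kP : P → Flow.E K) (kP-unique : ∀ p → Flow.dn K (kP p) ≡ inl (inr p) × (∀ k' → Flow.dn K k' ≡ inl (inr p) → k' ≡ kP p))
  (kQ : Q → Flow.E K) (kQ-unique : ∀ q → Flow.up K (kQ q) ≡ inl (inr q) × (∀ k' → Flow.up K k' ≡ inl (inr q) → k' ≡ kQ q)) where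
  private
    module K = Flow K
    module R = Flow R
    module S = Shape S

  nodrop : ∀ k → ¬ Dropped K R k
  nodrop k (p , r , q , _ , a , b) = S.nopass r a b

  nmR′ : ∀ r x y → R.up r ≡ x → R.dn r ≡ y → GE K R
  nmR′ r (inl p) _ _ _ = inl (kP p , nodrop (kP p))
  nmR′ r (inr _) (inl q) _ _ = inl (kQ q , nodrop (kQ q))
  nmR′ r (inr y) (inr x) a b = inr (r , ((y , a) , (x , b)))

  nmR : R.E → GE K R
  nmR r = nmR′ r (R.up r) (R.dn r) refl refl

  nm-q : ∀ r {y q} → R.up r ≡ inr y → R.dn r ≡ inl q → nmR r ≡ inl (kQ q , nodrop (kQ q))
  nm-q r = go (R.up r) (R.dn r) refl refl
    where
    go : ∀ x y (a : R.up r ≡ x) (b : R.dn r ≡ y) {z q} → x ≡ inr z → y ≡ inl q → nmR′ r x y a b ≡ inl (kQ q , nodrop (kQ q))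
    go _ _ a b refl refl = refl

  nm-p : ∀ r {y p} → R.dn r ≡ inr y → R.up r ≡ inl p → nmR r ≡ inl (kP p , nodrop (kP p))
  nm-p r = go (R.up r) (R.dn r) refl refl
    where
    go : ∀ x y (a : R.up r ≡ x) (b : R.dn r ≡ y) {z p} → y ≡ inr z → x ≡ inl p → nmR′ r x y a b ≡ inl (kP p , nodrop (kP p))
    go _ _ a b refl refl = refl

  nm-int : ∀ {r} (i : InternalR K R r) → nmR r ≡ inr (r , i)
  nm-int {r} ((y , a) , (x , b)) = go (R.up r) (R.dn r) refl refl a b
    where
    go : ∀ x' y' (a' : R.up r ≡ x') (b' : R.dn r ≡ y') → (a : R.up r ≡ inr y) → (b : R.dn r ≡ inr x) → nmR′ r x' y' a' b' ≡ inr (r , ((y , a) , (x , b)))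
    go (inl _) _ a' b' a b = ⊥-elim (inl≢inr (trans (sym a') a))
    go (inr _) (inl _) a' b' a b = ⊥-elim (inl≢inr (trans (sym b') b))
    go (inr _) (inr _) a' b' a b with inr-inj (trans (sym a') a) | inr-inj (trans (sym b') b)
    ... | refl | refl with uip a a' | uip b b'
    ... | refl | refl = refl

  module Up = PlugEnd {D = Dropped K R} {Int = InternalR K R} K.up R.up R.dn nodrop fst (λ a b → (_ , a) , (_ , b))
    kQ (λ q → fst (kQ-unique q)) (λ k q → snd (kQ-unique q) k) S.botR S.nopass nmR nm-q nm-int
  module Dn = PlugEnd {D = Dropped K R} {Int = InternalR K R} K.dn R.dn R.up nodrop snd (λ a b → (_ , b) , (_ , a))
    kP (λ p → fst (kP-unique p)) (λ k p → snd (kP-unique p) k) S.topR (λ r a b → S.nopass r b a) nmR nm-p nm-int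

  plugged : Flow U L
  plugged = record { V = GV K R ; E = GE K R ; lab = glab K R ; up = Up.gend ; dn = Dn.gend }

  plug-glue : IsGlue plugged K R
  plug-glue = record { vbij = ↔-refl ; ebij = ↔-refl ; lab-ok = λ _ → refl ; up-ok = up-ok ; dn-ok = dn-ok }
    where
    map2-id : ∀ {A B : Set} (z : A ⊎ B) → map₂ id z ≡ z
    map2-id (inl _) = refl
    map2-id (inr _) = refl
    up-ok′ : ∀ e → GUp K R e (Up.gend e)
    up-ok′ (inr (r , ((y , a) , _))) = y , a , refl
    up-ok′ (inl (k , d)) with K.up k in eq
    ... | inl (inl u) = Plug.top eq
    ... | inl (inr q) = Plug.rv eq (fst (snd (S.botR q))) (snd (Up.vQ q))
    ... | inr v = Plug.kv eq
    up-ok : ∀ e → GUp K R e (map₂ id (Up.gend e))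
    up-ok e = subst (GUp K R e) (sym (map2-id _)) (up-ok′ e)
    dn-ok′ : ∀ e → GDn K R e (Dn.gend e)
    dn-ok′ (inr (r , (_ , (x , b)))) = x , b , refl
    dn-ok′ (inl (k , d)) with K.dn k in eq
    ... | inl (inl u) = Plug.bot eq
    ... | inl (inr q) = Plug.rv eq (fst (snd (S.topR q))) (snd (Dn.vQ q))
    ... | inr v = Plug.kv eq
    dn-ok : ∀ e → GDn K R e (map₂ id (Dn.gend e))
    dn-ok e = subst (GDn K R e) (sym (map2-id _)) (dn-ok′ e)

module _ {At : Set} {bar : At → At} {U L : Set} {A : Flow U L} {at : Flow.E A → At} where
  private
    𝒩 : Fm (Flow.E A) → Fm (Flow.E A) → Set
    𝒩 = N bar A at

  𝔣⇒𝔱 : 𝒩 𝔣 𝔱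
  𝔣⇒𝔱 = lin (ax← ∧-unit) ⨾ idN ∧ᴺ lin (ax← 𝔱𝔱) ⨾ lin sw ⨾ lin (ax→ ∧-unit) ∨ᴺ idN ⨾ ∨-swap ⨾ lin (ax→ ∨-unit)

  ∨∧-mix : ∀ {a b c d} → 𝒩 ((a ∨ b) ∧ (c ∧ d)) ((a ∧ c) ∨ (b ∧ d))
  ∨∧-mix = lin (ax← ∧-assoc) ⨾ (∧-swap ⨾ lin sw) ∧ᴺ idN ⨾ ∧-swap ⨾ idN ∧ᴺ ∨-swap ⨾ lin sw ⨾ ∨-swap ⨾ ∧-swap ∨ᴺ ∧-swap

  ∧∨-mix : ∀ {a b c d} → 𝒩 ((a ∨ c) ∧ (b ∨ d)) ((c ∨ d) ∨ (a ∧ b))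
  ∧∨-mix = lin sw ⨾ (∧-swap ⨾ lin sw) ∨ᴺ idN ⨾ lin (ax→ ∨-assoc) ⨾ ∨-swap ⨾ idN ∨ᴺ ∧-swap

pick : ∀ {P Q V X : Set} → (P → X) → (Q → X) → X → P ⊎ V → Q ⊎ V → X
pick f g x (inl p) _ = f p
pick f g x (inr _) (inl q) = g q
pick f g x (inr _) (inr _) = x

module RhsShape (ρ : LRule) (np : NoPass ρ) = Shape (rhs-shape ρ np)
module LhsRedex (ρ : LRule) = Redex (lhs-redex ρ)

rhs-top : ∀ ρ → NoPass ρ → Fin (lp ρ) → Flow.E (rhs ρ)
rhs-top r-iii tt zero = # 0
rhs-top r-iv tt ()
rhs-top r-v tt ()
rhs-top r-vi tt ()
rhs-top r-vii tt zero = # 0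
rhs-top r-vii tt (suc zero) = # 1
rhs-top r-viii tt zero = # 3
rhs-top r-viii tt (suc zero) = # 4
rhs-top r-viii tt (suc (suc zero)) = # 0
rhs-top r-ix tt ()
rhs-top r-x tt zero = # 0
rhs-top r-x tt (suc zero) = # 1

rhs-top-ok : ∀ ρ np p → Flow.up (rhs ρ) (rhs-top ρ np p) ≡ inl p
rhs-top-ok r-iii tt zero = refl
rhs-top-ok r-iv tt ()
rhs-top-ok r-v tt ()
rhs-top-ok r-vi tt ()
rhs-top-ok r-vii tt zero = refl
rhs-top-ok r-vii tt (suc zero) = refl
rhs-top-ok r-viii tt zero = refl
rhs-top-ok r-viii tt (suc zero) = refl
rhs-top-ok r-viii tt (suc (suc zero)) = refl
rhs-top-ok r-ix tt ()
rhs-top-ok r-x tt zero = refl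
rhs-top-ok r-x tt (suc zero) = refl

rhs-bot : ∀ ρ → NoPass ρ → Fin (lq ρ) → Flow.E (rhs ρ)
rhs-bot r-iii tt ()
rhs-bot r-iv tt zero = # 0
rhs-bot r-v tt ()
rhs-bot r-vi tt zero = # 0
rhs-bot r-vi tt (suc zero) = # 1
rhs-bot r-vii tt ()
rhs-bot r-viii tt ()
rhs-bot r-ix tt zero = # 3
rhs-bot r-ix tt (suc zero) = # 4
rhs-bot r-ix tt (suc (suc zero)) = # 0
rhs-bot r-x tt zero = # 2
rhs-bot r-x tt (suc zero) = # 3

rhs-bot-ok : ∀ ρ np p → Flow.dn (rhs ρ) (rhs-bot ρ np p) ≡ inl p
rhs-bot-ok r-iii tt ()
rhs-bot-ok r-iv tt zero = refl
rhs-bot-ok r-v tt ()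
rhs-bot-ok r-vi tt zero = refl
rhs-bot-ok r-vi tt (suc zero) = refl
rhs-bot-ok r-vii tt ()
rhs-bot-ok r-viii tt ()
rhs-bot-ok r-ix tt zero = refl
rhs-bot-ok r-ix tt (suc zero) = refl
rhs-bot-ok r-ix tt (suc (suc zero)) = refl
rhs-bot-ok r-x tt zero = refl
rhs-bot-ok r-x tt (suc zero) = refl

subst-fm : ∀ ρ → NoPass ρ → {E : Set} → (Flow.E (rhs ρ) → E) → Fm E
subst-fm r-iii tt n = 𝔣
subst-fm r-iv tt n = 𝔱
subst-fm r-v tt n = 𝔣
subst-fm r-vi tt n = 𝔣
subst-fm r-vii tt n = 𝔱
subst-fm r-viii tt n = atom (n (# 3)) ∨ atom (n (# 4))
subst-fm r-ix tt n = atom (n (# 3)) ∧ atom (n (# 4))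
subst-fm r-x tt n = atom (n (# 2)) ∧ atom (n (# 3))

-- the vertex of the redex whose instance is replaced by instances of a given new vertex
own : ∀ ρ → NoPass ρ → Flow.V (rhs ρ) → Flow.V (lhs ρ)
own r-iii tt _ = # 1
own r-iv tt _ = # 0
own r-v tt _ = # 0
own r-vi tt _ = # 1
own r-vii tt _ = # 0
own r-viii tt _ = # 1
own r-ix tt _ = # 0
own r-x tt _ = # 0

new-total : ∀ ρ → NoPass ρ → Flow.V (lhs ρ) → (Flow.V (rhs ρ) → ℕ) → ℕ
new-total r-iii tt zero f = 0
new-total r-iii tt (suc zero) f = f (# 0) + 0
new-total r-iv tt zero f = f (# 0)
new-total r-iv tt (suc zero) f = 0
new-total r-v tt zero f = 0
new-total r-v tt (suc zero) f = 0
new-total r-vi tt zero f = 0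
new-total r-vi tt (suc zero) f = f (# 0) + f (# 1)
new-total r-vii tt zero f = (f (# 0) + f (# 1)) + 0
new-total r-vii tt (suc zero) f = 0
new-total r-viii tt zero f = 0
new-total r-viii tt (suc zero) f = f (# 0) + ((f (# 1) + f (# 2)) + 0)
new-total r-ix tt zero f = (f (# 1) + f (# 2)) + (f (# 0) + 0)
new-total r-ix tt (suc zero) f = 0
new-total r-x tt zero f = (f (# 0) + f (# 1)) + (f (# 2) + f (# 3))
new-total r-x tt (suc zero) f = 0

new-total-cong : ∀ ρ np y {f g} → (∀ z → f z ≡ g z) → new-total ρ np y f ≡ new-total ρ np y g
new-total-cong r-iii tt zero e = refl
new-total-cong r-iii tt (suc zero) e rewrite e (# 0) = refl
new-total-cong r-iv tt zero e rewrite e (# 0) = refl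
new-total-cong r-iv tt (suc zero) e = refl
new-total-cong r-v tt zero e = refl
new-total-cong r-v tt (suc zero) e = refl
new-total-cong r-vi tt zero e = refl
new-total-cong r-vi tt (suc zero) e rewrite e (# 0) | e (# 1) = refl
new-total-cong r-vii tt zero e rewrite e (# 0) | e (# 1) = refl
new-total-cong r-vii tt (suc zero) e = refl
new-total-cong r-viii tt zero e = refl
new-total-cong r-viii tt (suc zero) e rewrite e (# 0) | e (# 1) | e (# 2) = refl
new-total-cong r-ix tt zero e rewrite e (# 1) | e (# 2) | e (# 0) = refl
new-total-cong r-ix tt (suc zero) e = refl
new-total-cong r-x tt zero e rewrite e (# 0) | e (# 1) | e (# 2) | e (# 3) = refl
new-total-cong r-x tt (suc zero) e = refl

new-total-0 : ∀ ρ np y → new-total ρ np y (λ _ → 0) ≡ 0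
new-total-0 r-iii tt zero = refl
new-total-0 r-iii tt (suc zero) = refl
new-total-0 r-iv tt zero = refl
new-total-0 r-iv tt (suc zero) = refl
new-total-0 r-v tt zero = refl
new-total-0 r-v tt (suc zero) = refl
new-total-0 r-vi tt zero = refl
new-total-0 r-vi tt (suc zero) = refl
new-total-0 r-vii tt zero = refl
new-total-0 r-vii tt (suc zero) = refl
new-total-0 r-viii tt zero = refl
new-total-0 r-viii tt (suc zero) = refl
new-total-0 r-ix tt zero = refl
new-total-0 r-ix tt (suc zero) = refl
new-total-0 r-x tt zero = refl
new-total-0 r-x tt (suc zero) = refl

new-total-δ : ∀ ρ np y z → new-total ρ np y (δ (finite-≟ (RhsShape.finR ρ np)) z) ≡ δ (finite-≟ (LhsRedex.finR ρ)) (own ρ np z) y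
new-total-δ r-iii tt zero zero = refl
new-total-δ r-iii tt (suc zero) zero = refl
new-total-δ r-iv tt zero zero = refl
new-total-δ r-iv tt (suc zero) zero = refl
new-total-δ r-v tt y ()
new-total-δ r-vi tt zero zero = refl
new-total-δ r-vi tt zero (suc zero) = refl
new-total-δ r-vi tt (suc zero) zero = refl
new-total-δ r-vi tt (suc zero) (suc zero) = refl
new-total-δ r-vii tt zero zero = refl
new-total-δ r-vii tt zero (suc zero) = refl
new-total-δ r-vii tt (suc zero) zero = refl
new-total-δ r-vii tt (suc zero) (suc zero) = refl
new-total-δ r-viii tt zero zero = refl
new-total-δ r-viii tt zero (suc zero) = refl
new-total-δ r-viii tt zero (suc (suc zero)) = refl
new-total-δ r-viii tt (suc zero) zero = refl
new-total-δ r-viii tt (suc zero) (suc zero) = refl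
new-total-δ r-viii tt (suc zero) (suc (suc zero)) = refl
new-total-δ r-ix tt zero zero = refl
new-total-δ r-ix tt zero (suc zero) = refl
new-total-δ r-ix tt zero (suc (suc zero)) = refl
new-total-δ r-ix tt (suc zero) zero = refl
new-total-δ r-ix tt (suc zero) (suc zero) = refl
new-total-δ r-ix tt (suc zero) (suc (suc zero)) = refl
new-total-δ r-x tt zero zero = refl
new-total-δ r-x tt zero (suc zero) = refl
new-total-δ r-x tt zero (suc (suc zero)) = refl
new-total-δ r-x tt zero (suc (suc (suc zero))) = refl
new-total-δ r-x tt (suc zero) zero = refl
new-total-δ r-x tt (suc zero) (suc zero) = refl
new-total-δ r-x tt (suc zero) (suc (suc zero)) = refl
new-total-δ r-x tt (suc zero) (suc (suc (suc zero))) = refl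

module _ (ρ : LRule) (np : NoPass ρ) {E' : Set} (n : Flow.E (rhs ρ) → E') where
  redex-fm : Flow.E (lhs ρ) → Fm E'
  redex-fm r = pick (λ p → atom (n (rhs-top ρ np p))) (λ q → atom (n (rhs-bot ρ np q))) (subst-fm ρ np n) (Flow.up (lhs ρ) r) (Flow.dn (lhs ρ) r)

module _ {At : Set} {bar : At → At} {U L : Set} {A' : Flow U L} {at' : Flow.E A' → At} where

  NewVertices : ∀ ρ → NoPass ρ → (Flow.E (rhs ρ) → Flow.E A') → Set
  NewVertices ρ np n = ∀ z → N bar A' at' (mapFm (n ∘ RhsShape.iR ρ np z) (srcF (Flow.lab (rhs ρ) z)))
                                          (mapFm (n ∘ RhsShape.oR ρ np z) (tgtF (Flow.lab (rhs ρ) z)))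

  patch : ∀ ρ np n → NewVertices ρ np n → ∀ y →
    N bar A' at' (bind (redex-fm ρ np n) (mapFm (LhsRedex.iR ρ y) (srcF (Flow.lab (lhs ρ) y))))
                 (bind (redex-fm ρ np n) (mapFm (LhsRedex.oR ρ y) (tgtF (Flow.lab (lhs ρ) y))))
  patch r-iii tt n w zero = idN
  patch r-iii tt n w (suc zero) = idN ∧ᴺ w (# 0) ⨾ lin (ax→ ∧-unit)
  patch r-iv tt n w zero = lin (ax← ∨-unit) ⨾ idN ∨ᴺ w (# 0)
  patch r-iv tt n w (suc zero) = idN
  patch r-v tt n w zero = idN
  patch r-v tt n w (suc zero) = 𝔣⇒𝔱
  patch r-vi tt n w zero = idN
  patch r-vi tt n w (suc zero) = lin (ax← 𝔣𝔣) ⨾ w (# 0) ∧ᴺ w (# 1)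
  patch r-vii tt n w zero = w (# 0) ∨ᴺ w (# 1) ⨾ lin (ax→ 𝔱𝔱)
  patch r-vii tt n w (suc zero) = idN
  patch r-viii tt n w zero = idN
  patch r-viii tt n w (suc zero) = idN ∧ᴺ w (# 0) ⨾ ∨∧-mix ⨾ w (# 1) ∨ᴺ w (# 2) ⨾ lin (ax→ ∨-unit)
  patch r-ix tt n w zero = lin (ax← ∧-unit) ⨾ w (# 1) ∧ᴺ w (# 2) ⨾ ∧∨-mix ⨾ w (# 0) ∨ᴺ idN
  patch r-ix tt n w (suc zero) = idN
  patch r-x tt n w zero = w (# 0) ∨ᴺ w (# 1) ⨾ lin md ⨾ w (# 2) ∧ᴺ w (# 3)
  patch r-x tt n w (suc zero) = idN

  fold-patch : ∀ ρ np n (w : NewVertices ρ np n) y f → fold f (patch ρ np n w y) ≡ new-total ρ np y (λ z → fold f (w z))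
  fold-patch r-iii tt n w zero f = refl
  fold-patch r-iii tt n w (suc zero) f = refl
  fold-patch r-iv tt n w zero f = refl
  fold-patch r-iv tt n w (suc zero) f = refl
  fold-patch r-v tt n w zero f = refl
  fold-patch r-v tt n w (suc zero) f = refl
  fold-patch r-vi tt n w zero f = refl
  fold-patch r-vi tt n w (suc zero) f = refl
  fold-patch r-vii tt n w zero f = refl
  fold-patch r-vii tt n w (suc zero) f = refl
  fold-patch r-viii tt n w zero f = refl
  fold-patch r-viii tt n w (suc zero) f = refl
  fold-patch r-ix tt n w zero f = refl
  fold-patch r-ix tt n w (suc zero) f = refl
  fold-patch r-x tt n w zero f = refl
  fold-patch r-x tt n w (suc zero) f = refl

module _ {At : Set} {bar : At → At} (invol : ∀ a → bar (bar a) ≡ a) where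

  -- In viii and ix the new internal edges carry the dual atom.
  internal-atom : LRule → At → At
  internal-atom r-viii a = bar a
  internal-atom r-ix a = bar a
  internal-atom _ a = a

  module _ (ρ : LRule) (aP : Fin (lp ρ) → At) (aQ : Fin (lq ρ) → At) (a : At) where
    lhs-atom : Flow.E (lhs ρ) → At
    lhs-atom r = pick aP aQ a (Flow.up (lhs ρ) r) (Flow.dn (lhs ρ) r)
    rhs-atom : Flow.E (rhs ρ) → At
    rhs-atom r = pick aP aQ (internal-atom ρ a) (Flow.up (rhs ρ) r) (Flow.dn (rhs ρ) r)

  rhsOK : ∀ ρ np aP aQ a →
    (∀ y → AtOK bar (Flow.lab (lhs ρ) y) (lhs-atom ρ aP aQ a ∘ LhsRedex.iR ρ y) (lhs-atom ρ aP aQ a ∘ LhsRedex.oR ρ y)) →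
    ∀ z → AtOK bar (Flow.lab (rhs ρ) z) (rhs-atom ρ aP aQ a ∘ RhsShape.iR ρ np z) (rhs-atom ρ aP aQ a ∘ RhsShape.oR ρ np z)
  rhsOK r-iii tt aP aQ a h zero = tt
  rhsOK r-iv tt aP aQ a h zero = tt
  rhsOK r-v tt aP aQ a h ()
  rhsOK r-vi tt aP aQ a h zero = tt
  rhsOK r-vi tt aP aQ a h (suc zero) = tt
  rhsOK r-vii tt aP aQ a h zero = tt
  rhsOK r-vii tt aP aQ a h (suc zero) = tt
  rhsOK r-viii tt aP aQ a h zero = sym (h (# 1)) , sym (h (# 1))
  rhsOK r-viii tt aP aQ a h (suc zero) = cong bar (sym (fst (h (# 0))))
  rhsOK r-viii tt aP aQ a h (suc (suc zero)) = cong bar (sym (snd (h (# 0))))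
  rhsOK r-ix tt aP aQ a h zero = trans (cong bar (h (# 0))) (invol _) , trans (cong bar (h (# 0))) (invol _)
  rhsOK r-ix tt aP aQ a h (suc zero) = cong bar (sym (fst (h (# 1))))
  rhsOK r-ix tt aP aQ a h (suc (suc zero)) = cong bar (sym (snd (h (# 1))))
  rhsOK r-x tt aP aQ a h zero = sym (fst (h (# 0))) , sym (fst (h (# 0)))
  rhsOK r-x tt aP aQ a h (suc zero) = sym (snd (h (# 0))) , sym (snd (h (# 0)))
  rhsOK r-x tt aP aQ a h (suc (suc zero)) = sym (fst (h (# 1))) , sym (fst (h (# 1)))
  rhsOK r-x tt aP aQ a h (suc (suc (suc zero))) = sym (snd (h (# 1))) , sym (snd (h (# 1)))

redex-atoms : ∀ {At : Set} {bar : At → At} (invol : ∀ a → bar (bar a) ≡ a) {U L P Q : Set} {A : Flow U L} {R : Flow P Q} {X : Redex R}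
  {aU : U → At} {aL : L → At} {α : Fm U} {β : Fm L} (S : NStruct bar A aU aL α β) (F : Emb A X) →
  ∀ y → AtOK bar (Flow.lab R y) (NStruct.at S ∘ Emb.jE F ∘ Redex.iR X y) (NStruct.at S ∘ Emb.jE F ∘ Redex.oR X y)
redex-atoms {bar = bar} invol {A = A} {R} {X} S F y = go (Split.k I) (Split.lk I) (Split.pi I) (Split.po I) (Split.ok I)
  where
  module S = NStruct S
  module F = Emb F
  I = split S._≟V_ (F.jV y) S.der (λ z → ℕP.1+n≢0 (trans (sym (S.full (F.jV y))) z))
  go : ∀ k {i o} → Flow.lab A (F.jV y) ≡ k → IsPorts (Flow.dn A) (F.jV y) i → IsPorts (Flow.up A) (F.jV y) o →
    AtOK bar k (S.at ∘ i) (S.at ∘ o) → AtOK bar (Flow.lab R y) (S.at ∘ F.jE ∘ Redex.iR X y) (S.at ∘ F.jE ∘ Redex.oR X y)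
  go k l p q ok with trans (sym l) (F.jlab y)
  ... | refl = AtOK-reorder invol S.at k (ports-≤2 (ins≤2 k) p (F.ji y)) (ports-≤2 (outs≤2 k) q (F.jo y)) ok

module Replace {At : Set} {bar : At → At} (invol : ∀ a → bar (bar a) ≡ a) (ρ : LRule) (np : NoPass ρ)
  {U L : Set} {A : Flow U L} (W : WF A) {aU : U → At} {aL : L → At} {α : Fm U} {β : Fm L}
  (S : NStruct bar A aU aL α β) (F : Emb A (lhs-redex ρ)) where
  private
    module A = Flow A
    module S = NStruct S
    module R = Flow (rhs ρ)
    module X = LhsRedex ρ
    module C = Cut W F
    S' : Shape (rhs ρ)
    S' = rhs-shape ρ np
    module S' = Shape S'
    module G = Plugged {K = C.K} S' C.kP C.kP-unique C.kQ C.kQ-unique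

    E' : Set
    E' = GE C.K (rhs ρ)

    at' : E' → At
    at' (inl (k , _)) = S.at (fst k)
    at' (inr _) = internal-atom {bar = bar} invol ρ (S.at C.ε)

    nm : ∀ e → e ≢ C.ε → E'
    nm e n = inl ((e , n) , G.nodrop (e , n))

    φ : Fm E'
    φ = subst-fm ρ np G.nmR

    module T = Transfer {bar = bar} invol W F S (finite-≟ S'.finR) (glab C.K (rhs ρ)) G.Up.gend G.Dn.gend at' nm

    keeps : T.Keeps
    keeps = record
      { lab-nm = λ _ → refl ; at-nm = λ _ _ → refl
      ; ports-up = λ v {n} {i} Z ne → G.Up.ports-K {v = v} {i = λ j → i j , ne j} (record
          { hit = λ j → C.Up.kend≡ {k = i j , ne j} (C.Up.ver {v = v} (hit Z j)) ; inj = λ p → inj Z (cong fst p)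
          ; all = λ k p → let (j , q) = all Z (fst k) (C.Up.kend-ver p) in j , Σ≡ (λ _ _ → refl) q })
      ; ports-dn = λ v {n} {i} Z ne → G.Dn.ports-K {v = v} {i = λ j → i j , ne j} (record
          { hit = λ j → C.Dn.kend≡ {k = i j , ne j} (C.Dn.ver {v = v} (hit Z j)) ; inj = λ p → inj Z (cong fst p)
          ; all = λ k p → let (j , q) = all Z (fst k) (C.Dn.kend-ver p) in j , Σ≡ (λ _ _ → refl) q })
      ; up-nm = λ e n u p → cong G.Up.res (C.Up.kend≡ {k = e , n} (C.Up.bnd p))
      ; dn-nm = λ e n l p → cong G.Dn.res (C.Dn.kend≡ {k = e , n} (C.Dn.bnd p))
      ; up-un = λ e' u p → let (k , d , q , r) = G.Up.bnd e' p in fst k , C.Up.kend-bnd r , λ _ → q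
      ; dn-un = λ e' u p → let (k , d , q , r) = G.Dn.bnd e' p in fst k , C.Dn.kend-bnd r , λ _ → q }

    aP : Fin (lp ρ) → At
    aP p = S.at (fst (C.kP p))
    aQ : Fin (lq ρ) → At
    aQ q = S.at (fst (C.kQ q))

    at-lhs : ∀ r → lhs-atom {bar = bar} invol ρ aP aQ (S.at C.ε) r ≡ S.at (C.jE r)
    at-lhs r = go _ _ refl refl
      where
      go : ∀ x y → Flow.up (lhs ρ) r ≡ x → Flow.dn (lhs ρ) r ≡ y → pick aP aQ (S.at C.ε) x y ≡ S.at (C.jE r)
      go (inl p) y a b = cong (S.at ∘ C.jE) (sym (snd (snd (X.topR p)) r a))
      go (inr x) (inl q) a b = cong (S.at ∘ C.jE) (sym (snd (snd (X.botR q)) r b))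
      go (inr x) (inr y) a b = cong (S.at ∘ C.jE) (sym (X.only r a b))

    at-rhs : ∀ r → at' (G.nmR r) ≡ rhs-atom {bar = bar} invol ρ aP aQ (S.at C.ε) r
    at-rhs r = go _ _ refl refl
      where
      go : ∀ x y (a : R.up r ≡ x) (b : R.dn r ≡ y) → at' (G.nmR′ r x y a b) ≡ pick aP aQ (internal-atom {bar = bar} invol ρ (S.at C.ε)) x y
      go (inl p) y a b = refl
      go (inr x) (inl q) a b = refl
      go (inr x) (inr y) a b = refl

    new-vertices : NewVertices {bar = bar} {A' = T.A'} {at' = at'} ρ np G.nmR
    new-vertices z = vx (R.lab z) (inr z) _ _ refl (G.Dn.ports-R (S'.iP z)) (G.Up.ports-R (S'.oP z))
      (AtOK-cong bar (R.lab z) (λ j → at-rhs (S'.iR z j)) (λ j → at-rhs (S'.oR z j))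
        (rhsOK {bar = bar} invol ρ np aP aQ (S.at C.ε)
          (λ y → AtOK-cong bar (Flow.lab (lhs ρ) y) (λ j → at-lhs (X.iR y j)) (λ j → at-lhs (X.oR y j)) (redex-atoms invol S F y)) z))

    g≡ : ∀ r → T.g φ r ≡ redex-fm ρ np G.nmR r
    g≡ r = go (Flow.up (lhs ρ) r) (Flow.dn (lhs ρ) r)
      where
      nmR-top : ∀ p r → R.up r ≡ inl p → G.nmR r ≡ inl (C.kP p , G.nodrop (C.kP p))
      nmR-top p r e = top (R.up r) (R.dn r) refl refl e
        where
        top : ∀ x y (a : R.up r ≡ x) (b : R.dn r ≡ y) → x ≡ inl p → G.nmR′ r x y a b ≡ inl (C.kP p , G.nodrop (C.kP p))
        top _ y a b refl = refl
      nmR-bot : ∀ q r → R.dn r ≡ inl q → G.nmR r ≡ inl (C.kQ q , G.nodrop (C.kQ q))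
      nmR-bot q r e = bot (R.up r) (R.dn r) refl refl e
        where
        bot : ∀ x y (a : R.up r ≡ x) (b : R.dn r ≡ y) → y ≡ inl q → G.nmR′ r x y a b ≡ inl (C.kQ q , G.nodrop (C.kQ q))
        bot (inl p) _ a b refl = ⊥-elim (S'.nopass r a b)
        bot (inr x) _ a b refl = refl
      go : ∀ x y → T.g′ φ x y ≡ pick (λ p → atom (G.nmR (rhs-top ρ np p))) (λ q → atom (G.nmR (rhs-bot ρ np q))) φ x y
      go (inl p) y = cong atom (sym (nmR-top p _ (rhs-top-ok ρ np p)))
      go (inr x) (inl q) = cong atom (sym (nmR-bot q _ (rhs-bot-ok ρ np q)))
      go (inr x) (inr y) = refl

    patch′ : ∀ y → T.Patch φ y
    patch′ y = eqN (bind-cong g≡ (mapFm (X.iR y) (srcF (Flow.lab (lhs ρ) y)))) ⨾ patch ρ np G.nmR new-vertices y ⨾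
               eqN (sym (bind-cong g≡ (mapFm (X.oR y) (tgtF (Flow.lab (lhs ρ) y)))))

    fold-patch′ : ∀ y f → fold f (patch′ y) ≡ new-total ρ np y (f ∘ inr)
    fold-patch′ y f = trans (ℕP.+-identityʳ _) (fold-patch ρ np G.nmR new-vertices y f)

    _≟'_ : DecEq (C.KV ⊎ R.V)
    _≟'_ = SumP.≡-dec C._≟K_ (finite-≟ S'.finR)

    δ-inj2 : ∀ z z' → δ _≟'_ (inr z) (inr z') ≡ δ (finite-≟ S'.finR) z z'
    δ-inj2 z z' = go (finite-≟ S'.finR z z')
      where
      go : Dec (z ≡ z') → _
      go (yes p) = trans (δ-yes _≟'_ (cong inr p)) (sym (δ-yes (finite-≟ S'.finR) p))
      go (no n) = trans (δ-no _≟'_ (n ∘ inr-inj)) (sym (δ-no (finite-≟ S'.finR) n))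

  replaced : NStruct bar T.A' aU aL α β
  replaced = T.transferred φ keeps (own ρ np) patch′
    (λ y k → trans (fold-patch′ y _) (trans (new-total-cong ρ np y (λ z → δ-no _≟'_ {inl k} {inr z} λ ())) (new-total-0 ρ np y)))
    (λ y z → trans (fold-patch′ y _) (trans (new-total-cong ρ np y (δ-inj2 z)) (new-total-δ ρ np y z)))

  replaced-step : LStep ρ A T.A'
  replaced-step = record { K = C.K ; K-wf = C.K-wf ; gl = C.cut-glue ; gl' = G.plug-glue }

map1-inj : ∀ {X Y V : Set} (w z : X ⊎ V) → map₁ (inl {B = Y}) w ≡ map₁ inl z → w ≡ z
map1-inj (inl _) (inl _) refl = refl
map1-inj (inr _) (inr _) refl = refl

map2-inj : ∀ {X Y V : Set} (w z : X ⊎ V) → map₂ (inl {B = Y}) w ≡ map₂ inl z → w ≡ z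
map2-inj (inl _) (inl _) refl = refl
map2-inj (inr _) (inr _) refl = refl

-- Replacing a redex by a single edge, as in rules i and ii.
module Contract {At : Set} {bar : At → At} (invol : ∀ a → bar (bar a) ≡ a) {R : Flow (Fin 1) (Fin 1)} {X : Redex R}
  {U L : Set} {A : Flow U L} (W : WF A) {aU : U → At} {aL : L → At} {α : Fm U} {β : Fm L}
  (S : NStruct bar A aU aL α β) (F : Emb A X)
  (same : fst (Cut.kP W F zero) ≡ fst (Cut.kQ W F zero) → ⊥)
  (same-at : NStruct.at S (fst (Cut.kQ W F zero)) ≡ NStruct.at S (fst (Cut.kP W F zero))) where
  private
    module A = Flow A
    module S = NStruct S
    module C = Cut W F
    module K = Flow C.K
    module X = Redex X
    module R = Flow R

    R' : Flow (Fin 1) (Fin 1)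
    R' = rhs r-i

  kP kQ : C.KE
  kP = C.kP zero
  kQ = C.kQ zero

  private
    drop-P : ∀ {k} → k ≡ kP → Dropped C.K R' k
    drop-P refl = zero , zero , zero , fst (C.kP-unique zero) , refl , refl

    drop⇒P : ∀ {k} → Dropped C.K R' k → k ≡ kP
    drop⇒P {k} (zero , _ , _ , p , _) = snd (C.kP-unique zero) k p

    E' : Set
    E' = GE C.K R'

    keep : ∀ k → k ≢ kP → E'
    keep k n = inl (k , n ∘ drop⇒P)

    kQ≢kP : kQ ≢ kP
    kQ≢kP e = same (cong fst (sym e))

    nm′ : ∀ k → Dec (fst k ≡ fst kP) → E'
    nm′ k (yes _) = keep kQ kQ≢kP
    nm′ k (no n) = keep k (λ e → n (cong fst e))

  nm : ∀ e → e ≢ C.ε → E'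
  nm e n = nm′ (e , n) (e C.≟E fst kP)

  nm-kP : ∀ e n → e ≡ fst kP → nm e n ≡ keep kQ kQ≢kP
  nm-kP e n p with e C.≟E fst kP
  ... | yes _ = refl
  ... | no q = ⊥-elim (q p)

  nm-keep : ∀ k (n : k ≢ kP) → nm (fst k) (snd k) ≡ keep k n
  nm-keep k n with fst k C.≟E fst kP
  ... | yes p = ⊥-elim (n (Σ≡ (λ _ _ → refl) p))
  ... | no q = refl

  private
    no-Int : ∀ {Z : Set} → Σ (Fin 1) (InternalR C.K R') → Z
    no-Int (_ , ((() , _) , _))

    upP : Σ (U ⊎ K.V) λ z → K.up kP ≡ map₁ inl z
    upP with K.up kP in eq
    ... | inl (inl u) = inl u , refl
    ... | inl (inr zero) = ⊥-elim (kQ≢kP (sym (snd (C.kQ-unique zero) kP eq)))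
    ... | inr v = inr v , refl

    resU : (U ⊎ Fin 1) ⊎ K.V → U ⊎ K.V
    resU (inl (inl u)) = inl u
    resU (inl (inr _)) = fst upP
    resU (inr v) = inr v

    dnK : ∀ k → ¬ Dropped C.K R' k → Σ (L ⊎ K.V) λ z → K.dn k ≡ map₁ inl z
    dnK k d with K.dn k in eq
    ... | inl (inl u) = inl u , refl
    ... | inl (inr zero) = ⊥-elim (d (zero , zero , zero , refl , refl , refl))
    ... | inr v = inr v , refl

    up' : E' → U ⊎ (K.V ⊎ Fin 0)
    up' (inl (k , _)) = map₂ inl (resU (K.up k))
    up' (inr r) = no-Int r
    dn' : E' → L ⊎ (K.V ⊎ Fin 0)
    dn' (inl (k , d)) = map₂ inl (fst (dnK k d))
    dn' (inr r) = no-Int r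

    at' : E' → At
    at' (inl (k , _)) = S.at (fst k)
    at' (inr r) = no-Int r

    module T = Transfer {bar = bar} invol W F S (FinP._≟_ {0}) (glab C.K R') up' dn' at' nm

    upP≡ : ∀ {z} → K.up kP ≡ map₁ inl z → fst upP ≡ z
    upP≡ {z} p = map1-inj (fst upP) z (trans (sym (snd upP)) p)

    dnK≡ : ∀ {k d z} → K.dn k ≡ map₁ inl z → fst (dnK k d) ≡ z
    dnK≡ {k} {d} {z} p = map1-inj (fst (dnK k d)) z (trans (sym (snd (dnK k d))) p)

    up-end : ∀ k z → K.up k ≡ map₁ inl z → up' (nm (fst k) (snd k)) ≡ map₂ inl z
    up-end k z p with fst k C.≟E fst kP
    ... | yes e = trans (cong (λ w → map₂ inl (resU w)) (fst (C.kQ-unique zero)))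
                    (cong (map₂ inl) (upP≡ {z} (trans (cong K.up (Σ≡ (λ _ _ → refl) (sym e))) p)))
    ... | no n = trans (cong (λ w → map₂ inl (resU w)) p) (cong (map₂ inl) (res z))
      where
      res : ∀ z → resU (map₁ inl z) ≡ z
      res (inl _) = refl
      res (inr _) = refl

    dn≢P : ∀ k z → K.dn k ≡ map₁ inl z → k ≢ kP
    dn≢P k (inl _) p refl with () ← trans (sym p) (fst (C.kP-unique zero))
    dn≢P k (inr _) p refl with () ← trans (sym p) (fst (C.kP-unique zero))

    dn-end : ∀ k z → K.dn k ≡ map₁ inl z → dn' (nm (fst k) (snd k)) ≡ map₂ inl z
    dn-end k z p = trans (cong dn' (nm-keep k (dn≢P k z p))) (cong (map₂ inl) (dnK≡ {k} {_} {z} p))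

    up-inv : ∀ x z → up' x ≡ map₂ inl z → Σ C.KE λ k → K.up k ≡ map₁ inl z × (∀ n → x ≡ nm (fst k) n)
    up-inv (inr r) z p = no-Int r
    up-inv (inl (k , d)) z p with K.up k in eq
    ... | inl (inr zero) with snd (C.kQ-unique zero) k eq
    ...   | refl = kP , trans (snd upP) (cong (map₁ inl) (map2-inj (fst upP) z p)) , λ n → sym (nm-kP (fst kP) n refl)
    up-inv (inl (k , d)) (inl u) refl | inl (inl u) = k , eq , λ n → sym (nm-keep k (d ∘ drop-P))
    up-inv (inl (k , d)) (inr v) refl | inr v = k , eq , λ n → sym (nm-keep k (d ∘ drop-P))

    dn-inv : ∀ x z → dn' x ≡ map₂ inl z → Σ C.KE λ k → K.dn k ≡ map₁ inl z × (∀ n → x ≡ nm (fst k) n)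
    dn-inv (inr r) z p = no-Int r
    dn-inv (inl (k , d)) z p = k , trans (snd (dnK k d)) (cong (map₁ inl) (map2-inj (fst (dnK k d)) z p)) , λ n → sym (nm-keep k (d ∘ drop-P))

    nm-inj : ∀ {v : C.KV} k k' → K.up k ≡ inr v → K.up k' ≡ inr v → nm (fst k) (snd k) ≡ nm (fst k') (snd k') → k ≡ k'
    nm-inj k k' p q e with fst k C.≟E fst kP | fst k' C.≟E fst kP
    ... | yes a | yes b = Σ≡ (λ _ _ → refl) (trans a (sym b))
    ... | yes a | no b with () ← trans (sym q) (trans (cong K.up (sym (cong fst (inl-inj e)))) (fst (C.kQ-unique zero)))
    ... | no a | yes b with () ← trans (sym p) (trans (cong K.up (cong fst (inl-inj e))) (fst (C.kQ-unique zero)))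
    ... | no a | no b = cong fst (inl-inj e)

    keeps : T.Keeps
    keeps = record
      { lab-nm = λ _ → refl
      ; at-nm = at-nm
      ; ports-up = λ v {n} {i} Z ne → record
          { hit = λ j → up-end (i j , ne j) (inr v) (C.Up.kend≡ {k = i j , ne j} (C.Up.ver {v = v} (hit Z j)))
          ; inj = λ {j} {j'} e → inj Z (cong fst (nm-inj {v} (i j , ne j) (i j' , ne j')
              (C.Up.kend≡ {k = i j , ne j} (C.Up.ver {v = v} (hit Z j))) (C.Up.kend≡ {k = i j' , ne j'} (C.Up.ver {v = v} (hit Z j'))) e))
          ; all = λ x p → let (k , q , r) = up-inv x (inr v) p ; (j , w) = all Z (fst k) (C.Up.kend-ver q) in j , fin-up k r (i j) (ne j) w x }
      ; ports-dn = λ v {n} {i} Z ne → record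
          { hit = λ j → dn-end (i j , ne j) (inr v) (dnv v Z ne j)
          ; inj = λ {j} {j'} e → inj Z (cong (λ x → fst x) (inj-dn v Z ne j j' e))
          ; all = λ x p → let (k , q , r) = dn-inv x (inr v) p ; (j , w) = all Z (fst k) (C.Dn.kend-ver q) in j , fin-up k r (i j) (ne j) w x }
      ; up-nm = λ e n u p → up-end (e , n) (inl u) (C.Up.kend≡ {k = e , n} (C.Up.bnd p))
      ; dn-nm = λ e n u p → dn-end (e , n) (inl u) (C.Dn.kend≡ {k = e , n} (C.Dn.bnd p))
      ; up-un = λ x u p → let (k , q , r) = up-inv x (inl u) p in fst k , C.Up.kend-bnd q , r
      ; dn-un = λ x u p → let (k , q , r) = dn-inv x (inl u) p in fst k , C.Dn.kend-bnd q , r }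
      where
      at-nm : ∀ e n → at' (nm e n) ≡ S.at e
      at-nm e n with e C.≟E fst kP
      ... | yes refl = same-at
      ... | no _ = refl
      fin-up : ∀ k {x} → (∀ n → x ≡ nm (fst k) n) → ∀ e n → e ≡ fst k → ∀ y → nm e n ≡ x
      fin-up k r e n refl y = sym (r n)
      dnv : ∀ v {n} {i : Fin n → A.E} → IsPorts A.dn (fst v) i → (ne : ∀ j → i j ≢ C.ε) → ∀ j → K.dn (i j , ne j) ≡ inr v
      dnv v {i = i} Z ne j = C.Dn.kend≡ {k = i j , ne j} (C.Dn.ver {v = v} (hit Z j))
      inj-dn : ∀ v {n} {i : Fin n → A.E} (Z : IsPorts A.dn (fst v) i) (ne : ∀ j → i j ≢ C.ε) → ∀ j j' →
        nm (i j) (ne j) ≡ nm (i j') (ne j') → _≡_ {A = C.KE} (i j , ne j) (i j' , ne j')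
      inj-dn v {i = i} Z ne j j' e = cong fst (inl-inj (trans (sym (nm-keep (i j , ne j) (dn≢P (i j , ne j) (inr v) (dnv v Z ne j))))
        (trans e (nm-keep (i j' , ne j') (dn≢P (i j' , ne j') (inr v) (dnv v Z ne j'))))))

  contract-glue : IsGlue T.A' C.K R'
  contract-glue = record { vbij = ↔-refl ; ebij = ↔-refl ; lab-ok = λ _ → refl ; up-ok = up-ok ; dn-ok = dn-ok }
    where
    map2-id : ∀ {A B : Set} (z : A ⊎ B) → map₂ id z ≡ z
    map2-id (inl _) = refl
    map2-id (inr _) = refl
    viaP : ∀ z → K.up kP ≡ map₁ inl z → Plug.UpRes C.K R' kP (map₂ inl z)
    viaP (inl u) p = Plug.top p
    viaP (inr v) p = Plug.kv p
    up-ok′ : ∀ e → GUp C.K R' e (up' e)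
    up-ok′ (inr r) = no-Int r
    up-ok′ (inl (k , d)) with K.up k in eq
    ... | inl (inl u) = Plug.top eq
    ... | inl (inr zero) = Plug.pass {q = zero} {r = zero} {p = zero} {k = kP} eq refl refl (fst (C.kP-unique zero)) (viaP (fst upP) (snd upP))
    ... | inr v = Plug.kv eq
    up-ok : ∀ e → GUp C.K R' e (map₂ id (up' e))
    up-ok e = subst (GUp C.K R' e) (sym (map2-id _)) (up-ok′ e)
    dn-ok′ : ∀ e → GDn C.K R' e (dn' e)
    dn-ok′ (inr r) = no-Int r
    dn-ok′ (inl (k , d)) = go (fst (dnK k d)) (snd (dnK k d))
      where
      go : ∀ z → K.dn k ≡ map₁ inl z → Plug.DnRes C.K R' k (map₂ inl z)
      go (inl l) p = Plug.bot p
      go (inr v) p = Plug.kv p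
    dn-ok : ∀ e → GDn C.K R' e (map₂ id (dn' e))
    dn-ok e = subst (GDn C.K R' e) (sym (map2-id _)) (dn-ok′ e)

  contracted : (φ : Fm E') (patch : ∀ y → T.Patch φ y) → (∀ f y → fold f (patch y) ≡ 0) → NStruct bar T.A' aU aL α β
  contracted φ patch z = T.transferred φ keeps (λ ()) patch (λ y k → z _ y) (λ y ())

  edge : E'
  edge = keep kQ kQ≢kP

  g-top : ∀ φ r {z} → R.up r ≡ inl z → T.g φ r ≡ atom edge
  g-top φ r {zero} p = go (R.up r) (R.dn r) p
    where
    go : ∀ x y → x ≡ inl zero → T.g′ φ x y ≡ atom edge
    go _ y refl = cong atom (nm-kP (fst kP) _ refl)

  g-bot : ∀ φ r {y z} → R.up r ≡ inr y → R.dn r ≡ inl z → T.g φ r ≡ atom edge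
  g-bot φ r {y} {zero} p q = go (R.up r) (R.dn r) p q
    where
    go : ∀ x y' → x ≡ inr y → y' ≡ inl zero → T.g′ φ x y' ≡ atom edge
    go _ _ refl refl = cong atom (nm-keep kQ kQ≢kP)

no-loop : ∀ {U L} {A : Flow U L} → WF A → ∀ e v → Flow.up A e ≡ inr v → Flow.dn A e ≡ inr v → ⊥
no-loop {A = A} W e v p q = acyclic W ((e , ⇓) ∷ []) v ((tt , tt) , refl ∷ []) (cong (upPt A) p) (cong (dnPt A) q)

module _ {At : Set} {bar : At → At} (invol : ∀ a → bar (bar a) ≡ a) where

  LStepAt : ∀ {U L} ρ {A : Flow U L} (A' : Flow U L) → Emb A (lhs-redex ρ) → Set1
  LStepAt ρ {A} A' F = Σ (LStep ρ A A') λ st → ∀ y → from (IsGlue.vbij (LStep.gl st)) (inr y) ≡ Emb.jV F y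

  module _ {α β : Fm At} {A : Flow (Occ α) (Occ β)} (W : WF A) (S : NStruct bar A (atomAt α) (atomAt β) (occFm α) (occFm β)) where
    private
      finish : ∀ ρ (F : Emb A (lhs-redex ρ)) {A'} → NStruct bar A' (atomAt α) (atomAt β) (occFm α) (occFm β) →
        IsGlue A' (Cut.K W F) (rhs ρ) → Σ (Deriv bar α β) λ d → LStepAt ρ (flowOf d) F
      finish ρ F S' g with realizes S'
      ... | (d , iso) = d , record { K = Cut.K W F ; K-wf = Cut.K-wf W F ; gl = Cut.cut-glue W F ; gl' = glue-iso iso g } , λ y → refl

      via-replace : ∀ ρ → NoPass ρ → (F : Emb A (lhs-redex ρ)) → Σ (Deriv bar α β) λ d → LStepAt ρ (flowOf d) F
      via-replace ρ np F = finish ρ F (Replace.replaced invol ρ np W S F) (LStep.gl' (Replace.replaced-step {bar = bar} invol ρ np W S F))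

      loop : ∀ {P Q} {R : Flow P Q} {X : Redex R} (F : Emb A X) r r' y → Flow.dn R r ≡ inr y → Flow.up R r' ≡ inr y →
        Emb.jE F r ≡ Emb.jE F r' → ⊥
      loop F r r' y p q e = no-loop W (Emb.jE F r) (Emb.jV F y)
        (trans (cong (Flow.up A) e) (Cut.Up.jend W F q)) (Cut.Dn.jend W F p)

    local-step : ∀ ρ (F : Emb A (lhs-redex ρ)) → Σ (Deriv bar α β) λ d → LStepAt ρ (flowOf d) F
    local-step r-i F = finish r-i F (C.contracted 𝔣 patch1 zeros) C.contract-glue
      where
      tp : fst (Redex.topR (lhs-redex r-i) zero) ≡ # 1
      tp = sym (snd (snd (Redex.topR (lhs-redex r-i) zero)) (# 1) refl)
      bp : fst (Redex.botR (lhs-redex r-i) zero) ≡ # 2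
      bp = sym (snd (snd (Redex.botR (lhs-redex r-i) zero)) (# 2) refl)
      atoms = redex-atoms {bar = bar} invol S F (# 1)
      module C = Contract {bar = bar} invol W S F
        (λ e → loop F (# 1) (# 2) (# 1) refl refl (trans (cong (Emb.jE F) (sym tp)) (trans e (cong (Emb.jE F) bp))))
        (trans (cong (NStruct.at S ∘ Emb.jE F) bp) (trans (sym (snd atoms)) (cong (NStruct.at S ∘ Emb.jE F) (sym tp))))
      patch1 : ∀ y → _
      patch1 zero = idN
      patch1 (suc zero) = eqN (cong (𝔣 ∨_) (C.g-top 𝔣 (# 1) refl)) ⨾ ∨-swap ⨾ lin (ax→ ∨-unit) ⨾ eqN (sym (C.g-bot 𝔣 (# 2) refl refl))
      zeros : ∀ f y → fold f (patch1 y) ≡ 0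
      zeros f zero = refl
      zeros f (suc zero) = refl
    local-step r-ii F = finish r-ii F (C.contracted 𝔱 patch2 zeros) C.contract-glue
      where
      tp : fst (Redex.topR (lhs-redex r-ii) zero) ≡ # 0
      tp = sym (snd (snd (Redex.topR (lhs-redex r-ii) zero)) (# 0) refl)
      bp : fst (Redex.botR (lhs-redex r-ii) zero) ≡ # 2
      bp = sym (snd (snd (Redex.botR (lhs-redex r-ii) zero)) (# 2) refl)
      atoms = redex-atoms {bar = bar} invol S F (# 0)
      module C = Contract {bar = bar} invol W S F
        (λ e → loop F (# 0) (# 2) (# 0) refl refl (trans (cong (Emb.jE F) (sym tp)) (trans e (cong (Emb.jE F) bp))))
        (trans (cong (NStruct.at S ∘ Emb.jE F) bp) (trans (snd atoms) (cong (NStruct.at S ∘ Emb.jE F) (sym tp))))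
      patch2 : ∀ y → _
      patch2 zero = eqN (C.g-top 𝔱 (# 0) refl) ⨾ lin (ax← ∧-unit) ⨾ ∧-swap ⨾ eqN (cong (𝔱 ∧_) (sym (C.g-bot 𝔱 (# 2) refl refl)))
      patch2 (suc zero) = idN
      zeros : ∀ f y → fold f (patch2 y) ≡ 0
      zeros f zero = refl
      zeros f (suc zero) = refl
    local-step r-iii F = via-replace r-iii tt F
    local-step r-iv F = via-replace r-iv tt F
    local-step r-v F = via-replace r-v tt F
    local-step r-vi F = via-replace r-vi tt F
    local-step r-vii F = via-replace r-vii tt F
    local-step r-viii F = via-replace r-viii tt F
    local-step r-ix F = via-replace r-ix tt F
    local-step r-x F = via-replace r-x tt F

-- Translation of derivations of B into a flow on the edges of K, one of the vertices y of the
-- simple edge being left out and the other, z, being replaced by one new vertex.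
module Half {At : Set} {bar : At → At} {U L : Set} {B : Flow U L} (W : WF B) (F : Emb B Rai-redex)
  (at : Flow.E B → At) (_≟B_ : DecEq (Flow.V B)) {U' L' : Set} (lab' : Cut.KV W F ⊎ ⊤ → Label)
  (up' : Cut.KE W F → U' ⊎ (Cut.KV W F ⊎ ⊤)) (dn' : Cut.KE W F → L' ⊎ (Cut.KV W F ⊎ ⊤))
  (lab-K : ∀ v → lab' (inl v) ≡ Flow.lab (Cut.K W F) v)
  (ports-up : ∀ {v n} {i : Fin n → Cut.KE W F} → IsPorts (Flow.up (Cut.K W F)) v i → IsPorts up' (inl v) i)
  (ports-dn : ∀ {v n} {i : Fin n → Cut.KE W F} → IsPorts (Flow.dn (Cut.K W F)) v i → IsPorts dn' (inl v) i)
  (φ : Fm (Cut.KE W F)) (y z : Fin 2) (y≢z : y ≢ z) where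

  open Cut W F
  private
    module B = Flow B

  A' : Flow U' L'
  A' = record { V = KV ⊎ ⊤ ; E = KE ; lab = lab' ; up = up' ; dn = dn' }

  at' : KE → At
  at' = at ∘ fst

  h : B.E → Fm KE
  h e with e ≟E ε
  ... | yes _ = φ
  ... | no n = atom (e , n)

  h-ε : h ε ≡ φ
  h-ε with ε ≟E ε
  ... | yes _ = refl
  ... | no n = ⊥-elim (n refl)

  h-nm : ∀ e n → h e ≡ atom (e , n)
  h-nm e n with e ≟E ε
  ... | yes p = ⊥-elim (n p)
  ... | no _ = refl

  At-vertex : Fin 2 → Set
  At-vertex x = N bar A' at' (bind h (mapFm (jE ∘ Rai-ins x) (srcF (Flow.lab Rai x)))) (bind h (mapFm (jE ∘ Rai-outs x) (tgtF (Flow.lab Rai x))))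

  module _ (patch : At-vertex z) (patch-fold : ∀ f → fold f patch ≡ f (inr tt)) where
    private
      two : ∀ x → x ≡ y ⊎ x ≡ z
      two x with x FinP.≟ y | x FinP.≟ z
      ... | yes p | _ = inl p
      ... | no _ | yes q = inr q
      two zero | no p | no q = ⊥-elim (no-third y z y≢z p q)
        where
        no-third : ∀ (y z : Fin 2) → y ≢ z → zero ≢ y → zero ≢ z → ⊥
        no-third zero z a b c = b refl
        no-third (suc zero) zero a b c = c refl
        no-third (suc zero) (suc zero) a b c = a refl
      two (suc zero) | no p | no q = ⊥-elim (no-third y z y≢z p q)
        where
        no-third : ∀ (y z : Fin 2) → y ≢ z → suc zero ≢ y → suc zero ≢ z → ⊥
        no-third (suc zero) z a b c = b refl
        no-third zero (suc zero) a b c = c refl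
        no-third zero zero a b c = a refl

      _≟'_ : DecEq (KV ⊎ ⊤)
      _≟'_ = SumP.≡-dec _≟K_ UnitP._≟_

    owner : KV ⊎ ⊤ → B.V
    owner (inl k) = fst k
    owner (inr _) = jV z

    private
      bind-nm : ∀ {n} (i : Fin n → B.E) (ne : ∀ j → i j ≢ ε) (Z : Fm (Fin n)) → bind h (mapFm i Z) ≡ mapFm (λ j → i j , ne j) Z
      bind-nm i ne Z = trans (bind-bind h _ Z) (bind-cong (λ j → h-nm (i j) (ne j)) Z)

      ne-up : ∀ (v : KV) {n} {i : Fin n → B.E} → IsPorts B.up (fst v) i → ∀ j → i j ≢ ε
      ne-up v Z j = Up.ver≢ {v = v} (hit Z j)
      ne-dn : ∀ (v : KV) {n} {i : Fin n → B.E} → IsPorts B.dn (fst v) i → ∀ j → i j ≢ ε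
      ne-dn v Z j = Dn.ver≢ {v = v} (hit Z j)

      K-up : ∀ (v : KV) {n} {i : Fin n → B.E} (Z : IsPorts B.up (fst v) i) → IsPorts (Flow.up K) v (λ j → i j , ne-up v Z j)
      K-up v {i = i} Z = record
        { hit = λ j → Up.kend≡ {k = i j , ne-up v Z j} (Up.ver {v = v} (hit Z j)) ; inj = λ p → inj Z (cong fst p)
        ; all = λ k p → let (j , q) = all Z (fst k) (Up.kend-ver p) in j , Σ≡ (λ _ _ → refl) q }
      K-dn : ∀ (v : KV) {n} {i : Fin n → B.E} (Z : IsPorts B.dn (fst v) i) → IsPorts (Flow.dn K) v (λ j → i j , ne-dn v Z j)
      K-dn v {i = i} Z = record
        { hit = λ j → Dn.kend≡ {k = i j , ne-dn v Z j} (Dn.ver {v = v} (hit Z j)) ; inj = λ p → inj Z (cong fst p)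
        ; all = λ k p → let (j , q) = all Z (fst k) (Dn.kend-ver p) in j , Σ≡ (λ _ _ → refl) q }

      redex-patch : ∀ k v i o → v ≡ jV z → Flow.lab Rai z ≡ k → IsPorts B.dn v i → IsPorts B.up v o →
        Σ (N bar A' at' (bind h (mapFm i (srcF k))) (bind h (mapFm o (tgtF k)))) λ d → ∀ f → fold f d ≡ f (inr tt)
      redex-patch k v i o refl refl p q
        with reorder-ins {bar = bar} {A = B} {at = at} {A' = A'} {at' = at'} h (Flow.lab Rai z) p (ji z)
           | reorder-outs {bar = bar} {A = B} {at = at} {A' = A'} {at' = at'} h (Flow.lab Rai z) (jo z) q
      ... | (c , c0) | (d , d0) = (c ⨾ patch ⨾ d) ,
            λ f → trans (cong₂ _+_ (c0 f) (cong₂ _+_ (patch-fold f) (d0 f))) (ℕP.+-identityʳ _)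

      patches : Patches {bar = bar} {A = B} {at = at} {A' = A'} {at' = at'} h (_≢ jV y)
      patches k v i o v≢ l p q ok with jV? v
      ... | no n = eqN (bind-nm i (ne-dn v' p) (srcF k)) ⨾
                   vx k (inl v') _ _ (trans (lab-K v') l) (ports-dn (K-dn v' p)) (ports-up (K-up v' q)) ok ⨾
                   eqN (sym (bind-nm o (ne-up v' q) (tgtF k)))
        where
        v' : KV
        v' = v , λ y p → n (y , p)
      ... | yes (x , e) with two x
      ...   | inl refl = ⊥-elim (v≢ e)
      ...   | inr refl = fst (redex-patch k v i o e (trans (sym (jlab x)) (trans (cong B.lab (sym e)) l)) p q)

      patches-count : ∀ v' k v i o v≢ l p q ok → fold (δ _≟'_ v') (patches k v i o v≢ l p q ok) ≡ δ _≟B_ (owner v') v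
      patches-count v' k v i o v≢ l p q ok with jV? v
      patches-count (inr tt) k v i o v≢ l p q ok | no n =
        trans (ℕP.+-identityʳ _) (trans (δ-no _≟'_ {inr tt} {inl (v , λ y p → n (y , p))} λ ()) (sym (δ-no _≟B_ λ e → n (z , sym e))))
      patches-count (inl v') k v i o v≢ l p q ok | no n = trans (ℕP.+-identityʳ _) (tr (fst v' ≟B v))
        where
        tr : Dec (fst v' ≡ v) → δ _≟'_ (inl v') (inl (v , λ y p → n (y , p))) ≡ δ _≟B_ (fst v') v
        tr (yes refl) = trans (δ-yes _≟'_ {inl v'} {inl (v , λ y p → n (y , p))} refl) (sym (δ-yes _≟B_ refl))
        tr (no n') = trans (δ-no _≟'_ {inl v'} {inl (v , λ y p → n (y , p))} λ { refl → n' refl }) (sym (δ-no _≟B_ n'))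
      ... | yes (x , e) with two x
      ...   | inl refl = ⊥-elim (v≢ e)
      patches-count (inr tt) k v i o v≢ l p q ok | yes (x , e) | inr refl =
        trans (snd (redex-patch k v i o e (trans (sym (jlab x)) (trans (cong B.lab (sym e)) l)) p q) (δ _≟'_ (inr tt))) (trans (δ-yes _≟'_ {inr tt} {inr tt} refl) (sym (δ-yes _≟B_ (sym e))))
      patches-count (inl v') k v i o v≢ l p q ok | yes (x , e) | inr refl =
        trans (snd (redex-patch k v i o e (trans (sym (jlab x)) (trans (cong B.lab (sym e)) l)) p q) (δ _≟'_ (inl v'))) (trans (δ-no _≟'_ {inl v'} {inr tt} λ ()) (sym (δ-no _≟B_ λ e' → snd v' x (trans e' e))))

    half : ∀ {X Y} (d : N bar B at X Y) → fold (δ _≟B_ (jV y)) d ≡ 0 → N bar A' at' (bind h X) (bind h Y)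
    half d p = translate h patches d (fold-0 _≟B_ (jV y) d p)

    half-fold : ∀ {X Y} (d : N bar B at X Y) p v' → fold (δ _≟'_ v') (half d p) ≡ fold (δ _≟B_ (owner v')) d
    half-fold d p v' = fold-translate h patches (δ _≟'_ v') (δ _≟B_ (owner v')) (λ k v i o q l a b c → patches-count v' k v i o q l a b c) d _

    half-size : ∀ {X Y} (d : N bar B at X Y) p → fold (λ _ → 1) (half d p) ≡ fold (λ _ → 1) d
    half-size d p = fold-translate h patches (λ _ → 1) (λ _ → 1) one d _
      where
      one : ∀ k v i o v≢ l p q ok → fold (λ _ → 1) (patches k v i o v≢ l p q ok) ≡ 1
      one k v i o v≢ l p q ok with jV? v
      ... | no n = refl
      ... | yes (x , e) with two x
      ...   | inl refl = ⊥-elim (v≢ e)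
      ...   | inr refl = snd (redex-patch k v i o e (trans (sym (jlab x)) (trans (cong B.lab (sym e)) l)) p q) (λ _ → 1)

    owner≢ : ∀ v' → owner v' ≢ jV y
    owner≢ (inl k) e = snd k y e
    owner≢ (inr tt) e = y≢z (sym (jV-inj e))

    _≟H_ : DecEq (KV ⊎ ⊤)
    _≟H_ = _≟'_

split-once : ∀ a b w → w ≡ 1 → a + w + b ≡ 1 → a ≡ 0 × b ≡ 0
split-once zero zero w p q = refl , refl
split-once zero (suc b) .1 refl ()
split-once (suc zero) b .1 refl ()
split-once (suc (suc a)) b .1 refl ()

module _ {U L : Set} (A : Flow (U ⊎ Fin 1) (L ⊎ Fin 1)) where
  private
    module A = Flow A
    module Wk = Flow (Weak A)
    module CW = Flow (CoWeak A)

  weak-up-bnd : ∀ {e u} → A.up e ≡ inl (inl u) → Wk.up e ≡ inl u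
  weak-up-bnd p rewrite p = refl
  weak-up-port : ∀ {e z} → A.up e ≡ inl (inr z) → Wk.up e ≡ inr (inr tt)
  weak-up-port p rewrite p = refl
  weak-up-ver : ∀ {e v} → A.up e ≡ inr v → Wk.up e ≡ inr (inl v)
  weak-up-ver p rewrite p = refl
  weak-up-bnd⁻ : ∀ {e u} → Wk.up e ≡ inl u → A.up e ≡ inl (inl u)
  weak-up-bnd⁻ {e} p with A.up e
  weak-up-bnd⁻ refl | inl (inl u) = refl
  weak-up-port⁻ : ∀ {e} → Wk.up e ≡ inr (inr tt) → A.up e ≡ inl (inr zero)
  weak-up-port⁻ {e} p with A.up e
  weak-up-port⁻ refl | inl (inr zero) = refl
  weak-up-ver⁻ : ∀ {e v} → Wk.up e ≡ inr (inl v) → A.up e ≡ inr v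
  weak-up-ver⁻ {e} p with A.up e
  weak-up-ver⁻ refl | inr v = refl
  weak-up-ver⁻ () | inl (inl _)
  weak-up-ver⁻ () | inl (inr _)
  weak-dn-bnd : ∀ {e l} → A.dn e ≡ inl l → Wk.dn e ≡ inl l
  weak-dn-bnd p rewrite p = refl
  weak-dn-ver : ∀ {e v} → A.dn e ≡ inr v → Wk.dn e ≡ inr (inl v)
  weak-dn-ver p rewrite p = refl
  weak-dn-bnd⁻ : ∀ {e l} → Wk.dn e ≡ inl l → A.dn e ≡ inl l
  weak-dn-bnd⁻ {e} p with A.dn e
  weak-dn-bnd⁻ refl | inl _ = refl
  weak-dn-ver⁻ : ∀ {e v} → Wk.dn e ≡ inr (inl v) → A.dn e ≡ inr v
  weak-dn-ver⁻ {e} p with A.dn e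
  weak-dn-ver⁻ refl | inr v = refl
  weak-dn-tt : ∀ {e} → Wk.dn e ≡ inr (inr tt) → ⊥
  weak-dn-tt {e} p with A.dn e
  weak-dn-tt () | inl _
  weak-dn-tt () | inr _

  coweak-dn-bnd : ∀ {e u} → A.dn e ≡ inl (inl u) → CW.dn e ≡ inl u
  coweak-dn-bnd p rewrite p = refl
  coweak-dn-port : ∀ {e z} → A.dn e ≡ inl (inr z) → CW.dn e ≡ inr (inr tt)
  coweak-dn-port p rewrite p = refl
  coweak-dn-ver : ∀ {e v} → A.dn e ≡ inr v → CW.dn e ≡ inr (inl v)
  coweak-dn-ver p rewrite p = refl
  coweak-dn-bnd⁻ : ∀ {e u} → CW.dn e ≡ inl u → A.dn e ≡ inl (inl u)
  coweak-dn-bnd⁻ {e} p with A.dn e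
  coweak-dn-bnd⁻ refl | inl (inl u) = refl
  coweak-dn-port⁻ : ∀ {e} → CW.dn e ≡ inr (inr tt) → A.dn e ≡ inl (inr zero)
  coweak-dn-port⁻ {e} p with A.dn e
  coweak-dn-port⁻ refl | inl (inr zero) = refl
  coweak-dn-ver⁻ : ∀ {e v} → CW.dn e ≡ inr (inl v) → A.dn e ≡ inr v
  coweak-dn-ver⁻ {e} p with A.dn e
  coweak-dn-ver⁻ refl | inr v = refl
  coweak-dn-ver⁻ () | inl (inl _)
  coweak-dn-ver⁻ () | inl (inr _)
  coweak-up-bnd : ∀ {e l} → A.up e ≡ inl l → CW.up e ≡ inl l
  coweak-up-bnd p rewrite p = refl
  coweak-up-ver : ∀ {e v} → A.up e ≡ inr v → CW.up e ≡ inr (inl v)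
  coweak-up-ver p rewrite p = refl
  coweak-up-bnd⁻ : ∀ {e l} → CW.up e ≡ inl l → A.up e ≡ inl l
  coweak-up-bnd⁻ {e} p with A.up e
  coweak-up-bnd⁻ refl | inl _ = refl
  coweak-up-ver⁻ : ∀ {e v} → CW.up e ≡ inr (inl v) → A.up e ≡ inr v
  coweak-up-ver⁻ {e} p with A.up e
  coweak-up-ver⁻ refl | inr v = refl
  coweak-up-tt : ∀ {e} → CW.up e ≡ inr (inr tt) → ⊥
  coweak-up-tt {e} p with A.up e
  coweak-up-tt () | inl _
  coweak-up-tt () | inr _

ports-⇔ : ∀ {E X Y V V' I : Set} {end : E → X ⊎ V} {end' : E → Y ⊎ V'} {v v'} {i : I → E} →
  (∀ {e} → end e ≡ inr v → end' e ≡ inr v') → (∀ {e} → end' e ≡ inr v' → end e ≡ inr v) → IsPorts end v i → IsPorts end' v' i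
ports-⇔ f g Z = record { hit = λ j → f (hit Z j) ; inj = inj Z ; all = λ x p → all Z x (g p) }

module _ {U L : Set} (A : Flow (U ⊎ Fin 1) (L ⊎ Fin 1)) where
  private
    module A = Flow A

  weak-ports-up : ∀ {v n} {i : Fin n → A.E} → IsPorts A.up v i → IsPorts (Flow.up (Weak A)) (inl v) i
  weak-ports-up = ports-⇔ (weak-up-ver A) (weak-up-ver⁻ A)
  weak-ports-dn : ∀ {v n} {i : Fin n → A.E} → IsPorts A.dn v i → IsPorts (Flow.dn (Weak A)) (inl v) i
  weak-ports-dn = ports-⇔ (weak-dn-ver A) (weak-dn-ver⁻ A)
  coweak-ports-up : ∀ {v n} {i : Fin n → A.E} → IsPorts A.up v i → IsPorts (Flow.up (CoWeak A)) (inl v) i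
  coweak-ports-up = ports-⇔ (coweak-up-ver A) (coweak-up-ver⁻ A)
  coweak-ports-dn : ∀ {v n} {i : Fin n → A.E} → IsPorts A.dn v i → IsPorts (Flow.dn (CoWeak A)) (inl v) i
  coweak-ports-dn = ports-⇔ (coweak-dn-ver A) (coweak-dn-ver⁻ A)

  module _ {e} (un : A.up e ≡ inl (inr zero) × (∀ k → A.up k ≡ inl (inr zero) → k ≡ e)) where
    weak-new-up : IsPorts (Flow.up (Weak A)) (inr tt) (λ (_ : Fin 1) → e)
    weak-new-up = record { hit = λ _ → weak-up-port A (fst un) ; inj = λ { {zero} {zero} _ → refl }
                         ; all = λ x p → zero , sym (snd un x (weak-up-port⁻ A p)) }

  module _ {e} (un : A.dn e ≡ inl (inr zero) × (∀ k → A.dn k ≡ inl (inr zero) → k ≡ e)) where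
    coweak-new-dn : IsPorts (Flow.dn (CoWeak A)) (inr tt) (λ (_ : Fin 1) → e)
    coweak-new-dn = record { hit = λ _ → coweak-dn-port A (fst un) ; inj = λ { {zero} {zero} _ → refl }
                           ; all = λ x p → zero , sym (snd un x (coweak-dn-port⁻ A p)) }

  weak-new-dn : (i : Fin 0 → A.E) → IsPorts (Flow.dn (Weak A)) (inr tt) i
  weak-new-dn i = record { hit = λ () ; inj = λ { {()} } ; all = λ x p → ⊥-elim (weak-dn-tt A p) }
  coweak-new-up : (i : Fin 0 → A.E) → IsPorts (Flow.up (CoWeak A)) (inr tt) i
  coweak-new-up i = record { hit = λ () ; inj = λ { {()} } ; all = λ x p → ⊥-elim (coweak-up-tt A p) }

module Halves {At : Set} {bar : At → At} (invol : ∀ a → bar (bar a) ≡ a) {U L : Set} {B : Flow U L} (W : WF B) (F : Emb B Rai-redex)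
  {aU : U → At} {aL : L → At} {X : Fm U} {Y : Fm L} (S : NStruct bar B aU aL X Y) where
  open Cut W F
  private
    module B = Flow B
    module S = NStruct S
    module K = Flow K

  ε2 ε3 : KE
  ε2 = kQ zero
  ε3 = kP zero

  private
    ε2≡ : jE (# 1) ≡ fst ε2
    ε2≡ = cong jE (snd (snd (Redex.botR Rai-redex zero)) (# 1) refl)
    ε3≡ : jE (# 2) ≡ fst ε3
    ε3≡ = cong jE (snd (snd (Redex.topR Rai-redex zero)) (# 2) refl)

  same-atom : S.at (fst ε2) ≡ S.at (fst ε3)
  same-atom = trans (cong S.at (sym ε2≡)) (trans (redex-atoms invol S F zero) (trans (sym (redex-atoms invol S F (# 1))) (cong S.at ε3≡)))

  private
    top≢ : ∀ u → S.topE u ≢ ε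
    top≢ u = Up.bnd≢ (S.top-up u)
    bot≢ : ∀ l → S.botE l ≢ ε
    bot≢ l = Dn.bnd≢ (S.bot-dn l)

    module Wk = Half {bar = bar} W F S.at S._≟V_ (Flow.lab (Weak K)) (Flow.up (Weak K)) (Flow.dn (Weak K)) (λ _ → refl)
      (weak-ports-up K) (weak-ports-dn K) 𝔱 (# 1) (# 0) (λ ())
    module CW = Half {bar = bar} W F S.at S._≟V_ (Flow.lab (CoWeak K)) (Flow.up (CoWeak K)) (Flow.dn (CoWeak K)) (λ _ → refl)
      (coweak-ports-up K) (coweak-ports-dn K) 𝔣 (# 0) (# 1) (λ ())

    wk-h2 : Wk.h (jE (# 1)) ≡ atom ε2
    wk-h2 = trans (cong Wk.h ε2≡) (Wk.h-nm _ _)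
    wk-h3 : Wk.h (jE (# 2)) ≡ atom ε3
    wk-h3 = trans (cong Wk.h ε3≡) (Wk.h-nm _ _)
    cw-h2 : CW.h (jE (# 1)) ≡ atom ε2
    cw-h2 = trans (cong CW.h ε2≡) (CW.h-nm _ _)
    cw-h3 : CW.h (jE (# 2)) ≡ atom ε3
    cw-h3 = trans (cong CW.h ε3≡) (CW.h-nm _ _)

    wk-patch : Wk.At-vertex (# 0)
    wk-patch = lin (ax← ∨-unit) ⨾ idN ∨ᴺ vx aw↓ (inr tt) (λ ()) (λ _ → ε2) refl
                 (weak-new-dn K _) (weak-new-up K (kQ-unique zero)) tt ⨾
               eqN (cong₂ _∨_ (sym Wk.h-ε) (sym wk-h2))
    cw-patch : CW.At-vertex (# 1)
    cw-patch = eqN (cong₂ _∧_ CW.h-ε cw-h3) ⨾ idN ∧ᴺ vx aw↑ (inr tt) (λ _ → ε3) (λ ()) refl (coweak-new-dn K (kP-unique zero)) (coweak-new-up K _) tt ⨾ lin (ax→ ∧-unit)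

    wk-fold : ∀ f → fold f wk-patch ≡ f (inr tt)
    wk-fold f = ℕP.+-identityʳ _
    cw-fold : ∀ f → fold f cw-patch ≡ f (inr tt)
    cw-fold f = ℕP.+-identityʳ _

    module Sw = Split (split S._≟V_ (jV (# 1)) S.der (λ z → ℕP.1+n≢0 (trans (sym (S.full (jV (# 1)))) z)))
    module Sv = Split (split S._≟V_ (jV (# 0)) S.der (λ z → ℕP.1+n≢0 (trans (sym (S.full (jV (# 0)))) z)))

    w-zeros : fold (δ S._≟V_ (jV (# 1))) Sw.d1 ≡ 0 × fold (δ S._≟V_ (jV (# 1))) Sw.d3 ≡ 0
    w-zeros = split-once (fold (δ S._≟V_ (jV (# 1))) Sw.d1) (fold (δ S._≟V_ (jV (# 1))) Sw.d3) (δ S._≟V_ (jV (# 1)) (jV (# 1)))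
      (δ-yes S._≟V_ {jV (# 1)} {jV (# 1)} refl) (trans (sym (Sw.folds (δ S._≟V_ (jV (# 1))))) (S.full (jV (# 1))))
    v-zeros : fold (δ S._≟V_ (jV (# 0))) Sv.d1 ≡ 0 × fold (δ S._≟V_ (jV (# 0))) Sv.d3 ≡ 0
    v-zeros = split-once (fold (δ S._≟V_ (jV (# 0))) Sv.d1) (fold (δ S._≟V_ (jV (# 0))) Sv.d3) (δ S._≟V_ (jV (# 0)) (jV (# 0)))
      (δ-yes S._≟V_ {jV (# 0)} {jV (# 0)} refl) (trans (sym (Sv.folds (δ S._≟V_ (jV (# 0))))) (S.full (jV (# 0))))

    -- the removed cointeraction, with 𝔱 in place of ε₁
    wk-cut : ∀ k {i o} → k ≡ ai↑ → IsPorts B.dn (jV (# 1)) i → IsPorts B.up (jV (# 1)) o →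
      Σ (N bar (Weak K) Wk.at' (bind Wk.h (mapFm i (srcF k))) (bind Wk.h (mapFm o (tgtF k)) ∨ atom ε3)) λ d → ∀ f → fold f d ≡ 0
    wk-cut _ {i} refl p q = (fst c ⨾ eqN (cong₂ _∧_ Wk.h-ε wk-h3) ⨾ ∧-swap ⨾ lin (ax→ ∧-unit) ⨾ lin (ax← ∨-unit) ⨾ ∨-swap) ,
                       λ f → trans (ℕP.+-identityʳ _) (snd c f)
      where
      c : Σ (N bar (Weak K) Wk.at' (bind Wk.h (mapFm i (srcF ai↑))) (bind Wk.h (mapFm (jE ∘ Rai-ins (# 1)) (srcF ai↑)))) λ d → ∀ f → fold f d ≡ 0
      c = reorder-ins {bar = bar} {A = B} {at = S.at} {A' = Weak K} {at' = Wk.at'} Wk.h ai↑ p (ji (# 1))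

    cw-cut : ∀ k {i o} → k ≡ ai↓ → IsPorts B.dn (jV (# 0)) i → IsPorts B.up (jV (# 0)) o →
      Σ (N bar (CoWeak K) CW.at' (bind CW.h (mapFm i (srcF k)) ∧ atom ε2) (bind CW.h (mapFm o (tgtF k)))) λ d → ∀ f → fold f d ≡ 0
    cw-cut _ {i} {o} refl p q = (∧-swap ⨾ lin (ax→ ∧-unit) ⨾ lin (ax← ∨-unit) ⨾ ∨-swap ⨾ eqN (cong₂ _∨_ (sym CW.h-ε) (sym cw-h2)) ⨾ fst c) , snd c
      where
      c : Σ (N bar (CoWeak K) CW.at' (bind CW.h (mapFm (jE ∘ Rai-outs (# 0)) (tgtF ai↓))) (bind CW.h (mapFm o (tgtF ai↓)))) λ d → ∀ f → fold f d ≡ 0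
      c = reorder-outs {bar = bar} {A = B} {at = S.at} {A' = CoWeak K} {at' = CW.at'} CW.h ai↓ (jo (# 0)) q

    wk-d1 = Wk.half wk-patch wk-fold Sw.d1 (fst w-zeros)
    wk-d3 = Wk.half wk-patch wk-fold Sw.d3 (snd w-zeros)
    cw-d1 = CW.half cw-patch cw-fold Sv.d1 (fst v-zeros)
    cw-d3 = CW.half cw-patch cw-fold Sv.d3 (snd v-zeros)
    wk-mid = fst (wk-cut Sw.k (trans (sym Sw.lk) (jlab (# 1))) Sw.pi Sw.po)
    cw-mid = fst (cw-cut Sv.k (trans (sym Sv.lk) (jlab (# 0))) Sv.pi Sv.po)

    topK : U → KE
    topK u = S.topE u , top≢ u
    botK : L → KE
    botK l = S.botE l , bot≢ l

    bind-top : ∀ (h : B.E → Fm KE) → (∀ e n → h e ≡ atom (e , n)) → bind h (mapFm S.topE X) ≡ mapFm topK X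
    bind-top h e = trans (bind-bind h _ X) (bind-cong (λ u → e _ (top≢ u)) X)
    bind-bot : ∀ (h : B.E → Fm KE) → (∀ e n → h e ≡ atom (e , n)) → bind h (mapFm S.botE Y) ≡ mapFm botK Y
    bind-bot h e = trans (bind-bind h _ Y) (bind-cong (λ u → e _ (bot≢ u)) Y)

    wk-der : N bar (Weak K) Wk.at' (bind Wk.h (mapFm S.topE X)) (bind Wk.h (mapFm S.botE Y) ∨ atom ε3)
    wk-der = wk-d1 ⨾ eqN (bind-⟨⟩ Wk.h Sw.ξ _) ⨾ inCtx (bindCtx Wk.h Sw.ξ) wk-mid ⨾ switch-out (bindCtx Wk.h Sw.ξ) ⨾
             (eqN (sym (bind-⟨⟩ Wk.h Sw.ξ _)) ⨾ wk-d3) ∨ᴺ idN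

    cw-der : N bar (CoWeak K) CW.at' (bind CW.h (mapFm S.topE X) ∧ atom ε2) (bind CW.h (mapFm S.botE Y))
    cw-der = (cw-d1 ⨾ eqN (bind-⟨⟩ CW.h Sv.ξ _)) ∧ᴺ idN ⨾ switch-in (bindCtx CW.h Sv.ξ) ⨾ inCtx (bindCtx CW.h Sv.ξ) cw-mid ⨾
             eqN (sym (bind-⟨⟩ CW.h Sv.ξ _)) ⨾ cw-d3

    wk-der-fold : ∀ f → fold f wk-der ≡ fold f wk-d1 + fold f wk-d3
    wk-der-fold f = go (fold f wk-d1) (fold f wk-d3) (fold-switch-out f (bindCtx Wk.h Sw.ξ))
      (trans (fold-inCtx f (bindCtx Wk.h Sw.ξ) wk-mid) (snd (wk-cut Sw.k (trans (sym Sw.lk) (jlab (# 1))) Sw.pi Sw.po) f))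
      where
      go : ∀ a b {x y} → x ≡ 0 → y ≡ 0 → a + (y + (x + (b + 0))) ≡ a + b
      go a b refl refl = cong (a +_) (ℕP.+-identityʳ b)

    cw-der-fold : ∀ f → fold f cw-der ≡ fold f cw-d1 + fold f cw-d3
    cw-der-fold f = go (fold f cw-d1) (fold f cw-d3) (fold-switch-in f (bindCtx CW.h Sv.ξ))
      (trans (fold-inCtx f (bindCtx CW.h Sv.ξ) cw-mid) (snd (cw-cut Sv.k (trans (sym Sv.lk) (jlab (# 0))) Sv.pi Sv.po) f))
      where
      go : ∀ a b {x y} → x ≡ 0 → y ≡ 0 → a + 0 + 0 + (x + (y + b)) ≡ a + b
      go a b refl refl = cong (_+ b) (trans (ℕP.+-identityʳ _) (ℕP.+-identityʳ a))

    once : ∀ a b {w t n} → w ≡ 0 → t ≡ a + w + b → t ≡ n → a + b ≡ n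
    once a b refl p q = trans (cong (_+ b) (sym (ℕP.+-identityʳ a))) (trans (sym p) q)

  weak-struct : NStruct bar (Weak K) aU (case⊎ aL (λ _ → S.at (fst ε3))) X (mapFm inl Y ∨ atom (inr zero))
  weak-struct = record
    { _≟V_ = Wk._≟H_ wk-patch wk-fold ; at = Wk.at' ; topE = topK ; botE = case⊎ botK (λ _ → ε3)
    ; top-up = λ u → weak-up-bnd K (Up.kend≡ {k = topK u} (Up.bnd (S.top-up u)))
    ; top-un = λ e u p → Σ≡ (λ _ _ → refl) (S.top-un _ u (Up.kend-bnd (weak-up-bnd⁻ K p)))
    ; bot-dn = λ { (inl l) → weak-dn-bnd K (Dn.kend≡ {k = botK l} (Dn.bnd (S.bot-dn l))) ; (inr zero) → weak-dn-bnd K (fst (kP-unique zero)) }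
    ; bot-un = λ { e (inl l) p → Σ≡ (λ _ _ → refl) (S.bot-un _ l (Dn.kend-bnd (weak-dn-bnd⁻ K p)))
                 ; e (inr zero) p → snd (kP-unique zero) e (weak-dn-bnd⁻ K p) }
    ; at-top = S.at-top ; at-bot = λ { (inl l) → S.at-bot l ; (inr zero) → refl }
    ; der = eqN (sym (bind-top Wk.h Wk.h-nm)) ⨾ wk-der ⨾
            eqN (cong (_∨ atom ε3) (trans (bind-bot Wk.h Wk.h-nm) (sym (bind-bind _ _ Y))))
    ; full = λ v' → trans (ℕP.+-identityʳ _) (trans (wk-der-fold _) (trans
        (cong₂ _+_ (Wk.half-fold wk-patch wk-fold Sw.d1 (fst w-zeros) v') (Wk.half-fold wk-patch wk-fold Sw.d3 (snd w-zeros) v'))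
        (once (fold (δ S._≟V_ (Wk.owner wk-patch wk-fold v')) Sw.d1) (fold (δ S._≟V_ (Wk.owner wk-patch wk-fold v')) Sw.d3)
          (δ-no S._≟V_ (Wk.owner≢ wk-patch wk-fold v')) (Sw.folds (δ S._≟V_ (Wk.owner wk-patch wk-fold v'))) (S.full (Wk.owner wk-patch wk-fold v'))))) }

  coweak-struct : NStruct bar (CoWeak K) (case⊎ aU (λ _ → S.at (fst ε3))) aL (mapFm inl X ∧ atom (inr zero)) Y
  coweak-struct = record
    { _≟V_ = CW._≟H_ cw-patch cw-fold ; at = CW.at' ; topE = case⊎ topK (λ _ → ε2) ; botE = botK
    ; top-up = λ { (inl l) → coweak-up-bnd K (Up.kend≡ {k = topK l} (Up.bnd (S.top-up l))) ; (inr zero) → coweak-up-bnd K (fst (kQ-unique zero)) }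
    ; top-un = λ { e (inl l) p → Σ≡ (λ _ _ → refl) (S.top-un _ l (Up.kend-bnd (coweak-up-bnd⁻ K p)))
                 ; e (inr zero) p → snd (kQ-unique zero) e (coweak-up-bnd⁻ K p) }
    ; bot-dn = λ u → coweak-dn-bnd K (Dn.kend≡ {k = botK u} (Dn.bnd (S.bot-dn u)))
    ; bot-un = λ e u p → Σ≡ (λ _ _ → refl) (S.bot-un _ u (Dn.kend-bnd (coweak-dn-bnd⁻ K p)))
    ; at-top = λ { (inl l) → S.at-top l ; (inr zero) → same-atom } ; at-bot = S.at-bot
    ; der = eqN (cong (_∧ atom ε2) (trans (bind-bind _ _ X) (sym (bind-top CW.h CW.h-nm)))) ⨾ cw-der ⨾ eqN (bind-bot CW.h CW.h-nm)
    ; full = λ v' → trans (ℕP.+-identityʳ _) (trans (cw-der-fold _) (trans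
        (cong₂ _+_ (CW.half-fold cw-patch cw-fold Sv.d1 (fst v-zeros) v') (CW.half-fold cw-patch cw-fold Sv.d3 (snd v-zeros) v'))
        (once (fold (δ S._≟V_ (CW.owner cw-patch cw-fold v')) Sv.d1) (fold (δ S._≟V_ (CW.owner cw-patch cw-fold v')) Sv.d3)
          (δ-no S._≟V_ (CW.owner≢ cw-patch cw-fold v')) (Sv.folds (δ S._≟V_ (CW.owner cw-patch cw-fold v'))) (S.full (CW.owner cw-patch cw-fold v'))))) }

  vertices : ∀ {U L} {A : Flow U L} {aU aL X Y} → NStruct bar A aU aL X Y → ℕ
  vertices S = fold (λ _ → 1) (NStruct.der S)

  private
    fewer : ∀ a b {t} → t ≡ a + 1 + b → suc (a + b) ≡ t
    fewer a b p = trans (cong (_+ b) (ℕP.+-comm 1 a)) (sym p)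

  weak-vertices : suc (vertices weak-struct) ≡ vertices S
  weak-vertices = trans (cong suc (trans (ℕP.+-identityʳ _) (trans (wk-der-fold _)
    (cong₂ _+_ (Wk.half-size wk-patch wk-fold Sw.d1 (fst w-zeros)) (Wk.half-size wk-patch wk-fold Sw.d3 (snd w-zeros))))))
    (fewer (fold (λ _ → 1) Sw.d1) (fold (λ _ → 1) Sw.d3) (Sw.folds (λ _ → 1)))

  coweak-vertices : suc (vertices coweak-struct) ≡ vertices S
  coweak-vertices = trans (cong suc (trans (ℕP.+-identityʳ _) (trans (cw-der-fold _)
    (cong₂ _+_ (CW.half-size cw-patch cw-fold Sv.d1 (fst v-zeros)) (CW.half-size cw-patch cw-fold Sv.d3 (snd v-zeros))))))
    (fewer (fold (λ _ → 1) Sv.d1) (fold (λ _ → 1) Sv.d3) (Sv.folds (λ _ → 1)))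

foldFm : ∀ {U : Set} → (U → ℕ) → Fm U → ℕ
foldFm f 𝔣 = 0
foldFm f 𝔱 = 0
foldFm f (atom u) = f u
foldFm f (α ∨ β) = foldFm f α + foldFm f β
foldFm f (α ∧ β) = foldFm f α + foldFm f β

foldFm-map : ∀ {U U' : Set} (f : U' → ℕ) (g : U → U') F → foldFm f (mapFm g F) ≡ foldFm (f ∘ g) F
foldFm-map f g 𝔣 = refl
foldFm-map f g 𝔱 = refl
foldFm-map f g (atom u) = refl
foldFm-map f g (α ∨ β) = cong₂ _+_ (foldFm-map f g α) (foldFm-map f g β)
foldFm-map f g (α ∧ β) = cong₂ _+_ (foldFm-map f g α) (foldFm-map f g β)

foldFm-cong : ∀ {U : Set} {f g : U → ℕ} → (∀ u → f u ≡ g u) → ∀ F → foldFm f F ≡ foldFm g F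
foldFm-cong p 𝔣 = refl
foldFm-cong p 𝔱 = refl
foldFm-cong p (atom u) = p u
foldFm-cong p (α ∨ β) = cong₂ _+_ (foldFm-cong p α) (foldFm-cong p β)
foldFm-cong p (α ∧ β) = cong₂ _+_ (foldFm-cong p α) (foldFm-cong p β)

foldFm-0 : ∀ {U : Set} (F : Fm U) → foldFm (λ _ → 0) F ≡ 0
foldFm-0 𝔣 = refl
foldFm-0 𝔱 = refl
foldFm-0 (atom u) = refl
foldFm-0 (α ∨ β) = cong₂ _+_ (foldFm-0 α) (foldFm-0 β)
foldFm-0 (α ∧ β) = cong₂ _+_ (foldFm-0 α) (foldFm-0 β)

Linear : {U : Set} → Fm U → Set
Linear {U} X = Σ (DecEq U) λ _≟_ → ∀ u → foldFm (δ _≟_ u) X ≡ 1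

δ-⊎ : ∀ {A B : Set} (_≟A_ : DecEq A) (_≟B_ : DecEq B) (a : A) x →
  δ (SumP.≡-dec _≟A_ _≟B_) (inl a) (inl x) ≡ δ _≟A_ a x
δ-⊎ _≟A_ _≟B_ a x with a ≟A x
... | yes _ = refl
... | no _ = refl

δ-⊎ʳ : ∀ {A B : Set} (_≟A_ : DecEq A) (_≟B_ : DecEq B) (b : B) x →
  δ (SumP.≡-dec _≟A_ _≟B_) (inr b) (inr x) ≡ δ _≟B_ b x
δ-⊎ʳ _≟A_ _≟B_ b x with b ≟B x
... | yes _ = refl
... | no _ = refl

linear-snoc : ∀ {U : Set} (X : Fm U) → Linear X → DecEq (Fin 1) → Linear (mapFm inl X ∨ atom (inr zero)) × Linear (mapFm inl X ∧ atom (inr zero))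
linear-snoc {U} X (_≟_ , p) _≟1_ = (SumP.≡-dec _≟_ _≟1_ , go) , (SumP.≡-dec _≟_ _≟1_ , go)
  where
  d : DecEq (U ⊎ Fin 1)
  d = SumP.≡-dec _≟_ _≟1_
  go : ∀ u → foldFm (δ d u) (mapFm inl X) + δ d u (inr zero) ≡ 1
  go (inl u) = trans (ℕP.+-identityʳ _) (trans (foldFm-map _ inl X) (trans (foldFm-cong (δ-⊎ _≟_ _≟1_ u) X) (p u)))
  go (inr zero) = cong₂ _+_ (trans (foldFm-map _ inl X) (foldFm-0 X)) (δ-yes d {inr zero} {inr zero} refl)

occFm-linear : ∀ {At : Set} (α : Fm At) → Linear (occFm α)
occFm-linear α = occ-≟ α , count α
  where
  occ-≟ : ∀ {A : Set} (α : Fm A) → DecEq (Occ α)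
  occ-≟ α = finite-≟ (finite-Occ α)
  sub : ∀ {U V : Set} (_≟_ : DecEq V) (β : Fm U) (g : Occ β → V) → (∀ {x y} → g x ≡ g y → x ≡ y) →
    (∀ u → foldFm (δ (occ-≟ β) u) (occFm β) ≡ 1) → ∀ u → foldFm (δ _≟_ (g u)) (name β g) ≡ 1
  sub _≟_ β g gi h u = trans (cong (foldFm _) (sym (map-name g β id))) (trans (foldFm-map _ g (occFm β)) (trans (foldFm-cong eq (occFm β)) (h u)))
    where
    eq : ∀ x → δ _≟_ (g u) (g x) ≡ δ (occ-≟ β) u x
    eq x with occ-≟ β u x
    ... | yes refl = δ-yes _≟_ refl
    ... | no n = δ-no _≟_ (n ∘ gi)
  miss : ∀ {U V : Set} (_≟_ : DecEq V) (β : Fm U) (g : Occ β → V) v → (∀ x → v ≢ g x) → foldFm (δ _≟_ v) (name β g) ≡ 0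
  miss _≟_ β g v n = trans (cong (foldFm _) (sym (map-name g β id))) (trans (foldFm-map _ g (occFm β))
    (trans (foldFm-cong (λ x → δ-no _≟_ (n x)) (occFm β)) (foldFm-0 (occFm β))))
  count : ∀ {U : Set} (α : Fm U) u → foldFm (δ (occ-≟ α) u) (occFm α) ≡ 1
  count (atom a) tt = refl
  count (α ∨ β) (inl u) = cong₂ _+_ (sub (occ-≟ (α ∨ β)) α inl inl-inj (count α) u) (miss (occ-≟ (α ∨ β)) β inr (inl u) λ _ ())
  count (α ∨ β) (inr u) = cong₂ _+_ (miss (occ-≟ (α ∨ β)) α inl (inr u) λ _ ()) (sub (occ-≟ (α ∨ β)) β inr inr-inj (count β) u)
  count (α ∧ β) (inl u) = cong₂ _+_ (sub (occ-≟ (α ∧ β)) α inl inl-inj (count α) u) (miss (occ-≟ (α ∧ β)) β inr (inl u) λ _ ())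
  count (α ∧ β) (inr u) = cong₂ _+_ (miss (occ-≟ (α ∧ β)) α inl (inr u) λ _ ()) (sub (occ-≟ (α ∧ β)) β inr inr-inj (count β) u)

module Combine {U L : Set} (D1 : Flow U (L ⊎ Fin 1)) (D2 : Flow (U ⊎ Fin 1) L)
  (m2 : Σ (Flow.E D2) λ e → Flow.up D2 e ≡ inl (inr zero)) where
  private
    module D1 = Flow D1
    module D2 = Flow D2

  E : Set
  E = CE D1 D2
  V : Set
  V = CV D1 D2

  topU : U ⊎ D1.V → V
  topU (inl u) = inr (inl u)
  topU (inr v) = inl (inl v)

  topU2 : ∀ {e} z → D2.up e ≡ z → ¬ (D2.up e ≡ inl (inr zero)) → V
  topU2 (inl (inl u)) p n = inr (inl u)
  topU2 (inl (inr zero)) p n = ⊥-elim (n p)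
  topU2 (inr v) p n = inl (inr v)

  botL2 : L ⊎ D2.V → V
  botL2 (inl l) = inr (inr l)
  botL2 (inr v) = inl (inr v)

  botL : (L ⊎ Fin 1) ⊎ D1.V → V
  botL (inl (inl l)) = inr (inr l)
  botL (inl (inr _)) = botL2 (D2.dn (fst m2))
  botL (inr v) = inl (inl v)

  up : E → U ⊎ V
  up (inl (inl u)) = inl u
  up (inl (inr l)) = inr (inr (inr l))
  up (inr (inl e)) = inr (topU (D1.up e))
  up (inr (inr (e , n))) = inr (topU2 (D2.up e) refl n)

  dn : E → L ⊎ V
  dn (inl (inl u)) = inr (inr (inl u))
  dn (inl (inr l)) = inl l
  dn (inr (inl e)) = inr (botL (D1.dn e))
  dn (inr (inr (e , n))) = inr (botL2 (D2.dn e))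

  combined : Flow U L
  combined = record { V = V ; E = E ; lab = clab D1 D2 ; up = up ; dn = dn }

  is-comb : IsComb combined D1 D2
  is-comb = record { vbij = ↔-refl ; ebij = ↔-refl ; lab-ok = λ _ → refl
                   ; up-ok = λ e → subst (CUp D1 D2 e) (sym (map2-id (up e))) (up-ok e)
                   ; dn-ok = λ e → subst (CDn D1 D2 e) (sym (map2-id (dn e))) (dn-ok e) }
    where
    map2-id : ∀ {A B : Set} (z : A ⊎ B) → map₂ id z ≡ z
    map2-id (inl _) = refl
    map2-id (inr _) = refl
    d2-up : ∀ e z (p : D2.up e ≡ z) n → CUp D1 D2 (inr (inr (e , n))) (inr (topU2 z p n))
    d2-up e (inl (inl u)) p n = CombDef.d₂-top p
    d2-up e (inl (inr zero)) p n = ⊥-elim (n p)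
    d2-up e (inr v) p n = CombDef.d₂-v p
    up-ok : ∀ e → CUp D1 D2 e (up e)
    up-ok (inl (inl u)) = CombDef.u-new
    up-ok (inl (inr l)) = CombDef.l-new
    up-ok (inr (inl e)) with D1.up e in eq
    ... | inl u = CombDef.d₁-top eq
    ... | inr v = CombDef.d₁-v eq
    up-ok (inr (inr (e , n))) = d2-up e (D2.up e) refl n
    dn-ok : ∀ e → CDn D1 D2 e (dn e)
    dn-ok (inl (inl u)) = CombDef.u-new
    dn-ok (inl (inr l)) = CombDef.l-new
    dn-ok (inr (inl e)) with D1.dn e in eq
    ... | inl (inl l) = CombDef.d₁-bot eq
    ... | inr v = CombDef.d₁-v eq
    ... | inl (inr zero) with D2.dn (fst m2) in eq'
    ...   | inl l = CombDef.d₁-mbot eq (snd m2) eq'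
    ...   | inr v = CombDef.d₁-mv eq (snd m2) eq'
    dn-ok (inr (inr (e , n))) with D2.dn e in eq
    ... | inl l = CombDef.d₂-bot eq
    ... | inr v = CombDef.d₂-v eq

module Merge {U L : Set} (D1 : Flow U (L ⊎ Fin 1)) (D2 : Flow (U ⊎ Fin 1) L)
  (M1 : Σ (Flow.E D1) λ e → Flow.dn D1 e ≡ inl (inr zero) × (∀ k → Flow.dn D1 k ≡ inl (inr zero) → k ≡ e))
  (M2 : Σ (Flow.E D2) λ e → Flow.up D2 e ≡ inl (inr zero) × (∀ k → Flow.up D2 k ≡ inl (inr zero) → k ≡ e)) where
  private
    module D1 = Flow D1
    module D2 = Flow D2

  open Combine D1 D2 (fst M2 , fst (snd M2)) public

  m2 : D2.E
  m2 = fst M2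
  m1 : D1.E
  m1 = fst M1

  nm1 : D1.E → E
  nm1 e = inr (inl e)

  nm2′ : ∀ e z → D2.up e ≡ z → E
  nm2′ e (inl (inr zero)) p = nm1 m1
  nm2′ e (inl (inl u)) p = inr (inr (e , λ q → inl≢inr (inl-inj (trans (sym p) q))))
  nm2′ e (inr v) p = inr (inr (e , λ q → inl≢inr (trans (sym q) p)))

  nm2 : D2.E → E
  nm2 e = nm2′ e (D2.up e) refl

  is-m2 : ∀ e → D2.up e ≡ inl (inr zero) → e ≡ m2
  is-m2 e p = snd (snd M2) e p

  nm2-m : nm2 m2 ≡ nm1 m1
  nm2-m = go (D2.up m2) refl (fst (snd M2))
    where
    go : ∀ z (p : D2.up m2 ≡ z) → z ≡ inl (inr zero) → nm2′ m2 z p ≡ nm1 m1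
    go _ p refl = refl

  nm2-keep : ∀ e n → nm2 e ≡ inr (inr (e , n))
  nm2-keep e n = go (D2.up e) refl
    where
    go : ∀ z p → nm2′ e z p ≡ inr (inr (e , n))
    go (inl (inr zero)) p = ⊥-elim (n p)
    go (inl (inl u)) p = refl
    go (inr v) p = refl

  case-m2 : ∀ e → (e ≡ m2) ⊎ (¬ (D2.up e ≡ inl (inr zero)))
  case-m2 e = go (D2.up e) refl
    where
    go : ∀ z → D2.up e ≡ z → (e ≡ m2) ⊎ (¬ (D2.up e ≡ inl (inr zero)))
    go (inl (inr zero)) p = inl (is-m2 e p)
    go (inl (inl u)) p = inr λ q → inl≢inr (inl-inj (trans (sym p) q))
    go (inr v) p = inr λ q → inl≢inr (trans (sym q) p)

  dn-nm2 : ∀ e → dn (nm2 e) ≡ inr (botL2 (D2.dn e))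
  dn-nm2 e with case-m2 e
  ... | inl refl = trans (cong dn nm2-m) (cong (λ z → inr (botL z)) (fst (snd M1)))
  ... | inr n = cong dn (nm2-keep e n)

  nm2-inj : ∀ e e' → nm2 e ≡ nm2 e' → e ≡ e'
  nm2-inj e e' p with case-m2 e | case-m2 e'
  ... | inl q | inl q' = trans q (sym q')
  ... | inl refl | inr n with () ← trans (sym nm2-m) (trans p (nm2-keep e' n))
  ... | inr n | inl refl with () ← trans (sym (nm2-keep e n)) (trans p nm2-m)
  ... | inr n | inr n' with trans (sym (nm2-keep e n)) (trans p (nm2-keep e' n'))
  ...   | refl = refl

  topU-inv : ∀ z {v} → topU z ≡ inl (inl v) → z ≡ inr v
  topU-inv (inr v) refl = refl
  botL2-inv : ∀ z {v} → botL2 z ≡ inl (inr v) → z ≡ inr v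
  botL2-inv (inr v) refl = refl
  botL2-inv1 : ∀ z {v} → botL2 z ≢ inl (inl v)
  botL2-inv1 (inl l) ()
  botL2-inv1 (inr v) ()
  botL2-bot : ∀ z {l} → botL2 z ≡ inr (inr l) → z ≡ inl l
  botL2-bot (inl l) refl = refl
  botL-inv : ∀ z {v} → botL z ≡ inl (inl v) → z ≡ inr v
  botL-inv (inr v) refl = refl
  botL-inv (inl (inl l)) ()
  botL-inv (inl (inr _)) p = ⊥-elim (botL2-inv1 _ p)
  botL-inv2 : ∀ z {v} → botL z ≡ inl (inr v) → z ≡ inl (inr zero) × D2.dn m2 ≡ inr v
  botL-inv2 (inl (inr zero)) p = refl , botL2-inv _ p
  botL-inv2 (inl (inl l)) ()
  botL-inv2 (inr v) ()
  botL-bot : ∀ z {l} → botL z ≡ inr (inr l) → (z ≡ inl (inl l)) ⊎ (z ≡ inl (inr zero) × D2.dn m2 ≡ inl l)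
  botL-bot (inl (inl l)) refl = inl refl
  botL-bot (inl (inr zero)) p = inr (refl , botL2-bot _ p)
  topU2-inv : ∀ {e} z p n {v} → topU2 {e} z p n ≡ inl (inr v) → z ≡ inr v
  topU2-inv (inl (inl u)) p n ()
  topU2-inv (inl (inr zero)) p n q = ⊥-elim (n p)
  topU2-inv (inr v) p n refl = refl
  topU2-inv1 : ∀ {e} z p n {v} → topU2 {e} z p n ≢ inl (inl v)
  topU2-inv1 (inl (inl u)) p n ()
  topU2-inv1 (inl (inr zero)) p n q = n p
  topU2-inv1 (inr v) p n ()
  topU-inv2 : ∀ z {v} → topU z ≢ inl (inr v)
  topU-inv2 (inl u) ()
  topU-inv2 (inr v) ()
  topU-top : ∀ z {u} → topU z ≡ inr (inl u) → z ≡ inl u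
  topU-top (inl u) refl = refl
  topU-bot : ∀ z {l} → topU z ≢ inr (inr l)
  topU-bot (inl u) ()
  topU-bot (inr v) ()
  topU2-top : ∀ {e} z p n {u} → topU2 {e} z p n ≡ inr (inl u) → z ≡ inl (inl u)
  topU2-top (inl (inl u)) p n refl = refl
  topU2-top (inl (inr zero)) p n q = ⊥-elim (n p)
  topU2-bot : ∀ {e} z p n {l} → topU2 {e} z p n ≢ inr (inr l)
  topU2-bot (inl (inl u)) p n ()
  topU2-bot (inl (inr zero)) p n q = n p
  topU2-bot (inr v) p n ()
  botL-top : ∀ z {u} → botL z ≢ inr (inl u)
  botL2-top : ∀ z {u} → botL2 z ≢ inr (inl u)
  botL2-top (inl l) ()
  botL2-top (inr v) ()
  botL-top (inl (inl l)) ()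
  botL-top (inl (inr _)) p = botL2-top _ p
  botL-top (inr v) ()

  topU2-from-top : ∀ {e} z (q : D2.up e ≡ z) n {u} → z ≡ inl (inl u) → topU2 z q n ≡ inr (inl u)
  topU2-from-top _ q n refl = refl
  topU2-from-ver : ∀ {e} z (q : D2.up e ≡ z) n {v} → z ≡ inr v → topU2 z q n ≡ inl (inr v)
  topU2-from-ver _ q n refl = refl

  up-nm2 : ∀ {e} → (∀ {v} → D2.up e ≡ inr v → up (nm2 e) ≡ inr (inl (inr v))) × (∀ {u} → D2.up e ≡ inl (inl u) → up (nm2 e) ≡ inr (inr (inl u)))
  up-nm2 {e} = (λ p → go p (λ q → inl≢inr (trans (sym q) p)) (topU2-from-ver (D2.up e) refl _ p)) ,
    λ p → go p (λ q → inl≢inr (inl-inj (trans (sym p) q))) (topU2-from-top (D2.up e) refl _ p)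
    where
    go : ∀ {z w} → D2.up e ≡ z → (n : ¬ (D2.up e ≡ inl (inr zero))) → topU2 (D2.up e) refl n ≡ w → up (nm2 e) ≡ inr w
    go p n q = trans (cong up (nm2-keep e n)) (cong inr q)

module CombineStruct {At : Set} {bar : At → At} {U L : Set} {D1 : Flow U (L ⊎ Fin 1)} {D2 : Flow (U ⊎ Fin 1) L}
  {aU : U → At} {aL : L → At} {a : At} {X : Fm U} {Y : Fm L} (X-lin : Linear X) (Y-lin : Linear Y)
  (S1 : NStruct bar D1 aU (case⊎ aL (λ _ → a)) X (mapFm inl Y ∨ atom (inr zero)))
  (S2 : NStruct bar D2 (case⊎ aU (λ _ → a)) aL (mapFm inl X ∧ atom (inr zero)) Y) where
  private
    module D1 = Flow D1
    module D2 = Flow D2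
    module S1 = NStruct S1
    module S2 = NStruct S2

  open Merge D1 D2 (S1.botE (inr zero) , S1.bot-dn (inr zero) , λ k → S1.bot-un k (inr zero))
    (S2.topE (inr zero) , S2.top-up (inr zero) , λ k → S2.top-un k (inr zero)) public

  private
    at : E → At
    at (inl (inl u)) = aU u
    at (inl (inr l)) = aL l
    at (inr (inl e)) = S1.at e
    at (inr (inr (e , _))) = S2.at e

    at2 : ∀ e → at (nm2 e) ≡ S2.at e
    at2 e with case-m2 e
    ... | inl refl = trans (cong at nm2-m) (trans (S1.at-bot (inr zero)) (sym (S2.at-top (inr zero))))
    ... | inr n = cong at (nm2-keep e n)

    ports1-up : ∀ {v n} {i : Fin n → D1.E} → IsPorts D1.up v i → IsPorts up (inl (inl v)) (nm1 ∘ i)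
    ports1-up {v} {n} {i} Z = record { hit = λ j → cong (inr ∘ topU) (hit Z j) ; inj = λ { p → inj Z (inl-inj (inr-inj p)) } ; all = al }
      where
      al : ∀ x → up x ≡ inr (inl (inl v)) → Σ (Fin n) λ j → nm1 (i j) ≡ x
      al (inr (inl e)) p = let (j , q) = all Z e (topU-inv _ (inr-inj p)) in j , cong nm1 q
      al (inr (inr (e , n))) p = ⊥-elim (topU2-inv1 _ refl n (inr-inj p))
      al (inl (inl u)) ()
      al (inl (inr l)) ()

    ports1-dn : ∀ {v n} {i : Fin n → D1.E} → IsPorts D1.dn v i → IsPorts dn (inl (inl v)) (nm1 ∘ i)
    ports1-dn {v} {n} {i} Z = record { hit = λ j → cong (inr ∘ botL) (hit Z j) ; inj = λ { p → inj Z (inl-inj (inr-inj p)) } ; all = al }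
      where
      al : ∀ x → dn x ≡ inr (inl (inl v)) → Σ (Fin n) λ j → nm1 (i j) ≡ x
      al (inr (inl e)) p = let (j , q) = all Z e (botL-inv _ (inr-inj p)) in j , cong nm1 q
      al (inr (inr (e , n))) p = ⊥-elim (botL2-inv1 _ (inr-inj p))
      al (inl (inl u)) ()
      al (inl (inr l)) ()

    ports2-up : ∀ {v n} {i : Fin n → D2.E} → IsPorts D2.up v i → IsPorts up (inl (inr v)) (nm2 ∘ i)
    ports2-up {v} {n} {i} Z = record { hit = λ j → fst up-nm2 (hit Z j) ; inj = λ p → inj Z (nm2-inj _ _ p) ; all = al }
      where
      al : ∀ x → up x ≡ inr (inl (inr v)) → Σ (Fin n) λ j → nm2 (i j) ≡ x
      al (inr (inl e)) p = ⊥-elim (topU-inv2 _ (inr-inj p))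
      al (inr (inr (e , n))) p = let (j , q) = all Z e (topU2-inv _ refl n (inr-inj p)) in j , trans (cong nm2 q) (nm2-keep e n)
      al (inl (inl u)) ()
      al (inl (inr l)) ()

    ports2-dn : ∀ {v n} {i : Fin n → D2.E} → IsPorts D2.dn v i → IsPorts dn (inl (inr v)) (nm2 ∘ i)
    ports2-dn {v} {n} {i} Z = record { hit = λ j → trans (dn-nm2 (i j)) (cong (inr ∘ botL2) (hit Z j)) ; inj = λ p → inj Z (nm2-inj _ _ p) ; all = al }
      where
      al : ∀ x → dn x ≡ inr (inl (inr v)) → Σ (Fin n) λ j → nm2 (i j) ≡ x
      al (inr (inl e)) p with botL-inv2 _ (inr-inj p)
      ... | (q , r) = let (j , w) = all Z m2 r in j , trans (cong nm2 w) (trans nm2-m (cong nm1 (sym (S1.bot-un e (inr zero) q))))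
      al (inr (inr (e , n))) p = let (j , q) = all Z e (botL2-inv _ (inr-inj p)) in j , trans (cong nm2 q) (nm2-keep e n)
      al (inl (inl u)) ()
      al (inl (inr l)) ()

    one : ∀ {Z : Set} → Z → Fin 1 → Z
    one e _ = e
    pair : ∀ {Z : Set} → Z → Z → Fin 2 → Z
    pair e e' zero = e
    pair e e' (suc zero) = e'

    top2 : U → D2.E
    top2 u = S2.topE (inl u)
    bot1 : L → D1.E
    bot1 l = S1.botE (inl l)

    top2-n : ∀ u → ¬ (D2.up (top2 u) ≡ inl (inr zero))
    top2-n u q with () ← trans (sym (S2.top-up (inl u))) q

    coc-out : ∀ u → IsPorts up (inr (inl u)) (pair (nm1 (S1.topE u)) (nm2 (top2 u)))
    coc-out u = record { hit = ht ; inj = ij ; all = al }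
      where
      ht : ∀ j → up (pair (nm1 (S1.topE u)) (nm2 (top2 u)) j) ≡ inr (inr (inl u))
      ht zero = cong (inr ∘ topU) (S1.top-up u)
      ht (suc zero) = snd up-nm2 (S2.top-up (inl u))
      ij : ∀ {j k} → pair (nm1 (S1.topE u)) (nm2 (top2 u)) j ≡ pair (nm1 (S1.topE u)) (nm2 (top2 u)) k → j ≡ k
      ij {zero} {zero} p = refl
      ij {zero} {suc zero} p with () ← trans p (nm2-keep (top2 u) (top2-n u))
      ij {suc zero} {zero} p with () ← trans (sym p) (nm2-keep (top2 u) (top2-n u))
      ij {suc zero} {suc zero} p = refl
      al : ∀ x → up x ≡ inr (inr (inl u)) → Σ (Fin 2) λ j → pair (nm1 (S1.topE u)) (nm2 (top2 u)) j ≡ x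
      al (inr (inl e)) p = zero , cong nm1 (sym (S1.top-un e u (topU-top _ (inr-inj p))))
      al (inr (inr (e , n))) p with S2.top-un e (inl u) (topU2-top _ refl n (inr-inj p))
      ... | refl = suc zero , nm2-keep e n
      al (inl (inl _)) ()
      al (inl (inr l)) ()

    coc-in : ∀ u → IsPorts dn (inr (inl u)) (one (inl (inl u)))
    coc-in u = record { hit = λ _ → refl ; inj = λ { {zero} {zero} _ → refl } ; all = al }
      where
      al : ∀ x → dn x ≡ inr (inr (inl u)) → Σ (Fin 1) λ j → inl (inl u) ≡ x
      al (inl (inl _)) refl = zero , refl
      al (inr (inl e)) p = ⊥-elim (botL-top (D1.dn e) (inr-inj p))
      al (inr (inr (e , n))) p = ⊥-elim (botL2-top (D2.dn e) (inr-inj p))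

    con-out : ∀ l → IsPorts up (inr (inr l)) (one (inl (inr l)))
    con-out l = record { hit = λ _ → refl ; inj = λ { {zero} {zero} _ → refl } ; all = al }
      where
      al : ∀ x → up x ≡ inr (inr (inr l)) → Σ (Fin 1) λ j → inl (inr l) ≡ x
      al (inl (inr _)) refl = zero , refl
      al (inr (inl e)) p = ⊥-elim (topU-bot _ (inr-inj p))
      al (inr (inr (e , n))) p = ⊥-elim (topU2-bot _ refl n (inr-inj p))

    con-in : ∀ l → IsPorts dn (inr (inr l)) (pair (nm1 (bot1 l)) (nm2 (S2.botE l)))
    con-in l = record { hit = ht ; inj = ij ; all = al }
      where
      ht : ∀ j → dn (pair (nm1 (bot1 l)) (nm2 (S2.botE l)) j) ≡ inr (inr (inr l))
      ht zero = cong (inr ∘ botL) (S1.bot-dn (inl l))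
      ht (suc zero) = trans (dn-nm2 _) (cong (inr ∘ botL2) (S2.bot-dn l))
      apart : nm1 (bot1 l) ≢ nm2 (S2.botE l)
      apart p with case-m2 (S2.botE l)
      ... | inr n with () ← trans p (nm2-keep _ n)
      ... | inl e with inl-inj (inr-inj (trans p (trans (cong nm2 e) nm2-m)))
      ...   | q with () ← trans (sym (S1.bot-dn (inl l))) (trans (cong D1.dn q) (S1.bot-dn (inr zero)))
      ij : ∀ {j k} → pair (nm1 (bot1 l)) (nm2 (S2.botE l)) j ≡ pair (nm1 (bot1 l)) (nm2 (S2.botE l)) k → j ≡ k
      ij {zero} {zero} p = refl
      ij {zero} {suc zero} p = ⊥-elim (apart p)
      ij {suc zero} {zero} p = ⊥-elim (apart (sym p))
      ij {suc zero} {suc zero} p = refl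
      al : ∀ x → dn x ≡ inr (inr (inr l)) → Σ (Fin 2) λ j → pair (nm1 (bot1 l)) (nm2 (S2.botE l)) j ≡ x
      al (inl (inl u)) ()
      al (inl (inr _)) ()
      al (inr (inl e)) p with botL-bot _ (inr-inj p)
      ... | inl q = zero , cong nm1 (sym (S1.bot-un e (inl l) q))
      ... | inr (q , r) = suc zero , trans (cong nm2 (sym (S2.bot-un m2 l r))) (trans nm2-m (cong nm1 (sym (S1.bot-un e (inr zero) q))))
      al (inr (inr (e , n))) p = suc zero , trans (cong nm2 (sym (S2.bot-un e l (botL2-bot _ (inr-inj p))))) (nm2-keep e n)

    𝒩 : Fm E → Fm E → Set
    𝒩 = N bar combined at

    ∧-exchange : ∀ {a b c d} → 𝒩 ((a ∧ b) ∧ (c ∧ d)) ((a ∧ c) ∧ (b ∧ d))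
    ∧-exchange = lin (ax→ ∧-assoc) ⨾ idN ∧ᴺ (lin (ax← ∧-assoc) ⨾ ∧-swap ∧ᴺ idN ⨾ lin (ax→ ∧-assoc)) ⨾ lin (ax← ∧-assoc)
    ∨-exchange : ∀ {a b c d} → 𝒩 ((a ∨ b) ∨ (c ∨ d)) ((a ∨ c) ∨ (b ∨ d))
    ∨-exchange = lin (ax→ ∨-assoc) ⨾ idN ∨ᴺ (lin (ax← ∨-assoc) ⨾ ∨-swap ∨ᴺ idN ⨾ lin (ax→ ∨-assoc)) ⨾ lin (ax← ∨-assoc)

    duplicate : ∀ F → 𝒩 (mapFm (inl ∘ inl) F) (mapFm (nm1 ∘ S1.topE) F ∧ mapFm (nm2 ∘ top2) F)
    duplicate 𝔣 = lin (ax← 𝔣𝔣)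
    duplicate 𝔱 = lin (ax← ∧-unit)
    duplicate (atom u) = vx ac↑ (inr (inl u)) _ _ refl (coc-in u) (coc-out u) (S1.at-top u , trans (at2 _) (S2.at-top (inl u)))
    duplicate (α ∨ β) = duplicate α ∨ᴺ duplicate β ⨾ lin md
    duplicate (α ∧ β) = duplicate α ∧ᴺ duplicate β ⨾ ∧-exchange

    merge : ∀ F → 𝒩 (mapFm (nm1 ∘ bot1) F ∨ mapFm (nm2 ∘ S2.botE) F) (mapFm (inl ∘ inr) F)
    merge 𝔣 = lin (ax→ ∨-unit)
    merge 𝔱 = lin (ax→ 𝔱𝔱)
    merge (atom l) = vx ac↓ (inr (inr l)) _ _ refl (con-in l) (con-out l) (S1.at-bot (inl l) , trans (at2 _) (S2.at-bot l))
    merge (α ∨ β) = ∨-exchange ⨾ merge α ∨ᴺ merge β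
    merge (α ∧ β) = lin md ⨾ merge α ∧ᴺ merge β

    fold-duplicate : ∀ f F → fold f (duplicate F) ≡ foldFm (λ u → f (inr (inl u))) F
    fold-duplicate f 𝔣 = refl
    fold-duplicate f 𝔱 = refl
    fold-duplicate f (atom u) = refl
    fold-duplicate f (α ∨ β) = trans (ℕP.+-identityʳ _) (cong₂ _+_ (fold-duplicate f α) (fold-duplicate f β))
    fold-duplicate f (α ∧ β) = trans (ℕP.+-identityʳ _) (cong₂ _+_ (fold-duplicate f α) (fold-duplicate f β))

    fold-merge : ∀ f F → fold f (merge F) ≡ foldFm (λ l → f (inr (inr l))) F
    fold-merge f 𝔣 = refl
    fold-merge f 𝔱 = refl
    fold-merge f (atom u) = refl
    fold-merge f (α ∨ β) = cong₂ _+_ (fold-merge f α) (fold-merge f β)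
    fold-merge f (α ∧ β) = cong₂ _+_ (fold-merge f α) (fold-merge f β)

    patches1 : Patches {bar = bar} {A = D1} {at = S1.at} {A' = combined} {at' = at} (atom ∘ nm1) (λ _ → ⊤)
    patches1 k v i o _ l p q ok = eqN (bind-bind _ _ (srcF k)) ⨾ vx k (inl (inl v)) _ _ l (ports1-dn p) (ports1-up q) ok ⨾ eqN (sym (bind-bind _ _ (tgtF k)))

    patches2 : Patches {bar = bar} {A = D2} {at = S2.at} {A' = combined} {at' = at} (atom ∘ nm2) (λ _ → ⊤)
    patches2 k v i o _ l p q ok = eqN (bind-bind _ _ (srcF k)) ⨾
      vx k (inl (inr v)) _ _ l (ports2-dn p) (ports2-up q) (AtOK-cong bar k (λ j → at2 (i j)) (λ j → at2 (o j)) ok) ⨾ eqN (sym (bind-bind _ _ (tgtF k)))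

    der1 = translate (atom ∘ nm1) patches1 S1.der (allV _ S1.der)
    der2 = translate (atom ∘ nm2) patches2 S2.der (allV _ S2.der)

    left : 𝒩 (mapFm (nm1 ∘ S1.topE) X) (mapFm (nm1 ∘ bot1) Y ∨ atom (nm1 m1))
    left = eqN (sym (bind-bind _ _ X)) ⨾ der1 ⨾ eqN (cong (_∨ atom (nm1 m1)) (trans (cong (bind _) (bind-bind _ _ Y)) (bind-bind _ _ Y)))

    right : 𝒩 (mapFm (nm2 ∘ top2) X ∧ atom (nm1 m1)) (mapFm (nm2 ∘ S2.botE) Y)
    right = eqN (cong₂ _∧_ (sym (trans (cong (bind _) (bind-bind _ _ X)) (bind-bind _ _ X))) (cong atom (sym nm2-m))) ⨾ der2 ⨾ eqN (bind-bind _ _ Y)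

    whole : 𝒩 (mapFm (inl ∘ inl) X) (mapFm (inl ∘ inr) Y)
    whole = duplicate X ⨾ (left ⨾ ∨-swap) ∧ᴺ idN ⨾ ∧-swap ⨾ lin sw ⨾ right ∨ᴺ idN ⨾ ∨-swap ⨾ merge Y

    fold-whole : ∀ f → fold f whole ≡ foldFm (λ u → f (inr (inl u))) X + (fold f der1 + (fold f der2 + foldFm (λ l → f (inr (inr l))) Y))
    fold-whole f = go (fold f (duplicate X)) (fold f der1) (fold f der2) (fold f (merge Y)) (fold-duplicate f X) (fold-merge f Y)
      where
      go : ∀ a b c d {a' d'} → a ≡ a' → d ≡ d' → a + (((b + 0) + 0 + 0) + ((c + 0) + 0 + d)) ≡ a' + (b + (c + d'))
      go a b c d refl refl = cong (a +_) (cong₂ _+_ (trans (ℕP.+-identityʳ _) (trans (ℕP.+-identityʳ _) (ℕP.+-identityʳ b)))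
                                                    (cong (_+ d) (trans (ℕP.+-identityʳ _) (ℕP.+-identityʳ c))))

    _≟U_ = fst X-lin
    _≟L_ = fst Y-lin
    _≟D_ : DecEq (D1.V ⊎ D2.V)
    _≟D_ = SumP.≡-dec S1._≟V_ S2._≟V_
    _≟B_ : DecEq (U ⊎ L)
    _≟B_ = SumP.≡-dec _≟U_ _≟L_
    _≟C_ : DecEq V
    _≟C_ = SumP.≡-dec _≟D_ _≟B_

    fold-der1 : ∀ f → fold f der1 ≡ fold (λ v → f (inl (inl v))) S1.der
    fold-der1 f = fold-translate (atom ∘ nm1) patches1 f _ (λ k v i o q l a b c → ℕP.+-identityʳ _) S1.der _
    fold-der2 : ∀ f → fold f der2 ≡ fold (λ v → f (inl (inr v))) S2.der
    fold-der2 f = fold-translate (atom ∘ nm2) patches2 f _ (λ k v i o q l a b c → ℕP.+-identityʳ _) S2.der _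

    fold-zero : ∀ {U L} {A : Flow U L} {at' : Flow.E A → At} {X Y} (d : N bar A at' X Y) {f : Flow.V A → ℕ} → (∀ v → f v ≡ 0) → fold f d ≡ 0
    fold-zero d {f} p = trans (fold-cong p d) (zeros d)
      where
      zeros : ∀ {U L} {A : Flow U L} {at' : Flow.E A → At} {X Y} (d : N bar A at' X Y) → fold (λ _ → 0) d ≡ 0
      zeros (eqN _) = refl
      zeros (lin _) = refl
      zeros (c ⨾ d) = cong₂ _+_ (zeros c) (zeros d)
      zeros (c ∨ᴺ d) = cong₂ _+_ (zeros c) (zeros d)
      zeros (c ∧ᴺ d) = cong₂ _+_ (zeros c) (zeros d)
      zeros (vx k v i o _ _ _ _) = refl

    foldFm-zero : ∀ {U : Set} {f : U → ℕ} → (∀ u → f u ≡ 0) → ∀ F → foldFm f F ≡ 0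
    foldFm-zero p F = trans (foldFm-cong p F) (foldFm-0 F)

    counts : ∀ v {a b c d} → foldFm (λ u → δ _≟C_ v (inr (inl u))) X ≡ a → fold (δ _≟C_ v) der1 ≡ b → fold (δ _≟C_ v) der2 ≡ c →
      foldFm (λ l → δ _≟C_ v (inr (inr l))) Y ≡ d → a + (b + (c + d)) ≡ 1 → fold (δ _≟C_ v) whole ≡ 1
    counts v refl refl refl refl p = trans (fold-whole (δ _≟C_ v)) p

    zX : ∀ v → (∀ u → v ≢ inr (inl u)) → foldFm (λ u → δ _≟C_ v (inr (inl u))) X ≡ 0
    zX v n = foldFm-zero (λ u → δ-no _≟C_ {v} (n u)) X
    zY : ∀ v → (∀ l → v ≢ inr (inr l)) → foldFm (λ l → δ _≟C_ v (inr (inr l))) Y ≡ 0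
    zY v n = foldFm-zero (λ l → δ-no _≟C_ {v} (n l)) Y
    z1 : ∀ v → (∀ x → v ≢ inl (inl x)) → fold (δ _≟C_ v) der1 ≡ 0
    z1 v n = trans (fold-der1 (δ _≟C_ v)) (fold-zero S1.der (λ y → δ-no _≟C_ {v} (n y)))
    z2 : ∀ v → (∀ x → v ≢ inl (inr x)) → fold (δ _≟C_ v) der2 ≡ 0
    z2 v n = trans (fold-der2 (δ _≟C_ v)) (fold-zero S2.der (λ y → δ-no _≟C_ {v} (n y)))

    full : ∀ v → fold (δ _≟C_ v) whole ≡ 1
    full v@(inl (inl x)) = counts v (zX v λ _ ())
      (trans (fold-der1 (δ _≟C_ v)) (trans (fold-cong (λ y → trans (δ-⊎ _≟D_ _≟B_ (inl x) (inl y)) (δ-⊎ S1._≟V_ S2._≟V_ x y)) S1.der) (S1.full x)))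
      (z2 v λ _ ())
      (zY v λ _ ()) refl
    full v@(inl (inr x)) = counts v (zX v λ _ ())
      (z1 v λ _ ())
      (trans (fold-der2 (δ _≟C_ v)) (trans (fold-cong (λ y → trans (δ-⊎ _≟D_ _≟B_ (inr x) (inr y)) (δ-⊎ʳ S1._≟V_ S2._≟V_ x y)) S2.der) (S2.full x)))
      (zY v λ _ ()) refl
    full v@(inr (inl x)) = counts v
      (trans (foldFm-cong (λ y → trans (δ-⊎ʳ _≟D_ _≟B_ (inl x) (inl y)) (δ-⊎ _≟U_ _≟L_ x y)) X) (snd X-lin x))
      (z1 v λ _ ())
      (z2 v λ _ ())
      (zY v λ _ ()) refl
    full v@(inr (inr x)) = counts v (zX v λ _ ())
      (z1 v λ _ ())
      (z2 v λ _ ())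
      (trans (foldFm-cong (λ y → trans (δ-⊎ʳ _≟D_ _≟B_ (inr x) (inr y)) (δ-⊎ʳ _≟U_ _≟L_ x y)) Y) (snd Y-lin x)) refl

  comb-struct : NStruct bar combined aU aL X Y
  comb-struct = record
    { _≟V_ = _≟C_ ; at = at ; topE = inl ∘ inl ; botE = inl ∘ inr ; top-up = λ _ → refl
    ; top-un = λ { (inl (inl u)) _ refl → refl ; (inr (inl e)) _ () ; (inr (inr e)) _ () }
    ; bot-dn = λ _ → refl
    ; bot-un = λ { (inl (inr u)) _ refl → refl ; (inr (inl e)) _ () ; (inr (inr e)) _ () }
    ; at-top = λ _ → refl ; at-bot = λ _ → refl
    ; der = whole ; full = full }

inj2? : {X V : Set} → DecEq V → (x : X ⊎ V) (v : V) → Dec (x ≡ inr v)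
inj2? _≟_ (inl _) v = no λ ()
inj2? _≟_ (inr w) v = map′ (cong inr) inr-inj (w ≟ v)

listed : {A : Set} → Finite A → List A
listed (n , b) = tabulate (to b)

∈-listed : {A : Set} (f : Finite A) (a : A) → a ∈ listed f
∈-listed (n , b) a = subst (_∈ tabulate (to b)) (inv-l b a) (∈-tabulate⁺ {f = to b} (from b a))

-- Warshall's closure of a relation.
module Closure {V : Set} (R : V → V → Set) where

  Via : List V → V → V → Set
  Via [] a b = R a b
  Via (x ∷ xs) a b = Via xs a b ⊎ (Via xs a x × Via xs x b)

  via? : (∀ a b → Dec (R a b)) → ∀ xs a b → Dec (Via xs a b)
  via? R? [] a b = R? a b
  via? R? (x ∷ xs) a b = via? R? xs a b ⊎-dec (via? R? xs a x ×-dec via? R? xs x b)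

  via-step : ∀ xs {a b} → R a b → Via xs a b
  via-step [] r = r
  via-step (x ∷ xs) r = inl (via-step xs r)

  via-trans : ∀ xs {a b x} → x ∈ xs → Via xs a x → Via xs x b → Via xs a b
  via-trans (x ∷ xs) (here refl) p q = inr (to-x p , from-x q)
    where
    to-x : ∀ {a} → Via (x ∷ xs) a x → Via xs a x
    to-x (inl p) = p
    to-x (inr (p , _)) = p
    from-x : ∀ {b} → Via (x ∷ xs) x b → Via xs x b
    from-x (inl p) = p
    from-x (inr (_ , q)) = q
  via-trans (y ∷ xs) (there i) (inl p) (inl q) = inl (via-trans xs i p q)
  via-trans (y ∷ xs) (there i) (inl p) (inr (q , r)) = inr (via-trans xs i p q , r)
  via-trans (y ∷ xs) (there i) (inr (p , q)) (inl r) = inr (p , via-trans xs i q r)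
  via-trans (y ∷ xs) (there i) (inr (p , q)) (inr (r , t)) = inr (p , t)

or : Sign → Dir
or plus = ⇓
or minus = ⇑

or-inj : ∀ {x y} → or x ≡ or y → x ≡ y
or-inj {plus} {plus} p = refl
or-inj {minus} {minus} p = refl

-- Orienting positive edges downwards and negative ones upwards turns ai-paths into directed paths.
Arc : ∀ {U L} (A : Flow U L) → Polarity A → Flow.E A → Flow.V A → Flow.V A → Set
Arc A π e a b = src A (e , or (π e)) ≡ inr a × tgt A (e , or (π e)) ≡ inr b

module Ends {U L : Set} (A : Flow U L) where
  private
    module A = Flow A

  up-src : ∀ {e v} → A.up e ≡ inr v → src A (e , ⇓) ≡ inr v
  up-src p = cong (upPt A) p
  dn-tgt : ∀ {e v} → A.dn e ≡ inr v → tgt A (e , ⇓) ≡ inr v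
  dn-tgt p = cong (dnPt A) p
  up-src⁻ : ∀ {e v} → upPt A (A.up e) ≡ inr v → A.up e ≡ inr v
  up-src⁻ {e} p with A.up e
  up-src⁻ refl | inr v = refl
  dn-tgt⁻ : ∀ {e v} → dnPt A (A.dn e) ≡ inr v → A.dn e ≡ inr v
  dn-tgt⁻ {e} p with A.dn e
  dn-tgt⁻ refl | inr v = refl

  inc-src : ∀ {e} d {v} → src A (e , d) ≡ inr v → Incident A e v
  inc-src ⇓ p = inl (up-src⁻ p)
  inc-src ⇑ p = inr (dn-tgt⁻ p)
  inc-tgt : ∀ {e} d {v} → tgt A (e , d) ≡ inr v → Incident A e v
  inc-tgt ⇓ p = inr (dn-tgt⁻ p)
  inc-tgt ⇑ p = inl (up-src⁻ p)

  ends-only : ∀ {e} d {a b v} → src A (e , d) ≡ inr a → tgt A (e , d) ≡ inr b → Incident A e v → v ≡ a ⊎ v ≡ b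
  ends-only ⇓ p q (inl i) = inl (inr-inj (trans (sym i) (up-src⁻ p)))
  ends-only ⇓ p q (inr i) = inr (inr-inj (trans (sym i) (dn-tgt⁻ q)))
  ends-only ⇑ p q (inl i) = inr (inr-inj (trans (sym i) (up-src⁻ q)))
  ends-only ⇑ p q (inr i) = inl (inr-inj (trans (sym i) (dn-tgt⁻ p)))

  module _ (W : WF A) where

    in-degree : ∀ {v k e} → A.lab v ≡ k → A.dn e ≡ inr v → Fin (ins k)
    in-degree {v} refl p = from (inDeg W v) (_ , p)
    out-degree : ∀ {v k e} → A.lab v ≡ k → A.up e ≡ inr v → Fin (outs k)
    out-degree {v} refl p = from (outDeg W v) (_ , p)

    single-in : ∀ {v e e'} → ins (A.lab v) ≡ 1 → A.dn e ≡ inr v → A.dn e' ≡ inr v → e ≡ e'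
    single-in {v} q p p' = cong fst (from-inj (inDeg W v) {_ , p} {_ , p'} (Fin1 q _ _))
      where
      Fin1 : ∀ {n} → n ≡ 1 → (x y : Fin n) → x ≡ y
      Fin1 refl zero zero = refl
    single-out : ∀ {v e e'} → outs (A.lab v) ≡ 1 → A.up e ≡ inr v → A.up e' ≡ inr v → e ≡ e'
    single-out {v} q p p' = cong fst (from-inj (outDeg W v) {_ , p} {_ , p'} (Fin1 q _ _))
      where
      Fin1 : ∀ {n} → n ≡ 1 → (x y : Fin n) → x ≡ y
      Fin1 refl zero zero = refl

    weakening-edge : ∀ {v e e'} → A.lab v ≡ aw↓ → Incident A e v → Incident A e' v → e ≡ e'
    weakening-edge l (inr p) _ with () ← in-degree l p
    weakening-edge l (inl p) (inr q) with () ← in-degree l q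
    weakening-edge l (inl p) (inl q) = single-out (cong outs l) p q
    coweakening-edge : ∀ {v e e'} → A.lab v ≡ aw↑ → Incident A e v → Incident A e' v → e ≡ e'
    coweakening-edge l (inl p) _ with () ← out-degree l p
    coweakening-edge l (inr p) (inl q) with () ← out-degree l q
    coweakening-edge l (inr p) (inr q) = single-in (cong ins l) p q

module Graph {U L : Set} {A : Flow U L} (W : WF A) {π : Polarity A} (val : ValidPol A π) where
  open Ends A
  private
    module A = Flow A
    _≟V_ : DecEq A.V
    _≟V_ = finite-≟ (finV W)

  o : A.E → OE A
  o e = e , or (π e)

  R : A.V → A.V → Set
  R a b = Σ A.E λ e → Arc A π e a b

  open Closure R

  vs : List A.V
  vs = listed (finV W)

  T : A.V → A.V → Set
  T = Via vs

  T? : ∀ a b → Dec (T a b)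
  T? = via? (λ a b → finite-any? (finE W) λ e → inj2? _≟V_ (src A (o e)) a ×-dec inj2? _≟V_ (tgt A (o e)) b) vs

  arc⇒T : ∀ {e a b} → Arc A π e a b → T a b
  arc⇒T r = via-step vs (_ , r)

  T-trans : ∀ {a b c} → T a b → T b c → T a c
  T-trans {b = b} = via-trans vs (∈-listed (finV W) b)

  data Walk : A.V → A.V → Set where
    one : ∀ {a b} e → Arc A π e a b → Walk a b
    _,_◂_ : ∀ {a b c} e → Arc A π e a b → Walk b c → Walk a c

  _◂◂_ : ∀ {a b c} → Walk a b → Walk b c → Walk a c
  one e r ◂◂ w = e , r ◂ w
  (e , r ◂ w) ◂◂ w' = e , r ◂ (w ◂◂ w')

  T⇒walk : ∀ {a b} → T a b → Walk a b
  T⇒walk = go vs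
    where
    go : ∀ xs {a b} → Via xs a b → Walk a b
    go [] (e , r) = one e r
    go (x ∷ xs) (inl p) = go xs p
    go (x ∷ xs) (inr (p , q)) = go xs p ◂◂ go xs q

  walk⇒T : ∀ {a b} → Walk a b → T a b
  walk⇒T (one e r) = arc⇒T r
  walk⇒T (e , r ◂ w) = T-trans (arc⇒T r) (walk⇒T w)

  steps : ∀ {a b} → Walk a b → List (OE A)
  steps (one e r) = o e ∷ []
  steps (e , r ◂ w) = o e ∷ steps w

  sources : ∀ {a b} → Walk a b → List A.V
  sources {a} (one e r) = a ∷ []
  sources {a} (e , r ◂ w) = a ∷ sources w

  no-arc-loop : ∀ {e a} → ¬ Arc A π e a a
  no-arc-loop {e} (p , q) with π e
  ... | plus = no-loop W e _ (up-src⁻ p) (dn-tgt⁻ q)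
  ... | minus = no-loop W e _ (up-src⁻ q) (dn-tgt⁻ p)

  both-sides : ∀ {e e' v} → A.dn e ≡ inr v → A.up e' ≡ inr v → IsContr A (A.lab v)
  both-sides {v = v} p q = go (A.lab v) refl
    where
    go : ∀ k → A.lab v ≡ k → IsContr A k
    go ai↓ l with () ← in-degree W l p
    go ai↑ l with () ← out-degree W l q
    go aw↓ l with () ← in-degree W l p
    go aw↑ l with () ← out-degree W l q
    go ac↓ l = inl refl
    go ac↑ l = inr refl

  two-edges : ∀ {e e' v} → Incident A e v → Incident A e' v → π e ≢ π e' → IsAI A (A.lab v)
  two-edges {e} {e'} {v} p q n = go (A.lab v) refl
    where
    go : ∀ k → A.lab v ≡ k → IsAI A k
    go ai↓ l = inl refl
    go ai↑ l = inr refl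
    go ac↓ l = ⊥-elim (n (fst (val v) (inl l) e e' p q))
    go ac↑ l = ⊥-elim (n (fst (val v) (inr l) e e' p q))
    go aw↓ l = ⊥-elim (n (cong π (weakening-edge W l p q)))
    go aw↑ l = ⊥-elim (n (cong π (coweakening-edge W l p q)))

  arcs-link : ∀ {e e' a b c} → Arc A π e a b → Arc A π e' b c → Link A (o e) (o e')
  arcs-link {e} {e'} {b = b} (_ , p) (q , _) = b , p , q , go (π e ≟ˢ π e')
    where
    go : Dec (π e ≡ π e') → or (π e) ≡ or (π e') ⊎ (or (π e) ≢ or (π e') × IsAI A (A.lab b) × e ≢ e')
    go (yes r) = inl (cong or r)
    go (no n) = inr (n ∘ or-inj , two-edges (inc-tgt (or (π e)) p) (inc-src (or (π e')) q) n , λ { refl → n refl })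

  walk-chain : ∀ {a b} (w : Walk a b) → Chain A (steps w)
  walk-chain (one e r) = tt
  walk-chain (e , r ◂ one e' r') = arcs-link r r' , tt
  walk-chain (e , r ◂ w@(_ , r' ◂ _)) = arcs-link r r' , walk-chain w

  walk-start : ∀ {a b} (w : Walk a b) → StartsAt A (steps w) (inr a)
  walk-start (one e r) = fst r
  walk-start (e , r ◂ w) = fst r

  walk-end : ∀ {a b} (w : Walk a b) → EndsAt A (steps w) (inr b)
  walk-end (one e r) = snd r
  walk-end (e , r ◂ one e' r') = snd r'
  walk-end (e , r ◂ w@(_ , _ ◂ _)) = walk-end w

  cut-at : ∀ {a b x} (w : Walk a b) → Unique (sources w) → x ∈ sources w → Σ (Walk x b) λ w' → Unique (sources w') × (∀ {y} → y ∈ sources w' → y ∈ sources w)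
  cut-at w@(one e r) u (here refl) = w , u , id
  cut-at w@(e , r ◂ w') u (here refl) = w , u , id
  cut-at (e , r ◂ w) (_ ∷ u) (there i) = let (w' , u' , f) = cut-at w u i in w' , u' , there ∘ f

  _∈?_ : ∀ x (xs : List A.V) → Dec (x ∈ xs)
  x ∈? xs = Any.any? (x ≟V_) xs

  ∉⇒All : ∀ {x : A.V} {xs} → x ∉ xs → All (x ≢_) xs
  ∉⇒All {xs = []} n = []
  ∉⇒All {xs = y ∷ xs} n = (λ { refl → n (here refl) }) ∷ ∉⇒All (n ∘ there)

  simplify : ∀ {a b} (w : Walk a b) → Σ (Walk a b) λ w' → Unique (sources w') × (∀ {y} → y ∈ sources w' → y ∈ sources w)
  simplify (one e r) = one e r , [] ∷ [] , id
  simplify {a} (e , r ◂ w) with simplify w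
  ... | (w' , u , f) with a ∈? sources w'
  ...   | yes i = let (w'' , u' , g) = cut-at w' u i in w'' , u' , there ∘ f ∘ g
  ...   | no n = (e , r ◂ w') , ∉⇒All n ∷ u , λ { (here p) → here p ; (there p) → there (f p) }

  first-hit : ∀ {a b} → b ≢ a → Walk b a → Σ (Walk b a) λ w → a ∉ sources w
  first-hit n (one e r) = one e r , λ { (here p) → n (sym p) }
  first-hit {a} n (_,_◂_ {b = c} e r w) with c ≟V a
  ... | yes refl = one e r , λ { (here p) → n (sym p) }
  ... | no n' = let (w' , k) = first-hit n' w in (e , r ◂ w') , λ { (here p) → n (sym p) ; (there p) → k p }

  edge-source : ∀ {a b e x} (w : Walk a b) → e ∈ map fst (steps w) → src A (o e) ≡ inr x → x ∈ sources w
  edge-source (one e r) (here refl) p = here (inr-inj (trans (sym p) (fst r)))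
  edge-source (e , r ◂ w) (here refl) p = here (inr-inj (trans (sym p) (fst r)))
  edge-source (e , r ◂ w) (there i) p = there (edge-source w i p)

  unique-edges : ∀ {a b} (w : Walk a b) → Unique (sources w) → Unique (map fst (steps w))
  unique-edges (one e r) u = [] ∷ []
  unique-edges (e , r ◂ w) (n ∷ u) = go (map fst (steps w)) id ∷ unique-edges w u
    where
    go : ∀ xs → (∀ {x} → x ∈ xs → x ∈ map fst (steps w)) → All (e ≢_) xs
    go [] f = []
    go (x ∷ xs) f = (λ { refl → All.lookup n (edge-source w (f (here refl)) (fst r)) refl }) ∷ go xs (f ∘ there)

  arc-on-cycle : ∀ {e a b} → Arc A π e a b → T b a → EdgeOnAICycle A e
  arc-on-cycle {e} {a} {b} r t with first-hit (λ { refl → no-arc-loop r }) (T⇒walk t)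
  ... | (w , n) with simplify w
  ...   | (w' , u , f) = steps cyc , (((nonempty , walk-chain cyc) , (a , walk-start cyc , walk-end cyc) , unique-edges cyc (∉⇒All (n ∘ f) ∷ u))) , here refl
    where
    cyc : Walk a a
    cyc = e , r ◂ w'
    nonempty : NonEmpty A (steps cyc)
    nonempty = tt

  vertex-on-cycle : ∀ {v} → T v v → VertexOnAICycle A v
  vertex-on-cycle t with T⇒walk t
  ... | one e r = ⊥-elim (no-arc-loop r)
  ... | e , r ◂ w with arc-on-cycle r (walk⇒T w)
  ...   | (l , c , i) = l , c , go l i
    where
    go : ∀ l → e ∈ map fst l → Any (λ x → Incident A (fst x) _) l
    go (x ∷ l) (here refl) = here (inc-src (or (π (fst x))) (fst r))
    go (x ∷ l) (there i) = there (go l i)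

  Good : OE A → Set
  Good (e , d) = d ≡ or (π e)

  flip : Dir → Dir
  flip ⇓ = ⇑
  flip ⇑ = ⇓

  link-good : ∀ x y → Link A x y → (Good x → Good y) × (Good y → Good x)
  link-good (e , d) (e' , d') (w , p , q , inl refl) with same-pol
    where
    both : ∀ d → tgt A (e , d) ≡ inr w → src A (e' , d) ≡ inr w → IsContr A (A.lab w)
    both ⇓ p q = both-sides (dn-tgt⁻ p) (up-src⁻ q)
    both ⇑ p q = both-sides (dn-tgt⁻ q) (up-src⁻ p)
    same-pol : π e ≡ π e'
    same-pol = fst (val w) (both d p q) e e' (inc-tgt d p) (inc-src d q)
  ... | s≡ = (λ g → trans g (cong or s≡)) , (λ g → trans g (cong or (sym s≡)))
  link-good (e , d) (e' , d') (w , p , q , inr (n , ai , ne)) =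
    go d d' (π e) (π e') n (snd (val w) ai e e' (inc-tgt d p) (inc-src d' q) ne)
    where
    go : ∀ d d' x y → d ≢ d' → x ≢ y → (d ≡ or x → d' ≡ or y) × (d' ≡ or y → d ≡ or x)
    go ⇓ ⇓ x y n k = ⊥-elim (n refl)
    go ⇑ ⇑ x y n k = ⊥-elim (n refl)
    go d d' plus plus n k = ⊥-elim (k refl)
    go d d' minus minus n k = ⊥-elim (k refl)
    go ⇓ ⇑ plus minus n k = (λ _ → refl) , λ _ → refl
    go ⇓ ⇑ minus plus n k = (λ ()) , λ ()
    go ⇑ ⇓ plus minus n k = (λ ()) , λ ()
    go ⇑ ⇓ minus plus n k = (λ _ → refl) , λ _ → refl

  Bad : OE A → Set
  Bad (e , d) = d ≡ flip (or (π e))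

  good-or-bad : ∀ x → Good x ⊎ Bad x
  good-or-bad (e , d) with π e
  good-or-bad (e , ⇓) | plus = inl refl
  good-or-bad (e , ⇑) | plus = inr refl
  good-or-bad (e , ⇓) | minus = inr refl
  good-or-bad (e , ⇑) | minus = inl refl

  bad⇒¬good : ∀ x → Bad x → ¬ Good x
  bad⇒¬good (e , d) b g with π e
  bad⇒¬good (e , .⇑) refl () | plus
  bad⇒¬good (e , .⇓) refl () | minus

  all-good : ∀ x l → Chain A (x ∷ l) → Good x → All Good (x ∷ l)
  all-good x [] c g = g ∷ []
  all-good x (y ∷ l) (k , c) g = g ∷ all-good y l c (fst (link-good x y k) g)

  all-bad : ∀ x l → Chain A (x ∷ l) → Bad x → All Bad (x ∷ l)
  all-bad x [] c g = g ∷ []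
  all-bad x (y ∷ l) (k , c) g with good-or-bad y
  ... | inl h = ⊥-elim (bad⇒¬good x g (snd (link-good x y k) h))
  ... | inr h = g ∷ all-bad y l c h

  all-good-or-bad : ∀ x l → Chain A (x ∷ l) → All Good (x ∷ l) ⊎ All Bad (x ∷ l)
  all-good-or-bad x l c with good-or-bad x
  ... | inl g = inl (all-good x l c g)
  ... | inr g = inr (all-bad x l c g)

  good-arc : ∀ x {a b} → Good x → src A x ≡ inr a → tgt A x ≡ inr b → Arc A π (fst x) a b
  good-arc (e , _) refl p q = p , q

  bad-arc : ∀ x {a b} → Bad x → src A x ≡ inr a → tgt A x ≡ inr b → Arc A π (fst x) b a
  bad-arc (e , d) g p q with π e
  bad-arc (e , .⇑) refl p q | plus = q , p
  bad-arc (e , .⇓) refl p q | minus = q , p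

  private
    module Along (P : OE A → Set) (Q : A.V → A.V → Set) (Q-trans : ∀ {a b c} → Q a b → Q b c → Q a c)
                 (step : ∀ x {a b} → P x → src A x ≡ inr a → tgt A x ≡ inr b → Q a b) where

      Q* : A.V → A.V → Set
      Q* a b = a ≡ b ⊎ Q a b

      *-trans : ∀ {a b c} → Q* a b → Q* b c → Q* a c
      *-trans (inl refl) q = q
      *-trans (inr p) (inl refl) = inr p
      *-trans (inr p) (inr q) = inr (Q-trans p q)

      on-path : ∀ l {a b} → Chain A l → All P l → StartsAt A l (inr a) → EndsAt A l (inr b) → ∀ {x} → x ∈ l →
        Σ A.V λ c → Σ A.V λ d → src A x ≡ inr c × tgt A x ≡ inr d × P x × Q* a c × Q* d b
      on-path (x ∷ []) c (g ∷ _) p q (here refl) = _ , _ , p , q , g , inl refl , inl refl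
      on-path (x ∷ y ∷ l) ((w , r , t , _) , c) (g ∷ gs) p q (here refl) with on-path (y ∷ l) {a = w} c gs t q (here refl)
      ... | (c' , d' , e1 , e2 , g' , u , v) = _ , w , p , r , g , inl refl , *-trans u (*-trans (inr (step y g' e1 e2)) v)
      on-path (x ∷ y ∷ l) ((w , r , t , _) , c) (g ∷ gs) p q (there i) with on-path (y ∷ l) {a = w} c gs t q i
      ... | (c' , d' , e1 , e2 , g' , u , v) = c' , d' , e1 , e2 , g' , *-trans (inr (step x g p r)) u , v

  cycle-arc : ∀ l → AICycle A l → ∀ {x} → x ∈ l → Σ A.V λ a → Σ A.V λ b → Arc A π (fst x) a b × T b a
  cycle-arc l@(y ∷ l') ((_ , c) , (v , p , q) , u) i with all-good-or-bad y l' c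
  ... | inl gs with Along.on-path Good T T-trans (λ x g p q → arc⇒T (good-arc x g p q)) l c gs p q i
  ...   | (a , b , e1 , e2 , g , s1 , s2) = a , b , good-arc _ g e1 e2 , close (Along.*-trans Good T T-trans (λ x g p q → arc⇒T (good-arc x g p q)) s2 s1)
    where
    close : (b ≡ a) ⊎ T b a → T b a
    close (inl refl) = ⊥-elim (no-arc-loop (good-arc _ g e1 e2))
    close (inr t) = t
  cycle-arc l@(y ∷ l') ((_ , c) , (v , p , q) , u) i | inr gs
    with Along.on-path Bad (λ a b → T b a) (λ p q → T-trans q p) (λ x g p q → arc⇒T (bad-arc x g p q)) l c gs p q i
  ...   | (a , b , e1 , e2 , g , s1 , s2) = b , a , bad-arc _ g e1 e2 ,
          close (Along.*-trans Bad (λ a b → T b a) (λ p q → T-trans q p) (λ x g p q → arc⇒T (bad-arc x g p q)) s2 s1)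
    where
    close : (b ≡ a) ⊎ T a b → T a b
    close (inl refl) = ⊥-elim (no-arc-loop (bad-arc _ g e1 e2))
    close (inr t) = t

  cycle-vertex : ∀ {v} → VertexOnAICycle A v → T v v
  cycle-vertex {v} (l , c , i) = go l (λ j → cycle-arc _ c j) i
    where
    go : ∀ l → (∀ {x} → x ∈ l → Σ A.V λ a → Σ A.V λ b → Arc A π (fst x) a b × T b a) → Any (λ x → Incident A (fst x) v) l → T v v
    go (x ∷ l) f (there i) = go l (f ∘ there) i
    go ((e , d) ∷ l) f (here i) with f (here refl)
    ... | (a , b , r , t) with ends-only (or (π e)) (fst r) (snd r) i
    ...   | inl refl = T-trans (arc⇒T r) t
    ...   | inr refl = T-trans t (arc⇒T r)

  record Ranked : Set where
    field
      ρ : A.V → ℕ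
      bound : ℕ
      ρ≤ : ∀ v → ρ v ≤ bound
      ρ-arc : ∀ {e a b} → Arc A π e a b → ρ a < ρ b

  count : ∀ {P : A.V → Set} → (∀ v → Dec (P v)) → List A.V → ℕ
  count P? [] = 0
  count P? (x ∷ xs) with P? x
  ... | yes _ = suc (count P? xs)
  ... | no _ = count P? xs

  count-≤ : ∀ {P Q : A.V → Set} (P? : ∀ v → Dec (P v)) (Q? : ∀ v → Dec (Q v)) → (∀ v → P v → Q v) → ∀ xs → count P? xs ≤ count Q? xs
  count-≤ P? Q? f [] = z≤n
  count-≤ P? Q? f (x ∷ xs) with P? x | Q? x
  ... | yes p | yes q = s≤s (count-≤ P? Q? f xs)
  ... | yes p | no q = ⊥-elim (q (f x p))
  ... | no p | yes q = ℕP.m≤n⇒m≤1+n (count-≤ P? Q? f xs)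
  ... | no p | no q = count-≤ P? Q? f xs

  count-< : ∀ {P Q : A.V → Set} (P? : ∀ v → Dec (P v)) (Q? : ∀ v → Dec (Q v)) → (∀ v → P v → Q v) →
    ∀ {y} xs → y ∈ xs → ¬ P y → Q y → count P? xs < count Q? xs
  count-< P? Q? f (x ∷ xs) (here refl) n q with P? x | Q? x
  ... | yes p | _ = ⊥-elim (n p)
  ... | no _ | yes _ = s≤s (count-≤ P? Q? f xs)
  ... | no _ | no q' = ⊥-elim (q' q)
  count-< P? Q? f (x ∷ xs) (there i) n q with P? x | Q? x
  ... | yes p | yes _ = s≤s (count-< P? Q? f xs i n q)
  ... | yes p | no q' = ⊥-elim (q' (f x p))
  ... | no _ | yes _ = ℕP.m≤n⇒m≤1+n (count-< P? Q? f xs i n q)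
  ... | no _ | no _ = count-< P? Q? f xs i n q

  count-len : ∀ {P : A.V → Set} (P? : ∀ v → Dec (P v)) xs → count P? xs ≤ length xs
  count-len P? [] = z≤n
  count-len P? (x ∷ xs) with P? x
  ... | yes _ = s≤s (count-len P? xs)
  ... | no _ = ℕP.m≤n⇒m≤1+n (count-len P? xs)

  acyclic⇒ranked : (∀ v → ¬ T v v) → Ranked
  acyclic⇒ranked n = record
    { ρ = λ v → count (λ x → T? x v) vs ; bound = length vs ; ρ≤ = λ v → count-len (λ x → T? x v) vs
    ; ρ-arc = λ {e} {a} {b} r → count-< (λ x → T? x a) (λ x → T? x b) (λ x t → T-trans t (arc⇒T r)) vs (∈-listed (finV W) a) (n a) (arc⇒T r) }

  cycle-free⇒ranked : CycleFree A → Ranked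
  cycle-free⇒ranked cf = acyclic⇒ranked λ v t → let (l , c , _) = vertex-on-cycle t in cf l c

module GlueUnique {U L P Q : Set} {A : Flow U L} {K : Flow (U ⊎ Q) (L ⊎ P)} {R : Flow P Q} (S : Shape R) (WK : WF K) (G : IsGlue A K R) where
  private
    module K = Flow K
    module R = Flow R
    module S = Shape S
    module G = IsGlue G

  kP : P → K.E
  kP p = fst (dnL WK (inr p))
  kQ : Q → K.E
  kQ q = fst (upU WK (inr q))

  module Pl = Plugged {K = K} S kP (λ p → snd (dnL WK (inr p))) kQ (λ q → snd (upU WK (inr q)))

  up-det : ∀ g z → GUp K R g z → Pl.Up.gend g ≡ z
  up-det (inl (k , d)) _ (Plug.top p) rewrite p = refl
  up-det (inl (k , d)) _ (Plug.kv p) rewrite p = refl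
  up-det (inl (k , d)) _ (Plug.rv {q = q} {r} {y} p a b) rewrite p = cong (λ z → inr (inr z))
    (inr-inj (trans (sym (snd (Pl.Up.vQ q))) (trans (cong R.up (sym (snd (snd (S.botR q)) r a))) b)))
  up-det (inl (k , d)) _ (Plug.pass {r = r} p a b _ _) = ⊥-elim (S.nopass r b a)
  up-det (inr (r , ((y , a) , _))) _ (y' , b , refl) = cong (λ z → inr (inr z)) (inr-inj (trans (sym a) b))

  dn-det : ∀ g z → GDn K R g z → Pl.Dn.gend g ≡ z
  dn-det (inl (k , d)) _ (Plug.bot p) rewrite p = refl
  dn-det (inl (k , d)) _ (Plug.kv p) rewrite p = refl
  dn-det (inl (k , d)) _ (Plug.rv {p = q} {r} {y} p a b) rewrite p = cong (λ z → inr (inr z))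
    (inr-inj (trans (sym (snd (Pl.Dn.vQ q))) (trans (cong R.dn (sym (snd (snd (S.topR q)) r a))) b)))
  dn-det (inr (r , (_ , (y , a)))) _ (y' , b , refl) = cong (λ z → inr (inr z)) (inr-inj (trans (sym a) b))

  glue-flow-iso : FlowIso A Pl.plugged
  glue-flow-iso = record { vb = G.vbij ; eb = G.ebij ; lab-iso = G.lab-ok
    ; up-iso = λ e → up-det _ _ (G.up-ok e) ; dn-iso = λ e → dn-det _ _ (G.dn-ok e) }

module IsoMor {U L : Set} {A B : Flow U L} (I : FlowIso A B) where
  open FlowIso I
  private
    module A = Flow A
    module B = Flow B

  iso-mor : Mor A B
  iso-mor = record { fV = to vb ; fE = to eb ; fE-inj = to-inj eb ; fup = λ {e} p → trans (up-iso e) (cong (map₂ (to vb)) p)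
                   ; fdn = λ {e} p → trans (dn-iso e) (cong (map₂ (to vb)) p) ; flab = λ v → inl (sym (lab-iso v)) }

  private
    from-end : ∀ {X V V' : Set} (b : V ↔ V') (x : X ⊎ V) {y : X ⊎ V'} → y ≡ map₂ (to b) x → x ≡ map₂ (from b) y
    from-end b (inl x) refl = refl
    from-end b (inr x) refl = cong inr (sym (inv-r b x))

  iso-sym : FlowIso B A
  iso-sym = record { vb = ↔-sym vb ; eb = ↔-sym eb
    ; lab-iso = λ v → trans (cong B.lab (sym (inv-l vb v))) (sym (lab-iso (from vb v)))
    ; up-iso = λ e → from-end vb (A.up (from eb e)) (trans (cong B.up (sym (inv-l eb e))) (up-iso (from eb e)))
    ; dn-iso = λ e → from-end vb (A.dn (from eb e)) (trans (cong B.dn (sym (inv-l eb e))) (dn-iso (from eb e))) }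

mor-arc : ∀ {U1 L1 U2 L2} {A : Flow U1 L1} {B : Flow U2 L2} (M : Mor A B) (π : Polarity B) {e a b} →
  Arc A (π ∘ Mor.fE M) e a b → Arc B π (Mor.fE M e) (Mor.fV M a) (Mor.fV M b)
mor-arc M π {e} (p , q) = MorProps.fsrc M (e , or (π (Mor.fE M e))) p , MorProps.ftgt M (e , or (π (Mor.fE M e))) q

-- A vertex order compatible with the orientation of the edges whose sign satisfies S.
record Cert (S : Sign → Bool) {U L : Set} (A : Flow U L) : Set where
  open Flow A
  field
    π : Polarity A
    valid : ValidPol A π
    sgn : V → Sign
    sgn-ok : ∀ v → IsContr A (lab v) → ∀ e → Incident A e v → π e ≡ sgn v
    ρ : V → ℕ
    bound : ℕ
    ρ≤ : ∀ v → ρ v ≤ bound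
    ρ-arc : ∀ {e a b} → S (π e) ≡ true → Arc A π e a b → ρ a < ρ b

cert-mor : ∀ {S U1 L1 U2 L2} {A : Flow U1 L1} {B : Flow U2 L2} → Mor A B → Cert S B → Cert S A
cert-mor M C = record
  { π = C.π ∘ Mor.fE M ; valid = MorProps.polar-pull M C.valid ; sgn = C.sgn ∘ Mor.fV M
  ; sgn-ok = λ v c e i → C.sgn-ok _ (MorProps.fContr M v c) _ (MorProps.fincident M i)
  ; ρ = C.ρ ∘ Mor.fV M ; bound = C.bound ; ρ≤ = λ v → C.ρ≤ _ ; ρ-arc = λ {e} s≡ a → C.ρ-arc s≡ (mor-arc M C.π {e = e} a) }
  where module C = Cert C

cert-pull : ∀ {S U L} {A B : Flow U L} → FlowIso A B → Cert S B → Cert S A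
cert-pull I = cert-mor (IsoMor.iso-mor I)

wt : (S : Sign → Bool) → ℕ → Label → Sign → ℕ → ℕ
wt S n ac↓ plus r = if S plus then 3 ^ (n ∸ r) else 0
wt S n ac↓ minus r = if S minus then 3 ^ r else 0
wt S n ac↑ plus r = if S plus then 3 ^ r else 0
wt S n ac↑ minus r = if S minus then 3 ^ (n ∸ r) else 0
wt S n _ _ _ = 0

finite-sum : {V : Set} → Finite V → (V → ℕ) → ℕ
finite-sum (n , b) f = sum (f ∘ to b)

finite-sum-unique : {V : Set} (b c : Finite V) (f : V → ℕ) → finite-sum b f ≡ finite-sum c f
finite-sum-unique (n , b) (k , c) f =
  trans (sum-permute (f ∘ to b) (↔-trans c (↔-sym b))) (sum-cong-≗ (λ i → cong f (inv-l b (to c i))))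

finite-sum-⊎ : {V W : Set} (b : Finite V) (c : Finite W) (f : V ⊎ W → ℕ) →
  finite-sum (finite-⊎ b c) f ≡ finite-sum b (f ∘ inl) + finite-sum c (f ∘ inr)
finite-sum-⊎ (n , b) (k , c) f = go n (f ∘ inl ∘ to b) (λ i → f (to (snd (finite-⊎ (n , b) (k , c))) i))
    (λ i → cong (λ z → f (Data.Sum.map (to b) (to c) z)) (FinP.splitAt-↑ˡ n i k))
    (λ j → cong (λ z → f (Data.Sum.map (to b) (to c) z)) (FinP.splitAt-↑ʳ n k j))
  where
  import Data.Sum
  go : ∀ n (g : Fin n → ℕ) (h : Fin (n + k) → ℕ) → (∀ i → h (i ↑ˡ k) ≡ g i) → (∀ j → h (n ↑ʳ j) ≡ f (inr (to c j))) →
    sum h ≡ sum g + sum (f ∘ inr ∘ to c)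
  go zero g h p q = sum-cong-≗ q
  go (suc n) g h p q = trans (cong₂ _+_ (p zero) (go n (g ∘ suc) (h ∘ suc) (p ∘ suc) q)) (sym (ℕP.+-assoc (g zero) _ _))

finite-sum-↔ : {V W : Set} (b : Finite V) (c : Finite W) (e : V ↔ W) (f : V → ℕ) → finite-sum b f ≡ finite-sum c (f ∘ from e)
finite-sum-↔ b c e f = trans (finite-sum-unique b (finite-map c (↔-sym e)) f) refl

finite-sum-cong : {V : Set} (b : Finite V) {f g : V → ℕ} → (∀ v → f v ≡ g v) → finite-sum b f ≡ finite-sum b g
finite-sum-cong (n , b) p = sum-cong-≗ (λ i → p (to b i))

cls : ∀ ρ → InC ρ → Flow.V (rhs ρ) → Flow.V (lhs ρ)
cls r-viii c zero = # 1
cls r-viii c (suc _) = # 0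
cls r-ix c zero = # 0
cls r-ix c (suc _) = # 1
cls r-x c zero = # 0
cls r-x c (suc zero) = # 0
cls r-x c (suc (suc _)) = # 1

np-C : ∀ {ρ} → InC ρ → NoPass ρ
np-C c-viii = tt
np-C c-ix = tt
np-C c-x = tt

cls-bot : ∀ ρ (c : InC ρ) q → Σ _ λ r → Σ _ λ y → Flow.up (lhs ρ) r ≡ inr y × Flow.dn (lhs ρ) r ≡ inl q ×
  (∀ {z} → Flow.up (rhs ρ) (rhs-bot ρ (np-C c) q) ≡ inr z → cls ρ c z ≡ y)
cls-bot r-viii c ()
cls-bot r-ix c-ix zero = # 2 , _ , refl , refl , λ { refl → refl }
cls-bot r-ix c-ix (suc zero) = # 3 , _ , refl , refl , λ { refl → refl }
cls-bot r-ix c-ix (suc (suc zero)) = # 0 , _ , refl , refl , λ { refl → refl }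
cls-bot r-x c-x zero = # 3 , _ , refl , refl , λ { refl → refl }
cls-bot r-x c-x (suc zero) = # 4 , _ , refl , refl , λ { refl → refl }

cls-top : ∀ ρ (c : InC ρ) p → Σ _ λ r → Σ _ λ y → Flow.dn (lhs ρ) r ≡ inr y × Flow.up (lhs ρ) r ≡ inl p ×
  (∀ {z} → Flow.dn (rhs ρ) (rhs-top ρ (np-C c) p) ≡ inr z → cls ρ c z ≡ y)
cls-top r-viii c-viii zero = # 0 , _ , refl , refl , λ { refl → refl }
cls-top r-viii c-viii (suc zero) = # 1 , _ , refl , refl , λ { refl → refl }
cls-top r-viii c-viii (suc (suc zero)) = # 3 , _ , refl , refl , λ { refl → refl }
cls-top r-ix c ()
cls-top r-x c-x zero = # 0 , _ , refl , refl , λ { refl → refl }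
cls-top r-x c-x (suc zero) = # 1 , _ , refl , refl , λ { refl → refl }

int-sign : LRule → Sign → Sign
int-sign r-viii x = opp x
int-sign r-ix x = opp x
int-sign _ x = x

arc-ends : Sign → {V : Set} → V → V → V × V
arc-ends plus a b = a , b
arc-ends minus a b = b , a

cls-internal : ∀ ρ (c : InC ρ) x r {z w} → Flow.up (rhs ρ) r ≡ inr z → Flow.dn (rhs ρ) r ≡ inr w →
  arc-ends (int-sign ρ x) (cls ρ c z) (cls ρ c w) ≡ arc-ends x (LhsRedex.y0 ρ) (LhsRedex.x0 ρ)
cls-internal r-viii c plus (suc zero) refl refl = refl
cls-internal r-viii c plus (suc (suc zero)) refl refl = refl
cls-internal r-viii c plus (suc (suc (suc zero))) ()
cls-internal r-viii c plus (suc (suc (suc (suc zero)))) ()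
cls-internal r-viii c minus (suc zero) refl refl = refl
cls-internal r-viii c minus (suc (suc zero)) refl refl = refl
cls-internal r-viii c minus (suc (suc (suc zero))) ()
cls-internal r-viii c minus (suc (suc (suc (suc zero)))) ()
cls-internal r-ix c plus (suc zero) refl refl = refl
cls-internal r-ix c plus (suc (suc zero)) refl refl = refl
cls-internal r-ix c plus (suc (suc (suc zero))) refl ()
cls-internal r-ix c plus (suc (suc (suc (suc zero)))) refl ()
cls-internal r-ix c minus (suc zero) refl refl = refl
cls-internal r-ix c minus (suc (suc zero)) refl refl = refl
cls-internal r-ix c minus (suc (suc (suc zero))) refl ()
cls-internal r-ix c minus (suc (suc (suc (suc zero)))) refl ()
cls-internal r-x c plus (suc (suc (suc (suc zero)))) refl refl = refl
cls-internal r-x c plus (suc (suc (suc (suc (suc zero))))) refl refl = refl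
cls-internal r-x c plus (suc (suc (suc (suc (suc (suc zero)))))) refl refl = refl
cls-internal r-x c plus (suc (suc (suc (suc (suc (suc (suc zero))))))) refl refl = refl
cls-internal r-x c minus (suc (suc (suc (suc zero)))) refl refl = refl
cls-internal r-x c minus (suc (suc (suc (suc (suc zero))))) refl refl = refl
cls-internal r-x c minus (suc (suc (suc (suc (suc (suc zero)))))) refl refl = refl
cls-internal r-x c minus (suc (suc (suc (suc (suc (suc (suc zero))))))) refl refl = refl

opp-opp : ∀ x → opp (opp x) ≡ x
opp-opp plus = refl
opp-opp minus = refl

int-sign≡ : ∀ {ρ} → InC ρ → ∀ x → internal-atom {bar = opp} opp-opp ρ x ≡ int-sign ρ x
int-sign≡ c-viii x = refl
int-sign≡ c-ix x = refl
int-sign≡ c-x x = refl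

rhs-contr-sign : ∀ ρ (c : InC ρ) z → IsContr (rhs ρ) (Flow.lab (rhs ρ) z) →
  (Σ (Fin (ins (Flow.lab (rhs ρ) z))) λ j → Σ _ λ x → Σ _ λ y → Flow.up (rhs ρ) (RhsShape.iR ρ (np-C c) z j) ≡ inr x × Flow.dn (rhs ρ) (RhsShape.iR ρ (np-C c) z j) ≡ inr y) ⊎
  (Σ (Fin (outs (Flow.lab (rhs ρ) z))) λ j → Σ _ λ x → Σ _ λ y → Flow.up (rhs ρ) (RhsShape.oR ρ (np-C c) z j) ≡ inr x × Flow.dn (rhs ρ) (RhsShape.oR ρ (np-C c) z j) ≡ inr y)
rhs-contr-sign r-viii c-viii zero _ = inr (# 0 , _ , _ , refl , refl)
rhs-contr-sign r-viii c-viii (suc zero) (inl ())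
rhs-contr-sign r-viii c-viii (suc zero) (inr ())
rhs-contr-sign r-viii c-viii (suc (suc zero)) (inl ())
rhs-contr-sign r-viii c-viii (suc (suc zero)) (inr ())
rhs-contr-sign r-ix c-ix zero _ = inl (# 0 , _ , _ , refl , refl)
rhs-contr-sign r-ix c-ix (suc zero) (inl ())
rhs-contr-sign r-ix c-ix (suc zero) (inr ())
rhs-contr-sign r-ix c-ix (suc (suc zero)) (inl ())
rhs-contr-sign r-ix c-ix (suc (suc zero)) (inr ())
rhs-contr-sign r-x c-x zero _ = inr (# 0 , _ , _ , refl , refl)
rhs-contr-sign r-x c-x (suc zero) _ = inr (# 0 , _ , _ , refl , refl)
rhs-contr-sign r-x c-x (suc (suc zero)) _ = inl (# 0 , _ , _ , refl , refl)
rhs-contr-sign r-x c-x (suc (suc (suc zero))) _ = inl (# 0 , _ , _ , refl , refl)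

private
  3^-pos : ∀ x → 1 ≤ 3 ^ x
  3^-pos zero = s≤s z≤n
  3^-pos (suc x) = ℕP.≤-trans (3^-pos x) (ℕP.m≤m+n _ _)

  double-< : ∀ {x y} → x < y → 3 ^ x + 3 ^ x < 3 ^ y
  double-< {x} {y} p = ℕP.<-≤-trans (ℕP.m<m+n (3 ^ x + 3 ^ x) (3^-pos x))
    (ℕP.≤-trans (ℕP.≤-reflexive (trans (ℕP.+-assoc (3 ^ x) (3 ^ x) (3 ^ x)) (cong (λ z → 3 ^ x + (3 ^ x + z)) (sym (ℕP.+-identityʳ (3 ^ x))))))
                 (ℕP.^-monoʳ-≤ 3 {{_}} p))

  single-< : ∀ {x y} → x < y → 3 ^ x < 3 ^ y
  single-< p = ℕP.≤-<-trans (ℕP.m≤m+n _ _) (double-< p)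

  if-≤ : ∀ b x → (if b then x else 0) ≤ x
  if-≤ true x = ℕP.≤-refl
  if-≤ false x = z≤n

  rev-< : ∀ {a b n} → a < b → b ≤ n → n ∸ b < n ∸ a
  rev-< = ℕP.∸-monoʳ-<

  four : ∀ {x y X Y} → x + x < X → y + y < Y → x + (x + (y + (y + 0))) < X + (Y + 0)
  four {x} {y} {X} {Y} p q = ℕP.≤-<-trans (ℕP.≤-reflexive (solve 2 (λ x y → x :+ (x :+ (y :+ (y :+ con 0))) := (x :+ x) :+ (y :+ y)) refl x y))
    (ℕP.<-≤-trans (ℕP.+-mono-< p q) (ℕP.≤-reflexive (cong (X +_) (sym (ℕP.+-identityʳ Y)))))
    where open +-*-Solver

  lone : ∀ {w x X} → w ≤ x → x < X → w + 0 < X + 0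
  lone {w} {x} {X} p q = ℕP.≤-<-trans (ℕP.≤-reflexive (ℕP.+-identityʳ w)) (ℕP.<-≤-trans (ℕP.≤-<-trans p q) (ℕP.m≤m+n X 0))

  lone′ : ∀ {w x X} → w ≤ x → x < X → w + 0 < 0 + (X + 0)
  lone′ = lone

weight-decreases : ∀ ρ (c : InC ρ) (S : Sign → Bool) s0 n (r : Flow.V (lhs ρ) → ℕ) (σ : Flow.V (lhs ρ) → Sign) →
  (∀ y → IsContr (lhs ρ) (Flow.lab (lhs ρ) y) → σ y ≡ s0) → (∀ y → r y ≤ n) →
  r (fst (arc-ends s0 (LhsRedex.y0 ρ) (LhsRedex.x0 ρ))) < r (snd (arc-ends s0 (LhsRedex.y0 ρ) (LhsRedex.x0 ρ))) → S s0 ≡ true →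
  finite-sum (RhsShape.finR ρ (np-C c)) (λ z → wt S n (Flow.lab (rhs ρ) z) (int-sign ρ s0) (r (cls ρ c z))) <
  finite-sum (LhsRedex.finR ρ) (λ y → wt S n (Flow.lab (lhs ρ) y) (σ y) (r y))
weight-decreases r-viii c-viii S plus n r σ h le lt q rewrite h (# 0) (inl refl) | q = lone (if-≤ (S minus) _) (single-< (rev-< lt (le _)))
weight-decreases r-viii c-viii S minus n r σ h le lt q rewrite h (# 0) (inl refl) | q = lone (if-≤ (S plus) _) (single-< lt)
weight-decreases r-ix c-ix S plus n r σ h le lt q rewrite h (# 1) (inr refl) | q = lone′ (if-≤ (S minus) _) (single-< lt)
weight-decreases r-ix c-ix S minus n r σ h le lt q rewrite h (# 1) (inr refl) | q = lone′ (if-≤ (S plus) _) (single-< (rev-< lt (le _)))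
weight-decreases r-x c-x S plus n r σ h le lt q rewrite h (# 0) (inl refl) | h (# 1) (inr refl) | q =
  ℕP.<-≤-trans (four {3 ^ r (# 0)} {3 ^ (n ∸ r (# 1))} (double-< lt) (double-< (rev-< lt (le _))))
    (ℕP.≤-reflexive (solve 2 (λ a b → a :+ (b :+ con 0) := b :+ (a :+ con 0)) refl (3 ^ r (# 1)) (3 ^ (n ∸ r (# 0)))))
  where open +-*-Solver
weight-decreases r-x c-x S minus n r σ h le lt q rewrite h (# 0) (inl refl) | h (# 1) (inr refl) | q =
  ℕP.<-≤-trans (four {3 ^ (n ∸ r (# 0))} {3 ^ r (# 1)} (double-< (rev-< lt (le _))) (double-< lt))
    (ℕP.≤-reflexive (solve 2 (λ a b → a :+ (b :+ con 0) := b :+ (a :+ con 0)) refl (3 ^ (n ∸ r (# 1))) (3 ^ r (# 0))))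
  where open +-*-Solver

-- Steps of c preserve certificates: the new vertices take the places of the two old ones.
module CertStep {S : Sign → Bool} {U L : Set} (ρ : LRule) (c : InC ρ) {A A' : Flow U L} (st : LStep ρ A A') (C : Cert S A) where
  open LStep st
  private
    np = np-C c
    module X = LhsRedex ρ
    module SR = RhsShape ρ np
    module GL = GlueUnique X.shape K-wf gl
    module GR = GlueUnique (rhs-shape ρ np) K-wf gl'
    module K = Flow K
    module LL = Flow (lhs ρ)
    module RR = Flow (rhs ρ)
    B = GL.Pl.plugged
    B' = GR.Pl.plugged
    module B = Flow B
    module B' = Flow B'
    CB : Cert S B
    CB = cert-pull (IsoMor.iso-sym GL.glue-flow-iso) C
    module CB = Cert CB

    int0 : InternalR K (lhs ρ) X.r0
    int0 = (_ , X.up0) , (_ , X.dn0)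

  s0 : Sign
  s0 = CB.π (inr (X.r0 , int0))

  private
    πk : K.E → Sign
    πk k = CB.π (inl (k , GL.Pl.nodrop k))

    sI : Sign
    sI = int-sign ρ s0

    π' : B'.E → Sign
    π' (inl (k , _)) = πk k
    π' (inr _) = sI

    aP : Fin (lp ρ) → Sign
    aP p = πk (GL.kP p)
    aQ : Fin (lq ρ) → Sign
    aQ q = πk (GL.kQ q)

    lhs-sign : ∀ r → lhs-atom {bar = opp} opp-opp ρ aP aQ s0 r ≡ CB.π (GL.Pl.nmR r)
    lhs-sign r = go _ _ refl refl
      where
      go : ∀ x y (a : LL.up r ≡ x) (b : LL.dn r ≡ y) → pick aP aQ s0 x y ≡ CB.π (GL.Pl.nmR′ r x y a b)
      go (inl p) y a b = refl
      go (inr x) (inl q) a b = refl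
      go (inr x) (inr y) a b = int (X.only r a b) a b
        where
        int : ∀ {r} → r ≡ X.r0 → (a : LL.up r ≡ inr x) (b : LL.dn r ≡ inr y) → s0 ≡ CB.π (inr (r , ((x , a) , (y , b))))
        int refl a b = cong CB.π (trans (sym (GL.Pl.nm-int int0)) (GL.Pl.nm-int ((x , a) , (y , b))))

    rhs-sign : ∀ r → π' (GR.Pl.nmR r) ≡ rhs-atom {bar = opp} opp-opp ρ aP aQ s0 r
    rhs-sign r = go _ _ refl refl
      where
      go : ∀ x y (a : RR.up r ≡ x) (b : RR.dn r ≡ y) → π' (GR.Pl.nmR′ r x y a b) ≡ pick aP aQ (internal-atom {bar = opp} opp-opp ρ s0) x y
      go (inl p) y a b = refl
      go (inr x) (inl q) a b = refl
      go (inr x) (inr y) a b = sym (int-sign≡ c s0)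

    ok' : ∀ z → AtOK opp (RR.lab z) (π' ∘ GR.Pl.nmR ∘ SR.iR z) (π' ∘ GR.Pl.nmR ∘ SR.oR z)
    ok' z = AtOK-cong opp (RR.lab z) (λ j → rhs-sign _) (λ j → rhs-sign _) (rhsOK {bar = opp} opp-opp ρ np aP aQ s0
      (λ y → AtOK-cong opp (LL.lab y) (λ j → lhs-sign _) (λ j → lhs-sign _)
        (valid⇒ok B CB.π (inr y) (LL.lab y) refl (GL.Pl.Dn.ports-R (X.iP y)) (GL.Pl.Up.ports-R (X.oP y)) (CB.valid (inr y)))) z)

    inc-K : ∀ {v} e → Incident B' e (inl v) → Σ K.E λ k → Σ _ λ d → e ≡ inl (k , d) × Incident B (inl (k , GL.Pl.nodrop k)) (inl v)
    inc-K (inl (k , d)) (inl p) = k , d , refl , inl (cong GL.Pl.Up.res (GR.Pl.Up.res-K (K.up k) p))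
    inc-K (inl (k , d)) (inr p) = k , d , refl , inr (cong GL.Pl.Dn.res (GR.Pl.Dn.res-K (K.dn k) p))
    inc-K (inr r) (inl ())
    inc-K (inr r) (inr ())

    valid' : ValidPol B' π'
    valid' (inr z) = ok⇒valid B' π' (inr z) (RR.lab z) refl (GR.Pl.Dn.ports-R (SR.iP z)) (GR.Pl.Up.ports-R (SR.oP z)) (ok' z)
    valid' (inl v) = contr , ai
      where
      contr : IsContr B' (K.lab v) → ∀ e e' → Incident B' e (inl v) → Incident B' e' (inl v) → π' e ≡ π' e'
      contr i e e' p q with inc-K e p | inc-K e' q
      ... | (k , d , refl , p') | (k' , d' , refl , q') = fst (CB.valid (inl v)) i _ _ p' q'
      ai : IsAI B' (K.lab v) → ∀ e e' → Incident B' e (inl v) → Incident B' e' (inl v) → e ≢ e' → π' e ≢ π' e'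
      ai i e e' p q n with inc-K e p | inc-K e' q
      ... | (k , d , refl , p') | (k' , d' , refl , q') = snd (CB.valid (inl v)) i _ _ p' q'
        (λ { refl → n refl })

    sgn' : B'.V → Sign
    sgn' (inl v) = CB.sgn (inl v)
    sgn' (inr z) = sI

    sgn-ok' : ∀ v → IsContr B' (B'.lab v) → ∀ e → Incident B' e v → π' e ≡ sgn' v
    sgn-ok' (inl v) i e p with inc-K e p
    ... | (k , d , refl , p') = CB.sgn-ok (inl v) i _ p'
    sgn-ok' (inr z) i e p = go (rhs-contr-sign ρ c z i)
      where
      int : ∀ {r x y} → RR.up r ≡ inr x → RR.dn r ≡ inr y → π' (GR.Pl.nmR r) ≡ sI
      int a b = cong π' (GR.Pl.nm-int ((_ , a) , (_ , b)))
      go : _ ⊎ _ → π' e ≡ sI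
      go (inl (j , x , y , a , b)) = trans (fst (valid' (inr z)) i e (GR.Pl.nmR (SR.iR z j)) p (inr (hit (GR.Pl.Dn.ports-R (SR.iP z)) j))) (int a b)
      go (inr (j , x , y , a , b)) = trans (fst (valid' (inr z)) i e (GR.Pl.nmR (SR.oR z j)) p (inl (hit (GR.Pl.Up.ports-R (SR.oP z)) j))) (int a b)

    clsG : GV K (rhs ρ) → GV K (lhs ρ)
    clsG (inl v) = inl v
    clsG (inr z) = inr (cls ρ c z)

    cls-vQ : ∀ q → cls ρ c (fst (GR.Pl.Up.vQ q)) ≡ fst (GL.Pl.Up.vQ q)
    cls-vQ q with cls-bot ρ c q
    ... | (r , y , a , b , f) = trans
      (f (trans (cong RR.up (snd (snd (SR.botR q)) _ (rhs-bot-ok ρ np q))) (snd (GR.Pl.Up.vQ q))))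
      (inr-inj (trans (sym a) (trans (cong LL.up (snd (snd (X.botR q)) r b)) (snd (GL.Pl.Up.vQ q)))))

    cls-vP : ∀ q → cls ρ c (fst (GR.Pl.Dn.vQ q)) ≡ fst (GL.Pl.Dn.vQ q)
    cls-vP q with cls-top ρ c q
    ... | (r , y , a , b , f) = trans
      (f (trans (cong RR.dn (snd (snd (SR.topR q)) _ (rhs-top-ok ρ np q))) (snd (GR.Pl.Dn.vQ q))))
      (inr-inj (trans (sym a) (trans (cong LL.dn (snd (snd (X.topR q)) r b)) (snd (GL.Pl.Dn.vQ q)))))

    up-cls : ∀ z {a} → GR.Pl.Up.res z ≡ inr a → GL.Pl.Up.res z ≡ inr (clsG a)
    up-cls (inl (inl u)) ()
    up-cls (inl (inr q)) refl = cong (λ z → inr (inr z)) (sym (cls-vQ q))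
    up-cls (inr v) refl = refl

    dn-cls : ∀ z {a} → GR.Pl.Dn.res z ≡ inr a → GL.Pl.Dn.res z ≡ inr (clsG a)
    dn-cls (inl (inl u)) ()
    dn-cls (inl (inr q)) refl = cong (λ z → inr (inr z)) (sym (cls-vP q))
    dn-cls (inr v) refl = refl

    src-cls : ∀ k d {n a} → src B' (inl (k , n) , d) ≡ inr a → src B (inl (k , GL.Pl.nodrop k) , d) ≡ inr (clsG a)
    src-cls k ⇓ {n} p = Ends.up-src B {inl (k , GL.Pl.nodrop k)} (up-cls (K.up k) (Ends.up-src⁻ B' {inl (k , n)} p))
    src-cls k ⇑ {n} p = Ends.dn-tgt B {inl (k , GL.Pl.nodrop k)} (dn-cls (K.dn k) (Ends.dn-tgt⁻ B' {inl (k , n)} p))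
    tgt-cls : ∀ k d {n a} → tgt B' (inl (k , n) , d) ≡ inr a → tgt B (inl (k , GL.Pl.nodrop k) , d) ≡ inr (clsG a)
    tgt-cls k ⇑ {n} p = Ends.up-src B {inl (k , GL.Pl.nodrop k)} (up-cls (K.up k) (Ends.up-src⁻ B' {inl (k , n)} p))
    tgt-cls k ⇓ {n} p = Ends.dn-tgt B {inl (k , GL.Pl.nodrop k)} (dn-cls (K.dn k) (Ends.dn-tgt⁻ B' {inl (k , n)} p))

  rank : Flow.V (lhs ρ) → ℕ
  rank y = CB.ρ (inr y)

  lhs-sgn : ∀ y → IsContr (lhs ρ) (LL.lab y) → CB.sgn (inr y) ≡ s0
  lhs-sgn y i = sym (CB.sgn-ok (inr y) i (inr (X.r0 , int0)) (inc (X.two y)))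
      where
      inc : y ≡ X.y0 ⊎ y ≡ X.x0 → Incident B (inr (X.r0 , int0)) (inr y)
      inc (inl refl) = inl refl
      inc (inr refl) = inr refl

  contr-sign : ∀ y → IsContr (lhs ρ) (LL.lab y) → ∀ {e} → Incident A e (from (IsGlue.vbij gl) (inr y)) → Cert.π C e ≡ s0
  contr-sign y i p = trans (Cert.sgn-ok C _ (subst (IsContr A) (sym (trans (IsGlue.lab-ok gl _) (cong (glab K (lhs ρ)) (inv-l (IsGlue.vbij gl) (inr y))))) i) _ p) (lhs-sgn y i)

  module _ (live : S s0 ≡ true) where

    rank-arc : rank (fst (arc-ends s0 X.y0 X.x0)) < rank (snd (arc-ends s0 X.y0 X.x0))
    rank-arc = go s0 refl
      where
      go : ∀ x → s0 ≡ x → rank (fst (arc-ends x X.y0 X.x0)) < rank (snd (arc-ends x X.y0 X.x0))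
      go plus e = CB.ρ-arc {e = inr (X.r0 , int0)} live (cong (λ z → src B (inr (X.r0 , int0) , or z)) e , cong (λ z → tgt B (inr (X.r0 , int0) , or z)) e)
      go minus e = CB.ρ-arc {e = inr (X.r0 , int0)} live (cong (λ z → src B (inr (X.r0 , int0) , or z)) e , cong (λ z → tgt B (inr (X.r0 , int0) , or z)) e)

    private
      ρ' : B'.V → ℕ
      ρ' v = CB.ρ (clsG v)

      ρ-arc' : ∀ {e a b} → S (π' e) ≡ true → Arc B' π' e a b → ρ' a < ρ' b
      ρ-arc' {inl (k , n)} t (p , q) = CB.ρ-arc t (src-cls k (or (πk k)) {n} p , tgt-cls k (or (πk k)) {n} q)
      ρ-arc' {inr (r , ((z , u) , (w , v)))} {a} {b} t (p , q) = go sI refl p q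
        where
        mid : rank (fst (arc-ends sI (cls ρ c z) (cls ρ c w))) < rank (snd (arc-ends sI (cls ρ c z) (cls ρ c w)))
        mid = subst (λ x → rank (fst x) < rank (snd x)) (sym (cls-internal ρ c s0 r u v)) rank-arc
        go : ∀ x → sI ≡ x → src B' (inr (r , ((z , u) , (w , v))) , or x) ≡ inr a → tgt B' (inr (r , ((z , u) , (w , v))) , or x) ≡ inr b → ρ' a < ρ' b
        go plus e refl refl = subst (λ x → rank (fst (arc-ends x (cls ρ c z) (cls ρ c w))) < rank (snd (arc-ends x (cls ρ c z) (cls ρ c w)))) e mid
        go minus e refl refl = subst (λ x → rank (fst (arc-ends x (cls ρ c z) (cls ρ c w))) < rank (snd (arc-ends x (cls ρ c z) (cls ρ c w)))) e mid

      CB' : Cert S B'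
      CB' = record { π = π' ; valid = valid' ; sgn = sgn' ; sgn-ok = sgn-ok' ; ρ = ρ' ; bound = CB.bound ; ρ≤ = λ v → CB.ρ≤ _ ; ρ-arc = λ {e} → ρ-arc' {e} }

    cert-step : Cert S A'
    cert-step = cert-pull GR.glue-flow-iso CB'

    weigh : ∀ {U L} {A : Flow U L} → Cert S A → Flow.V A → ℕ
    weigh {A = A} C v = wt S (Cert.bound C) (Flow.lab A v) (Cert.sgn C v) (Cert.ρ C v)

    total : ∀ {U L} {A : Flow U L} → Finite (Flow.V A) → Cert S A → ℕ
    total f C = finite-sum f (weigh C)

    private
      total-K : ℕ
      total-K = finite-sum (finV K-wf) (λ v → wt S CB.bound (K.lab v) (CB.sgn (inl v)) (CB.ρ (inl v)))

      total-before : (f : Finite (Flow.V A)) → total f C ≡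
        total-K + finite-sum X.finR (λ y → wt S CB.bound (LL.lab y) (CB.sgn (inr y)) (rank y))
      total-before f = trans (finite-sum-↔ f (finite-⊎ (finV K-wf) X.finR) (IsGlue.vbij gl) (weigh C))
        (trans (finite-sum-cong (finite-⊎ (finV K-wf) X.finR)
          (λ v → cong (λ k → wt S CB.bound k (CB.sgn v) (CB.ρ v)) (trans (IsGlue.lab-ok gl _) (cong (glab K (lhs ρ)) (inv-l (IsGlue.vbij gl) v)))))
          (finite-sum-⊎ (finV K-wf) X.finR (λ v → wt S CB.bound (glab K (lhs ρ) v) (CB.sgn v) (CB.ρ v))))

      total-after : (f : Finite (Flow.V A')) → total f cert-step ≡
        total-K + finite-sum SR.finR (λ z → wt S CB.bound (RR.lab z) sI (rank (cls ρ c z)))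
      total-after f = trans (finite-sum-↔ f (finite-⊎ (finV K-wf) SR.finR) (IsGlue.vbij gl') (weigh cert-step))
        (trans (finite-sum-cong (finite-⊎ (finV K-wf) SR.finR) eq)
          (finite-sum-⊎ (finV K-wf) SR.finR (λ v → wt S CB.bound (glab K (rhs ρ) v) (sgn' v) (ρ' v))))
        where
        eq : ∀ v → wt S CB.bound (Flow.lab A' (from (IsGlue.vbij gl') v)) (sgn' (to (IsGlue.vbij gl') (from (IsGlue.vbij gl') v))) (ρ' (to (IsGlue.vbij gl') (from (IsGlue.vbij gl') v))) ≡
                   wt S CB.bound (glab K (rhs ρ) v) (sgn' v) (ρ' v)
        eq v rewrite IsGlue.lab-ok gl' (from (IsGlue.vbij gl') v) | inv-l (IsGlue.vbij gl') v = refl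

    total-decreases : (f : Finite (Flow.V A)) (f' : Finite (Flow.V A')) → total f' cert-step < total f C
    total-decreases f f' = ℕP.≤-<-trans (ℕP.≤-reflexive (total-after f'))
      (ℕP.<-≤-trans (ℕP.+-monoʳ-< total-K (weight-decreases ρ c S s0 CB.bound rank (λ y → CB.sgn (inr y)) lhs-sgn (λ y → CB.ρ≤ _) rank-arc live))
        (ℕP.≤-reflexive (sym (total-before f))))

    cert-agree : ∀ k (d : ¬ Dropped K (lhs ρ) k) (d' : ¬ Dropped K (rhs ρ) k) →
      Cert.π C (from (IsGlue.ebij gl) (inl (k , d))) ≡ Cert.π cert-step (from (IsGlue.ebij gl') (inl (k , d')))
    cert-agree k d d' = sym (cong π' (inv-l (IsGlue.ebij gl') (inl (k , d'))))

private
  rules : List LRule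
  rules = r-i ∷ r-ii ∷ r-iii ∷ r-iv ∷ r-v ∷ r-vi ∷ r-vii ∷ r-viii ∷ r-ix ∷ r-x ∷ []

  ∈-rules : ∀ ρ → ρ ∈ rules
  ∈-rules r-i = here refl
  ∈-rules r-ii = there (here refl)
  ∈-rules r-iii = there (there (here refl))
  ∈-rules r-iv = there (there (there (here refl)))
  ∈-rules r-v = there (there (there (there (here refl))))
  ∈-rules r-vi = there (there (there (there (there (here refl)))))
  ∈-rules r-vii = there (there (there (there (there (there (here refl))))))
  ∈-rules r-viii = there (there (there (there (there (there (there (here refl)))))))
  ∈-rules r-ix = there (there (there (there (there (there (there (there (here refl))))))))
  ∈-rules r-x = there (there (there (there (there (there (there (there (there (here refl)))))))))

any-rule? : {P : LRule → Set} → (∀ ρ → Dec (P ρ)) → Dec (Σ LRule P)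
any-rule? P? = map′ Any.satisfied (λ { (ρ , p) → lose (∈-rules ρ) p }) (Any.any? P? rules)

InW? : ∀ ρ → Dec (InW ρ)
InW? r-i = yes w-i
InW? r-ii = yes w-ii
InW? r-iii = yes w-iii
InW? r-iv = yes w-iv
InW? r-v = yes w-v
InW? r-vi = yes w-vi
InW? r-vii = yes w-vii
InW? r-viii = no λ ()
InW? r-ix = no λ ()
InW? r-x = no λ ()

InC? : ∀ ρ → Dec (InC ρ)
InC? r-i = no λ ()
InC? r-ii = no λ ()
InC? r-iii = no λ ()
InC? r-iv = no λ ()
InC? r-v = no λ ()
InC? r-vi = no λ ()
InC? r-vii = no λ ()
InC? r-viii = yes c-viii
InC? r-ix = yes c-ix
InC? r-x = yes c-x

w-weight : Label → ℕ
w-weight ac↓ = 2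
w-weight ac↑ = 2
w-weight _ = 1

w-total : ∀ {U L} {A : Flow U L} → Finite (Flow.V A) → ℕ
w-total {A = A} f = finite-sum f (w-weight ∘ Flow.lab A)

finite-Fin : ∀ n → Finite (Fin n)
finite-Fin n = n , ↔-refl

finite-rhs : ∀ {ρ} → InW ρ → Finite (Flow.V (rhs ρ))
finite-rhs w-i = finite-Fin _
finite-rhs w-ii = finite-Fin _
finite-rhs w-iii = finite-Fin _
finite-rhs w-iv = finite-Fin _
finite-rhs w-v = finite-Fin _
finite-rhs w-vi = finite-Fin _
finite-rhs w-vii = finite-Fin _

glue-total : ∀ {U L P Q} {A : Flow U L} {K : Flow (U ⊎ Q) (L ⊎ P)} {R : Flow P Q} (G : IsGlue A K R) →
  (f : Finite (Flow.V A)) (k : Finite (Flow.V K)) (r : Finite (Flow.V R)) → w-total {A = A} f ≡ w-total {A = K} k + w-total {A = R} r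
glue-total {A = A} {K} {R} G f k r = trans (finite-sum-↔ f (finite-⊎ k r) (IsGlue.vbij G) (w-weight ∘ Flow.lab A))
  (trans (finite-sum-cong (finite-⊎ k r) (λ v → cong w-weight (trans (IsGlue.lab-ok G _) (cong (glab K R) (inv-l (IsGlue.vbij G) v)))))
    (finite-sum-⊎ k r (w-weight ∘ glab K R)))

w-decreases : ∀ {U L ρ} {A A' : Flow U L} → InW ρ → LStep ρ A A' → (f : Finite (Flow.V A)) (f' : Finite (Flow.V A')) →
  w-total {A = A'} f' < w-total {A = A} f
w-decreases {ρ = ρ} w st f f' = subst₂ _<_ (sym (glue-total (LStep.gl' st) f' (finV (LStep.K-wf st)) (finite-rhs w)))
  (sym (glue-total (LStep.gl st) f (finV (LStep.K-wf st)) (LhsRedex.finR ρ))) (ℕP.+-monoʳ-< _ (table w))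
  where
  table : ∀ {ρ} (w : InW ρ) → w-total {A = rhs ρ} (finite-rhs w) < w-total {A = lhs ρ} (LhsRedex.finR ρ)
  table w-i = s≤s z≤n
  table w-ii = s≤s z≤n
  table w-iii = s≤s (s≤s z≤n)
  table w-iv = s≤s (s≤s z≤n)
  table w-v = s≤s z≤n
  table w-vi = s≤s (s≤s (s≤s z≤n))
  table w-vii = s≤s (s≤s (s≤s z≤n))

module Normalise {At : Set} {bar : At → At} (invol : ∀ a → bar (bar a) ≡ a) (bar≢ : ∀ a → bar a ≢ a) {α β : Fm At} where

  Der : Set
  Der = Deriv bar α β

  wf : (d : Der) → WF (flowOf d)
  wf d = flowOf-wf {bar = bar} invol bar≢ d

  reduce : ∀ d ρ (p : Pat (flowOf d) (lhs-redex ρ)) → Σ Der λ d' → LStepAt {bar = bar} invol ρ (flowOf d') (embed (wf d) (lhs-redex ρ) p)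
  reduce d ρ p = local-step {bar = bar} invol (wf d) (flowOf-struct d) ρ (embed (wf d) (lhs-redex ρ) p)

  module _ (I : LRule → Set) (I? : ∀ ρ → Dec (I ρ)) where

    Red : Flow (Occ α) (Occ β) → Flow (Occ α) (Occ β) → Set1
    Red A A' = Σ LRule λ ρ → I ρ × LStep ρ A A'

    NoPat : ∀ {U L} → Flow U L → Set
    NoPat A = ∀ ρ → I ρ → ¬ Pat A (lhs-redex ρ)

    normal⇒no-pat : ∀ d → ¬ (Σ _ (Red (flowOf d))) → NoPat (flowOf d)
    normal⇒no-pat d n ρ i p with reduce d ρ p
    ... | (d' , st , _) = n (_ , ρ , i , st)

    no-pat⇒normal : ∀ {A} → NoPat A → ¬ (Σ _ (Red A))
    no-pat⇒normal n (_ , ρ , i , st) = n ρ i (pat-of-glue (LStep.gl st) (lhs-redex ρ))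

    normalise : (Inv : Der → Set) (μ : ∀ d → Inv d → ℕ) →
      (∀ {d d' ρ} → I ρ → LStep ρ (flowOf d) (flowOf d') → (i : Inv d) → Σ (Inv d') λ i' → μ d' i' < μ d i) →
      ∀ d → Inv d → Σ Der λ d' → Star Red (flowOf d) (flowOf d') × ¬ (Σ _ (Red (flowOf d')))
    normalise Inv μ decr d i = go (suc (μ d i)) d i ℕP.≤-refl
      where
      go : ∀ n d i → μ d i < n → Σ Der λ d' → Star Red (flowOf d) (flowOf d') × ¬ (Σ _ (Red (flowOf d')))
      go (suc n) d i (s≤s le) with any-rule? (λ ρ → I? ρ ×-dec pat? (wf d) (lhs-redex ρ))
      ... | no np = d , nil , no-pat⇒normal (λ ρ i p → np (ρ , i , p))
      ... | yes (ρ , j , p) with reduce d ρ p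
      ...   | (d' , st , _) with decr {d} {d'} j st i
      ...     | (i' , lt) with go n d' i' (ℕP.<-≤-trans lt le)
      ...       | (d'' , ss , nf) = d'' , (ρ , j , st) ◅ ss , nf

  normalise-w : ∀ d → Σ Der λ d' → Star _⟶w_ (flowOf d) (flowOf d') × NormalW (flowOf d')
  normalise-w d = normalise InW InW? (λ _ → ⊤) (λ d _ → w-total {A = flowOf d} (finite-DV {bar = bar} d))
    (λ {d} {d'} w st _ → tt , w-decreases {A = flowOf d} {flowOf d'} w st (finite-DV {bar = bar} d) (finite-DV {bar = bar} d')) d tt

  cert-total : ∀ {S} (d : Der) → Cert S (flowOf d) → ℕ
  cert-total {S} d C = finite-sum (finite-DV {bar = bar} d) (λ v → wt S (Cert.bound C) (Flow.lab (flowOf d) v) (Cert.sgn C v) (Cert.ρ C v))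

  normalise-c : ∀ (d : Der) → Cert (λ _ → true) (flowOf d) → Σ Der λ d' → Star _⟶c_ (flowOf d) (flowOf d') × NormalC (flowOf d')
  normalise-c = normalise InC InC? (λ (d : Der) → Cert (λ _ → true) (flowOf d)) cert-total
    (λ {d} {d'} {ρ} c st C → CertStep.cert-step ρ c st C refl , CertStep.total-decreases ρ c st C refl (finite-DV {bar = bar} d) (finite-DV {bar = bar} d'))

  cert-star : ∀ {A A' : Flow (Occ α) (Occ β)} → Star _⟶c_ A A' → Cert (λ _ → true) A → Cert (λ _ → true) A'
  cert-star nil C = C
  cert-star ((ρ , c , st) ◅ ss) C = cert-star ss (CertStep.cert-step ρ c st C refl)

neg : Sign → Bool
neg plus = false
neg minus = true

IsContr? : ∀ {U L} (A : Flow U L) k → Dec (IsContr A k)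
IsContr? A k = (k ≟ˡ ac↓) ⊎-dec (k ≟ˡ ac↑)

Incident? : ∀ {U L} {A : Flow U L} → WF A → ∀ e v → Dec (Incident A e v)
Incident? {A = A} W e v = inj2? (finite-≟ (finV W)) (Flow.up A e) v ⊎-dec inj2? (finite-≟ (finV W)) (Flow.dn A e) v

module OnCycle {U L : Set} {A : Flow U L} (W : WF A) {π : Polarity A} (valid : ValidPol A π) where
  open Graph W valid
  open Ends A
  private
    module A = Flow A

  T-last : ∀ {a b} → T a b → Σ A.E λ e → Σ A.V λ c → Arc A π e c b × (a ≡ c ⊎ T a c)
  T-last t = go (T⇒walk t)
    where
    go : ∀ {a b} → Walk a b → Σ A.E λ e → Σ A.V λ c → Arc A π e c b × (a ≡ c ⊎ T a c)
    go (one e r) = e , _ , r , inl refl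
    go (e , r ◂ w) with go w
    ... | (e' , c , r' , inl refl) = e' , c , r' , inr (arc⇒T r)
    ... | (e' , c , r' , inr t) = e' , c , r' , inr (T-trans (arc⇒T r) t)

  T-first : ∀ {a b} → T a b → Σ A.E λ e → Σ A.V λ c → Arc A π e a c × (c ≡ b ⊎ T c b)
  T-first t = go (T⇒walk t)
    where
    go : ∀ {a b} → Walk a b → Σ A.E λ e → Σ A.V λ c → Arc A π e a c × (c ≡ b ⊎ T c b)
    go (one e r) = e , _ , r , inl refl
    go (e , r ◂ w) = e , _ , r , inr (walk⇒T w)

  pred-on-cycle : ∀ {v} → T v v → Σ A.E λ e → Σ A.V λ c → Arc A π e c v × T c c
  pred-on-cycle t with T-last t
  ... | (e , c , r , inl refl) = e , c , r , t
  ... | (e , c , r , inr u) = e , c , r , T-trans (arc⇒T r) u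

  succ-on-cycle : ∀ {v} → T v v → Σ A.E λ e → Σ A.V λ c → Arc A π e v c × T c c
  succ-on-cycle t with T-first t
  ... | (e , c , r , inl refl) = e , c , r , t
  ... | (e , c , r , inr u) = e , c , r , T-trans u (arc⇒T r)

  neg-arc : ∀ {e a b} → π e ≡ minus → Arc A π e a b → A.dn e ≡ inr a × A.up e ≡ inr b
  neg-arc {e} m≡ (p , q) with π e
  neg-arc refl (p , q) | minus = dn-tgt⁻ p , up-src⁻ q

  same-sign : ∀ {v e e'} → IsContr A (A.lab v) → Incident A e v → π e ≡ minus → Incident A e' v → π e' ≡ minus
  same-sign c i m≡ j = trans (fst (valid _) c _ _ j i) m≡

  arc-in : ∀ {e a b} → Arc A π e a b → Incident A e b
  arc-in {e} (p , q) = inc-tgt (or (π e)) q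
  arc-out : ∀ {e a b} → Arc A π e a b → Incident A e a
  arc-out {e} (p , q) = inc-src (or (π e)) p

  arc-ends≡ : ∀ {e a b c d} → Arc A π e a b → Arc A π e c d → a ≡ c × b ≡ d
  arc-ends≡ (p , q) (p' , q') = inr-inj (trans (sym p) p') , inr-inj (trans (sym q) q')

  turns : ∀ {v} → T v v → ∀ {k} → A.lab v ≡ k → k ≢ aw↓ × k ≢ aw↑
  turns {v} t l with pred-on-cycle t | succ-on-cycle t
  ... | (e , a , r , _) | (e' , b , r' , _) = (λ { refl → loop (weakening-edge W l (arc-in r) (arc-out r')) }) , λ { refl → loop (coweakening-edge W l (arc-in r) (arc-out r')) }
    where
    loop : e ≡ e' → ⊥
    loop refl = no-arc-loop (subst (λ x → Arc A π e x v) (fst (arc-ends≡ r r')) r)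

module NegRedex {U L : Set} {A : Flow U L} (W : WF A) (C : Cert neg A) where
  open Cert C using (π; valid; ρ; bound; ρ≤; ρ-arc)
  open Graph W valid
  open OnCycle W valid
  open Ends A
  private
    module A = Flow A

  record NegRedex : Set where
    field
      rule : LRule
      isC : InC rule
      pat : Pat A (lhs-redex rule)
      y : Flow.V (lhs rule)
      y-contr : IsContr (lhs rule) (Flow.lab (lhs rule) y)
      negative : π (fst pat) ≡ minus
      y-neg : NegV A π (Emb.jV (embed W (lhs-redex rule) pat) y)
      y-cyc : VertexOnAICycle A (Emb.jV (embed W (lhs-redex rule) pat) y)

  private
    at-y0 : ∀ {P : A.V → Set} ρ (p : Pat A (lhs-redex ρ)) → P (fst (snd p)) → P (Emb.jV (embed W (lhs-redex ρ) p) (LhsRedex.y0 ρ))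
    at-y0 {P} ρ p = subst P (sym (embed-y0 W (lhs-redex ρ) p))
    at-x0 : ∀ {P : A.V → Set} ρ (p : Pat A (lhs-redex ρ)) → P (fst (snd (snd p))) → P (Emb.jV (embed W (lhs-redex ρ) p) (LhsRedex.x0 ρ))
    at-x0 {P} ρ p = subst P (sym (embed-x0 W (lhs-redex ρ) p))

  find↓ : ∀ n v → ρ v ≤ n → A.lab v ≡ ac↓ → T v v → NegV A π v → NegRedex
  find↓ n v le l t (e , i , m≡) with pred-on-cycle t
  ... | (e' , a , r , u) with same-sign (inl l) i m≡ (arc-in r)
  ...   | m' with neg-arc m' r
  ...     | (d , p) = go (A.lab a) refl n le
    where
    found : ∀ ρ → InC ρ → (pat : Pat A (lhs-redex ρ)) → fst (snd pat) ≡ v → fst pat ≡ e' → Flow.lab (lhs ρ) (LhsRedex.y0 ρ) ≡ ac↓ → NegRedex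
    found ρ c pat refl refl l≡ = record { rule = ρ ; isC = c ; pat = pat ; y = LhsRedex.y0 ρ ; y-contr = inl l≡ ; negative = m'
      ; y-neg = at-y0 {NegV A π} ρ pat (e' , arc-in r , m') ; y-cyc = at-y0 {VertexOnAICycle A} ρ pat (vertex-on-cycle t) }
    go : ∀ k → A.lab a ≡ k → ∀ n → ρ v ≤ n → NegRedex
    go ai↓ la _ _ with () ← in-degree W la d
    go ai↑ la _ _ = found r-viii c-viii (e' , v , a , p , d , l , la) refl refl refl
    go aw↓ la _ _ = ⊥-elim (fst (turns u la) refl)
    go aw↑ la _ _ = ⊥-elim (snd (turns u la) refl)
    go ac↑ la _ _ = found r-x c-x (e' , v , a , p , d , l , la) refl refl refl
    go ac↓ la zero le with () ← ℕP.≤-trans (ρ-arc (cong neg m') r) le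
    go ac↓ la (suc n) le = find↓ n a (ℕP.≤-pred (ℕP.≤-trans (ρ-arc (cong neg m') r) le)) la u (e' , inr d , m')

  find↑ : ∀ n v → bound ∸ ρ v ≤ n → A.lab v ≡ ac↑ → T v v → NegV A π v → NegRedex
  find↑ n v le l t (e , i , m≡) with succ-on-cycle t
  ... | (e' , a , r , u) with same-sign (inr l) i m≡ (arc-out r)
  ...   | m' with neg-arc m' r
  ...     | (d , p) = go (A.lab a) refl n le
    where
    found : ∀ ρ → InC ρ → (pat : Pat A (lhs-redex ρ)) → fst (snd (snd pat)) ≡ v → fst pat ≡ e' → Flow.lab (lhs ρ) (LhsRedex.x0 ρ) ≡ ac↑ → NegRedex
    found ρ c pat refl refl l≡ = record { rule = ρ ; isC = c ; pat = pat ; y = LhsRedex.x0 ρ ; y-contr = inr l≡ ; negative = m'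
      ; y-neg = at-x0 {NegV A π} ρ pat (e' , arc-out r , m') ; y-cyc = at-x0 {VertexOnAICycle A} ρ pat (vertex-on-cycle t) }
    lt : bound ∸ ρ a < bound ∸ ρ v
    lt = ℕP.∸-monoʳ-< (ρ-arc (cong neg m') r) (ρ≤ a)
    go : ∀ k → A.lab a ≡ k → ∀ n → bound ∸ ρ v ≤ n → NegRedex
    go ai↑ la _ _ with () ← out-degree W la p
    go ai↓ la _ _ = found r-ix c-ix (e' , a , v , p , d , la , l) refl refl refl
    go aw↓ la _ _ = ⊥-elim (fst (turns u la) refl)
    go aw↑ la _ _ = ⊥-elim (snd (turns u la) refl)
    go ac↓ la _ _ = found r-x c-x (e' , a , v , p , d , la , l) refl refl refl
    go ac↑ la zero le with () ← ℕP.≤-trans lt le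
    go ac↑ la (suc n) le = find↑ n a (ℕP.≤-pred (ℕP.≤-trans lt le)) la u (e' , inl p , m')

  neg-redex : (∀ v → IsContr A (A.lab v) → VertexOnAICycle A v → PosV A π v) ⊎ NegRedex
  neg-redex with finite-any? (finV W) (λ v → IsContr? A (A.lab v) ×-dec T? v v ×-dec finite-any? (finE W) (λ e → Incident? W e v ×-dec (π e ≟ˢ minus)))
  ... | yes (v , inl l , t , nv) = inr (find↓ (ρ v) v ℕP.≤-refl l t nv)
  ... | yes (v , inr l , t , nv) = inr (find↑ (bound ∸ ρ v) v ℕP.≤-refl l t nv)
  ... | no n = inl λ v c y e i → positive (π e) refl λ m≡ → n (v , c , cycle-vertex y , e , i , m≡)
    where
    positive : ∀ x {e} → π e ≡ x → ¬ (π e ≡ minus) → π e ≡ plus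
    positive plus p n = p
    positive minus p n = ⊥-elim (n p)

module _ {U L : Set} {A : Flow U L} (W : WF A) {π : Polarity A} (val : ValidPol A π) where
  private
    module A = Flow A

    some-edge : ∀ v k → A.lab v ≡ k → Sign
    some-edge v ac↓ l = π (fst (labelled-outs W (lhs-redex r-i) v l) zero)
    some-edge v ac↑ l = π (fst (labelled-ins W (lhs-redex r-i) v l) zero)
    some-edge v _ l = plus

    ok : ∀ v k l → IsContr A k → ∀ e → Incident A e v → π e ≡ some-edge v k l
    ok v ac↓ l c e i = fst (val v) (inl l) _ _ i (inl (hit (snd (labelled-outs W (lhs-redex r-i) v l)) zero))
    ok v ac↑ l c e i = fst (val v) (inr l) _ _ i (inr (hit (snd (labelled-ins W (lhs-redex r-i) v l)) zero))
    ok v ai↓ l (inl ())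
    ok v ai↓ l (inr ())
    ok v ai↑ l (inl ())
    ok v ai↑ l (inr ())
    ok v aw↓ l (inl ())
    ok v aw↓ l (inr ())
    ok v aw↑ l (inl ())
    ok v aw↑ l (inr ())

  make-cert : ∀ {S} (ρ : A.V → ℕ) bound → (∀ v → ρ v ≤ bound) → (∀ {e a b} → S (π e) ≡ true → Arc A π e a b → ρ a < ρ b) → Cert S A
  make-cert ρ bound ρ≤ arc = record { π = π ; valid = val ; sgn = λ v → some-edge v _ refl ; sgn-ok = λ v c → ok v _ refl c
    ; ρ = ρ ; bound = bound ; ρ≤ = ρ≤ ; ρ-arc = λ {e} → arc {e} }

module PositiveCycles {At : Set} {bar : At → At} (invol : ∀ a → bar (bar a) ≡ a) (bar≢ : ∀ a → bar a ≢ a) {α β : Fm At} where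
  open Normalise {bar = bar} invol bar≢ {α} {β}

  clock-cert : (d : Der) (π : Polarity (flowOf d)) → ValidPol (flowOf d) π → Cert neg (flowOf d)
  clock-cert d π val = make-cert (wf d) val (clock d) (size d) (λ v → ℕP.<⇒≤ (clock<size d v)) (λ {e} → arc {e})
    where
    arc : ∀ {e a b} → neg (π e) ≡ true → Arc (flowOf d) π e a b → clock d a < clock d b
    arc {e} p r with π e
    arc {e} p (r , q) | minus = clock-edge d e (Ends.up-src⁻ (flowOf d) {e} q) (Ends.dn-tgt⁻ (flowOf d) {e} r)

  record Positive (d : Der) (π : Polarity (flowOf d)) : Set1 where
    field
      d1 : Der
      π₁ : Polarity (flowOf d1)
      steps : Star PolCStep (flowOf d , π) (flowOf d1 , π₁)
      positive : ∀ v → IsContr (flowOf d1) (Flow.lab (flowOf d1) v) → VertexOnAICycle (flowOf d1) v → PosV (flowOf d1) π₁ v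

  make-positive : ∀ d (C : Cert neg (flowOf d)) → Positive d (Cert.π C)
  make-positive d C = go (suc (cert-total d C)) d C ℕP.≤-refl
    where
    go : ∀ n d (C : Cert neg (flowOf d)) → cert-total d C < n → Positive d (Cert.π C)
    go (suc n) d C (s≤s le) with NegRedex.neg-redex (wf d) C
    ... | inl pos = record { d1 = d ; π₁ = Cert.π C ; steps = nil ; positive = pos }
    ... | inr X with reduce d (NegRedex.NegRedex.rule X) (NegRedex.NegRedex.pat X)
    ...   | (d' , st , at) = extend (go n d' C' (ℕP.<-≤-trans (CertStep.total-decreases rule isC st C live (finite-DV {bar = bar} d) (finite-DV {bar = bar} d')) le))
      where
      open NegRedex.NegRedex X
      live : neg (CertStep.s0 rule isC st C) ≡ true
      live = cong neg (trans (sym (CertStep.contr-sign rule isC st C y y-contr {fst y-neg} (subst (Incident (flowOf d) (fst y-neg)) (sym (at y)) (fst (snd y-neg))))) (snd (snd y-neg)))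
      C' : Cert neg (flowOf d')
      C' = CertStep.cert-step rule isC st C live
      st' : PolCStep (flowOf d , Cert.π C) (flowOf d' , Cert.π C')
      st' = record { ρ = rule ; isC = isC ; st = st ; v = y ; v-contr = y-contr
        ; v-neg = subst (NegV (flowOf d) (Cert.π C)) (sym (at y)) y-neg ; v-cyc = subst (VertexOnAICycle (flowOf d)) (sym (at y)) y-cyc
        ; valid' = Cert.valid C' ; agree = CertStep.cert-agree rule isC st C live }
      extend : Positive d' (Cert.π C') → Positive d (Cert.π C)
      extend P = record { d1 = Positive.d1 P ; π₁ = Positive.π₁ P ; steps = st' ◅ Positive.steps P ; positive = Positive.positive P }

Joins : ∀ {U L} (A : Flow U L) → Label → Label → Flow.E A → Set
Joins A k k' e = Σ (Flow.V A) λ v → Σ (Flow.V A) λ w →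
  Flow.up A e ≡ inr v × Flow.dn A e ≡ inr w × Flow.lab A v ≡ k × Flow.lab A w ≡ k'

joins? : ∀ {U L} (A : Flow U L) k k' e → Dec (Joins A k k' e)
joins? A k k' e = go (Flow.up A e) (Flow.dn A e)
  where
  go : ∀ (x : _ ⊎ Flow.V A) (y : _ ⊎ Flow.V A) → Dec (Σ _ λ v → Σ _ λ w → x ≡ inr v × y ≡ inr w × Flow.lab A v ≡ k × Flow.lab A w ≡ k')
  go (inl _) y = no λ ()
  go (inr v) (inl _) = no λ ()
  go (inr v) (inr w) = map′ (λ { (p , q) → v , w , refl , refl , p , q }) (λ { (_ , _ , refl , refl , p , q) → p , q })
    ((_ ≟ˡ _) ×-dec (_ ≟ˡ _))

module _ {U L : Set} {A : Flow U L} where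
  open Ends A

  simple : ∀ {e} → Joins A ai↓ ai↑ e → SimpleEdge A e
  simple {e} (v , w , p , q , l , l') = ⇓ , ((tt , tt) , ⇓ , refl ∷ []) , inl ((v , up-src {e} p , l) , w , dn-tgt {e} q , l')

  simple⁻ : WF A → ∀ {e} → SimpleEdge A e → Joins A ai↓ ai↑ e
  simple⁻ W (⇓ , _ , inl ((v , p , l) , w , q , l')) = v , w , up-src⁻ p , dn-tgt⁻ q , l , l'
  simple⁻ W (⇓ , _ , inr ((v , p , l) , _)) with () ← out-degree W l (up-src⁻ p)
  simple⁻ W (⇑ , _ , inl ((v , p , l) , _)) with () ← in-degree W l (dn-tgt⁻ p)
  simple⁻ W (⇑ , _ , inr ((v , p , l) , w , q , l')) = w , v , up-src⁻ q , dn-tgt⁻ p , l' , l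

CNormal : ∀ {U L} → Flow U L → Set
CNormal A = ∀ e → ¬ Joins A ac↓ ai↑ e × ¬ Joins A ai↓ ac↑ e × ¬ Joins A ac↓ ac↑ e

module Pull {U1 L1 U2 L2 : Set} {H : Flow U1 L1} {B : Flow U2 L2} (M : Mor H B) where
  open Mor M

  lab-pull : ∀ v {k} → Flow.lab H v ≡ k → IsAI H k ⊎ IsContr H k → Flow.lab B (fV v) ≡ k
  lab-pull v refl k with flab v | k
  ... | inl p | _ = p
  ... | inr (n , _) | inl i = ⊥-elim (n i)
  ... | inr (_ , n) | inr i = ⊥-elim (n i)

  joins-push : ∀ {k k' e} → IsAI H k ⊎ IsContr H k → IsAI H k' ⊎ IsContr H k' → Joins H k k' e → Joins B k k' (fE e)
  joins-push i j (v , w , p , q , l , l') = fV v , fV w , fup p , fdn q , lab-pull v l i , lab-pull w l' j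

  cnormal-pull : CNormal B → CNormal H
  cnormal-pull n e = (λ j → fst (n (fE e)) (joins-push (inr (inl refl)) (inl (inr refl)) j)) ,
    (λ j → fst (snd (n (fE e))) (joins-push (inl (inl refl)) (inr (inr refl)) j)) ,
    λ j → snd (snd (n (fE e))) (joins-push (inr (inl refl)) (inr (inr refl)) j)

AllFragile : ∀ {U L} → Flow U L → Set
AllFragile B = ∀ l → AICycle B l → Any (λ x → SimpleEdge B (fst x)) l

module _ {U1 L1 U2 L2 : Set} {H : Flow U1 L1} {B : Flow U2 L2} (M : Mor H B) (WH : WF H) (WB : WF B) where
  open Mor M
  open MorProps M
  open Graph WH (snd (polar WH))
  open OnCycle WH (snd (polar WH))

  private
    unique-map : ∀ l → Unique (edges H l) → Unique (edges B (map fOE l))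
    unique-map [] u = []
    unique-map ((e , d) ∷ l) (n ∷ u) = go l n ∷ unique-map l u
      where
      go : ∀ l → All (e ≢_) (edges H l) → All (fE e ≢_) (edges B (map fOE l))
      go [] [] = []
      go (x ∷ l) (n ∷ ns) = n ∘ fE-inj ∷ go l ns

    cycle-push : ∀ l → AICycle H l → AICycle B (map fOE l)
    cycle-push l (p , (v , q , r) , u) = fpath l p , (fV v , fstart l q , fend l r) , unique-map l u

    lab-cyclic : ∀ {v k} → T v v → Flow.lab B (fV v) ≡ k → Flow.lab H v ≡ k
    lab-cyclic {v} {k} t p with flab v
    ... | inl q = trans (sym q) p
    ... | inr (n , m') = ⊥-elim (go _ refl n m')
      where
      go : ∀ k → Flow.lab H v ≡ k → ¬ IsAI H (Flow.lab H v) → ¬ IsContr H (Flow.lab H v) → ⊥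
      go ai↓ l n _ = n (inl l)
      go ai↑ l n _ = n (inr l)
      go ac↓ l _ n = n (inl l)
      go ac↑ l _ n = n (inr l)
      go aw↓ l _ _ = fst (turns t l) refl
      go aw↑ l _ _ = snd (turns t l) refl

    simple-pull : ∀ {e a b} → Arc H (fst (polar WH)) e a b → T b a → Joins B ai↓ ai↑ (fE e) → Joins H ai↓ ai↑ e
    simple-pull {e} {a} {b} r t (v , w , p' , q' , l , l') = go (or (fst (polar WH) e)) (fst r) (snd r)
      where
      both : ∀ {x y} → Flow.up H e ≡ inr x → Flow.dn H e ≡ inr y → T x x → T y y → Joins H ai↓ ai↑ e
      both up dn tx ty = _ , _ , up , dn , lab-cyclic tx (trans (cong (Flow.lab B) (inr-inj (trans (sym (fup up)) p'))) l) ,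
                                           lab-cyclic ty (trans (cong (Flow.lab B) (inr-inj (trans (sym (fdn dn)) q'))) l')
      go : ∀ d → src H (e , d) ≡ inr a → tgt H (e , d) ≡ inr b → Joins H ai↓ ai↑ e
      go ⇓ p q = both (Ends.up-src⁻ H p) (Ends.dn-tgt⁻ H q) (T-trans (arc⇒T r) t) (T-trans t (arc⇒T r))
      go ⇑ p q = both (Ends.up-src⁻ H q) (Ends.dn-tgt⁻ H p) (T-trans t (arc⇒T r)) (T-trans (arc⇒T r) t)

  fragile-pull : AllFragile B → AllFragile H
  fragile-pull f l c = go l (λ i → cycle-arc l c i) (f _ (cycle-push l c))
    where
    go : ∀ l → (∀ {x} → x ∈ l → Σ (Flow.V H) λ a → Σ (Flow.V H) λ b → Arc H (fst (polar WH)) (fst x) a b × T b a) →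
      Any (λ x → SimpleEdge B (fst x)) (map fOE l) → Any (λ x → SimpleEdge H (fst x)) l
    go (x ∷ l) g (here i) = let (a , b , r , t) = g (here refl) in here (simple (simple-pull r t (simple⁻ WB i)))
    go (x ∷ l) g (there i) = there (go l (g ∘ there) i)

-- B is obtained from A by adding a simple edge ε₁ between an interaction ν and a cointeraction μ.
module Halved {U L : Set} {B : Flow U L} {A : Flow (U ⊎ Fin 1) (L ⊎ Fin 1)} (WB : WF B) (WA : WF A) (g : IsGlue B A Rai) where
  private
    module A = Flow A
    module B = Flow B
    module GU = GlueUnique (Redex.shape Rai-redex) WA g
    P = GU.Pl.plugged
    module P = Flow P
    back : Mor P B
    back = IsoMor.iso-mor (IsoMor.iso-sym GU.glue-flow-iso)
    module back = Mor back
    int : InternalR A Rai (# 0)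
    int = (zero , refl) , (suc zero , refl)

  ν μ : B.V
  ν = from (IsGlue.vbij g) (inr zero)
  μ = from (IsGlue.vbij g) (inr (suc zero))

  nm : A.E → B.E
  nm e = back.fE (inl (e , GU.Pl.nodrop e))

  private
    nm-inj : ∀ {x y} → nm x ≡ nm y → x ≡ y
    nm-inj p with back.fE-inj {inl _} {inl _} p
    ... | refl = refl

    vQ≡ : fst (GU.Pl.Up.vQ zero) ≡ zero
    vQ≡ = inr-inj (trans (sym (snd (GU.Pl.Up.vQ zero))) (cong (Flow.up Rai) (sym (snd (snd (Redex.botR Rai-redex zero)) (# 1) refl))))
    vP≡ : fst (GU.Pl.Dn.vQ zero) ≡ suc zero
    vP≡ = inr-inj (trans (sym (snd (GU.Pl.Dn.vQ zero))) (cong (Flow.dn Rai) (sym (snd (snd (Redex.topR Rai-redex zero)) (# 2) refl))))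

  nm-up-ver : ∀ {e v} → A.up e ≡ inr v → B.up (nm e) ≡ inr (from (IsGlue.vbij g) (inl v))
  nm-up-ver {e} p = back.fup {inl (e , _)} (cong GU.Pl.Up.res p)
  nm-dn-ver : ∀ {e v} → A.dn e ≡ inr v → B.dn (nm e) ≡ inr (from (IsGlue.vbij g) (inl v))
  nm-dn-ver {e} p = back.fdn {inl (e , _)} (cong GU.Pl.Dn.res p)
  nm-ν : ∀ {e} → A.up e ≡ inl (inr zero) → B.up (nm e) ≡ inr ν
  nm-ν {e} p = back.fup {inl (e , _)} (trans (cong GU.Pl.Up.res p) (cong (λ z → inr (inr z)) vQ≡))
  nm-μ : ∀ {e} → A.dn e ≡ inl (inr zero) → B.dn (nm e) ≡ inr μ
  nm-μ {e} p = back.fdn {inl (e , _)} (trans (cong GU.Pl.Dn.res p) (cong (λ z → inr (inr z)) vP≡))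

  nm-up-bnd : ∀ {e u} → A.up e ≡ inl (inl u) → B.up (nm e) ≡ inl u
  nm-up-bnd {e} p = trans (FlowIso.up-iso (IsoMor.iso-sym GU.glue-flow-iso) (inl (e , _))) (cong (map₂ back.fV) (cong GU.Pl.Up.res p))
  nm-dn-bnd : ∀ {e u} → A.dn e ≡ inl (inl u) → B.dn (nm e) ≡ inl u
  nm-dn-bnd {e} p = trans (FlowIso.dn-iso (IsoMor.iso-sym GU.glue-flow-iso) (inl (e , _))) (cong (map₂ back.fV) (cong GU.Pl.Dn.res p))

  ε1-up : B.up (ε₁ g) ≡ inr ν
  ε1-up = back.fup {inr (# 0 , int)} refl
  ε1-dn : B.dn (ε₁ g) ≡ inr μ
  ε1-dn = back.fdn {inr (# 0 , int)} refl
  nm≢ : ∀ {e} → nm e ≢ ε₁ g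
  nm≢ p with () ← back.fE-inj {inl _} {inr _} p

  lab-of : ∀ v → B.lab (from (IsGlue.vbij g) v) ≡ glab A Rai v
  lab-of v = trans (IsGlue.lab-ok g _) (cong (glab A Rai) (inv-l (IsGlue.vbij g) v))

  weak-mor : Mor (Weak A) B
  weak-mor = record { fV = fV ; fE = nm ; fE-inj = nm-inj
    ; fup = λ { {v = inl v} p → nm-up-ver (weak-up-ver⁻ A p) ; {v = inr tt} p → nm-ν (weak-up-port⁻ A p) }
    ; fdn = λ { {v = inl v} p → nm-dn-ver (weak-dn-ver⁻ A p) ; {v = inr tt} p → ⊥-elim (weak-dn-tt A p) }
    ; flab = λ { (inl v) → inl (lab-of (inl v)) ; (inr tt) → inr ((λ { (inl ()) ; (inr ()) }) , λ { (inl ()) ; (inr ()) }) } }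
    where
    fV : A.V ⊎ ⊤ → B.V
    fV (inl v) = from (IsGlue.vbij g) (inl v)
    fV (inr tt) = ν

  coweak-mor : Mor (CoWeak A) B
  coweak-mor = record { fV = fV ; fE = nm ; fE-inj = nm-inj
    ; fdn = λ { {v = inl v} p → nm-dn-ver (coweak-dn-ver⁻ A p) ; {v = inr tt} p → nm-μ (coweak-dn-port⁻ A p) }
    ; fup = λ { {v = inl v} p → nm-up-ver (coweak-up-ver⁻ A p) ; {v = inr tt} p → ⊥-elim (coweak-up-tt A p) }
    ; flab = λ { (inl v) → inl (lab-of (inl v)) ; (inr tt) → inr ((λ { (inl ()) ; (inr ()) }) , λ { (inl ()) ; (inr ()) }) } }
    where
    fV : A.V ⊎ ⊤ → B.V
    fV (inl v) = from (IsGlue.vbij g) (inl v)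
    fV (inr tt) = μ

  weak-wf : WF (Weak A)
  weak-wf = record
    { finV = finite-⊎ (finV WA) finite-⊤ ; finE = finE WA
    ; upU = λ u → let (e , p , q) = upU WA (inl u) in e , weak-up-bnd A p , λ e' p' → q e' (weak-up-bnd⁻ A p')
    ; dnL = λ l → let (e , p , q) = dnL WA l in e , weak-dn-bnd A p , λ e' p' → q e' (weak-dn-bnd⁻ A p')
    ; inDeg = λ { (inl v) → ports⇒↔ (weak-ports-dn A (snd (ins-ports WA v))) ; (inr tt) → ports⇒↔ (weak-new-dn A (λ ())) }
    ; outDeg = λ { (inl v) → ports⇒↔ (weak-ports-up A (snd (outs-ports WA v)))
                 ; (inr tt) → ports⇒↔ (weak-new-up A (snd (upU WA (inr zero)))) }
    ; acyclic = MorProps.acyclic-pull weak-mor WB ; polar = _ , MorProps.polar-pull weak-mor (snd (polar WB)) }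

  coweak-wf : WF (CoWeak A)
  coweak-wf = record
    { finV = finite-⊎ (finV WA) finite-⊤ ; finE = finE WA
    ; upU = λ u → let (e , p , q) = upU WA u in e , coweak-up-bnd A p , λ e' p' → q e' (coweak-up-bnd⁻ A p')
    ; dnL = λ l → let (e , p , q) = dnL WA (inl l) in e , coweak-dn-bnd A p , λ e' p' → q e' (coweak-dn-bnd⁻ A p')
    ; inDeg = λ { (inl v) → ports⇒↔ (coweak-ports-dn A (snd (ins-ports WA v)))
                ; (inr tt) → ports⇒↔ (coweak-new-dn A (snd (dnL WA (inr zero)))) }
    ; outDeg = λ { (inl v) → ports⇒↔ (coweak-ports-up A (snd (outs-ports WA v))) ; (inr tt) → ports⇒↔ (coweak-new-up A (λ ())) }
    ; acyclic = MorProps.acyclic-pull coweak-mor WB ; polar = _ , MorProps.polar-pull coweak-mor (snd (polar WB)) }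

data Tree (Leaf : ∀ {U L} → Flow U L → Set) (Cuttable : ∀ {U L} (B : Flow U L) → Flow.E B → Set) :
  {U L : Set} → Flow U L → Flow U L → Set1 where
  leaf  : ∀ {U L} {B : Flow U L} → Leaf B → Tree Leaf Cuttable B B
  node : ∀ {U L} {B C : Flow U L} (A : Flow (U ⊎ Fin 1) (L ⊎ Fin 1)) {D1 : Flow U (L ⊎ Fin 1)} {D2 : Flow (U ⊎ Fin 1) L} →
    WF A → (g : IsGlue B A Rai) → Cuttable B (ε₁ g) →
    Tree Leaf Cuttable (Weak A) D1 → Tree Leaf Cuttable (CoWeak A) D2 → IsComb C D1 D2 → Tree Leaf Cuttable B C

BC-tree EX-tree : ∀ {U L} → Flow U L → Flow U L → Set1
BC-tree = Tree (λ B → ¬ HasFragile B) EdgeOnAICycle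
EX-tree = Tree (λ B → ¬ Σ (Flow.E B) (Extremal B)) Extremal

bc⇒tree : ∀ {U L} {B C : Flow U L} → B ⟶bc C → BC-tree B C
bc⇒tree (bc-stop n) = leaf n
bc⇒tree (bc-split A W g c r r' K) = node A W g c (bc⇒tree r) (bc⇒tree r') K
tree⇒bc : ∀ {U L} {B C : Flow U L} → BC-tree B C → B ⟶bc C
tree⇒bc (leaf n) = bc-stop n
tree⇒bc (node A W g c r r' K) = bc-split A W g c (tree⇒bc r) (tree⇒bc r') K
ex⇒tree : ∀ {U L} {B C : Flow U L} → B ⟶ex C → EX-tree B C
ex⇒tree (ex-stop n) = leaf n
ex⇒tree (ex-split A W g c r r' K) = node A W g c (ex⇒tree r) (ex⇒tree r') K
tree⇒ex : ∀ {U L} {B C : Flow U L} → EX-tree B C → B ⟶ex C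
tree⇒ex (leaf n) = ex-stop n
tree⇒ex (node A W g c r r' K) = ex-split A W g c (tree⇒ex r) (tree⇒ex r') K

Sole : ∀ {E X V : Set} → (E → X ⊎ V) → X → Set
Sole {E} end x = Σ E λ e → end e ≡ inl x × (∀ k → end k ≡ inl x → k ≡ e)

sole-pull : ∀ {E E' X V V' : Set} {end : E → X ⊎ V} {end' : E' → X ⊎ V'} (b : E ↔ E') {f : V → V'} →
  (∀ e → end' (to b e) ≡ map₂ f (end e)) → ∀ {x} → Sole end' x → Sole end x
sole-pull {end = end} {end'} b {f} h (e , p , q) = from b e , un (end _) (trans (sym (trans (cong end' (sym (inv-l b e))) (h (from b e)))) p) ,
  λ k r → trans (sym (inv-r b k)) (cong (from b) (q (to b k) (trans (h k) (cong (map₂ f) r))))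
  where
  un : ∀ z {x} → map₂ f z ≡ inl x → z ≡ inl x
  un (inl _) refl = refl

module CombIso {U L : Set} {C : Flow U L} {D1 : Flow U (L ⊎ Fin 1)} {D2 : Flow (U ⊎ Fin 1) L}
  (M1 : Sole (Flow.dn D1) (inr zero)) (M2 : Sole (Flow.up D2) (inr zero)) (K : IsComb C D1 D2) where
  open Merge D1 D2 M1 M2 public
  private
    module D1 = Flow D1
    module D2 = Flow D2

  private
    up-det : ∀ {x z} → CUp D1 D2 x z → up x ≡ z
    up-det CombDef.u-new = refl
    up-det CombDef.l-new = refl
    up-det (CombDef.d₁-top p) = cong (inr ∘ topU) p
    up-det (CombDef.d₁-v p) = cong (inr ∘ topU) p
    up-det (CombDef.d₂-top {e} {p = n} p) = cong inr (topU2-from-top (D2.up e) refl n p)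
    up-det (CombDef.d₂-v {e} {p = n} p) = cong inr (topU2-from-ver (D2.up e) refl n p)

    dn-det : ∀ {x z} → CDn D1 D2 x z → dn x ≡ z
    dn-det CombDef.u-new = refl
    dn-det CombDef.l-new = refl
    dn-det (CombDef.d₁-bot p) = cong (inr ∘ botL) p
    dn-det (CombDef.d₁-v p) = cong (inr ∘ botL) p
    dn-det (CombDef.d₁-mbot p q r) with is-m2 _ q
    ... | refl = cong inr (trans (cong botL p) (cong botL2 r))
    dn-det (CombDef.d₁-mv p q r) with is-m2 _ q
    ... | refl = cong inr (trans (cong botL p) (cong botL2 r))
    dn-det (CombDef.d₂-bot p) = cong (inr ∘ botL2) p
    dn-det (CombDef.d₂-v p) = cong (inr ∘ botL2) p

  comb-flow-iso : FlowIso C combined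
  comb-flow-iso = record { vb = IsComb.vbij K ; eb = IsComb.ebij K ; lab-iso = IsComb.lab-ok K
    ; up-iso = λ e → up-det (IsComb.up-ok K e) ; dn-iso = λ e → dn-det (IsComb.dn-ok K e) }

  back : Mor combined C
  back = IsoMor.iso-mor (IsoMor.iso-sym comb-flow-iso)

  mor1 : Mor D1 combined
  mor1 = record { fV = inl ∘ inl ; fE = nm1 ; fE-inj = λ { refl → refl } ; fup = cong (inr ∘ topU) ; fdn = cong (inr ∘ botL) ; flab = λ _ → inl refl }

  mor2 : Mor D2 combined
  mor2 = record { fV = inl ∘ inr ; fE = nm2 ; fE-inj = nm2-inj _ _ ; fup = fst up-nm2
    ; fdn = λ {e} p → trans (dn-nm2 e) (cong (inr ∘ botL2) p) ; flab = λ _ → inl refl }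

  comb-top : ∀ u → Sole (Flow.up C) u
  comb-top u = sole-pull {end' = up} (IsComb.ebij K) (FlowIso.up-iso comb-flow-iso) (inl (inl u) , refl ,
    λ { (inl (inl _)) refl → refl ; (inl (inr _)) () ; (inr (inl _)) () ; (inr (inr _)) () })
  comb-bot : ∀ l → Sole (Flow.dn C) l
  comb-bot l = sole-pull {end' = dn} (IsComb.ebij K) (FlowIso.dn-iso comb-flow-iso) (inl (inr l) , refl ,
    λ { (inl (inl _)) () ; (inl (inr _)) refl → refl ; (inr (inl _)) () ; (inr (inr _)) () })

module _ {Leaf : ∀ {U L} → Flow U L → Set} {Cuttable : ∀ {U L} (B : Flow U L) → Flow.E B → Set} where

  tree-bounds : ∀ {U L} {B C : Flow U L} → WF B → Tree Leaf Cuttable B C → (∀ u → Sole (Flow.up C) u) × (∀ l → Sole (Flow.dn C) l)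
  tree-bounds W (leaf _) = upU W , dnL W
  tree-bounds W (node A WA g _ r r' K) = comb-top , comb-bot
    where open CombIso (snd (tree-bounds (Halved.weak-wf W WA g) r) (inr zero)) (fst (tree-bounds (Halved.coweak-wf W WA g) r') (inr zero)) K

record Rank {U L : Set} (A : Flow U L) (π : Polarity A) : Set where
  field
    ρ : Flow.V A → ℕ
    bound : ℕ
    ρ≤ : ∀ v → ρ v ≤ bound
    ρ-arc : ∀ {e a b} → Arc A π e a b → ρ a < ρ b

Ord : Sign → ℕ → ℕ → Set
Ord plus i j = i < j
Ord minus i j = j < i

rank-edge : ∀ {U L} {A : Flow U L} {π} (R : Rank A π) {e v w} → Flow.up A e ≡ inr v → Flow.dn A e ≡ inr w → Ord (π e) (Rank.ρ R v) (Rank.ρ R w)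
rank-edge {A = A} {π} R {e} p q = go (π e) refl
  where
  go : ∀ x → π e ≡ x → Ord x (Rank.ρ R _) (Rank.ρ R _)
  go plus s≡ = Rank.ρ-arc R {e} (trans (cong (λ x → src A (e , or x)) s≡) (cong (upPt A) p) , trans (cong (λ x → tgt A (e , or x)) s≡) (cong (dnPt A) q))
  go minus s≡ = Rank.ρ-arc R {e} (trans (cong (λ x → src A (e , or x)) s≡) (cong (dnPt A) q) , trans (cong (λ x → tgt A (e , or x)) s≡) (cong (upPt A) p))

edge-rank : ∀ {U L} {A : Flow U L} {π} (ρ : Flow.V A → ℕ) bound → (∀ v → ρ v ≤ bound) →
  (∀ {e v w} → Flow.up A e ≡ inr v → Flow.dn A e ≡ inr w → Ord (π e) (ρ v) (ρ w)) → Rank A π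
edge-rank {A = A} {π} ρ bound ρ≤ h = record { ρ = ρ ; bound = bound ; ρ≤ = ρ≤ ; ρ-arc = λ {e} → go e (π e) refl }
  where
  go : ∀ e x {a b} → π e ≡ x → Arc A π e a b → ρ a < ρ b
  go e plus s≡ (p , q) = subst (λ x → Ord x _ _) s≡ (h (Ends.up-src⁻ A (trans (cong (λ x → src A (e , or x)) (sym s≡)) p)) (Ends.dn-tgt⁻ A (trans (cong (λ x → tgt A (e , or x)) (sym s≡)) q)))
  go e minus s≡ (p , q) = subst (λ x → Ord x _ _) s≡ (h (Ends.up-src⁻ A (trans (cong (λ x → tgt A (e , or x)) (sym s≡)) q)) (Ends.dn-tgt⁻ A (trans (cong (λ x → src A (e , or x)) (sym s≡)) p)))

module CombRank {U L : Set} {C : Flow U L} {D1 : Flow U (L ⊎ Fin 1)} {D2 : Flow (U ⊎ Fin 1) L}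
  (M1 : Sole (Flow.dn D1) (inr zero)) (M2 : Sole (Flow.up D2) (inr zero)) (K : IsComb C D1 D2) where
  open CombIso M1 M2 K
  private
    module D1 = Flow D1
    module D2 = Flow D2

  module _ (π : Polarity combined) (val : ValidPol combined π) (R1 : Rank D1 (π ∘ nm1)) (R2 : Rank D2 (π ∘ nm2)) where
    private
      module R1 = Rank R1
      module R2 = Rank R2

      sB : Sign
      sB = π (nm1 m1)

      o1 o2 : Sign → ℕ
      o1 plus = 0
      o1 minus = suc R2.bound
      o2 plus = suc R1.bound
      o2 minus = 0

      top : ℕ
      top = suc (suc (suc (R1.bound + R2.bound)))

      lo hi : Sign → ℕ
      lo plus = 0
      lo minus = top
      hi plus = top
      hi minus = 0

      ρ : V → ℕ
      ρ (inl (inl v)) = suc (o1 sB + R1.ρ v)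
      ρ (inl (inr v)) = suc (o2 sB + R2.ρ v)
      ρ (inr (inl u)) = lo (π (inl (inl u)))
      ρ (inr (inr l)) = hi (π (inl (inr l)))

      Mid : ℕ → Set
      Mid k = 1 ≤ k × k < top

      mid1 : ∀ v → Mid (ρ (inl (inl v)))
      mid1 v = s≤s z≤n , s≤s (go sB)
        where
        go : ∀ x → suc (o1 x + R1.ρ v) ≤ suc (suc (R1.bound + R2.bound))
        go plus = ℕP.m≤n⇒m≤1+n (s≤s (ℕP.≤-trans (R1.ρ≤ v) (ℕP.m≤m+n _ _)))
        go minus = s≤s (s≤s (ℕP.≤-trans (ℕP.≤-reflexive (ℕP.+-comm R2.bound (R1.ρ v))) (ℕP.+-monoˡ-≤ R2.bound (R1.ρ≤ v))))

      mid2 : ∀ v → Mid (ρ (inl (inr v)))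
      mid2 v = s≤s z≤n , s≤s (go sB)
        where
        go : ∀ x → suc (o2 x + R2.ρ v) ≤ suc (suc (R1.bound + R2.bound))
        go minus = ℕP.m≤n⇒m≤1+n (s≤s (ℕP.≤-trans (R2.ρ≤ v) (ℕP.m≤n+m _ _)))
        go plus = s≤s (s≤s (ℕP.+-monoʳ-≤ R1.bound (R2.ρ≤ v)))

      ρ≤top : ∀ v → ρ v ≤ top
      ρ≤top (inl (inl v)) = ℕP.<⇒≤ (snd (mid1 v))
      ρ≤top (inl (inr v)) = ℕP.<⇒≤ (snd (mid2 v))
      ρ≤top (inr (inl u)) with π (inl (inl u))
      ... | plus = z≤n
      ... | minus = ℕP.≤-refl
      ρ≤top (inr (inr l)) with π (inl (inr l))
      ... | plus = ℕP.≤-refl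
      ... | minus = z≤n

      data Hi (x : Sign) : ℕ → Set where
        ext : Hi x (hi x)
        mid : ∀ {k} → Mid k → Hi x k
      data Lo (x : Sign) : ℕ → Set where
        ext : Lo x (lo x)
        mid : ∀ {k} → Mid k → Lo x k

      lo-hi : ∀ x → Ord x (lo x) (hi x)
      lo-hi plus = s≤s z≤n
      lo-hi minus = s≤s z≤n
      lo-mid : ∀ x {k} → Mid k → Ord x (lo x) k
      lo-mid plus (p , q) = p
      lo-mid minus (p , q) = q
      mid-hi : ∀ x {k} → Mid k → Ord x k (hi x)
      mid-hi plus (p , q) = q
      mid-hi minus (p , q) = p

      con-sign : ∀ {x l} → dn x ≡ inr (inr (inr l)) → π (inl (inr l)) ≡ π x
      con-sign {x} {l} p = fst (val (inr (inr l))) (inl refl) (inl (inr l)) x (inl refl) (inr p)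
      coc-sign : ∀ {x u} → up x ≡ inr (inr (inl u)) → π (inl (inl u)) ≡ π x
      coc-sign {x} {u} p = fst (val (inr (inl u))) (inr refl) (inl (inl u)) x (inr refl) (inl p)

      from-coc : ∀ {x u b} → up x ≡ inr (inr (inl u)) → dn x ≡ inr b → (Mid (ρ b) ⊎ Σ L λ l → b ≡ inr (inr l)) → Ord (π x) (ρ (inr (inl u))) (ρ b)
      from-coc {x} p q (inl k) rewrite coc-sign {x} p = lo-mid (π x) k
      from-coc {x} p q (inr (l , refl)) rewrite coc-sign {x} p | con-sign {x} q = lo-hi (π x)

      to-con : ∀ {x l a} → up x ≡ inr a → dn x ≡ inr (inr (inr l)) → Mid (ρ a) → Ord (π x) (ρ a) (ρ (inr (inr l)))
      to-con {x} p q k rewrite con-sign {x} q = mid-hi (π x) k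

      shift : ∀ x k {i j} → Ord x i j → Ord x (suc (k + i)) (suc (k + j))
      shift plus k p = s≤s (ℕP.+-monoʳ-< k p)
      shift minus k p = s≤s (ℕP.+-monoʳ-< k p)

      bridge : ∀ v w → Ord sB (ρ (inl (inl v))) (ρ (inl (inr w)))
      bridge v w = go sB
        where
        go : ∀ x → Ord x (suc (o1 x + R1.ρ v)) (suc (o2 x + R2.ρ w))
        go plus = s≤s (s≤s (ℕP.≤-trans (R1.ρ≤ v) (ℕP.m≤m+n _ _)))
        go minus = s≤s (s≤s (ℕP.≤-trans (R2.ρ≤ w) (ℕP.m≤m+n _ _)))

      low-end : ∀ z → Mid (ρ (botL2 z)) ⊎ Σ L λ l → botL2 z ≡ inr (inr l)
      low-end (inl l) = inr (l , refl)
      low-end (inr v) = inl (mid2 v)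
      low-end1 : ∀ z → Mid (ρ (botL z)) ⊎ Σ L λ l → botL z ≡ inr (inr l)
      low-end1 (inl (inl l)) = inr (l , refl)
      low-end1 (inl (inr _)) = low-end _
      low-end1 (inr v) = inl (mid1 v)

      edge1 : ∀ e z z' → D1.up e ≡ z → D1.dn e ≡ z' → Ord (π (nm1 e)) (ρ (topU z)) (ρ (botL z'))
      edge1 e (inl u) z' p q = from-coc {nm1 e} (cong (inr ∘ topU) p) (cong (inr ∘ botL) q) (low-end1 z')
      edge1 e (inr v) (inl (inl l)) p q = to-con {nm1 e} (cong (inr ∘ topU) p) (cong (inr ∘ botL) q) (mid1 v)
      edge1 e (inr v) (inr w) p q = shift _ (o1 sB) (rank-edge R1 p q)
      edge1 e (inr v) (inl (inr zero)) p q with snd (snd M1) e q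
      ... | refl = go (D2.dn m2) refl
        where
        go : ∀ z → D2.dn m2 ≡ z → Ord sB (ρ (inl (inl v))) (ρ (botL2 z))
        go (inl l) r = to-con {nm1 m1} (cong (inr ∘ topU) p) (trans (cong (inr ∘ botL) q) (cong (inr ∘ botL2) r)) (mid1 v)
        go (inr w) r = bridge v w

      edge2 : ∀ e n z z' (p : D2.up e ≡ z) → D2.dn e ≡ z' → up (inr (inr (e , n))) ≡ inr (topU2 z p n) → Ord (π (inr (inr (e , n)))) (ρ (topU2 z p n)) (ρ (botL2 z'))
      edge2 e n (inl (inl u)) z' p q h = from-coc {inr (inr (e , n))} h (cong (inr ∘ botL2) q) (low-end z')
      edge2 e n (inl (inr zero)) z' p q h = ⊥-elim (n p)
      edge2 e n (inr v) (inl l) p q h = to-con {inr (inr (e , n))} h (cong (inr ∘ botL2) q) (mid2 v)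
      edge2 e n (inr v) (inr w) p q h = subst (λ x → Ord (π x) (ρ (inl (inr v))) (ρ (inl (inr w)))) (nm2-keep e n) (shift _ (o2 sB) (rank-edge R2 p q))

      ends : ∀ {x a b} → up x ≡ inr a → dn x ≡ inr b → Ord (π x) (ρ a) (ρ b)
      ends {inl (inl u)} () q
      ends {inl (inr l)} p ()
      ends {inr (inl e)} refl refl = edge1 e _ _ refl refl
      ends {inr (inr (e , n))} refl refl = edge2 e n _ _ refl refl refl

    combined-rank : Rank combined π
    combined-rank = edge-rank ρ top ρ≤top (λ {e} → ends {e})

  comb-rank : ∀ π → ValidPol C π → (∀ π₁ → ValidPol D1 π₁ → Rank D1 π₁) → (∀ π2 → ValidPol D2 π2 → Rank D2 π2) → Rank C π
  comb-rank π val r1 r2 = record { ρ = R.ρ ∘ to (IsComb.vbij K) ; bound = R.bound ; ρ≤ = λ v → R.ρ≤ (to (IsComb.vbij K) v)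
    ; ρ-arc = λ {e} a → R.ρ-arc (mor-arc (IsoMor.iso-mor comb-flow-iso) (π ∘ Mor.fE back) {e = e}
        (subst (λ x → src C (e , or x) ≡ inr _ × tgt C (e , or x) ≡ inr _) (cong π (sym (inv-r (IsComb.ebij K) e))) a)) }
    where
    val' = MorProps.polar-pull back val
    module R = Rank (combined-rank (π ∘ Mor.fE back) val' (r1 _ (MorProps.polar-pull mor1 val')) (r2 _ (MorProps.polar-pull mor2 val')))

bc-rank : ∀ {U L} {B C : Flow U L} → WF B → AllFragile B → BC-tree B C → ∀ π → ValidPol C π → Rank C π
bc-rank W f (leaf n) π val = record { ρ = R.ρ ; bound = R.bound ; ρ≤ = R.ρ≤ ; ρ-arc = R.ρ-arc }
  where module R = Graph.Ranked (Graph.cycle-free⇒ranked W val (λ l c → n (l , c , f l c)))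
bc-rank W f (node A WA g _ r r' K) π val = CombRank.comb-rank
  (snd (tree-bounds H.weak-wf r) (inr zero)) (fst (tree-bounds H.coweak-wf r') (inr zero)) K π val
  (bc-rank H.weak-wf (fragile-pull H.weak-mor H.weak-wf W f) r) (bc-rank H.coweak-wf (fragile-pull H.coweak-mor H.coweak-wf W f) r')
  where module H = Halved W WA g

data Down {U L : Set} (A : Flow U L) : Flow.E A → Flow.E A → Set where
  here : ∀ {e} → Down A e e
  next : ∀ {e v e' f} → Flow.dn A e ≡ inr v → Flow.up A e' ≡ inr v → Down A e' f → Down A e f

-- edges starting at an interaction (if p) or at an upper end in S
Src : ∀ {U L} (A : Flow U L) → Bool → (U → Set) → Flow.E A → Set
Src A p S e = (p ≡ true × Σ (Flow.V A) λ v → Flow.up A e ≡ inr v × Flow.lab A v ≡ ai↓) ⊎ Σ _ λ u → Flow.up A e ≡ inl u × S u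

Snk : ∀ {U L} (A : Flow U L) → Bool → (L → Set) → Flow.E A → Set
Snk A q T e = (q ≡ true × Σ (Flow.V A) λ v → Flow.dn A e ≡ inr v × Flow.lab A v ≡ ai↑) ⊎ Σ _ λ l → Flow.dn A e ≡ inl l × T l

Separated : ∀ {U L} (A : Flow U L) → Bool → Bool → (U → Set) → (L → Set) → Set
Separated A p q S T = ∀ {e f} → Src A p S e → Down A e f → Snk A q T f → ⊥

None : {X : Set} → X → Set
None _ = ⊥

module _ {U L : Set} (A : Flow U L) where

  src-map : ∀ {p S S'} → (∀ u → S u → S' u) → ∀ {e} → Src A p S e → Src A p S' e
  src-map f (inl x) = inl x
  src-map f (inr (u , p , q)) = inr (u , p , f u q)
  snk-map : ∀ {q T T'} → (∀ u → T u → T' u) → ∀ {e} → Snk A q T e → Snk A q T' e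
  snk-map f (inl x) = inl x
  snk-map f (inr (u , p , q)) = inr (u , p , f u q)

down-push : ∀ {U1 L1 U2 L2} {A : Flow U1 L1} {B : Flow U2 L2} (M : Mor A B) → ∀ {e f} → Down A e f → Down B (Mor.fE M e) (Mor.fE M f)
down-push M here = here
down-push M (next p q r) = next (Mor.fdn M p) (Mor.fup M q) (down-push M r)

module CombPaths {U L : Set} {C : Flow U L} {D1 : Flow U (L ⊎ Fin 1)} {D2 : Flow (U ⊎ Fin 1) L}
  (M1 : Sole (Flow.dn D1) (inr zero)) (M2 : Sole (Flow.up D2) (inr zero)) (K : IsComb C D1 D2)
  {p q : Bool} {S : U → Set} {T : L → Set} where
  open CombIso M1 M2 K
  private
    module D1 = Flow D1
    module D2 = Flow D2

    meet : ∀ {X Y Z : Set} {x : X ⊎ Z} {y : Y ⊎ Z} {v w} → x ≡ inr v → y ≡ inr v → y ≡ inr w → x ≡ inr w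
    meet b a c = trans b (cong inr (inr-inj (trans (sym a) c)))

    below1 : ∀ y {v} → up y ≡ inr (inl (inl v)) → Σ D1.E λ e → y ≡ nm1 e × D1.up e ≡ inr v
    below1 (inl (inl u)) ()
    below1 (inl (inr l)) ()
    below1 (inr (inl e)) r = e , refl , topU-inv _ (inr-inj r)
    below1 (inr (inr (e , n))) r = ⊥-elim (topU2-inv1 _ refl n (inr-inj r))

    below2 : ∀ y {v} → up y ≡ inr (inl (inr v)) → Σ D2.E λ e → y ≡ nm2 e × D2.up e ≡ inr v
    below2 (inl (inl u)) ()
    below2 (inl (inr l)) ()
    below2 (inr (inl e)) r = ⊥-elim (topU-inv2 (D1.up e) (inr-inj r))
    below2 (inr (inr (e , n))) r = e , sym (nm2-keep e n) , topU2-inv _ refl n (inr-inj r)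

    below-coc : ∀ y {u} → up y ≡ inr (inr (inl u)) → (Σ D1.E λ e → y ≡ nm1 e × D1.up e ≡ inl u) ⊎ (Σ D2.E λ e → y ≡ nm2 e × D2.up e ≡ inl (inl u))
    below-coc (inl (inl u)) ()
    below-coc (inl (inr l)) ()
    below-coc (inr (inl e)) r = inl (e , refl , topU-top _ (inr-inj r))
    below-coc (inr (inr (e , n))) r = inr (e , sym (nm2-keep e n) , topU2-top _ refl n (inr-inj r))

    below-con : ∀ y {l x} → up y ≡ inr (inr (inr l)) → Down combined y x → Snk combined q T x → T l
    below-con (inl (inl u)) () _ _
    below-con (inl (inr l)) refl here (inl (_ , _ , () , _))
    below-con (inl (inr l)) refl here (inr (_ , refl , t)) = t
    below-con (inl (inr l)) refl (next () _ _) _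
    below-con (inr (inl e)) r _ _ = ⊥-elim (topU-bot (D1.up e) (inr-inj r))
    below-con (inr (inr (e , n))) r _ _ = ⊥-elim (topU2-bot _ refl n (inr-inj r))

    run2 : ∀ {y x} e → y ≡ nm2 e → Down combined y x → Snk combined q T x → Σ D2.E λ f → Down D2 e f × Snk D2 q T f
    run2 e refl d k = go (D2.dn e) refl d k
      where
      go : ∀ z {x} → D2.dn e ≡ z → Down combined (nm2 e) x → Snk combined q T x → Σ D2.E λ f → Down D2 e f × Snk D2 q T f
      go (inl l) r here (inl (_ , v , a , b)) with () ← trans (sym b) (cong (clab D1 D2) (inr-inj (trans (sym a) (trans (dn-nm2 e) (cong (inr ∘ botL2) r)))))
      go (inl l) r here (inr (_ , a , b)) with () ← trans (sym a) (dn-nm2 e)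
      go (inl l) r (next {e' = y} a b d) k = e , here , inr (l , r , below-con y (meet b a (trans (dn-nm2 e) (cong (inr ∘ botL2) r))) d k)
      go (inr v) r here (inl (t , w , a , b)) = e , here , inl (t , v , r , trans (cong (clab D1 D2) (inr-inj (trans (sym (trans (dn-nm2 e) (cong (inr ∘ botL2) r))) a))) b)
      go (inr v) r here (inr (_ , a , b)) with () ← trans (sym a) (dn-nm2 e)
      go (inr v) r (next {e' = y} a b d) k with below2 y (meet b a (trans (dn-nm2 e) (cong (inr ∘ botL2) r)))
      ... | (e' , h , h') with run2 e' h d k
      ...   | (f , d' , k') = f , next r h' d' , k'

    Cross : Set
    Cross = Σ D2.E λ f → Down D2 m2 f × Snk D2 q T f

    run1 : ∀ {y x} e → y ≡ nm1 e → Down combined y x → Snk combined q T x →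
      (Σ D1.E λ f → Down D1 e f × Snk D1 q (case⊎ T None) f) ⊎ (Down D1 e m1 × Cross)
    run1 e refl d k = go (D1.dn e) refl d k
      where
      go : ∀ z {x} → D1.dn e ≡ z → Down combined (nm1 e) x → Snk combined q T x → (Σ D1.E λ f → Down D1 e f × Snk D1 q (case⊎ T None) f) ⊎ (Down D1 e m1 × Cross)
      go (inl (inr zero)) r d k with snd (snd M1) e r
      ... | refl = inr (here , run2 m2 (sym nm2-m) d k)
      go (inl (inl l)) r here (inl (_ , v , a , b)) with () ← trans (sym b) (cong (clab D1 D2) (inr-inj (trans (sym a) (cong (inr ∘ botL) r))))
      go (inl (inl l)) r here (inr (_ , () , b))
      go (inl (inl l)) r (next {e' = y} a b d) k = inl (e , here , inr (inl l , r , below-con y (meet b a (cong (inr ∘ botL) r)) d k))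
      go (inr v) r here (inl (t , w , a , b)) = inl (e , here , inl (t , v , r , trans (cong (clab D1 D2) (inr-inj (trans (sym (cong (inr ∘ botL) r)) a))) b))
      go (inr v) r here (inr (_ , () , b))
      go (inr v) r (next {e' = y} a b d) k with below1 y (meet b a (cong (inr ∘ botL) r))
      ... | (e' , h , h') with run1 e' h d k
      ...   | inl (f , d' , k') = inl (f , next r h' d' , k')
      ...   | inr (d' , c) = inr (next r h' d' , c)

  module _ (n1 : Separated D1 p q S (case⊎ T None)) (n2 : Separated D2 p q (case⊎ S None) T)
           (cross : ∀ {e f} → Src D1 p S e → Down D1 e m1 → Down D2 m2 f → Snk D2 q T f → ⊥) where
    private
      from1 : ∀ {x} e → Src D1 p S e → Down combined (nm1 e) x → Snk combined q T x → ⊥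
      from1 e h d k with run1 e refl d k
      ... | inl (f , d' , k') = n1 h d' k'
      ... | inr (d' , f , d'' , k') = cross h d' d'' k'

      from2 : ∀ {x} e → Src D2 p (case⊎ S None) e → Down combined (nm2 e) x → Snk combined q T x → ⊥
      from2 e h d k with run2 e refl d k
      ... | (f , d' , k') = n2 h d' k'

      combined-separated : Separated combined p q S T
      combined-separated {y} (inl (t , inl (inl v) , a , b)) d k with below1 y a
      ... | (e , refl , c) = from1 e (inl (t , v , c , b)) d k
      combined-separated {y} (inl (t , inl (inr v) , a , b)) d k with below2 y a
      ... | (e , refl , c) = from2 e (inl (t , v , c , b)) d k
      combined-separated (inl (t , inr (inl u) , a , ())) d k
      combined-separated (inl (t , inr (inr u) , a , ())) d k
      combined-separated {inl (inl u)} (inr (_ , refl , t)) here (inl (_ , _ , refl , ()))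
      combined-separated {inl (inl u)} (inr (_ , refl , t)) here (inr (_ , () , _))
      combined-separated {inl (inl u)} (inr (_ , refl , t)) (next {e' = y} refl b d) k with below-coc y b
      ... | inl (e , refl , c) = from1 e (inr (u , c , t)) d k
      ... | inr (e , refl , c) = from2 e (inr (inl u , c , t)) d k
      combined-separated {inl (inr l)} (inr (_ , () , t))
      combined-separated {inr (inl l)} (inr (_ , () , t))
      combined-separated {inr (inr l)} (inr (_ , () , t))

    comb-separated : Separated C p q S T
    comb-separated {e} {f} h d k = combined-separated (srcC h) (down-push (IsoMor.iso-mor comb-flow-iso) d) (snk k)
      where
      I = comb-flow-iso
      srcC : Src C p S e → Src combined p S (to (IsComb.ebij K) e)
      srcC (inl (t , v , a , b)) = inl (t , _ , trans (FlowIso.up-iso I e) (cong (map₂ _) a) , trans (sym (FlowIso.lab-iso I v)) b)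
      srcC (inr (u , a , b)) = inr (u , trans (FlowIso.up-iso I e) (cong (map₂ _) a) , b)
      snk : Snk C q T f → Snk combined q T (to (IsComb.ebij K) f)
      snk (inl (t , v , a , b)) = inl (t , _ , trans (FlowIso.dn-iso I f) (cong (map₂ _) a) , trans (sym (FlowIso.lab-iso I v)) b)
      snk (inr (u , a , b)) = inr (u , trans (FlowIso.dn-iso I f) (cong (map₂ _) a) , b)

All1 : {X : Set} → X → Set
All1 _ = ⊤

module _ {Leaf : ∀ {U L} → Flow U L → Set} {Cuttable : ∀ {U L} (B : Flow U L) → Flow.E B → Set} where

  module Push {U L : Set} {B : Flow U L} {A : Flow (U ⊎ Fin 1) (L ⊎ Fin 1)} (W : WF B) (WA : WF A) (g : IsGlue B A Rai) where
    open Halved W WA g public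

    weak-src : ∀ {p S e} → Src (Weak A) p S e → Src B p S (nm e)
    weak-src (inl (t , v , a , b)) = inl (t , _ , Mor.fup weak-mor a , Pull.lab-pull weak-mor v b (inl (inl refl)))
    weak-src (inr (u , a , b)) = inr (u , nm-up-bnd (weak-up-bnd⁻ A a) , b)

    weak-snk : ∀ {q T T1 e} → (T1 zero → q ≡ true) → Snk (Weak A) q (case⊎ T T1) e → Snk B q T (nm e)
    weak-snk h (inl (t , v , a , b)) = inl (t , _ , Mor.fdn weak-mor a , Pull.lab-pull weak-mor v b (inl (inr refl)))
    weak-snk h (inr (inl l , a , b)) = inr (l , nm-dn-bnd (weak-dn-bnd⁻ A a) , b)
    weak-snk h (inr (inr zero , a , b)) = inl (h b , μ , nm-μ (weak-dn-bnd⁻ A a) , lab-of (inr (suc zero)))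

    coweak-src : ∀ {p S S1 e} → (S1 zero → p ≡ true) → Src (CoWeak A) p (case⊎ S S1) e → Src B p S (nm e)
    coweak-src h (inl (t , v , a , b)) = inl (t , _ , Mor.fup coweak-mor a , Pull.lab-pull coweak-mor v b (inl (inl refl)))
    coweak-src h (inr (inl u , a , b)) = inr (u , nm-up-bnd (coweak-up-bnd⁻ A a) , b)
    coweak-src h (inr (inr zero , a , b)) = inl (h b , ν , nm-ν (coweak-up-bnd⁻ A a) , lab-of (inr zero))

    coweak-snk : ∀ {q T e} → Snk (CoWeak A) q T e → Snk B q T (nm e)
    coweak-snk (inl (t , v , a , b)) = inl (t , _ , Mor.fdn coweak-mor a , Pull.lab-pull coweak-mor v b (inl (inr refl)))
    coweak-snk (inr (u , a , b)) = inr (u , nm-dn-bnd (coweak-dn-bnd⁻ A a) , b)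

  private
    widen : ∀ {X : Set} {S : X → Set} {S1 : Fin 1 → Set} (u : X ⊎ Fin 1) → case⊎ S None u → case⊎ S S1 u
    widen (inl u) h = h
    widen (inr _) ()

  tree-separated↓ : ∀ {U L S T} {B C : Flow U L} → WF B → Tree Leaf Cuttable B C → Separated B true false S T → Separated C true false S T
  tree-separated↓ W (leaf _) n = n
  tree-separated↓ {S = S} {T} W (node A {D1} {D2} WA g _ r r' K) n = CombPaths.comb-separated
    (snd (tree-bounds weak-wf r) (inr zero)) M2 K n1 (λ h → n2 (src-map D2 widen h)) λ _ _ d k → n2 (inr (inr zero , fst (snd M2) , tt)) d k
    where
    open Push W WA g
    M2 = fst (tree-bounds coweak-wf r') (inr zero)
    n1 = tree-separated↓ weak-wf r (λ h d k → n (weak-src h) (down-push weak-mor d) (weak-snk {T1 = None} (λ ()) k))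
    n2 = tree-separated↓ coweak-wf r' (λ h d k → n (coweak-src {S1 = All1} (λ _ → refl) h) (down-push coweak-mor d) (coweak-snk k))

  tree-separated↑ : ∀ {U L S T} {B C : Flow U L} → WF B → Tree Leaf Cuttable B C → Separated B false true S T → Separated C false true S T
  tree-separated↑ W (leaf _) n = n
  tree-separated↑ {S = S} {T} W (node A {D1} {D2} WA g _ r r' K) n = CombPaths.comb-separated
    M1 (fst (tree-bounds coweak-wf r') (inr zero)) K (λ h d k → n1 h d (snk-map D1 widen k)) n2 λ h d _ _ → n1 h d (inr (inr zero , fst (snd M1) , tt))
    where
    open Push W WA g
    M1 = snd (tree-bounds weak-wf r) (inr zero)
    n1 = tree-separated↑ weak-wf r (λ h d k → n (weak-src h) (down-push weak-mor d) (weak-snk {T1 = All1} (λ _ → refl) k))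
    n2 = tree-separated↑ coweak-wf r' (λ h d k → n (coweak-src {S1 = None} (λ ()) h) (down-push coweak-mor d) (coweak-snk k))

private
  other : ∀ {X : Set} {n} → n ≡ 2 → Fin n ↔ X → (x : X) → Σ X λ y → y ≢ x
  other refl b x with from b x in eq
  ... | zero = to b (suc zero) , λ { refl → absurd (trans (sym eq) (inv-r b (suc zero))) }
    where
    absurd : zero ≡ suc {n = 1} zero → ⊥
    absurd ()
  ... | suc zero = to b zero , λ { refl → absurd (trans (sym eq) (inv-r b zero)) }
    where
    absurd : suc {n = 1} zero ≡ zero → ⊥
    absurd ()

  equal-others : ∀ {X : Set} {n} → n ≡ 2 → Fin n ↔ X → (x y z : X) → y ≢ x → z ≢ x → y ≡ z
  equal-others refl b x y z n n' = from-inj b (go _ _ _ (n ∘ from-inj b) (n' ∘ from-inj b))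
    where
    go : (i j k : Fin 2) → j ≢ i → k ≢ i → j ≡ k
    go zero zero _ n _ = ⊥-elim (n refl)
    go zero (suc zero) zero _ n' = ⊥-elim (n' refl)
    go zero (suc zero) (suc zero) _ _ = refl
    go (suc zero) (suc zero) _ n _ = ⊥-elim (n refl)
    go (suc zero) zero zero _ _ = refl
    go (suc zero) zero (suc zero) _ n' = ⊥-elim (n' refl)

module _ {U L : Set} {A : Flow U L} (W : WF A) where
  private
    module A = Flow A

  OnlyOther↓ OnlyOther↑ : A.V → A.E → A.E → Set
  OnlyOther↓ v e y = A.dn y ≡ inr v × y ≢ e × (∀ z → A.dn z ≡ inr v → z ≢ e → z ≡ y)
  OnlyOther↑ v e y = A.up y ≡ inr v × y ≢ e × (∀ z → A.up z ≡ inr v → z ≢ e → z ≡ y)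

  other↓ : ∀ {v e} → A.lab v ≡ ai↑ → A.dn e ≡ inr v → Σ A.E (OnlyOther↓ v e)
  other↓ {v} {e} l p with other (cong ins l) (inDeg W v) (e , p)
  ... | ((y , q) , n) = y , q , (λ { refl → n (Σ≡ uip refl) }) ,
    λ z r n' → cong fst (equal-others (cong ins l) (inDeg W v) (e , p) (z , r) (y , q) (n' ∘ cong fst) n)

  other↑ : ∀ {v e} → A.lab v ≡ ai↓ → A.up e ≡ inr v → Σ A.E (OnlyOther↑ v e)
  other↑ {v} {e} l p with other (cong outs l) (outDeg W v) (e , p)
  ... | ((y , q) , n) = y , q , (λ { refl → n (Σ≡ uip refl) }) ,
    λ z r n' → cong fst (equal-others (cong outs l) (outDeg W v) (e , p) (z , r) (y , q) (n' ∘ cong fst) n)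

module CFlow {U L : Set} {A : Flow U L} (W : WF A) (cn : CNormal A) where
  open Ends A
  open Graph W (snd (polar W)) using (both-sides)
  private
    module A = Flow A

  StartsLow EndsHigh : A.E → Set
  StartsLow e = Σ A.V λ v → A.up e ≡ inr v × (A.lab v ≡ ai↓ ⊎ A.lab v ≡ ac↓)
  EndsHigh e = Σ A.V λ v → A.dn e ≡ inr v × (A.lab v ≡ ai↑ ⊎ A.lab v ≡ ac↑)

  -- Below an interaction or a contraction only contractions follow.
  low-next : ∀ {e v e'} → StartsLow e → A.dn e ≡ inr v → A.up e' ≡ inr v → A.lab v ≡ ac↓
  low-next {e} (w , p , l) q r with both-sides q r
  ... | inl k = k
  low-next {e} (w , p , inl l) q r | inr k = ⊥-elim (fst (snd (cn e)) (w , _ , p , q , l , k))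
  low-next {e} (w , p , inr l) q r | inr k = ⊥-elim (snd (snd (cn e)) (w , _ , p , q , l , k))

  high-next : ∀ {e v e'} → EndsHigh e → A.up e ≡ inr v → A.dn e' ≡ inr v → A.lab v ≡ ac↑
  high-next {e} (w , p , l) q r with both-sides r q
  ... | inr k = k
  high-next {e} (w , p , inl l) q r | inl k = ⊥-elim (fst (cn e) (_ , w , q , p , k , l))
  high-next {e} (w , p , inr l) q r | inl k = ⊥-elim (snd (snd (cn e)) (_ , w , q , p , k , l))

  down-simple : ∀ {e f w} → StartsLow e → Down A e f → A.dn f ≡ inr w → A.lab w ≡ ai↑ → e ≡ f
  down-simple h here q k = refl
  down-simple h (next {e' = e'} a b d) q k with low-next h a b
  ... | l with down-simple (_ , b , inr l) d q k
  ...   | refl = ⊥-elim (fst (cn e') (_ , _ , b , q , l , k))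

  private
    conn↓ : ∀ e l {w} → StartsLow e → Chain A ((e , ⇓) ∷ l) → All (λ x → snd x ≡ ⇓) l → EndsAt A ((e , ⇓) ∷ l) (inr w) → A.lab w ≡ ai↑ → l ≡ []
    conn↓ e [] h c a q k = refl
    conn↓ e ((e' , .⇓) ∷ l) h ((v , p , r , _) , c) (refl ∷ a) q k with low-next h (dn-tgt⁻ p) (up-src⁻ r)
    ... | lv with conn↓ e' l (_ , up-src⁻ r , inr lv) c a q k
    ...   | refl = ⊥-elim (fst (cn e') (_ , _ , up-src⁻ r , dn-tgt⁻ q , lv , k))

    conn↑ : ∀ e l {w} → EndsHigh e → Chain A ((e , ⇑) ∷ l) → All (λ x → snd x ≡ ⇑) l → EndsAt A ((e , ⇑) ∷ l) (inr w) → A.lab w ≡ ai↓ → l ≡ []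
    conn↑ e [] h c a q k = refl
    conn↑ e ((e' , .⇑) ∷ l) h ((v , p , r , _) , c) (refl ∷ a) q k with high-next h (up-src⁻ p) (dn-tgt⁻ r)
    ... | lv with conn↑ e' l (_ , dn-tgt⁻ r , inr lv) c a q k
    ...   | refl = ⊥-elim (fst (snd (cn e')) (_ , _ , up-src⁻ q , dn-tgt⁻ r , k , lv))

  connection-simple : ∀ l → AIConn A l → length l ≡ 1
  connection-simple ((e , ⇓) ∷ l) (((_ , c) , .⇓ , refl ∷ a) , inl ((v , p , k) , w , q , k')) = cong (suc ∘ length) (conn↓ e l (v , up-src⁻ p , inl k) c a q k')
  connection-simple ((e , ⇓) ∷ l) (_ , inr ((v , p , k) , _)) with () ← out-degree W k (up-src⁻ p)
  connection-simple ((e , ⇑) ∷ l) (_ , inl ((v , p , k) , _)) with () ← in-degree W k (dn-tgt⁻ p)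
  connection-simple ((e , ⇑) ∷ l) (((_ , c) , .⇑ , refl ∷ a) , inr ((v , p , k) , w , q , k')) = cong (suc ∘ length) (conn↑ e l (v , dn-tgt⁻ p , inl k) c a q k')

any-list? : {X : Set} → Finite X → ∀ n {P : List X → Set} → (∀ l → Dec (P l)) → Dec (Σ (List X) λ l → length l ≡ n × P l)
any-list? f zero P? = map′ (λ p → [] , refl , p) (λ { ([] , _ , p) → p }) (P? [])
any-list? f (suc n) P? = map′ (λ { (x , l , q , p) → x ∷ l , cong suc q , p }) (λ { (x ∷ l , q , p) → x , l , ℕP.suc-injective q , p })
  (finite-any? f λ x → any-list? f n (λ l → P? (x ∷ l)))

longest : {X : Set} → Finite X → {P : List X → Set} → (∀ l → Dec (P l)) → ∀ n → (∀ l → P l → length l ≤ n) → Σ (List X) P →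
  Σ (List X) λ l → P l × (∀ l' → P l' → length l' ≤ length l)
longest f P? n le (l0 , p0) with any-list? f n P?
... | yes (l , refl , p) = l , p , le
longest f P? zero le (l0 , p0) | no no-l = ⊥-elim (no-l (l0 , ℕP.n≤0⇒n≡0 (le l0 p0) , p0))
longest f P? (suc n) le (l0 , p0) | no no-l = longest f P? n (λ l p → ℕP.≤-pred (ℕP.≤∧≢⇒< (le l p) λ q → no-l (l , q , p))) (l0 , p0)

last-such : {X : Set} {P : X → Set} → (∀ x → Dec (P x)) → ∀ {l} → Any P l → Σ (List X) λ as → Σ X λ x → Σ (List X) λ bs → l ≡ as ++ (x ∷ bs) × P x × All (¬_ ∘ P) bs
last-such P? {x ∷ l} i with Any.any? P? l
... | yes j = let (as , y , bs , p , q , r) = last-such P? j in x ∷ as , y , bs , cong (x ∷_) p , q , r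
last-such P? {x ∷ l} (here p) | no n = [] , x , l , refl , p , go l n
  where
  go : ∀ l → ¬ Any _ l → All _ l
  go [] n = []
  go (x ∷ l) n = n ∘ here ∷ go l (n ∘ there)
last-such P? {x ∷ l} (there i) | no n = ⊥-elim (n i)

module Extremality {U L : Set} {A : Flow U L} (W : WF A) (C : Cert (λ _ → true) A) (cn : CNormal A) where
  open Cert C using (π; valid; ρ; bound; ρ≤; ρ-arc)
  open Graph W valid
  open CFlow W cn
  private
    module A = Flow A

    inner-length : ∀ x y l → (k : Link A x y) → Chain A (y ∷ l) → (All Good (y ∷ l) → length l + ρ (fst k) ≤ bound) × (All Bad (y ∷ l) → length l ≤ ρ (fst k))
    inner-length x y [] k c = (λ _ → ρ≤ _) , λ _ → z≤n
    inner-length x y (z ∷ l) k@(w , _ , p , _) (k'@(w' , q , _) , c) with inner-length y z l k' c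
    ... | (f , h) = (λ { (g ∷ gs) → ℕP.≤-trans (ℕP.≤-reflexive (sym (ℕP.+-suc (length l) (ρ w)))) (ℕP.≤-trans (ℕP.+-monoʳ-≤ (length l) (ρ-arc refl (good-arc y g p q))) (f gs)) }) ,
      λ { (b ∷ bs) → ℕP.≤-<-trans (h bs) (ρ-arc refl (bad-arc y b p q)) }

  path-length : ∀ l → IsAIPath A l → length l ≤ suc (suc bound)
  path-length (x ∷ []) c = s≤s z≤n
  path-length (x ∷ y ∷ l) (_ , k , c) with all-good-or-bad y l c
  ... | inl g = s≤s (s≤s (ℕP.≤-trans (ℕP.m≤m+n _ _) (fst (inner-length x y l k c) g)))
  ... | inr b = s≤s (s≤s (ℕP.≤-trans (snd (inner-length x y l k c) b) (ρ≤ _)))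

  private
    finite-OE : Finite (OE A)
    finite-OE = finite-map (finite-⊎ (finE W) (finE W)) (mk↔ₛ′ (λ { (inl e) → e , ⇓ ; (inr e) → e , ⇑ }) (λ { (e , ⇓) → inl e ; (e , ⇑) → inr e })
      (λ { (e , ⇓) → refl ; (e , ⇑) → refl }) (λ { (inl e) → refl ; (inr e) → refl }))
    _≟V_ = finite-≟ (finV W)
    _≟E_ = finite-≟ (finE W)

    link? : ∀ x y → Dec (Link A x y)
    link? x y = finite-any? (finV W) λ w → inj2? _≟V_ (tgt A x) w ×-dec inj2? _≟V_ (src A y) w ×-dec
      ((snd x ≟ᵈ snd y) ⊎-dec (¬? (snd x ≟ᵈ snd y) ×-dec ((A.lab w ≟ˡ ai↓) ⊎-dec (A.lab w ≟ˡ ai↑)) ×-dec ¬? (fst x ≟E fst y)))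

    path? : ∀ l → Dec (IsAIPath A l)
    path? [] = no λ { (() , _) }
    path? (x ∷ []) = yes (tt , tt)
    path? (x ∷ y ∷ l) = map′ (λ { (k , _ , c) → tt , k , c }) (λ { (_ , k , c) → k , tt , c }) (link? x y ×-dec path? (y ∷ l))

  simple? : ∀ e → Dec (SimpleEdge A e)
  simple? e = map′ simple (simple⁻ W) (joins? A ai↓ ai↑ e)

  extremal-exists : ∀ {e} → SimpleEdge A e → Σ A.E (Extremal A)
  extremal-exists {e} se with longest finite-OE (λ l → path? l ×-dec Any.any? (e ≟E_) (edges A l)) _ (λ l p → path-length l (fst p)) ((e , ⇓) ∷ [] , (tt , tt) , here refl)
  ... | (l , (p , i) , mx) with last-such simple? (Any.map (λ { refl → se }) i)
  ...   | (as , e' , bs , q , se' , ns) = e' , se' , l , (p , λ l' p' sub → mx l' (p' , sub i)) , (p , λ l' _ → connection-simple l') , as , bs , q , ns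

private
  locate : ∀ {X Y : Set} (l : List (X × Y)) as {e bs} → map fst l ≡ as ++ (e ∷ bs) → Σ (List (X × Y)) λ ls → Σ Y λ d → Σ (List (X × Y)) λ rs → l ≡ ls ++ ((e , d) ∷ rs) × map fst rs ≡ bs
  locate ((e , d) ∷ l) [] refl = [] , d , l , refl , refl
  locate (x ∷ l) (a ∷ as) q with locate l as (ListP.∷-injectiveʳ q)
  ... | (ls , d , rs , refl , r) = x ∷ ls , d , rs , refl , r

module _ {U L : Set} {A : Flow U L} (W : WF A) where
  open Ends A
  private
    module A = Flow A

    chain-suffix : ∀ ls {x y rs} → Chain A (ls ++ (x ∷ y ∷ rs)) → Link A x y
    chain-suffix [] (k , _) = k
    chain-suffix (z ∷ []) (_ , c) = chain-suffix [] c
    chain-suffix (z ∷ z' ∷ ls) (_ , c) = chain-suffix (z' ∷ ls) c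

    extend : ∀ ls {x} y → IsAIPath A (ls ++ (x ∷ [])) → Link A x y → IsAIPath A (ls ++ (x ∷ y ∷ []))
    extend [] y _ k = tt , k , tt
    extend (z ∷ []) y (_ , c , _) k = tt , c , k , tt
    extend (z ∷ z' ∷ ls) y (_ , c , p) k = tt , c , snd (extend (z' ∷ ls) y (tt , p) k)

    not-maximal : ∀ ls {x} y → Link A x y → ¬ Maximal A (ls ++ (x ∷ []))
    not-maximal ls {x} y k (p , mx) = ℕP.<⇒≱ longer (mx _ (extend ls y p k) (sub ls))
      where
      longer : length (ls ++ (x ∷ [])) < length (ls ++ (x ∷ y ∷ []))
      longer rewrite ListP.length-++ ls {x ∷ []} | ListP.length-++ ls {x ∷ y ∷ []} = ℕP.+-monoʳ-< (length ls) ℕP.≤-refl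
      sub : ∀ ls {e} → e ∈ edges A (ls ++ (x ∷ [])) → e ∈ edges A (ls ++ (x ∷ y ∷ []))
      sub [] (here p) = here p
      sub (z ∷ ls) (here p) = here p
      sub (z ∷ ls) (there i) = there (sub ls i)

  extremal-next : ∀ {e v w} → A.up e ≡ inr v → A.dn e ≡ inr w → A.lab v ≡ ai↓ → A.lab w ≡ ai↑ → Extremal A e →
    (∀ y → A.dn y ≡ inr w → y ≢ e → ¬ SimpleEdge A y) ⊎ (∀ y → A.up y ≡ inr v → y ≢ e → ¬ SimpleEdge A y)
  extremal-next {e} {v} {w} p q l l' (_ , path , mx , _ , as , bs , eq , ns) with locate path as eq
  ... | (ls , ⇓ , [] , refl , refl) = let (y , a , n , _) = other↓ W l' q in
    ⊥-elim (not-maximal ls (y , ⇑) (w , dn-tgt q , dn-tgt a , inr ((λ ()) , inr l' , λ z → n (sym z))) mx)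
  ... | (ls , ⇑ , [] , refl , refl) = let (y , a , n , _) = other↑ W l p in
    ⊥-elim (not-maximal ls (y , ⇓) (v , up-src p , up-src a , inr ((λ ()) , inl l , λ z → n (sym z))) mx)
  ... | (ls , ⇓ , (y , ⇓) ∷ rs , refl , refl) with chain-suffix ls (snd (fst mx))
  ...   | (w' , a , b , _) with () ← out-degree W (trans (cong A.lab (inr-inj (trans (sym (dn-tgt⁻ a)) q))) l') (up-src⁻ b)
  extremal-next {e} {v} {w} p q l l' (_ , path , mx , _ , as , bs , eq , n ∷ ns) | (ls , ⇓ , (y , ⇑) ∷ rs , refl , refl) with chain-suffix ls (snd (fst mx))
  ...   | (w' , a , b , inl ())
  ...   | (w' , a , b , inr (_ , _ , ne)) with inr-inj (trans (sym (dn-tgt⁻ a)) q)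
  ...     | refl = let (y' , _ , _ , un) = other↓ W l' q in inl λ z r n' s' → n (subst (SimpleEdge A) (trans (un z r n') (sym (un y (dn-tgt⁻ b) (λ r → ne (sym r))))) s')
  extremal-next {e} {v} {w} p q l l' (_ , path , mx , _ , as , bs , eq , ns) | (ls , ⇑ , (y , ⇑) ∷ rs , refl , refl) with chain-suffix ls (snd (fst mx))
  ...   | (w' , a , b , _) with () ← in-degree W (trans (cong A.lab (inr-inj (trans (sym (up-src⁻ a)) p))) l) (dn-tgt⁻ b)
  extremal-next {e} {v} {w} p q l l' (_ , path , mx , _ , as , bs , eq , n ∷ ns) | (ls , ⇑ , (y , ⇓) ∷ rs , refl , refl) with chain-suffix ls (snd (fst mx))
  ...   | (w' , a , b , inl ())
  ...   | (w' , a , b , inr (_ , _ , ne)) with inr-inj (trans (sym (up-src⁻ a)) p)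
  ...     | refl = let (y' , _ , _ , un) = other↑ W l p in inr λ z r n' s' → n (subst (SimpleEdge A) (trans (un z r n') (sym (un y (up-src⁻ b) (λ r → ne (sym r))))) s')

ex-separated : ∀ {U L} {B C : Flow U L} → WF B → Cert (λ _ → true) B → CNormal B → EX-tree B C → Separated C true true None None
ex-separated {B = B} W C cn (leaf n) (inl (_ , v , p , l)) d (inl (_ , w , q , l')) with CFlow.down-simple W cn (v , p , inl l) d q l'
... | refl = n (Extremality.extremal-exists W C cn (simple (v , w , p , q , l , l')))
ex-separated {B = B} W C cn (node A {D1} {D2} WA g ext r r' K) = CombPaths.comb-separated M1 M2 K (λ h d k → n1 h d (snk-map D1 (λ { (inl _) () ; (inr _) () }) k)) (λ h → n2 (src-map D2 (λ { (inl _) () ; (inr _) () }) h)) cross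
  where
  open Push {Leaf = λ B → ¬ Σ (Flow.E B) (Extremal B)} {Cuttable = Extremal} W WA g
  M1 = snd (tree-bounds weak-wf r) (inr zero)
  M2 = fst (tree-bounds coweak-wf r') (inr zero)
  n1 = ex-separated weak-wf (cert-mor weak-mor C) (Pull.cnormal-pull weak-mor cn) r
  n2 = ex-separated coweak-wf (cert-mor coweak-mor C) (Pull.cnormal-pull coweak-mor cn) r'
  cross : ∀ {e f} → Src D1 true None e → Down D1 e (fst M1) → Down D2 (fst M2) f → Snk D2 true None f → ⊥
  cross with extremal-next W ε1-up ε1-dn (lab-of (inr zero)) (lab-of (inr (suc zero))) ext
  ... | inl ns = λ h d _ _ → tree-separated↓ weak-wf r clear h d (inr (inr zero , fst (snd M1) , tt))
    where
    clear : Separated (Weak A) true false None (case⊎ None All1)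
    clear (inl h) d (inl (() , _))
    clear (inr (_ , _ , ())) d k
    clear (inl h) d (inr (inl _ , _ , ()))
    clear {e} {f} (inl (t , v , a , b)) d (inr (inr zero , c , _)) with CFlow.down-simple W cn {nm e} {nm f} (_ , Mor.fup weak-mor a , inl (Pull.lab-pull weak-mor v b (inl (inl refl)))) (down-push weak-mor d) (nm-μ (weak-dn-bnd⁻ A c)) (lab-of (inr (suc zero)))
    ... | eq = ns (nm f) (nm-μ (weak-dn-bnd⁻ A c)) (nm≢ {_}) (simple (_ , μ , subst (λ x → Flow.up B x ≡ inr (Mor.fV weak-mor v)) eq (Mor.fup weak-mor a) , nm-μ (weak-dn-bnd⁻ A c) , Pull.lab-pull weak-mor v b (inl (inl refl)) , lab-of (inr (suc zero))))
  ... | inr ns = λ _ _ d k → tree-separated↑ coweak-wf r' clear (inr (inr zero , fst (snd M2) , tt)) d k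
    where
    clear : Separated (CoWeak A) false true (case⊎ None All1) None
    clear (inl (() , _)) d k
    clear h d (inr (_ , _ , ()))
    clear (inr (inl _ , _ , ())) d k
    clear {e} {f} (inr (inr zero , c , _)) d (inl (t , v , a , b)) with CFlow.down-simple W cn {nm e} {nm f} (ν , nm-ν (coweak-up-bnd⁻ A c) , inl (lab-of (inr zero))) (down-push coweak-mor d) (Mor.fdn coweak-mor a) (Pull.lab-pull coweak-mor v b (inl (inr refl)))
    ... | eq = ns (nm e) (nm-ν (coweak-up-bnd⁻ A c)) (nm≢ {_}) (simple (ν , _ , nm-ν (coweak-up-bnd⁻ A c) , subst (λ x → Flow.dn B x ≡ inr (Mor.fV coweak-mor v)) (sym eq) (Mor.fdn coweak-mor a) , lab-of (inr zero) , Pull.lab-pull coweak-mor v b (inl (inr refl))))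

module FragileCycles {At : Set} {bar : At → At} (invol : ∀ a → bar (bar a) ≡ a) (bar≢ : ∀ a → bar a ≢ a) {α β : Fm At} where
  open Normalise {bar = bar} invol bar≢ {α} {β}

  private
    ascent : (d : Der) → ∀ x l {v w} → Chain (flowOf d) (x ∷ l) → All (λ y → snd y ≡ ⇑) (x ∷ l) → StartsAt (flowOf d) (x ∷ l) (inr v) → EndsAt (flowOf d) (x ∷ l) (inr w) → clock d v < clock d w
    ascent d (e , .⇑) [] c (refl ∷ _) p q = clock-edge d e (Ends.up-src⁻ (flowOf d) {e} q) (Ends.dn-tgt⁻ (flowOf d) {e} p)
    ascent d (e , .⇑) (y ∷ l) ((u , r , t , _) , c) (refl ∷ a) p q = ℕP.<-trans (clock-edge d e (Ends.up-src⁻ (flowOf d) {e} r) (Ends.dn-tgt⁻ (flowOf d) {e} p)) (ascent d y l c a t q)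

  module _ (d : Der) (π : Polarity (flowOf d)) (val : ValidPol (flowOf d) π)
    (positive : ∀ v → IsContr (flowOf d) (Flow.lab (flowOf d) v) → VertexOnAICycle (flowOf d) v → PosV (flowOf d) π v) where
    open Graph (wf d) val
    open OnCycle (wf d) val
    private
      A = flowOf d
      module A = Flow A

      end-label : ∀ {v e} → T v v → Incident A e v → π e ≡ minus → A.lab v ≡ ai↓ ⊎ A.lab v ≡ ai↑
      end-label {v} {e} t i m≡ = go _ refl
        where
        contr : IsContr A (A.lab v) → ⊥
        contr c with () ← trans (sym m≡) (positive v c (vertex-on-cycle t) e i)
        go : ∀ k → A.lab v ≡ k → k ≡ ai↓ ⊎ k ≡ ai↑
        go ai↓ l = inl refl
        go ai↑ l = inr refl
        go aw↓ l = ⊥-elim (fst (turns t l) refl)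
        go aw↑ l = ⊥-elim (snd (turns t l) refl)
        go ac↓ l = ⊥-elim (contr (inl l))
        go ac↑ l = ⊥-elim (contr (inr l))

      negative-simple : ∀ {e a b} → π e ≡ minus → Arc A π e a b → T b a → SimpleEdge A e
      negative-simple {e} {a} {b} m≡ r t with neg-arc {e} m≡ r
      ... | (p , q) with end-label {a} {e} (T-trans (arc⇒T r) t) (inr p) m≡ | end-label {b} {e} (T-trans t (arc⇒T r)) (inl q) m≡
      ... | inl l | _ with () ← Ends.in-degree A (wf d) {e = e} l p
      ... | _ | inr l with () ← Ends.out-degree A (wf d) {e = e} l q
      ... | inr l | inl l' = simple {A = A} {e} (b , a , q , p , l' , l)

      all-plus : ∀ (l : List (OE A)) → ¬ Any (λ x → π (fst x) ≡ minus) l → All (λ x → π (fst x) ≡ plus) l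
      all-plus [] n = []
      all-plus (x ∷ l) n = plus! _ refl (n ∘ here) ∷ all-plus l (n ∘ there)
        where
        plus! : ∀ x {e} → π e ≡ x → ¬ (π e ≡ minus) → π e ≡ plus
        plus! plus p n = p
        plus! minus p n = ⊥-elim (n p)

      directions : ∀ (f : Sign → Dir) (l : List (OE A)) → All (λ x → snd x ≡ f (π (fst x))) l → All (λ x → π (fst x) ≡ plus) l → All (λ x → snd x ≡ f plus) l
      directions f [] [] [] = []
      directions f (x ∷ l) (g ∷ gs) (p ∷ ps) = trans g (cong f p) ∷ directions f l gs ps

    positive⇒fragile : AllFragile A
    positive⇒fragile l c with Any.any? (λ x → π (fst x) ≟ˢ minus) l
    ... | yes i = go l (λ j → cycle-arc l c j) i
      where
      go : ∀ l → (∀ {x} → x ∈ l → Σ A.V λ a → Σ A.V λ b → Arc A π (fst x) a b × T b a) → Any (λ x → π (fst x) ≡ minus) l → Any (λ x → SimpleEdge A (fst x)) l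
      go (x ∷ l) f (here m≡) = let (a , b , r , t) = f (here refl) in here (negative-simple m≡ r t)
      go (x ∷ l) f (there i) = there (go l (f ∘ there) i)
    positive⇒fragile (x ∷ l) (path , (v , p , q) , _) | no n with all-good-or-bad x l (snd path)
    ... | inl gs = ⊥-elim (acyclic (wf d) (x ∷ l) v (path , directions or (x ∷ l) gs (all-plus _ n)) p q)
    ... | inr bs = ⊥-elim (ℕP.<-irrefl refl (ascent d x l (snd path) (directions (flip ∘ or) (x ∷ l) bs (all-plus _ n)) p q))

separated-iso : ∀ {U L} {A B : Flow U L} → FlowIso A B → ∀ {p q S T} → Separated B p q S T → Separated A p q S T
separated-iso {A = A} {B} I {p} {q} {S} {T} n {e} {f} h d k = n (source h) (down-push (IsoMor.iso-mor I) d) (sink k)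
  where
  open FlowIso I
  source : Src A p S e → Src B p S (to eb e)
  source (inl (t , v , a , b)) = inl (t , _ , trans (up-iso e) (cong (map₂ _) a) , trans (sym (lab-iso v)) b)
  source (inr (u , a , b)) = inr (u , trans (up-iso e) (cong (map₂ _) a) , b)
  sink : Snk A q T f → Snk B q T (to eb f)
  sink (inl (t , v , a , b)) = inl (t , _ , trans (dn-iso f) (cong (map₂ _) a) , trans (sym (lab-iso v)) b)
  sink (inr (u , a , b)) = inr (u , trans (dn-iso f) (cong (map₂ _) a) , b)

private
  -- an edge passing through the right-hand side replaces a contraction or a cocontraction
  pass-vertex : ∀ {ρ} → InW ρ → ∀ r {p q} → Flow.up (rhs ρ) r ≡ inl p → Flow.dn (rhs ρ) r ≡ inl q →
    Σ (Flow.V (lhs ρ)) λ y → (Σ (Flow.E (lhs ρ)) λ r1 → Flow.up (lhs ρ) r1 ≡ inl p × Flow.dn (lhs ρ) r1 ≡ inr y) ×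
      (Σ (Flow.E (lhs ρ)) λ r2 → Flow.up (lhs ρ) r2 ≡ inr y × Flow.dn (lhs ρ) r2 ≡ inl q)
  pass-vertex w-i zero refl refl = # 1 , (# 1 , refl , refl) , # 2 , refl , refl
  pass-vertex w-ii zero refl refl = # 0 , (# 0 , refl , refl) , # 2 , refl , refl
  pass-vertex w-iii zero _ ()
  pass-vertex w-iv zero () _
  pass-vertex w-vi zero () _
  pass-vertex w-vi (suc zero) () _
  pass-vertex w-vii zero _ ()
  pass-vertex w-vii (suc zero) _ ()

  one-sided : ∀ {ρ} → InW ρ → ∀ r r' {y} → Flow.dn (rhs ρ) r ≡ inr y → Flow.up (rhs ρ) r' ≡ inr y → ⊥
  one-sided w-i zero _ ()
  one-sided w-ii zero _ ()
  one-sided w-iii _ zero _ ()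
  one-sided w-iv zero _ ()
  one-sided w-vi zero _ ()
  one-sided w-vi (suc zero) _ ()
  one-sided w-vii _ zero _ ()
  one-sided w-vii _ (suc zero) _ ()

  no-ai : ∀ {ρ} → InW ρ → ∀ y → ¬ (Flow.lab (rhs ρ) y ≡ ai↓) × ¬ (Flow.lab (rhs ρ) y ≡ ai↑)
  no-ai w-iii zero = (λ ()) , λ ()
  no-ai w-iv zero = (λ ()) , λ ()
  no-ai w-vi zero = (λ ()) , λ ()
  no-ai w-vi (suc zero) = (λ ()) , λ ()
  no-ai w-vii zero = (λ ()) , λ ()
  no-ai w-vii (suc zero) = (λ ()) , λ ()

module WStep {U L : Set} {ρ : LRule} (w : InW ρ) {A A' : Flow U L} (st : LStep ρ A A') where
  open LStep st
  private
    module X = LhsRedex ρ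
    module GL = GlueUnique X.shape K-wf gl
    module G' = IsGlue gl'
    module K = Flow K
    module LL = Flow (lhs ρ)
    module RR = Flow (rhs ρ)
    module A' = Flow A'
    P = GL.Pl.plugged
    module P = Flow P

    pe : K.E → P.E
    pe k = inl (k , GL.Pl.nodrop k)

    vQ≡ : ∀ {q r y} → LL.up r ≡ inr y → LL.dn r ≡ inl q → fst (GL.Pl.Up.vQ q) ≡ y
    vQ≡ {q} {r} a b = inr-inj (trans (sym (snd (GL.Pl.Up.vQ q))) (trans (cong LL.up (sym (snd (snd (X.botR q)) r b))) a))
    vP≡ : ∀ {p r y} → LL.dn r ≡ inr y → LL.up r ≡ inl p → fst (GL.Pl.Dn.vQ p) ≡ y
    vP≡ {p} {r} a b = inr-inj (trans (sym (snd (GL.Pl.Dn.vQ p))) (trans (cong LL.dn (sym (snd (snd (X.topR p)) r b))) a))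

    join : ∀ {x y z} → Down P x y → Down P y z → Down P x z
    join here d = d
    join (next p q r) d = next p q (join r d)

    trace : ∀ {k v} → Plug.UpRes K (rhs ρ) k (inr (inl v)) → Σ K.E λ k0 → K.up k0 ≡ inr v × Down P (pe k0) (pe k)
    trace (Plug.kv p) = _ , p , here
    trace (Plug.pass {e = e} {r = r} {k = k} a b c d u) with trace u | pass-vertex w r c b
    ... | (k0 , p , path) | (y , (r1 , a1 , b1) , r2 , a2 , b2) = k0 , p , join path turn
      where
      turn : Down P (pe k) (pe e)
      turn = next {v = inr y} (trans (cong GL.Pl.Dn.res d) (cong (λ z → inr (inr z)) (vP≡ b1 a1)))
                          (trans (cong GL.Pl.Up.res a) (cong (λ z → inr (inr z)) (vQ≡ a2 b2))) here

    Upper : A'.E → K.V → Set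
    Upper a v = Σ K.E λ k → (Σ _ λ n → to G'.ebij a ≡ inl (k , n)) × Plug.UpRes K (rhs ρ) k (inr (inl v))

    upper : ∀ a {v x} → A'.up a ≡ inr v → to G'.vbij v ≡ inl x → Upper a x
    upper a {v} {x} p q = go _ refl (subst (GUp K (rhs ρ) (to G'.ebij a)) (trans (cong (map₂ (to G'.vbij)) p) (cong inr q)) (G'.up-ok a))
      where
      go : ∀ g → to G'.ebij a ≡ g → GUp K (rhs ρ) g (inr (inl x)) → Upper a x
      go (inl (k , n)) e u = k , (n , e) , u
      go (inr (r , _)) e (_ , _ , ())

    lower : ∀ a {v x k n} → A'.dn a ≡ inr v → to G'.vbij v ≡ inl x → to G'.ebij a ≡ inl (k , n) → K.dn k ≡ inr x
    lower a {v} {x} {k} {n} p q e = go (subst₂ (GDn K (rhs ρ)) e (trans (cong (map₂ (to G'.vbij)) p) (cong inr q)) (G'.dn-ok a))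
      where
      go : Plug.DnRes K (rhs ρ) k (inr (inl x)) → K.dn k ≡ inr x
      go (Plug.kv p) = p

    has-up : ∀ a {v y} → A'.up a ≡ inr v → to G'.vbij v ≡ inr y → Σ RR.E λ r → RR.up r ≡ inr y
    has-up a {v} {y} p q = go _ (subst (GUp K (rhs ρ) (to G'.ebij a)) (trans (cong (map₂ (to G'.vbij)) p) (cong inr q)) (G'.up-ok a))
      where
      res : ∀ {k} → Plug.UpRes K (rhs ρ) k (inr (inr y)) → Σ RR.E λ r → RR.up r ≡ inr y
      res (Plug.rv _ _ c) = _ , c
      res (Plug.pass _ _ _ _ u) = res u
      go : ∀ g → GUp K (rhs ρ) g (inr (inr y)) → Σ RR.E λ r → RR.up r ≡ inr y
      go (inl _) u = res u
      go (inr (r , _)) (_ , c , refl) = r , c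

    has-dn : ∀ a {v y} → A'.dn a ≡ inr v → to G'.vbij v ≡ inr y → Σ RR.E λ r → RR.dn r ≡ inr y
    has-dn a {v} {y} p q = go _ (subst (GDn K (rhs ρ) (to G'.ebij a)) (trans (cong (map₂ (to G'.vbij)) p) (cong inr q)) (G'.dn-ok a))
      where
      go : ∀ g → GDn K (rhs ρ) g (inr (inr y)) → Σ RR.E λ r → RR.dn r ≡ inr y
      go (inl _) (Plug.rv _ _ c) = _ , c
      go (inr (r , _)) (_ , c , refl) = r , c

    Reaches : K.E → Set
    Reaches k = Σ P.E λ f → Down P (pe k) f × Snk P true None f

    lift : ∀ {a f k n} → Down A' a f → Snk A' true None f → to G'.ebij a ≡ inl (k , n) → Reaches k
    lift {a} {k = k} here (inl (_ , v , p , l)) e = go _ refl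
      where
      go : ∀ g → to G'.vbij v ≡ g → Reaches k
      go (inl x) q = pe k , here , inl (refl , inl x , cong GL.Pl.Dn.res (lower a p q e) , trans (cong (glab K (rhs ρ)) (sym q)) (trans (sym (G'.lab-ok v)) l))
      go (inr y) q = ⊥-elim (snd (no-ai w y) (trans (cong (glab K (rhs ρ)) (sym q)) (trans (sym (G'.lab-ok v)) l)))
    lift {a} {f} {k} (next {v = v} {e' = b} p r d) t e = go _ refl
      where
      go : ∀ g → to G'.vbij v ≡ g → Reaches k
      go (inr y) q = ⊥-elim (one-sided w _ _ (snd (has-dn a p q)) (snd (has-up b r q)))
      go (inl x) q with upper b r q
      ... | (k' , (_ , e') , u) with trace u | lift d t e'
      ...   | (k0 , c , path) | (f' , d' , t') = f' , next (cong GL.Pl.Dn.res (lower a p q e)) (cong GL.Pl.Up.res c) (join path d') , t'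

  w-separated : Separated A true true None None → Separated A' true true None None
  w-separated n {a} (inl (_ , v , p , l)) d t = go _ refl
    where
    nP : Separated P true true None None
    nP = separated-iso (IsoMor.iso-sym GL.glue-flow-iso) n
    go : ∀ g → to G'.vbij v ≡ g → ⊥
    go (inr y) q = fst (no-ai w y) (trans (cong (glab K (rhs ρ)) (sym q)) (trans (sym (G'.lab-ok v)) l))
    go (inl x) q with upper a p q
    ... | (k , (_ , e) , u) with trace u | lift d t e
    ...   | (k0 , c , path) | (f , d' , t') = nP (inl (refl , inl x , cong GL.Pl.Up.res c , trans (cong (glab K (rhs ρ)) (sym q)) (trans (sym (G'.lab-ok v)) l))) (join path d') t'

w-star : ∀ {U L} {A A' : Flow U L} → Star _⟶w_ A A' → Separated A true true None None → Separated A' true true None None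
w-star nil n = n
w-star ((ρ , w , st) ◅ ss) n = w-star ss (WStep.w-separated w st n)

module _ {U L : Set} {A : Flow U L} (W : WF A) (np : ∀ ρ → InW ρ → ¬ Pat A (lhs-redex ρ)) where
  open Ends A
  private
    module A = Flow A

    as-down : ∀ e l {w} → Chain A ((e , ⇓) ∷ l) → All (λ x → snd x ≡ ⇓) l → EndsAt A ((e , ⇓) ∷ l) (inr w) → Σ A.E λ f → Down A e f × A.dn f ≡ inr w
    as-down e [] c a p = e , here , dn-tgt⁻ p
    as-down e ((e' , .⇓) ∷ l) ((v , p , q , _) , c) (refl ∷ a) r with as-down e' l c a r
    ... | (f , d , t) = f , next (dn-tgt⁻ p) (up-src⁻ q) d , t

    low-end : ∀ {e f w} → Down A e f → A.dn f ≡ inr w → Σ A.V λ v → A.dn e ≡ inr v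
    low-end here p = _ , p
    low-end (next p _ _) _ = _ , p
    high-end : ∀ {e f w} → Down A e f → A.up e ≡ inr w → Σ A.V λ v → A.up f ≡ inr v
    high-end here p = _ , p
    high-end (next _ q d) _ = high-end d q

    from-weakening : ∀ {e v w} → A.up e ≡ inr v → A.dn e ≡ inr w → A.lab v ≡ aw↓ → ⊥
    from-weakening {e} {v} {w} p q l = go _ refl
      where
      go : ∀ k → A.lab w ≡ k → ⊥
      go ai↓ k with () ← in-degree W k q
      go aw↓ k with () ← in-degree W k q
      go ai↑ k = np r-iii w-iii (e , v , w , p , q , l , k)
      go aw↑ k = np r-v w-v (e , v , w , p , q , l , k)
      go ac↓ k = np r-i w-i (e , v , w , p , q , l , k)
      go ac↑ k = np r-vi w-vi (e , v , w , p , q , l , k)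

    to-coweakening : ∀ {e v w} → A.up e ≡ inr v → A.dn e ≡ inr w → A.lab w ≡ aw↑ → ⊥
    to-coweakening {e} {v} {w} p q l = go _ refl
      where
      go : ∀ k → A.lab v ≡ k → ⊥
      go ai↑ k with () ← out-degree W k p
      go aw↑ k with () ← out-degree W k p
      go ai↓ k = np r-iv w-iv (e , v , w , p , q , k , l)
      go aw↓ k = np r-v w-v (e , v , w , p , q , k , l)
      go ac↓ k = np r-vii w-vii (e , v , w , p , q , k , l)
      go ac↑ k = np r-ii w-ii (e , v , w , p , q , k , l)

  separated⇒streamlined : Separated A true true None None → StreamlinedFlow A
  separated⇒streamlined n ((e , .⇓) ∷ l , ((_ , c) , refl ∷ a) , (v , p , lv) , w , q , lw) with as-down e l c a q
  ... | (f , d , t) = go lv lw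
    where
    go : A.lab v ≡ ai↓ ⊎ A.lab v ≡ aw↓ → A.lab w ≡ ai↑ ⊎ A.lab w ≡ aw↑ → ⊥
    go (inr l) _ = from-weakening (up-src⁻ p) (snd (low-end d t)) l
    go (inl _) (inr l) = to-coweakening (snd (high-end d (up-src⁻ p))) t l
    go (inl l) (inl l') = n (inl (refl , v , up-src⁻ p , l)) d (inl (refl , w , t , l'))

module Output {At : Set} {bar : At → At} (invol : ∀ a → bar (bar a) ≡ a) (bar≢ : ∀ a → bar a ≢ a) {α β : Fm At} where
  open Normalise {bar = bar} invol bar≢ {α} {β}
  open FragileCycles {bar = bar} invol bar≢ {α} {β}

  valid-star : ∀ {X Y : PFlow (Occ α) (Occ β)} → Star PolCStep X Y → ValidPol (fst X) (snd X) → ValidPol (fst Y) (snd Y)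
  valid-star nil v = v
  valid-star (x ◅ xs) v = valid-star xs (PolCStep.valid' x)

  bc-cert : ∀ (d d' : Der) → AllFragile (flowOf d) → flowOf d ⟶bc flowOf d' → Cert (λ _ → true) (flowOf d')
  bc-cert d d' f r = make-cert (wf d') (snd (polar (wf d'))) R.ρ R.bound R.ρ≤ (λ _ → R.ρ-arc)
    where module R = Rank (bc-rank (wf d) f (bc⇒tree r) _ (snd (polar (wf d'))))

  c-normal : ∀ (d : Der) → NormalC (flowOf d) → CNormal (flowOf d)
  c-normal d n e = (λ j → np r-viii c-viii (e , j)) , (λ j → np r-ix c-ix (e , j)) , λ j → np r-x c-x (e , j)
    where np = normal⇒no-pat InC InC? d n

  super-streamlined : ∀ {Φ₀ Φ₅ : Der} → Str Φ₀ Φ₅ → SuperStreamlined Φ₅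
  super-streamlined {Φ₀} {Φ₅} S = separated⇒streamlined (wf Φ₅) (normal⇒no-pat InW InW? Φ₅ w-nf)
    (w-star w-steps (ex-separated (wf Φ₃) C3 (c-normal Φ₃ ex₁-nf) (ex⇒tree ex₂))) , w-nf
    where
    open Str S
    C3 : Cert (λ _ → true) (flowOf Φ₃)
    C3 = cert-star ex₁ (bc-cert Φ₁ Φ₂ (positive⇒fragile Φ₁ π₁ (valid-star bc₁ π₀-valid) bc₁-done) bc₂)

module Grow {At : Set} {bar : At → At} (invol : ∀ a → bar (bar a) ≡ a) (bar≢ : ∀ a → bar a ≢ a)
  (Leaf : ∀ {U L} → Flow U L → Set) (Cuttable : ∀ {U L} (B : Flow U L) → Flow.E B → Set) (Inv : ∀ {U L} → Flow U L → Set)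
  (choose : ∀ {U L} {B : Flow U L} → WF B → Inv B → Leaf B ⊎ Σ (Flow.E B) λ e → Joins B ai↓ ai↑ e × Cuttable B e)
  (inherit : ∀ {U L} {B : Flow U L} {A} → WF B → WF A → IsGlue B A Rai → Inv B → Inv (Weak A) × Inv (CoWeak A)) where

  Outcome : ∀ {U L} (B : Flow U L) (aU : U → At) (aL : L → At) → Fm U → Fm L → Set1
  Outcome {U} {L} B aU aL X Y = Σ (Flow U L) λ C → NStruct bar C aU aL X Y × Tree Leaf Cuttable B C ×
    (C ≡ B ⊎ (∀ {C'} → FlowIso C' C → Tree Leaf Cuttable B C'))

  grow : ∀ n {U L} {B : Flow U L} {aU aL X Y} → WF B → Inv B → Linear X → Linear Y → (S : NStruct bar B aU aL X Y) →
    fold (λ _ → 1) (NStruct.der S) < n → Outcome B aU aL X Y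
  grow (suc n) {B = B} {aU} {aL} {X} {Y} W I X-lin Y-lin S (s≤s le) = go (choose W I)
    where
    go : Leaf B ⊎ (Σ (Flow.E B) λ e → Joins B ai↓ ai↑ e × Cuttable B e) → Outcome B aU aL X Y
    go (inl l) = B , S , leaf l , inl refl
    go (inr (e , j , c)) = C.combined , C.comb-struct , cut C.is-comb , inr (λ iso → cut (comb-iso iso C.is-comb))
      where
      pat : Pat B Rai-redex
      pat = e , j
      F : Emb B Rai-redex
      F = embed W Rai-redex pat
      module H = Halves {bar = bar} invol W F S
      module HB = Halved W (Cut.K-wf W F) (Cut.cut-glue W F)
      both = inherit W (Cut.K-wf W F) (Cut.cut-glue W F) I
      lt : ∀ {x} → suc x ≡ fold (λ _ → 1) (NStruct.der S) → x < n
      lt p = ℕP.≤-trans (ℕP.≤-reflexive p) le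
      snoc : ∀ {V : Set} (Z : Fm V) → Linear Z → Linear (mapFm inl Z ∨ atom (inr zero)) × Linear (mapFm inl Z ∧ atom (inr zero))
      snoc Z l = linear-snoc Z l (finite-≟ (finite-Fin 1))
      left = grow n HB.weak-wf (fst both) X-lin (fst (snoc Y Y-lin)) H.weak-struct (lt H.weak-vertices)
      right = grow n HB.coweak-wf (snd both) (snd (snoc X X-lin)) Y-lin H.coweak-struct (lt H.coweak-vertices)
      module C = CombineStruct X-lin Y-lin (fst (snd left)) (fst (snd right))
      cut : ∀ {C'} → IsComb C' (fst left) (fst right) → Tree Leaf Cuttable B C'
      cut K = node (Cut.K W F) (Cut.K-wf W F) (Cut.cut-glue W F) (subst (Cuttable B) (sym (embed-r0 W Rai-redex pat)) c)
        (fst (snd (snd left))) (fst (snd (snd right))) K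

  grow-derivation : ∀ {α β} (d : Deriv bar α β) → Inv (flowOf d) → Σ (Deriv bar α β) λ d' → Tree Leaf Cuttable (flowOf d) (flowOf d')
  grow-derivation {α} {β} d I = finish (grow _ (flowOf-wf {bar = bar} invol bar≢ d) I (occFm-linear α) (occFm-linear β) (flowOf-struct d) ℕP.≤-refl)
    where
    finish : Outcome (flowOf d) (atomAt α) (atomAt β) (occFm α) (occFm β) → Σ (Deriv bar α β) λ d' → Tree Leaf Cuttable (flowOf d) (flowOf d')
    finish (_ , _ , t , inl refl) = d , t
    finish (_ , S , _ , inr f) = let (d' , iso) = realizes S in d' , f iso

module _ {U L : Set} {B : Flow U L} (W : WF B) where
  private
    π = fst (polar W)
  open Graph W (snd (polar W))

  private
    on-list : ∀ {e} (l : List (OE B)) → e ∈ edges B l → Σ (OE B) λ x → x ∈ l × fst x ≡ e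
    on-list (x ∷ l) (here refl) = x , here refl , refl
    on-list (x ∷ l) (there i) = let (y , j , p) = on-list l i in y , there j , p

    on-cycle? : ∀ e → Dec (EdgeOnAICycle B e)
    on-cycle? e = map′ (λ { (a , b , r , t) → arc-on-cycle r t }) back
      (finite-any? (finV W) λ a → finite-any? (finV W) λ b →
        (inj2? (finite-≟ (finV W)) (src B (e , or (π e))) a ×-dec inj2? (finite-≟ (finV W)) (tgt B (e , or (π e))) b) ×-dec T? b a)
      where
      back : EdgeOnAICycle B e → Σ _ λ a → Σ _ λ b → Arc B π e a b × T b a
      back (l , c , i) with on-list l i
      ... | ((.e , d) , j , refl) = cycle-arc l c j

    simple-on : ∀ l → Any (λ x → SimpleEdge B (fst x)) l → Σ (Flow.E B) λ e → SimpleEdge B e × e ∈ edges B l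
    simple-on (x ∷ l) (here s≡) = fst x , s≡ , here refl
    simple-on (x ∷ l) (there i) = let (e , s≡ , j) = simple-on l i in e , s≡ , there j

  fragile-edge : ¬ HasFragile B ⊎ Σ (Flow.E B) λ e → Joins B ai↓ ai↑ e × EdgeOnAICycle B e
  fragile-edge with finite-any? (finE W) (λ e → joins? B ai↓ ai↑ e ×-dec on-cycle? e)
  ... | yes (e , j , c) = inr (e , j , c)
  ... | no n = inl λ { (l , c , i) → let (e , s≡ , j) = simple-on l i in n (e , simple⁻ W s≡ , l , c , j) }

  extremal-edge : Cert (λ _ → true) B → CNormal B → (¬ Σ (Flow.E B) (Extremal B)) ⊎ Σ (Flow.E B) λ e → Joins B ai↓ ai↑ e × Extremal B e
  extremal-edge C cn with finite-any? (finE W) (joins? B ai↓ ai↑)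
  ... | yes (e , j) = let (e' , x) = Extremality.extremal-exists W C cn (simple {A = B} {e} j) in inr (e' , simple⁻ W (fst x) , x)
  ... | no n = inl λ { (e , x) → n (e , simple⁻ W (fst x)) }

module Existence {At : Set} {bar : At → At} (invol : ∀ a → bar (bar a) ≡ a) (bar≢ : ∀ a → bar a ≢ a) {α β : Fm At} where
  open Normalise {bar = bar} invol bar≢ {α} {β}
  open PositiveCycles {bar = bar} invol bar≢ {α} {β}
  open FragileCycles {bar = bar} invol bar≢ {α} {β}
  open Output {bar = bar} invol bar≢ {α} {β}

  break-cycles : (d : Der) → Σ Der λ d' → BC-tree (flowOf d) (flowOf d')
  break-cycles d = Grow.grow-derivation {bar = bar} invol bar≢ (λ B → ¬ HasFragile B) EdgeOnAICycle (λ _ → ⊤)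
    (λ W _ → fragile-edge W) (λ _ _ _ _ → tt , tt) d tt

  remove-extremal : (d : Der) → Cert (λ _ → true) (flowOf d) → CNormal (flowOf d) → Σ Der λ d' → EX-tree (flowOf d) (flowOf d')
  remove-extremal d C cn = Grow.grow-derivation {bar = bar} invol bar≢ (λ B → ¬ Σ (Flow.E B) (Extremal B)) Extremal (λ B → Cert (λ _ → true) B × CNormal B)
    (λ W I → extremal-edge W (fst I) (snd I))
    (λ W WA g I → (cert-mor (Halved.weak-mor W WA g) (fst I) , Pull.cnormal-pull (Halved.weak-mor W WA g) (snd I)) ,
                  cert-mor (Halved.coweak-mor W WA g) (fst I) , Pull.cnormal-pull (Halved.coweak-mor W WA g) (snd I)) d (C , cn)

  module _ (Φ₀ : Der) (π₀ : Polarity (flowOf Φ₀)) (val : ValidPol (flowOf Φ₀) π₀) where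

    output₅ : (P : Positive Φ₀ π₀) (Φ₂ Φ₃ Φ₄ : Der) → BC-tree (flowOf (Positive.d1 P)) (flowOf Φ₂) →
      Star _⟶c_ (flowOf Φ₂) (flowOf Φ₃) → NormalC (flowOf Φ₃) → EX-tree (flowOf Φ₃) (flowOf Φ₄) →
      (Σ Der λ Φ₅ → Star _⟶w_ (flowOf Φ₄) (flowOf Φ₅) × NormalW (flowOf Φ₅)) → Σ Der (Str Φ₀)
    output₅ P Φ₂ Φ₃ Φ₄ bc cs cn ex (Φ₅ , ws , wn) = Φ₅ , record
      { π₀ = π₀ ; π₀-valid = val ; Φ₁ = Positive.d1 P ; π₁ = Positive.π₁ P ; bc₁ = Positive.steps P ; bc₁-done = Positive.positive P
      ; Φ₂ = Φ₂ ; bc₂ = tree⇒bc bc ; Φ₃ = Φ₃ ; ex₁ = cs ; ex₁-nf = cn ; Φ₄ = Φ₄ ; ex₂ = tree⇒ex ex ; w-steps = ws ; w-nf = wn }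

    output4 : (P : Positive Φ₀ π₀) (Φ₂ Φ₃ : Der) → BC-tree (flowOf (Positive.d1 P)) (flowOf Φ₂) →
      Star _⟶c_ (flowOf Φ₂) (flowOf Φ₃) → NormalC (flowOf Φ₃) → (Σ Der λ Φ₄ → EX-tree (flowOf Φ₃) (flowOf Φ₄)) → Σ Der (Str Φ₀)
    output4 P Φ₂ Φ₃ bc cs cn (Φ₄ , ex) = output₅ P Φ₂ Φ₃ Φ₄ bc cs cn ex (normalise-w Φ₄)

    output3 : (P : Positive Φ₀ π₀) (Φ₂ : Der) → BC-tree (flowOf (Positive.d1 P)) (flowOf Φ₂) → Cert (λ _ → true) (flowOf Φ₂) →
      (Σ Der λ Φ₃ → Star _⟶c_ (flowOf Φ₂) (flowOf Φ₃) × NormalC (flowOf Φ₃)) → Σ Der (Str Φ₀)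
    output3 P Φ₂ bc C (Φ₃ , cs , cn) = output4 P Φ₂ Φ₃ bc cs cn (remove-extremal Φ₃ (cert-star cs C) (c-normal Φ₃ cn))

    output2 : (P : Positive Φ₀ π₀) → (Σ Der λ Φ₂ → BC-tree (flowOf (Positive.d1 P)) (flowOf Φ₂)) → Σ Der (Str Φ₀)
    output2 P (Φ₂ , bc) = output3 P Φ₂ bc C (normalise-c Φ₂ C)
      where
      C = bc-cert (Positive.d1 P) Φ₂ (positive⇒fragile (Positive.d1 P) (Positive.π₁ P) (valid-star (Positive.steps P) val) (Positive.positive P)) (tree⇒bc bc)

  output : (Φ₀ : Der) → Σ Der (Str Φ₀)
  output Φ₀ = run (polar (wf Φ₀))
    where
    run : Σ (Polarity (flowOf Φ₀)) (ValidPol (flowOf Φ₀)) → Σ Der (Str Φ₀)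
    run (π₀ , val) = go (make-positive Φ₀ (clock-cert Φ₀ π₀ val))
      where
      go : Positive Φ₀ π₀ → Σ Der (Str Φ₀)
      go P = output2 Φ₀ π₀ val P (break-cycles (Positive.d1 P))

theorem5p25 : (At : Set) (bar : At → At) →
  (∀ a → bar (bar a) ≡ a) → (∀ a → bar a ≢ a) →
  {α β : Fm At} (Φ₀ : Deriv bar α β) →
  Σ (Deriv bar α β) (Str Φ₀) × (∀ Φ₅ → Str Φ₀ Φ₅ → SuperStreamlined Φ₅)
theorem5p25 At bar invol bar≢ Φ₀ = Existence.output {bar = bar} invol bar≢ Φ₀ , λ Φ₅ → Output.super-streamlined {bar = bar} invol bar≢ {Φ₀ = Φ₀} {Φ₅}
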